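{- Let $H_0$ be an $n$-vertex $3$-graph such that: (1) $H_0$ has no vanishing ordering of its vertices; (2) the edge set of $H_0$ can be partitioned into two spanning subhypergraphs $H_1$ and $H_2$ (both on the vertex set of $H_0$) such that there is an ordering of the vertices of $H_0$ which is vanishing both for $H_1$ and for $H_2$, and, with respect to this ordering, whenever $e_1$ is an edge of $H_1$ and $e_2$ is an edge of $H_2$ with $|e_1\cap e_2|=2$, the pair $e_1\cap e_2$ is right with respect to $H_1$ and left with respect to $H_2$; (3) the edge set of $H_0$ can be partitioned into two spanning subhypergraphs $H'_1$ and $H'_2$ such that there is an ordering of the vertices which is vanishing both for $H'_1$ and for $H'_2$, and, with respect to this ordering, whenever $e_1$ is an edge of $H'_1$ and $e_2$ is an edge of $H'_2$ with $|e_1\cap e_2|=2$, the pair $e_1\cap e_2$ is top with respect to $H'_1$ and left with respect to $H'_2$. Then the uniform Tur\'an density of $H_0$ is equal to $1/27$.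
   Context: A $3$-graph is a $3$-uniform hypergraph. An ordering $v_1,\ldots,v_n$ of the vertices of a $3$-graph $H$ is vanishing if the set of pairs $(i,j)$, $1\le i<j\le n$, can be partitioned into sets $L$, $T$, $R$ such that every edge $\{v_i,v_j,v_k\}$ of $H$ with $i<j<k$ satisfies $(i,j)\in L$, $(i,k)\in T$ and $(j,k)\in R$. For a fixed vanishing ordering, a pair of vertices contained in a common edge of $H$ is called left, top or right (with respect to $H$) according to whether it lies in $L$, $T$ or $R$; for such pairs this is uniquely determined by the ordering. A $3$-graph $H$ on $n$ vertices is $(d,\varepsilon)$-dense if every subset $W$ of its vertices induces at least $d\binom{|W|}{3}-\varepsilon n^3$ edges. The uniform Tur\'an density of a $3$-graph $H_0$ is the supremum of all $d\in[0,1]$ such that for every $\varepsilon>0$ there exist arbitrarily large $(d,\varepsilon)$-dense $3$-graphs not containing $H_0$ as a (not necessarily induced) subhypergraph. -}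

module Defs where

open import Data.Nat as ℕ using (ℕ; _≥_; _<ᵇ_)
open import Data.Nat.Combinatorics using (_C_)
open import Data.Bool using (Bool; true; false; _∧_; if_then_else_)
open import Data.Fin using (Fin; toℕ; _<_)
open import Data.Fin.Subset using (Subset; ∣_∣; inside)
open import Data.Fin.Permutation using (Permutation′; _⟨$⟩ʳ_)
open import Data.Vec using (lookup)
open import Data.List using (List; map; allFin)
open import Data.Nat.ListAction using (sum)
open import Data.Integer using (+_)
open import Data.Rational as ℚ using (ℚ; _/_; _*_; _-_; 0ℚ; 1ℚ)
open import Data.Product using (Σ; _×_; ∃; ∃-syntax)
open import Data.Sum using (_⊎_)
open import Relation.Nullary using (¬_)
open import Relation.Binary.PropositionalEquality using (_≡_)
open import Function.Definitions using (Injective)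
open import Function.Bundles using (_⇔_)

-- A 3-graph on the vertex set Fin n.  The edge {a,b,c} with a < b < c
-- (as elements of Fin n) is present iff  edge a b c ≡ true ; the values
-- of  edge  on non-strictly-increasing triples are irrelevant.
record 3Graph (n : ℕ) : Set where
  field
    edge : Fin n → Fin n → Fin n → Bool
open 3Graph public

Adj : {n : ℕ} → 3Graph n → Fin n → Fin n → Fin n → Set
Adj H x y z =
    (x < y × y < z × edge H x y z ≡ true)
  ⊎ (x < z × z < y × edge H x z y ≡ true)
  ⊎ (y < x × x < z × edge H y x z ≡ true)
  ⊎ (y < z × z < x × edge H y z x ≡ true)
  ⊎ (z < x × x < y × edge H z x y ≡ true)
  ⊎ (z < y × y < x × edge H z y x ≡ true)

-- An ordering v_0, ..., v_{n-1} of the vertices: position i ↦ vertex π i.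
Ordering : ℕ → Set
Ordering n = Permutation′ n

data Label : Set where
  L T R : Label

-- The ordering π is vanishing for H: there is a partition of the pairs
-- (i,j), i < j, of positions into L, T, R (a labelling function; only its
-- values on pairs i < j matter) such that every edge {v_i,v_j,v_k},
-- i < j < k, has (i,j) ∈ L, (i,k) ∈ T, (j,k) ∈ R.
Vanishing : {n : ℕ} → 3Graph n → Ordering n → Set
Vanishing {n} H π =
  Σ (Fin n → Fin n → Label) λ lab →
    ∀ (i j k : Fin n) → i < j → j < k →
      Adj H (π ⟨$⟩ʳ i) (π ⟨$⟩ʳ j) (π ⟨$⟩ʳ k) →
      (lab i j ≡ L) × (lab i k ≡ T) × (lab j k ≡ R)

HasVanishingOrdering : {n : ℕ} → 3Graph n → Set
HasVanishingOrdering {n} H = Σ (Ordering n) λ π → Vanishing H π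

-- The role (left / top / right) of the pair {v_i, v_j} (positions i < j)
-- inside the edge {v_i, v_j, v_k}: right if k < i, top if i < k < j,
-- left if j < k.
RoleIs : {n : ℕ} → Fin n → Fin n → Fin n → Label → Set
RoleIs i j k L = j < k
RoleIs i j k T = i < k × k < j
RoleIs i j k R = k < i

EdgePartition : {n : ℕ} → 3Graph n → 3Graph n → 3Graph n → Set
EdgePartition H0 H1 H2 =
  ∀ x y z → (Adj H0 x y z ⇔ (Adj H1 x y z ⊎ Adj H2 x y z))
          × ¬ (Adj H1 x y z × Adj H2 x y z)

-- Conditions (2)/(3) of the theorem, with the role ℓ₁ required for H1 and
-- ℓ₂ for H2: a partition H0 = H1 ⊔ H2 and an ordering vanishing for both,
-- such that whenever e1 = {v_i,v_j,v_k} ∈ H1 and e2 = {v_i,v_j,v_l} ∈ H2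
-- intersect in exactly the pair {v_i,v_j} (i < j), this pair has role ℓ₁
-- in e1 (w.r.t. H1) and role ℓ₂ in e2 (w.r.t. H2).
-- (Since H1, H2 are edge-disjoint, e1 ≠ e2 automatically, so
-- |e1 ∩ e2| = 2 exactly when they share such a pair.)
SplitCondition : {n : ℕ} → 3Graph n → Label → Label → Set
SplitCondition {n} H0 ℓ₁ ℓ₂ =
  Σ (3Graph n) λ H1 → Σ (3Graph n) λ H2 → Σ (Ordering n) λ π →
    EdgePartition H0 H1 H2 × Vanishing H1 π × Vanishing H2 π ×
    (∀ (i j k l : Fin n) → i < j →
       Adj H1 (π ⟨$⟩ʳ i) (π ⟨$⟩ʳ j) (π ⟨$⟩ʳ k) →
       Adj H2 (π ⟨$⟩ʳ i) (π ⟨$⟩ʳ j) (π ⟨$⟩ʳ l) →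
       RoleIs i j k ℓ₁ × RoleIs i j l ℓ₂)

private
  ltᵇ : {n : ℕ} → Fin n → Fin n → Bool
  ltᵇ a b = toℕ a <ᵇ toℕ b

  inW : {n : ℕ} → Subset n → Fin n → Bool
  inW W a with lookup W a
  ... | inside = true
  ... | _      = false

  sumFin : (n : ℕ) → (Fin n → ℕ) → ℕ
  sumFin n f = sum (map f (allFin n))

edgesIn : {n : ℕ} → 3Graph n → Subset n → ℕ
edgesIn {n} H W =
  sumFin n λ a → sumFin n λ b → sumFin n λ c →
    if ltᵇ a b ∧ ltᵇ b c ∧ inW W a ∧ inW W b ∧ inW W c ∧ edge H a b c
    then 1 else 0

ℕtoℚ : ℕ → ℚ
ℕtoℚ m = + m / 1

Dense : {n : ℕ} → 3Graph n → ℚ → ℚ → Set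
Dense {n} H d ε =
  ∀ (W : Subset n) →
    (d * ℕtoℚ (∣ W ∣ C 3)) - (ε * ℕtoℚ (n ℕ.^ 3)) ℚ.≤ ℕtoℚ (edgesIn H W)

Contains : {n0 n : ℕ} → 3Graph n → 3Graph n0 → Set
Contains {n0} {n} H H0 =
  Σ (Fin n0 → Fin n) λ f → Injective _≡_ _≡_ f ×
    (∀ x y z → Adj H0 x y z → Adj H (f x) (f y) (f z))

Admissible : {n0 : ℕ} → 3Graph n0 → ℚ → Set
Admissible H0 d =
  ∀ (ε : ℚ) → 0ℚ ℚ.< ε → ∀ (N₀ : ℕ) →
    Σ ℕ λ N → N ≥ N₀ × Σ (3Graph N) λ H → Dense H d ε × ¬ Contains H H0

-- The uniform Turán density of H0 equals δ (δ rational), i.e. δ is the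
-- supremum of the admissible d ∈ [0,1].  Since admissibility is downward
-- closed in d, this is: every rational d ∈ [0,δ) is admissible and no
-- rational d ∈ (δ,1] is admissible.
UniformTuranDensityIs : {n0 : ℕ} → 3Graph n0 → ℚ → Set
UniformTuranDensityIs H0 δ =
    (∀ (d : ℚ) → 0ℚ ℚ.≤ d → d ℚ.< δ → Admissible H0 d)
  × (∀ (d : ℚ) → δ ℚ.< d → d ℚ.≤ 1ℚ → ¬ Admissible H0 d)

{-# OPTIONS --safe #-}
-- Lower bound.  Colour the pairs of [N] at random by L, T, R and take the triples i < j < k whose pairs
-- (i,j), (i,k), (j,k) are coloured L, T, R.  Some colouring has few 4-cycle correlations, hence every cut
-- contains each colour with density close to 1/3 (Cauchy–Schwarz twice), hence every vertex set spans its
-- share 1/27 of triples.  A copy of H₀ in this hypergraph, sorted, would be a vanishing ordering of H₀.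
--
-- Upper bound.  Let H be (d,ε)-dense with d > 1/27, and cut its vertex set into M consecutive blocks.  In place
-- of hypergraph regularity, sub-boxes of the blocks are chosen on which finitely many functions are regular
-- (their mean cannot change on large sub-boxes), and boxes of pair functions on which H has density below κ are
-- removed one after another; since each removal costs a fixed amount of a bounded potential, the process stops.
-- What remains (the predicate G) depends only on finitely many colours of pairs, and every box of pairs in it
-- has H-density at least about κ.  So if H is H₀-free, then the products of G over the edges of a copy of H₀
-- have small mean: the corresponding factors of H can be replaced by κ one at a time.  By regularity the colours
-- of the pairs behave like independent random labels, and by sampling each label distribution can be replaced by
-- a uniform distribution on K labels, with K independent of the number of colours; then these products vanish
-- identically.  If G has density above 1/27 on all triples of many blocks, this is impossible: for each triple
-- the labels heavy in the roles left, top and right have measures with product above 1/27, so with sum above 1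
-- (AM–GM), so two of the roles share labels.  Ramsey's theorem makes the two roles uniform and yields common
-- labels, and the corresponding split of H₀ (for top/right the reversal of the top/left one) embeds into G.
-- Hence by Ramsey some m blocks have density below d on all triples, and a random set of vertices with the
-- right weights on these blocks contradicts the density of H.
module Submission where

open import Defs
open import Data.Nat as ℕ using (ℕ; zero; suc; z≤n; s≤s)
import Data.Nat.Properties as ℕₚ
import Data.Nat.DivMod as ℕD
open import Data.Nat.Combinatorics using (nCk+nC[k+1]≡[n+1]C[k+1]; nC1≡n) renaming (_C_ to _choose_)
open import Data.Integer as ℤ using (+_)
import Data.Integer.Properties as ℤₚ
open import Data.Rational using (ℚ; _+_; _*_; _-_; -_; _≤_; _<_; 0ℚ; 1ℚ; _/_)
import Data.Rational as ℚ
import Data.Rational.Properties as ℚₚ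
import Data.Rational.Unnormalised as ℚᵘ
import Data.Rational.Unnormalised.Properties as ℚᵘₚ
open import Data.Rational.Solver
open import Data.Bool using (Bool; true; false; _∧_; not; if_then_else_)
import Data.Bool.Properties as Boolₚ
open import Data.Fin as F using (Fin; toℕ)
import Data.Fin.Properties as Fₚ
open import Data.Fin.Subset using (Subset; ∣_∣)
open import Data.Nat.ListAction using (sum)
open import Data.Fin.Permutation as Perm using (Permutation′; _⟨$⟩ʳ_; _⟨$⟩ˡ_)
open import Data.Vec as Vec using (Vec; []; _∷_; lookup; _[_]≔_)
import Data.Vec.Properties as Vecₚ
open import Data.List as List using (List; []; _∷_; _++_; length; map; concatMap)
import Data.List.Properties as Listₚ
open import Data.List.Relation.Unary.All as All using (All; []; _∷_)
import Data.List.Relation.Unary.All.Properties as Allₚ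
open import Data.List.Relation.Unary.Any using (here; there)
open import Data.List.Membership.Propositional using (_∈_; lose)
import Data.List.Membership.Propositional.Properties as Memₚ
open import Data.List.Relation.Unary.AllPairs using (AllPairs; []; _∷_)
import Data.List.Relation.Unary.Unique.Propositional.Properties as Uniqueₚ
open import Data.Product using (Σ; _×_; _,_; proj₁; proj₂)
open import Data.Sum using (_⊎_; inj₁; inj₂; [_,_]′)
open import Data.Unit using (⊤; tt)
open import Data.Empty using (⊥; ⊥-elim)
open import Function using (_∘_; id)
open import Function.Definitions using (Injective)
open import Function.Bundles using (Equivalence)
open import Relation.Nullary using (¬_; Dec; yes; no; does)
open import Relation.Nullary.Decidable as Dec using (_×-dec_; _⊎-dec_)
open import Relation.Binary.Definitions using (tri<; tri≈; tri>)
open import Relation.Binary.PropositionalEquality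
open +-*-Solver using (solve; _:=_; _:+_; _:*_; _:-_; :-_; con)

-- All constants must be fixed before the host graph is seen, and their order shapes the proof: `g`
-- (a sixteenth of d - 1/27, also used as κ), the number `M` of blocks, the number of labels given
-- by `K`, then `τ`, `ρ` and the tightness `δ`, the number of rounds, the regularity `ζ` of the
-- colours, the box size `s`, and `ε` last. The danger is a circle. A colour records all tests found
-- so far, so the number of colours grows with the number of rounds, whose bound depends on `δ`; yet
-- `δ` must be small against the number of labels if products with small mean are to vanish.
-- Sampling breaks the circle because `K` depends on `M` and `θ` only. The Ramsey bounds do not
-- involve the number of labels either: labels are found by averaging over measures, so only lower
-- bounds on measures matter. The claim of the upper bound is a negation, so its proof is a
-- derivation of ⊥. Violating boxes and homogeneous sets, which cannot be searched for, are
-- therefore provided under double negation or to a continuation into ⊥.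

variable
  a′ b′ c′ l′ r′ p′ q′ x′ y′ : ℚ
  V W Z : Set

-- An inequality a ≤ b follows from any l ≤ r with the same difference of the two
-- sides; the equality of the differences is left to the ring solver.
≤-by : l′ ≤ r′ → b′ - a′ ≡ r′ - l′ → a′ ≤ b′
≤-by {l} {r} {b} {a} h e = subst₂ _≤_ (solve 2 (λ l a → l :+ (a :- l) := a) refl l a)
  (trans (solve 3 (λ r l a → r :+ (a :- l) := (r :- l) :+ a) refl r l a)
         (trans (cong (_+ a) (sym e)) (solve 2 (λ a b → (b :- a) :+ a := b) refl a b)))
  (ℚₚ.+-monoˡ-≤ (a - l) h)

≡-by : l′ ≡ r′ → b′ - a′ ≡ r′ - l′ → a′ ≡ b′
≡-by {l} {r} {b} {a} refl e = ℚₚ.≤-antisym (≤-by (ℚₚ.≤-refl {l}) e)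
  (≤-by (ℚₚ.≤-refl {0ℚ}) (trans (solve 2 (λ a b → a :- b := :- (b :- a)) refl a b)
    (trans (cong -_ e) (solve 1 (λ l → :- (l :- l) := con 0ℚ :- con 0ℚ) refl l))))

infixr 6 _⊕_
_⊕_ : a′ ≤ b′ → l′ ≤ r′ → a′ + l′ ≤ b′ + r′
_⊕_ = ℚₚ.+-mono-≤

0≤- : a′ ≤ b′ → 0ℚ ≤ b′ - a′
0≤- {a} {b} h = ≤-by h (solve 2 (λ a b → (b :- a) :- con 0ℚ := b :- a) refl a b)

infixr 7 _⊛_ _⊗_
_⊛_ : 0ℚ ≤ a′ → 0ℚ ≤ b′ → 0ℚ ≤ a′ * b′
_⊛_ {a} {b} u v = subst (_≤ a * b) (ℚₚ.*-zeroʳ a) (ℚₚ.*-monoˡ-≤-nonNeg a {{ℚ.nonNegative u}} v)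

_⊗_ : 0ℚ ≤ c′ → a′ ≤ b′ → c′ * a′ ≤ c′ * b′
_⊗_ {c} u v = ℚₚ.*-monoˡ-≤-nonNeg c {{ℚ.nonNegative u}} v

*-mono : 0ℚ ≤ a′ → 0ℚ ≤ y′ → a′ ≤ x′ → b′ ≤ y′ → a′ * b′ ≤ x′ * y′
*-mono {a} {y} {x} {b} u v h k = ℚₚ.≤-trans (u ⊗ k)
  (subst₂ _≤_ (ℚₚ.*-comm y a) (ℚₚ.*-comm y x) (v ⊗ h))

0<* : 0ℚ < a′ → 0ℚ < b′ → 0ℚ < a′ * b′
0<* {a} {b} u v = ℚₚ.positive⁻¹ (a * b) {{ℚₚ.pos*pos⇒pos a {{ℚ.positive u}} b {{ℚ.positive v}}}}

0<+ : 0ℚ < a′ → 0ℚ < b′ → 0ℚ < a′ + b′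
0<+ u v = ℚₚ.+-mono-< u v

0≤1 : 0ℚ ≤ 1ℚ
0≤1 = ℚ.*≤* (ℤ.+≤+ z≤n)

0<1 : 0ℚ < 1ℚ
0<1 = ℚ.*<* (ℤ.+<+ (s≤s z≤n))

≰→≥ : ¬ (a′ ≤ b′) → b′ ≤ a′
≰→≥ h = ℚₚ.<⇒≤ (ℚₚ.≰⇒> h)

<≤⊥ : a′ < b′ → b′ ≤ a′ → ⊥
<≤⊥ h k = ℚₚ.<-irrefl refl (ℚₚ.<-≤-trans h k)

-- Inequalities in ℚ are decidable, hence stable under double negation. Through this, bounds leave
-- the arguments by contradiction that stand in for undecidable searches.
≤-stable : ¬ ¬ (a′ ≤ b′) → a′ ≤ b′
≤-stable {a} {b} h with a ℚₚ.≤? b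
... | yes p = p
... | no np = ⊥-elim (h np)

0<-by : a′ < b′ → 0ℚ < b′ - a′
0<-by {a} {b} h = ℚₚ.≰⇒> λ k → <≤⊥ h (≤-by k (solve 2 (λ a b → a :- b := con 0ℚ :- (b :- a)) refl a b))

*-cancel : 0ℚ < c′ → c′ * a′ ≤ c′ * b′ → a′ ≤ b′
*-cancel {c} u h = ℚₚ.*-cancelˡ-≤-pos c {{ℚ.positive u}} h

0≤² : ∀ x′ → 0ℚ ≤ x′ * x′
0≤² x with ℚₚ.≤-total 0ℚ x
... | inj₁ h = h ⊛ h
... | inj₂ h = subst (0ℚ ≤_) (solve 1 (λ x → (con 0ℚ :- x) :* (con 0ℚ :- x) := x :* x) refl x) (0≤- h ⊛ 0≤- h)

opaque
  inverse : 0ℚ < p′ → Σ ℚ λ r′ → 0ℚ < r′ × p′ * r′ ≡ 1ℚ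
  inverse {p} h = (ℚ.1/ p) , ℚₚ.positive⁻¹ _ {{ℚₚ.1/pos⇒pos p}} , ℚₚ.*-inverseʳ p
    where instance
      pos : ℚ.Positive p
      pos = ℚ.positive h
      nz : ℚ.NonZero p
      nz = ℚₚ.pos⇒nonZero p

-- `ℕtoℚ` in recursive form: `ι (suc n)` unfolds to `ι n + 1ℚ`, which suits induction and the ring
-- solver.
ι : ℕ → ℚ
ι zero = 0ℚ
ι (suc n) = ι n + 1ℚ

0≤ι : ∀ n → 0ℚ ≤ ι n
0≤ι zero = ℚₚ.≤-refl
0≤ι (suc n) = 0≤ι n ⊕ 0≤1

0<ι : ∀ n → 0ℚ < ι (suc n)
0<ι n = ℚₚ.+-mono-≤-< (0≤ι n) 0<1

ι-+ : ∀ m n → ι (m ℕ.+ n) ≡ ι m + ι n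
ι-+ zero n = sym (ℚₚ.+-identityˡ (ι n))
ι-+ (suc m) n = trans (cong (_+ 1ℚ) (ι-+ m n)) (solve 2 (λ a b → (a :+ b) :+ con 1ℚ := (a :+ con 1ℚ) :+ b) refl (ι m) (ι n))

ι-* : ∀ m n → ι (m ℕ.* n) ≡ ι m * ι n
ι-* zero n = sym (ℚₚ.*-zeroˡ (ι n))
ι-* (suc m) n = trans (ι-+ n (m ℕ.* n)) (trans (cong (λ z → ι n + z) (ι-* m n))
  (solve 2 (λ a b → b :+ a :* b := (a :+ con 1ℚ) :* b) refl (ι m) (ι n)))

ι-mono : ∀ {m n} → m ℕ.≤ n → ι m ≤ ι n
ι-mono {n = n} z≤n = 0≤ι n
ι-mono (s≤s h) = ι-mono h ⊕ ℚₚ.≤-refl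

suc/1 : ∀ n → ℚᵘ.mkℚᵘ (+ suc n) 0 ℚᵘ.≃ ℚᵘ.mkℚᵘ (+ n) 0 ℚᵘ.+ ℚᵘ.1ℚᵘ
suc/1 n = ℚᵘ.*≡* (trans (ℤₚ.*-identityʳ (+ suc n)) (sym (trans (ℤₚ.*-identityʳ _)
  (trans (cong (ℤ._+ (+ 1)) (ℤₚ.*-identityʳ (+ n))) (cong +_ (ℕₚ.+-comm n 1))))))

ℕtoℚ≡ι : ∀ n → ℕtoℚ n ≡ ι n
ℕtoℚ≡ι zero = refl
ℕtoℚ≡ι (suc n) = trans (ℚₚ.toℚᵘ-injective
   (ℚᵘₚ.≃-trans (ℚₚ.toℚᵘ-fromℚᵘ (ℚᵘ.mkℚᵘ (+ suc n) 0))
   (ℚᵘₚ.≃-trans (suc/1 n)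
   (ℚᵘₚ.≃-trans (ℚᵘₚ.+-cong (ℚᵘₚ.≃-sym (ℚₚ.toℚᵘ-fromℚᵘ (ℚᵘ.mkℚᵘ (+ n) 0))) (ℚᵘₚ.≃-refl {ℚᵘ.1ℚᵘ}))
   (ℚᵘₚ.≃-sym (ℚₚ.toℚᵘ-homo-+ (ℕtoℚ n) 1ℚ))))))
   (cong (_+ 1ℚ) (ℕtoℚ≡ι n))

archimedean : ∀ x′ → Σ ℕ λ n → x′ ≤ ι n
archimedean x = ℤ.∣ ℚ.↥ x ∣ , subst (x ≤_) (ℕtoℚ≡ι ℤ.∣ ℚ.↥ x ∣) (ℚₚ.toℚᵘ-cancel-≤
  (ℚᵘₚ.≤-respʳ-≃ (ℚᵘₚ.≃-sym (ℚₚ.toℚᵘ-fromℚᵘ (ℚᵘ.mkℚᵘ (+ ℤ.∣ ℚ.↥ x ∣) 0)))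
    (go x)))
  where
  bound : ∀ z d → z ℤ.* + 1 ℤ.≤ + ℤ.∣ z ∣ ℤ.* + suc d
  bound (+ n) d = subst₂ ℤ._≤_ (ℤₚ.pos-* n 1) (ℤₚ.pos-* n (suc d)) (ℤ.+≤+ (ℕₚ.*-monoʳ-≤ n (s≤s z≤n)))
  bound (ℤ.-[1+ n ]) d = subst₂ ℤ._≤_ (sym (ℤₚ.*-identityʳ ℤ.-[1+ n ])) (ℤₚ.pos-* (suc n) (suc d)) ℤ.-≤+
  go : ∀ x′ → ℚ.toℚᵘ x′ ℚᵘ.≤ ℚᵘ.mkℚᵘ (+ ℤ.∣ ℚ.↥ x′ ∣) 0
  go (ℚ.mkℚ n d _) = ℚᵘ.*≤* (bound n d)

archimedean⁻¹ : 0ℚ < p′ → ∀ x′ → Σ ℕ λ n → x′ ≤ ι n * p′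
archimedean⁻¹ {p} h x with inverse h
... | r , 0<r , pr with archimedean (x * r)
... | n , le = n , subst (_≤ ι n * p) (trans (ℚₚ.*-assoc x r p) (trans (cong (x *_) (trans (ℚₚ.*-comm r p) pr)) (ℚₚ.*-identityʳ x)))
  (subst₂ _≤_ (ℚₚ.*-comm p (x * r)) (ℚₚ.*-comm p (ι n)) (ℚₚ.<⇒≤ h ⊗ le))

infixr 8 _^_
_^_ : ℚ → ℕ → ℚ
x ^ zero = 1ℚ
x ^ suc n = x * x ^ n

0<^ : 0ℚ < x′ → ∀ n → 0ℚ < x′ ^ n
0<^ h zero = 0<1
0<^ h (suc n) = 0<* h (0<^ h n)

^≤1 : 0ℚ ≤ x′ → x′ ≤ 1ℚ → ∀ n → x′ ^ n ≤ 1ℚ × 0ℚ ≤ x′ ^ n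
^≤1 h k zero = ℚₚ.≤-refl , 0≤1
^≤1 h k (suc n) with ^≤1 h k n
... | u , v = *-mono h 0≤1 k u , h ⊛ v

⟦_⟧ : Bool → ℚ
⟦ true ⟧ = 1ℚ
⟦ false ⟧ = 0ℚ

0≤⟦⟧ : ∀ b′ → 0ℚ ≤ ⟦ b′ ⟧
0≤⟦⟧ true = 0≤1
0≤⟦⟧ false = ℚₚ.≤-refl

⟦⟧≤1 : ∀ b′ → ⟦ b′ ⟧ ≤ 1ℚ
⟦⟧≤1 true = ℚₚ.≤-refl
⟦⟧≤1 false = 0≤1

⟦∧⟧ : ∀ b′ c′ → ⟦ b′ ∧ c′ ⟧ ≡ ⟦ b′ ⟧ * ⟦ c′ ⟧
⟦∧⟧ true c = sym (ℚₚ.*-identityˡ ⟦ c ⟧)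
⟦∧⟧ false c = sym (ℚₚ.*-zeroˡ ⟦ c ⟧)

⟦not⟧ : ∀ b′ → ⟦ not b′ ⟧ ≡ 1ℚ - ⟦ b′ ⟧
⟦not⟧ true = refl
⟦not⟧ false = refl

*⟦⟧≤ : ∀ b′ → 0ℚ ≤ x′ → ⟦ b′ ⟧ * x′ ≤ x′
*⟦⟧≤ {x} b h = subst (⟦ b ⟧ * x ≤_) (ℚₚ.*-identityˡ x) (*-mono (0≤⟦⟧ b) h (⟦⟧≤1 b) ℚₚ.≤-refl)

min₂ : 0ℚ < a′ → 0ℚ < b′ → Σ ℚ λ m → 0ℚ < m × m ≤ a′ × m ≤ b′
min₂ {a} {b} u v with ℚₚ.≤-total a b
... | inj₁ h = a , u , ℚₚ.≤-refl , h
... | inj₂ h = b , v , h , ℚₚ.≤-refl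

half : ∀ x′ → 0ℚ < x′ → Σ ℚ λ h → 0ℚ < h × h + h ≡ x′
half x p with inverse (0<ι 1)
... | r , r0 , e = x * r , 0<* p r0 , trans (solve 2 (λ x r → x :* r :+ x :* r := x :* ((con 0ℚ :+ con 1ℚ :+ con 1ℚ) :* r)) refl x r) (trans (cong (x *_) e) (ℚₚ.*-identityʳ x))
-- Finite probability measures

sumW : List (ℚ × V) → (V → ℚ) → ℚ
sumW [] f = 0ℚ
sumW ((w , v) ∷ l) f = w * f v + sumW l f

-- A finitely supported probability measure, used only through its expectation.
record Mean (V : Set) : Set where
  constructor mean
  field
    weights : List (ℚ × V)
    nonneg : All (λ wv → 0ℚ ≤ proj₁ wv) weights
    total : sumW weights (λ _ → 1ℚ) ≡ 1ℚ
opaque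
  E : Mean V → (V → ℚ) → ℚ
  E μ f = sumW (Mean.weights μ) f

sumW-cong : (l : List (ℚ × V)) {f g : V → ℚ} → (∀ v → f v ≡ g v) → sumW l f ≡ sumW l g
sumW-cong [] h = refl
sumW-cong ((w , v) ∷ l) h = cong₂ _+_ (cong (w *_) (h v)) (sumW-cong l h)

sumW-+ : (l : List (ℚ × V)) (f g : V → ℚ) → sumW l (λ v → f v + g v) ≡ sumW l f + sumW l g
sumW-+ [] f g = refl
sumW-+ ((w , v) ∷ l) f g = trans (cong (λ z → w * (f v + g v) + z) (sumW-+ l f g))
  (solve 5 (λ w a b s t → w :* (a :+ b) :+ (s :+ t) := (w :* a :+ s) :+ (w :* b :+ t)) refl w (f v) (g v) (sumW l f) (sumW l g))

sumW-* : (l : List (ℚ × V)) (c : ℚ) (f : V → ℚ) → sumW l (λ v → c * f v) ≡ c * sumW l f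
sumW-* [] c f = sym (ℚₚ.*-zeroʳ c)
sumW-* ((w , v) ∷ l) c f = trans (cong (λ z → w * (c * f v) + z) (sumW-* l c f))
  (solve 4 (λ w c a s → w :* (c :* a) :+ c :* s := c :* (w :* a :+ s)) refl w c (f v) (sumW l f))

sumW-mono : (l : List (ℚ × V)) {f g : V → ℚ} → All (λ wv → 0ℚ ≤ proj₁ wv) l →
  All (λ wv → f (proj₂ wv) ≤ g (proj₂ wv)) l → sumW l f ≤ sumW l g
sumW-mono [] _ _ = ℚₚ.≤-refl
sumW-mono ((w , v) ∷ l) (p ∷ ps) (q ∷ qs) = (p ⊗ q) ⊕ sumW-mono l ps qs

sumW-swap : (l : List (ℚ × V)) (k : List (ℚ × W)) (f : V → W → ℚ) →
  sumW l (λ a → sumW k (f a)) ≡ sumW k (λ b → sumW l (λ a → f a b))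
sumW-swap [] k f = sym (trans (sumW-* k 0ℚ (λ _ → 0ℚ)) (ℚₚ.*-zeroˡ (sumW k (λ _ → 0ℚ))))
sumW-swap ((w , v) ∷ l) k f = trans (cong₂ _+_ (sym (sumW-* k w (f v))) (sumW-swap l k f))
  (sym (sumW-+ k (λ b → w * f v b) (λ b → sumW l (λ a → f a b))))

sumW-++ : (l k : List (ℚ × V)) (f : V → ℚ) → sumW (l ++ k) f ≡ sumW l f + sumW k f
sumW-++ [] k f = sym (ℚₚ.+-identityˡ _)
sumW-++ ((w , v) ∷ l) k f = trans (cong (λ z → w * f v + z) (sumW-++ l k f)) (sym (ℚₚ.+-assoc (w * f v) (sumW l f) (sumW k f)))

sumW-map : (l : List (ℚ × V)) (r : V → ℚ) (f : V → ℚ) →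
  sumW (map (λ wv → r (proj₂ wv) * proj₁ wv , proj₂ wv) l) f ≡ sumW l (λ v → r v * f v)
sumW-map [] r f = refl
sumW-map ((w , v) ∷ l) r f = cong₂ _+_ (solve 3 (λ r w f → (r :* w) :* f := w :* (r :* f)) refl (r v) w (f v)) (sumW-map l r f)

scale : ℚ → List (ℚ × V) → List (ℚ × V)
scale c = map (λ wv → c * proj₁ wv , proj₂ wv)

sumW-scale : (c : ℚ) (l : List (ℚ × V)) (f : V → ℚ) → sumW (scale c l) f ≡ c * sumW l f
sumW-scale c l f = trans (sumW-map l (λ _ → c) f) (sumW-* l c f)

scale-nonneg : {c : ℚ} → 0ℚ ≤ c → (l : List (ℚ × V)) → All (λ wv → 0ℚ ≤ proj₁ wv) l → All (λ wv → 0ℚ ≤ proj₁ wv) (scale c l)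
scale-nonneg h l ps = Allₚ.map⁺ (All.map (λ p → h ⊛ p) ps)

opaque
  unfolding E
  bindW : List (ℚ × V) → (V → Mean W) → List (ℚ × W)
  bindW [] k = []
  bindW ((w , v) ∷ l) k = scale w (Mean.weights (k v)) ++ bindW l k

  sumW-bind : (l : List (ℚ × V)) (k : V → Mean W) (f : W → ℚ) → sumW (bindW l k) f ≡ sumW l (λ v → E (k v) f)
  sumW-bind [] k f = refl
  sumW-bind ((w , v) ∷ l) k f = trans (sumW-++ (scale w (Mean.weights (k v))) (bindW l k) f)
    (cong₂ _+_ (sumW-scale w (Mean.weights (k v)) f) (sumW-bind l k f))

  bindW-nonneg : (l : List (ℚ × V)) (k : V → Mean W) → All (λ wv → 0ℚ ≤ proj₁ wv) l → All (λ wv → 0ℚ ≤ proj₁ wv) (bindW l k)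
  bindW-nonneg [] k [] = []
  bindW-nonneg ((w , v) ∷ l) k (p ∷ ps) = Allₚ.++⁺ (scale-nonneg p (Mean.weights (k v)) (Mean.nonneg (k v))) (bindW-nonneg l k ps)

argmin : (f : V → ℚ) (x : ℚ × V) (l : List (ℚ × V)) → Σ V λ v → All (λ wv → f v ≤ f (proj₂ wv)) (x ∷ l)
argmin f (_ , v) [] = v , ℚₚ.≤-refl ∷ []
argmin f (_ , v) (y ∷ l) with argmin f y l
... | v′ , ps with ℚₚ.≤-total (f v) (f v′)
... | inj₁ h = v , ℚₚ.≤-refl ∷ All.map (ℚₚ.≤-trans h) ps
... | inj₂ h = v′ , h ∷ ps

opaque
  unfolding E bindW
  E-cong : (μ : Mean V) {f g : V → ℚ} → (∀ v → f v ≡ g v) → E μ f ≡ E μ g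
  E-cong μ = sumW-cong (Mean.weights μ)

  E-+ : (μ : Mean V) (f g : V → ℚ) → E μ (λ v → f v + g v) ≡ E μ f + E μ g
  E-+ μ = sumW-+ (Mean.weights μ)

  E-* : (μ : Mean V) (c : ℚ) (f : V → ℚ) → E μ (λ v → c * f v) ≡ c * E μ f
  E-* μ = sumW-* (Mean.weights μ)

  E-mono : (μ : Mean V) {f g : V → ℚ} → (∀ v → f v ≤ g v) → E μ f ≤ E μ g
  E-mono μ h = sumW-mono (Mean.weights μ) (Mean.nonneg μ) (All.universal (λ wv → h (proj₂ wv)) (Mean.weights μ))

  E-const : (μ : Mean V) (c : ℚ) → E μ (λ _ → c) ≡ c
  E-const μ c = trans (sumW-cong (Mean.weights μ) (λ _ → sym (ℚₚ.*-identityʳ c)))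
    (trans (sumW-* (Mean.weights μ) c (λ _ → 1ℚ)) (trans (cong (c *_) (Mean.total μ)) (ℚₚ.*-identityʳ c)))

  E-swap : (μ : Mean V) (ν : Mean W) (f : V → W → ℚ) →
    E μ (λ a → E ν (f a)) ≡ E ν (λ b → E μ (λ a → f a b))
  E-swap μ ν = sumW-swap (Mean.weights μ) (Mean.weights ν)

  -- First-moment method. Total mass 1 excludes an empty support, and the least value on the support
  -- cannot exceed the mean.
  E-∃ : (μ : Mean V) (f : V → ℚ) → Σ V λ v → f v ≤ E μ f
  E-∃ μ@(mean [] _ ()) f
  E-∃ μ@(mean (x ∷ l) nn tot) f with argmin f x l
  ... | v , ps = v , subst (_≤ E μ f) (E-const μ (f v)) (sumW-mono (x ∷ l) nn ps)

  pure : V → Mean V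
  pure v = mean ((1ℚ , v) ∷ []) (0≤1 ∷ []) refl

  E-pure : (v : V) (f : V → ℚ) → E (pure v) f ≡ f v
  E-pure v f = solve 1 (λ x → con 1ℚ :* x :+ con 0ℚ := x) refl (f v)

  bind : Mean V → (V → Mean W) → Mean W
  bind μ k = mean (bindW (Mean.weights μ) k) (bindW-nonneg (Mean.weights μ) k (Mean.nonneg μ))
    (trans (sumW-bind (Mean.weights μ) k (λ _ → 1ℚ)) (trans (sumW-cong (Mean.weights μ) (λ v → Mean.total (k v))) (Mean.total μ)))

  E-bind : (μ : Mean V) (k : V → Mean W) (f : W → ℚ) → E (bind μ k) f ≡ E μ (λ v → E (k v) f)
  E-bind μ = sumW-bind (Mean.weights μ)

  cond : (μ : Mean V) (u : V → Bool) → 0ℚ < E μ (λ v → ⟦ u v ⟧) → Mean V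
  cond μ u h with inverse h
  ... | r , r0 , e = mean (map (λ wv → (r * ⟦ u (proj₂ wv) ⟧) * proj₁ wv , proj₂ wv) (Mean.weights μ))
    (Allₚ.map⁺ (All.map (λ {wv} p → (ℚₚ.<⇒≤ r0 ⊛ 0≤⟦⟧ (u (proj₂ wv))) ⊛ p) (Mean.nonneg μ)))
    (trans (sumW-map (Mean.weights μ) (λ v → r * ⟦ u v ⟧) (λ _ → 1ℚ))
      (trans (sumW-cong (Mean.weights μ) (λ v → ℚₚ.*-identityʳ _))
        (trans (sumW-* (Mean.weights μ) r (λ v → ⟦ u v ⟧)) (trans (ℚₚ.*-comm r _) e))))

  E-cond : (μ : Mean V) (u : V → Bool) (h : 0ℚ < E μ (λ v → ⟦ u v ⟧)) (f : V → ℚ) →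
    E (cond μ u h) f * E μ (λ v → ⟦ u v ⟧) ≡ E μ (λ v → ⟦ u v ⟧ * f v)
  E-cond μ u h f with inverse h
  ... | r , r0 , e = trans (cong (_* E μ (λ v → ⟦ u v ⟧)) (trans (sumW-map (Mean.weights μ) (λ v → r * ⟦ u v ⟧) f)
       (trans (sumW-cong (Mean.weights μ) (λ v → ℚₚ.*-assoc r ⟦ u v ⟧ (f v))) (sumW-* (Mean.weights μ) r (λ v → ⟦ u v ⟧ * f v)))))
     (trans (solve 3 (λ r x p → (r :* x) :* p := x :* (p :* r)) refl r (E μ (λ v → ⟦ u v ⟧ * f v)) (E μ (λ v → ⟦ u v ⟧)))
       (trans (cong (E μ (λ v → ⟦ u v ⟧ * f v) *_) e) (ℚₚ.*-identityʳ _)))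

  sumV : ∀ {n} → Vec V n → (V → ℚ) → ℚ
  sumV [] f = 0ℚ
  sumV (v ∷ vs) f = f v + sumV vs f

  sumV-[] : (f : V → ℚ) → sumV [] f ≡ 0ℚ
  sumV-[] f = refl

  sumV-∷ : ∀ {n} (v : V) (vs : Vec V n) (f : V → ℚ) → sumV (v ∷ vs) f ≡ f v + sumV vs f
  sumV-∷ v vs f = refl

  weigh : ∀ {n} → ℚ → Vec V n → List (ℚ × V)
  weigh r [] = []
  weigh r (v ∷ vs) = (r , v) ∷ weigh r vs

  sumW-weigh : ∀ {n} (r : ℚ) (vs : Vec V n) (f : V → ℚ) → sumW (weigh r vs) f ≡ r * sumV vs f
  sumW-weigh r [] f = sym (ℚₚ.*-zeroʳ r)
  sumW-weigh r (v ∷ vs) f = trans (cong (λ z → r * f v + z) (sumW-weigh r vs f)) (sym (ℚₚ.*-distribˡ-+ r (f v) (sumV vs f)))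

  sumV-1 : ∀ {n} (vs : Vec V n) → sumV vs (λ _ → 1ℚ) ≡ ι n
  sumV-1 [] = refl
  sumV-1 {n = suc n} (v ∷ vs) = trans (ℚₚ.+-comm 1ℚ (sumV vs (λ _ → 1ℚ))) (cong (λ z → z + 1ℚ) (sumV-1 vs))

  weigh-nonneg : ∀ {n} {r : ℚ} (vs : Vec V n) → 0ℚ ≤ r → All (λ wv → 0ℚ ≤ proj₁ wv) (weigh r vs)
  weigh-nonneg [] h = []
  weigh-nonneg (v ∷ vs) h = h ∷ weigh-nonneg vs h

  avg : ∀ {n} → Vec V (suc n) → Mean V
  avg {n = n} vs = let (r , r0 , e) = inverse (0<ι n) in
    mean (weigh r vs) (weigh-nonneg vs (ℚₚ.<⇒≤ r0))
      (trans (sumW-weigh r vs (λ _ → 1ℚ)) (trans (cong (r *_) (sumV-1 vs)) (trans (ℚₚ.*-comm r _) e)))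

  E-avg : ∀ {n} (vs : Vec V (suc n)) (f : V → ℚ) → ι (suc n) * E (avg vs) f ≡ sumV vs f
  E-avg {n = n} vs f = let (r , r0 , e) = inverse (0<ι n) in
    trans (cong (ι (suc n) *_) (sumW-weigh r vs f)) (trans (sym (ℚₚ.*-assoc (ι (suc n)) r (sumV vs f)))
      (trans (cong (_* sumV vs f) e) (ℚₚ.*-identityˡ _)))

E-nonneg : (μ : Mean V) {f : V → ℚ} → (∀ v → 0ℚ ≤ f v) → 0ℚ ≤ E μ f
E-nonneg μ {f} h = subst (_≤ E μ f) (E-const μ 0ℚ) (E-mono μ h)

E-≤c : (μ : Mean V) {f : V → ℚ} {c : ℚ} → (∀ v → f v ≤ c) → E μ f ≤ c
E-≤c μ {f} {c} h = subst (E μ f ≤_) (E-const μ c) (E-mono μ h)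

E-≥c : (μ : Mean V) {f : V → ℚ} {c : ℚ} → (∀ v → c ≤ f v) → c ≤ E μ f
E-≥c μ {f} {c} h = subst (_≤ E μ f) (E-const μ c) (E-mono μ h)

E-*ʳ : (μ : Mean V) (c : ℚ) (f : V → ℚ) → E μ (λ v → f v * c) ≡ E μ f * c
E-*ʳ μ c f = trans (E-cong μ (λ v → ℚₚ.*-comm (f v) c)) (trans (E-* μ c f) (ℚₚ.*-comm c _))

E-neg : (μ : Mean V) (f g : V → ℚ) → E μ (λ v → f v - g v) ≡ E μ f - E μ g
E-neg μ f g = trans (E-+ μ f (λ v → - g v)) (cong (λ z → E μ f + z)
  (trans (E-cong μ (λ v → solve 1 (λ x → :- x := (:- con 1ℚ) :* x) refl (g v)))
    (trans (E-* μ (- 1ℚ) g) (solve 1 (λ x → (:- con 1ℚ) :* x := :- x) refl (E μ g)))))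

E-+c : (μ : Mean V) (f : V → ℚ) (c : ℚ) → E μ (λ v → f v + c) ≡ E μ f + c
E-+c μ f c = trans (E-+ μ f (λ _ → c)) (cong (λ z → E μ f + z) (E-const μ c))

E-not : (μ : Mean V) (u : V → Bool) → E μ (λ v → ⟦ not (u v) ⟧) ≡ 1ℚ - E μ (λ v → ⟦ u v ⟧)
E-not μ u = trans (E-cong μ (λ v → ⟦not⟧ (u v))) (trans (E-neg μ (λ _ → 1ℚ) (λ v → ⟦ u v ⟧)) (cong (_- E μ (λ v → ⟦ u v ⟧)) (E-const μ 1ℚ)))

-- The mean of the square of `f v - E μ f` is nonnegative, and expanding it gives the difference of
-- the two sides.
cauchy : (μ : Mean V) (f : V → ℚ) → E μ f * E μ f ≤ E μ (λ v → f v * f v)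
cauchy μ f = ≤-by (E-nonneg μ (λ v → 0≤² (f v - E μ f))) (sym (trans (cong (_- 0ℚ) eq)
  (solve 2 (λ s m → (s :+ ((:- (m :+ m)) :* m :+ m :* m)) :- con 0ℚ := s :- m :* m) refl (E μ (λ v → f v * f v)) (E μ f))))
  where
  e = E μ f
  eq : E μ (λ v → (f v - e) * (f v - e)) ≡ E μ (λ v → f v * f v) + ((- (e + e)) * e + e * e)
  eq = trans (E-cong μ (λ v → solve 2 (λ x m → (x :- m) :* (x :- m) := x :* x :+ ((:- (m :+ m)) :* x :+ m :* m)) refl (f v) e))
    (trans (E-+ μ (λ v → f v * f v) (λ v → (- (e + e)) * f v + e * e)) (cong (λ z → E μ (λ v → f v * f v) + z)
      (trans (E-+c μ (λ v → (- (e + e)) * f v) (e * e)) (cong (_+ e * e) (E-* μ (- (e + e)) f)))))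

_⊠_ : Mean V → Mean W → Mean (V × W)
μ ⊠ ν = bind μ (λ a → bind ν (λ b → pure (a , b)))

E-⊠ : (μ : Mean V) (ν : Mean W) (f : V × W → ℚ) → E (μ ⊠ ν) f ≡ E μ (λ a → E ν (λ b → f (a , b)))
E-⊠ μ ν f = trans (E-bind μ _ f) (E-cong μ (λ a → trans (E-bind ν _ f) (E-cong ν (λ b → E-pure (a , b) f))))

Π : ∀ {m} → (Fin m → Mean V) → Mean (Vec V m)
Π {m = zero} A = pure []
Π {m = suc m} A = bind (A F.zero) (λ v → bind (Π (A ∘ F.suc)) (λ x → pure (v ∷ x)))

E-Π : ∀ {m} (A : Fin (suc m) → Mean V) (f : Vec V (suc m) → ℚ) →
  E (Π A) f ≡ E (A F.zero) (λ v → E (Π (A ∘ F.suc)) (λ x → f (v ∷ x)))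
E-Π A f = trans (E-bind (A F.zero) _ f) (E-cong (A F.zero) (λ v →
  trans (E-bind (Π (A ∘ F.suc)) _ f) (E-cong (Π (A ∘ F.suc)) (λ x → E-pure (v ∷ x) f))))

-- The coordinates of a product measure are independent, so drawing one afresh keeps every mean.
-- Independence is used in this form: the other coordinates are frozen while `i` varies.
resample : ∀ {m} (A : Fin m → Mean V) (i : Fin m) (f : Vec V m → ℚ) →
  E (Π A) f ≡ E (Π A) (λ x → E (A i) (λ v → f (x [ i ]≔ v)))
resample A F.zero f = trans (E-Π A f) (sym (trans (E-Π A _)
  (trans (E-const (A F.zero) _) (E-swap (Π (A ∘ F.suc)) (A F.zero) (λ x v → f (v ∷ x))))))
resample A (F.suc i) f = trans (E-Π A f) (trans (E-cong (A F.zero) (λ v → resample (A ∘ F.suc) i (λ x → f (v ∷ x)))) (sym (E-Π A _)))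

resample₂ : ∀ {m} (A : Fin m → Mean V) (i j : Fin m) (f : Vec V m → ℚ) →
  E (Π A) f ≡ E (Π A) (λ x → E (A i) (λ a → E (A j) (λ b → f ((x [ i ]≔ a) [ j ]≔ b))))
resample₂ A i j f = trans (resample A j f) (resample A i (λ x → E (A j) (λ b → f (x [ j ]≔ b))))

resample₃ : ∀ {m} (A : Fin m → Mean V) (i j k : Fin m) (f : Vec V m → ℚ) →
  E (Π A) f ≡ E (Π A) (λ x → E (A i) (λ a → E (A j) (λ b → E (A k) (λ c → f (((x [ i ]≔ a) [ j ]≔ b) [ k ]≔ c)))))
resample₃ A i j k f = trans (resample A k f) (resample₂ A i j (λ x → E (A k) (λ c → f (x [ k ]≔ c))))

marginal₂ : ∀ {m} (A : Fin m → Mean V) {i j : Fin m} → i ≢ j → (f : V → V → ℚ) →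
  E (Π A) (λ x → f (lookup x i) (lookup x j)) ≡ E (A i) (λ a → E (A j) (f a))
marginal₂ A {i} {j} ne f = trans (resample₂ A i j _) (trans (E-cong (Π A) (λ x → E-cong (A i) (λ a → E-cong (A j) (λ b →
  cong₂ f (trans (Vecₚ.lookup∘update′ ne (x [ i ]≔ a) b) (Vecₚ.lookup∘update i x a)) (Vecₚ.lookup∘update j (x [ i ]≔ a) b))))) (E-const (Π A) _))

lookup₃ : ∀ {m} {i j k : Fin m} → i ≢ j → i ≢ k → j ≢ k → (x : Vec V m) (a b c : V) →
  let y = ((x [ i ]≔ a) [ j ]≔ b) [ k ]≔ c in lookup y i ≡ a × lookup y j ≡ b × lookup y k ≡ c
lookup₃ {i = i} {j} {k} ij ik jk x a b c =
  trans (Vecₚ.lookup∘update′ ik ((x [ i ]≔ a) [ j ]≔ b) c) (trans (Vecₚ.lookup∘update′ ij (x [ i ]≔ a) b) (Vecₚ.lookup∘update i x a)) ,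
  trans (Vecₚ.lookup∘update′ jk ((x [ i ]≔ a) [ j ]≔ b) c) (Vecₚ.lookup∘update j (x [ i ]≔ a) b) ,
  Vecₚ.lookup∘update k ((x [ i ]≔ a) [ j ]≔ b) c

marginal₃ : ∀ {m} (A : Fin m → Mean V) {i j k : Fin m} → i ≢ j → i ≢ k → j ≢ k → (f : V → V → V → ℚ) →
  E (Π A) (λ x → f (lookup x i) (lookup x j) (lookup x k)) ≡ E (A i) (λ a → E (A j) (λ b → E (A k) (f a b)))
marginal₃ A {i} {j} {k} ij ik jk f = trans (resample₃ A i j k _) (trans (E-cong (Π A) (λ x → E-cong (A i) (λ a → E-cong (A j) (λ b → E-cong (A k) (λ c →
  let (p , q , r) = lookup₃ ij ik jk x a b c in
  trans (cong₂ (λ p q → f p q (lookup (((x [ i ]≔ a) [ j ]≔ b) [ k ]≔ c) k)) p q) (cong (f a b) r)))))) (E-const (Π A) _))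
-- Conditioning and regularity

variable
  m : ℕ

-- ν is μ conditioned on the event test; the law is multiplied out so that no division occurs.
record Sub {V : Set} (s : ℚ) (ν μ : Mean V) : Set where
  constructor sub
  field
    test : V → Bool
    large : s ≤ E μ (λ v → ⟦ test v ⟧)
    law : ∀ f → E ν f * E μ (λ v → ⟦ test v ⟧) ≡ E μ (λ v → ⟦ test v ⟧ * f v)
Sub-weaken : ∀ {s t} {ν μ : Mean V} → s ≤ t → Sub t ν μ → Sub s ν μ
Sub-weaken h (sub u l w) = sub u (ℚₚ.≤-trans h l) w

Sub-refl : (μ : Mean V) → Sub 1ℚ μ μ
Sub-refl μ = sub (λ _ → true) (ℚₚ.≤-reflexive (sym (E-const μ 1ℚ)))
  (λ f → trans (cong (E μ f *_) (E-const μ 1ℚ)) (trans (ℚₚ.*-identityʳ (E μ f)) (E-cong μ (λ v → sym (ℚₚ.*-identityˡ (f v))))))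

Sub-trans : ∀ {s t} {ρ ν μ : Mean V} → 0ℚ ≤ s → 0ℚ ≤ t → Sub s ρ ν → Sub t ν μ → Sub (s * t) ρ μ
Sub-trans {s = s} {t} {ρ} {ν} {μ} 0s 0t (sub u l w) (sub u′ l′ w′) =
  sub (λ v → u′ v ∧ u v) (subst (s * t ≤_) mass (*-mono 0s (ℚₚ.≤-trans 0t l′) l l′))
    (λ f → trans (cong (E ρ f *_) (sym mass)) (trans (sym (ℚₚ.*-assoc (E ρ f) (E ν (λ v → ⟦ u v ⟧)) (E μ (λ v → ⟦ u′ v ⟧))))
      (trans (cong (_* E μ (λ v → ⟦ u′ v ⟧)) (w f)) (trans (w′ (λ v → ⟦ u v ⟧ * f v))
        (E-cong μ (λ v → trans (sym (ℚₚ.*-assoc ⟦ u′ v ⟧ ⟦ u v ⟧ (f v))) (cong (_* f v) (sym (⟦∧⟧ (u′ v) (u v))))))))))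
  where
  mass : E ν (λ v → ⟦ u v ⟧) * E μ (λ v → ⟦ u′ v ⟧) ≡ E μ (λ v → ⟦ u′ v ∧ u v ⟧)
  mass = trans (w′ (λ v → ⟦ u v ⟧)) (E-cong μ (λ v → sym (⟦∧⟧ (u′ v) (u v))))

-- Conditioning on an event of mass at least `s` raises densities by a factor of at most 1/s. This
-- later bounds the weight of a single vertex.
Sub-dominated : ∀ {s} {ν μ : Mean V} → Sub s ν μ → ∀ f → (∀ v → 0ℚ ≤ f v) → s * E ν f ≤ E μ f
Sub-dominated {s = s} {ν} {μ} (sub u l w) f h = ℚₚ.≤-trans
  (subst₂ _≤_ (ℚₚ.*-comm (E ν f) s) refl (E-nonneg ν h ⊗ l))
  (subst (_≤ E μ f) (sym (w f)) (E-mono μ (λ v → *⟦⟧≤ (u v) (h v))))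

Box : ∀ {V m} → ℚ → (Fin m → Mean V) → (Fin m → Mean V) → Set
Box s A′ A = ∀ i → Sub s (A′ i) (A i)

Box-trans : ∀ {s t} {A″ A′ A : Fin m → Mean V} → 0ℚ ≤ s → 0ℚ ≤ t → Box s A″ A′ → Box t A′ A → Box (s * t) A″ A
Box-trans 0s 0t b b′ i = Sub-trans 0s 0t (b i) (b′ i)

Box-weaken : ∀ {s t} {A′ A : Fin m → Mean V} → s ≤ t → Box t A′ A → Box s A′ A
Box-weaken h b i = Sub-weaken h (b i)

Box-refl : ∀ {s} (A : Fin m → Mean V) → s ≤ 1ℚ → Box s A A
Box-refl A h i = Sub-weaken h (Sub-refl (A i))

ind : Vec (V → Bool) m → Vec V m → ℚ
ind [] [] = 1ℚ
ind (u ∷ us) (x ∷ xs) = ⟦ u x ⟧ * ind us xs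

0≤ind : (us : Vec (V → Bool) m) (x : Vec V m) → 0ℚ ≤ ind us x
0≤ind [] [] = 0≤1
0≤ind (u ∷ us) (x ∷ xs) = 0≤⟦⟧ (u x) ⊛ 0≤ind us xs

ind≤1 : (us : Vec (V → Bool) m) (x : Vec V m) → ind us x ≤ 1ℚ
ind≤1 [] [] = ℚₚ.≤-refl
ind≤1 (u ∷ us) (x ∷ xs) = ℚₚ.≤-trans (*⟦⟧≤ (u x) (0≤ind us xs)) (ind≤1 us xs)

mass : (Fin m → Mean V) → Vec (V → Bool) m → ℚ
mass A us = E (Π A) (ind us)

mass-∷ : (A : Fin (suc m) → Mean V) (u : V → Bool) (us : Vec (V → Bool) m) →
  mass A (u ∷ us) ≡ E (A F.zero) (λ v → ⟦ u v ⟧) * mass (A ∘ F.suc) us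
mass-∷ A u us = trans (E-Π A _) (trans (E-cong (A F.zero) (λ v → E-* (Π (A ∘ F.suc)) ⟦ u v ⟧ (ind us)))
  (E-*ʳ (A F.zero) (mass (A ∘ F.suc) us) (λ v → ⟦ u v ⟧)))

0≤mass : (A : Fin m → Mean V) (us : Vec (V → Bool) m) → 0ℚ ≤ mass A us
0≤mass A us = E-nonneg (Π A) (0≤ind us)

mass≤1 : (A : Fin m → Mean V) (us : Vec (V → Bool) m) → mass A us ≤ 1ℚ
mass≤1 A us = E-≤c (Π A) (ind≤1 us)

mass≤ : (A : Fin m → Mean V) (us : Vec (V → Bool) m) (i : Fin m) → mass A us ≤ E (A i) (λ v → ⟦ lookup us i v ⟧)
mass≤ A (u ∷ us) F.zero = subst₂ _≤_ (sym (mass-∷ A u us)) (ℚₚ.*-identityʳ _)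
  (E-nonneg (A F.zero) (λ v → 0≤⟦⟧ (u v)) ⊗ mass≤1 (A ∘ F.suc) us)
mass≤ A (u ∷ us) (F.suc i) = ℚₚ.≤-trans (subst₂ _≤_ (sym (mass-∷ A u us)) (ℚₚ.*-identityˡ _)
  (*-mono (E-nonneg (A F.zero) (λ v → 0≤⟦⟧ (u v))) (0≤mass (A ∘ F.suc) us) (E-≤c (A F.zero) (λ v → ⟦⟧≤1 (u v))) ℚₚ.≤-refl)) (mass≤ (A ∘ F.suc) us i)

tests : ∀ {s} {A′ A : Fin m → Mean V} → Box s A′ A → Vec (V → Bool) m
tests b = Vec.tabulate (λ i → Sub.test (b i))

mass-large : ∀ {s} {A′ A : Fin m → Mean V} → 0ℚ ≤ s → (b : Box s A′ A) → s ^ m ≤ mass A (tests b)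
mass-large {m = zero} {A = A} 0s b = ℚₚ.≤-reflexive (sym (E-pure [] (ind [])))
mass-large {m = suc m} {s = s} {A = A} 0s b = subst (s ^ suc m ≤_) (sym (mass-∷ A (Sub.test (b F.zero)) _))
  (*-mono 0s (0≤mass (A ∘ F.suc) (tests (b ∘ F.suc))) (Sub.large (b F.zero)) (mass-large 0s (b ∘ F.suc)))

-- Conditioning each factor of a product separately amounts to conditioning the product on the box
-- of all the tests.
box-law : ∀ {s} {A′ A : Fin m → Mean V} (b : Box s A′ A) (φ : Vec V m → ℚ) →
  E (Π A′) φ * mass A (tests b) ≡ E (Π A) (λ x → ind (tests b) x * φ x)
box-law {m = zero} {A′ = A′} {A} b φ = trans (cong₂ _*_ (E-pure [] φ) (E-pure [] (ind [])))
  (trans (ℚₚ.*-comm (φ []) 1ℚ) (sym (E-pure [] (λ x → ind [] x * φ x))))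
box-law {m = suc m} {A′ = A′} {A} b φ =
  trans (cong₂ _*_ (E-Π A′ φ) (mass-∷ A (Sub.test (b F.zero)) us))
  (trans (solve 3 (λ a b c → a :* (b :* c) := (a :* b) :* c) refl (E (A′ F.zero) h) (E (A F.zero) (λ v → ⟦ Sub.test (b F.zero) v ⟧)) M)
  (trans (cong (_* M) (Sub.law (b F.zero) h))
  (trans (sym (E-*ʳ (A F.zero) M (λ v → ⟦ Sub.test (b F.zero) v ⟧ * h v)))
  (trans (E-cong (A F.zero) (λ v → trans (ℚₚ.*-assoc ⟦ Sub.test (b F.zero) v ⟧ (h v) M)
      (trans (cong (⟦ Sub.test (b F.zero) v ⟧ *_) (box-law (b ∘ F.suc) (λ x → φ (v ∷ x))))
      (trans (sym (E-* (Π (A ∘ F.suc)) ⟦ Sub.test (b F.zero) v ⟧ _))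
        (E-cong (Π (A ∘ F.suc)) (λ x → sym (ℚₚ.*-assoc ⟦ Sub.test (b F.zero) v ⟧ (ind us x) (φ (v ∷ x)))))))))
    (sym (E-Π A _))))))
  where
  us = tests (b ∘ F.suc)
  M = mass (A ∘ F.suc) us
  h : _ → ℚ
  h v = E (Π (A′ ∘ F.suc)) (λ x → φ (v ∷ x))

-- Disjoint boxes exhaust the complement of a box, so a lower bound on all boxes
-- for a functional vanishing on the whole space is also an upper bound.
complement-bound : ∀ {ξ} (Λ : (Vec V m → ℚ) → ℚ) → (∀ {f g} → (∀ x → f x ≡ g x) → Λ f ≡ Λ g) →
  (∀ f g → Λ (λ x → f x + g x) ≡ Λ f + Λ g) → Λ (λ _ → 1ℚ) ≤ 0ℚ →
  (∀ us → - ξ ≤ Λ (ind us)) → ∀ us → Λ (ind us) ≤ ι m * ξ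
complement-bound {ξ = ξ} Λ Λ-cong Λ-+ z low [] =
  ℚₚ.≤-trans (subst (_≤ 0ℚ) (Λ-cong (λ { [] → refl })) z) (ℚₚ.≤-reflexive (sym (ℚₚ.*-zeroˡ ξ)))
complement-bound {m = suc m} {ξ = ξ} Λ Λ-cong Λ-+ z low (u ∷ us) =
  ≤-by (complement-bound (λ g → Λ (λ x → g (Vec.tail x))) (λ h → Λ-cong (λ x → h (Vec.tail x)))
         (λ f g → Λ-+ (λ x → f (Vec.tail x)) (λ x → g (Vec.tail x))) z low′ us ⊕ low (u′ ∷ us))
    (trans (cong (λ t → (ι m + 1ℚ) * ξ - t) (≡-by split (solve 3 (λ a b c → (c :- b) :- a := c :- (a :+ b)) refl (Λ (ind (u ∷ us))) (Λ (ind (u′ ∷ us))) τ)))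
      (solve 4 (λ i ξ b c → (i :+ con 1ℚ) :* ξ :- (c :- b) := (i :* ξ :+ b) :- (c :+ :- ξ)) refl (ι m) ξ (Λ (ind (u′ ∷ us))) τ))
  where
  u′ = λ v → not (u v)
  τ = Λ (λ x → ind us (Vec.tail x))
  split : Λ (ind (u ∷ us)) + Λ (ind (u′ ∷ us)) ≡ τ
  split = trans (sym (Λ-+ (ind (u ∷ us)) (ind (u′ ∷ us)))) (Λ-cong (λ { (x ∷ xs) →
    trans (cong (λ t → ⟦ u x ⟧ * ind us xs + t * ind us xs) (⟦not⟧ (u x)))
      (solve 2 (λ p q → p :* q :+ (con 1ℚ :- p) :* q := q) refl ⟦ u x ⟧ (ind us xs)) }))
  low′ : ∀ us → - ξ ≤ Λ (λ x → ind us (Vec.tail x))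
  low′ us = subst (- ξ ≤_) (Λ-cong (λ { (x ∷ xs) → ℚₚ.*-identityˡ (ind us xs) })) (low ((λ _ → true) ∷ us))

Reg : ∀ {V m} → ℚ → ℚ → (Fin m → Mean V) → (Vec V m → ℚ) → Set
Reg α ξ A φ = ∀ A′ → Box α A′ A → (E (Π A′) φ ≤ E (Π A) φ + ξ) × (E (Π A) φ ≤ E (Π A′) φ + ξ)

2ℚ : ℚ
2ℚ = 1ℚ + 1ℚ

-- One-sided and without division, so that it speaks of boxes of every mass, even zero.
-- `complement-bound` recovers the opposite inequality.
Low : ∀ {V m} → ℚ → (Fin m → Mean V) → (Vec V m → ℚ) → Set
Low ξ A φ = ∀ us → E (Π A) φ * mass A us - ξ ≤ E (Π A) (λ x → ind us x * φ x)

-- A large sub-box is a box of mass at least `α ^ m`. Its deviation is at least -ξ′ by `Low` and at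
-- most m ξ′ by `complement-bound`; the numerical hypotheses say that both become at most ξ after
-- division by the mass.
low⇒reg : ∀ {α ξ ξ′} → 0ℚ ≤ α → 0ℚ < α ^ m → ι m * ξ′ ≤ α ^ m * ξ → ξ′ ≤ α ^ m * ξ → 0ℚ ≤ ξ →
  (A : Fin m → Mean V) (φ : Vec V m → ℚ) → Low ξ′ A φ → Reg α ξ A φ
low⇒reg {m = m} {V = V} {α = α} {ξ} {ξ′} 0α 0αm c₁ c₂ 0ξ A φ low A′ b = up , down
  where
  e = E (Π A) φ
  us = tests b
  M = mass A us
  M0 : 0ℚ < M
  M0 = ℚₚ.<-≤-trans 0αm (mass-large 0α b)
  Λ : (Vec V m → ℚ) → ℚ
  Λ g = E (Π A) (λ x → g x * φ x) - e * E (Π A) g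
  Λ-cong : ∀ {f g} → (∀ x → f x ≡ g x) → Λ f ≡ Λ g
  Λ-cong h = cong₂ (λ a b → a - e * b) (E-cong (Π A) (λ x → cong (_* φ x) (h x))) (E-cong (Π A) h)
  Λ-+ : ∀ f g → Λ (λ x → f x + g x) ≡ Λ f + Λ g
  Λ-+ f g = trans (cong₂ (λ a b → a - e * b) (trans (E-cong (Π A) (λ x → ℚₚ.*-distribʳ-+ (φ x) (f x) (g x))) (E-+ (Π A) _ _)) (E-+ (Π A) f g))
    (solve 5 (λ a b e c d → (a :+ b) :- e :* (c :+ d) := (a :- e :* c) :+ (b :- e :* d)) refl
      (E (Π A) (λ x → f x * φ x)) (E (Π A) (λ x → g x * φ x)) e (E (Π A) f) (E (Π A) g))
  z : Λ (λ _ → 1ℚ) ≤ 0ℚ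
  z = ℚₚ.≤-reflexive (trans (cong₂ (λ a b → a - e * b) (E-cong (Π A) (λ x → ℚₚ.*-identityˡ (φ x))) (E-const (Π A) 1ℚ))
    (solve 1 (λ e → e :- e :* con 1ℚ := con 0ℚ) refl e))
  lowΛ : ∀ us → - ξ′ ≤ Λ (ind us)
  lowΛ us = ≤-by (low us) (solve 3 (λ a b x → (a :- b) :- (:- x) := a :- (b :- x)) refl (E (Π A) (λ x → ind us x * φ x)) (e * mass A us) ξ′)
  eq : E (Π A′) φ * M ≡ E (Π A) (λ x → ind us x * φ x)
  eq = box-law b φ
  αM : α ^ m * ξ ≤ M * ξ
  αM = subst₂ _≤_ (ℚₚ.*-comm ξ _) (ℚₚ.*-comm ξ _) (0ξ ⊗ mass-large 0α b)
  eq′ : M * E (Π A′) φ ≡ E (Π A) (λ x → ind us x * φ x)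
  eq′ = trans (ℚₚ.*-comm M (E (Π A′) φ)) eq
  up : E (Π A′) φ ≤ e + ξ
  up = *-cancel M0 (≤-by (complement-bound Λ Λ-cong Λ-+ z lowΛ us ⊕ c₁ ⊕ αM)
    (trans (cong (λ t → M * (e + ξ) - t) eq′)
      (solve 6 (λ M e ξ t i a → M :* (e :+ ξ) :- t := (i :+ (a :+ M :* ξ)) :- ((t :- e :* M) :+ (i :+ a))) refl
         M e ξ (E (Π A) (λ x → ind us x * φ x)) (ι m * ξ′) (α ^ m * ξ))))
  down : e ≤ E (Π A′) φ + ξ
  down = *-cancel M0 (≤-by (lowΛ us ⊕ c₂ ⊕ αM)
    (trans (trans (cong (_- M * e) (ℚₚ.*-distribˡ-+ M (E (Π A′) φ) ξ)) (cong (λ s → s + M * ξ - M * e) eq′))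
      (solve 6 (λ M e ξ t x a → t :+ M :* ξ :- M :* e := ((t :- e :* M) :+ (a :+ M :* ξ)) :- (:- x :+ (x :+ a))) refl
         M e ξ (E (Π A) (λ x → ind us x * φ x)) ξ′ (α ^ m * ξ))))

-- Mean decrement. A box violating `Low` has mass at least ξ/2 since φ ≤ 2, and conditioning on it
-- lowers the mean of φ by at least ξ; as φ ≥ 0, at most `k` steps are possible. The continuation
-- also learns that the mean has not grown, which `rounds` relies on.
lower : ∀ {V m} {ξ σ} → 0ℚ < ξ → 0ℚ < σ → σ ≤ 1ℚ → σ + σ ≤ ξ → (φ : Vec V m → ℚ) → (∀ x → 0ℚ ≤ φ x) → (∀ x → φ x ≤ 2ℚ) →
  ∀ k (A : Fin m → Mean V) → E (Π A) φ ≤ ι k * ξ →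
  (∀ A′ → Box (σ ^ k) A′ A → E (Π A′) φ ≤ E (Π A) φ → Low ξ A′ φ → ⊥) → ⊥
lower {V} {m} {ξ} {σ} 0ξ 0σ σ1 2σ φ φ0 φ2 k A h cont =
  cont A (Box-refl A (proj₁ (^≤1 (ℚₚ.<⇒≤ 0σ) σ1 k))) ℚₚ.≤-refl (λ us → ≤-stable λ viol → step k us (ℚₚ.≰⇒> viol) h cont)
  where
  step : ∀ k us → E (Π A) (λ x → ind us x * φ x) < E (Π A) φ * mass A us - ξ → E (Π A) φ ≤ ι k * ξ →
    (∀ A′ → Box (σ ^ k) A′ A → E (Π A′) φ ≤ E (Π A) φ → Low ξ A′ φ → ⊥) → ⊥
  step k us viol h cont = go k h cont
    where
    e = E (Π A) φ
    M = mass A us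
    e0 : 0ℚ ≤ E (Π A) (λ x → ind us x * φ x)
    e0 = E-nonneg (Π A) (λ x → 0≤ind us x ⊛ φ0 x)
    ξ≤ : ξ ≤ e * M
    ξ≤ = ≤-by (e0 ⊕ ℚₚ.<⇒≤ viol) (solve 4 (λ t e M ξ → e :* M :- ξ := (t :+ (e :* M :- ξ)) :- (con 0ℚ :+ t)) refl (E (Π A) (λ x → ind us x * φ x)) e M ξ)
    σ≤M : σ ≤ M
    σ≤M = *-cancel (0<ι 1) (≤-by (2σ ⊕ ξ≤ ⊕ (subst₂ _≤_ (ℚₚ.*-comm M e) (ℚₚ.*-comm M 2ℚ) (0≤mass A us ⊗ E-≤c (Π A) φ2)))
      (solve 4 (λ s M ξ t → (con 0ℚ :+ con 1ℚ :+ con 1ℚ) :* M :- (con 0ℚ :+ con 1ℚ :+ con 1ℚ) :* s := (ξ :+ (t :+ (con 1ℚ :+ con 1ℚ) :* M)) :- (s :+ s :+ (ξ :+ t))) refl σ M ξ (e * M)))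
    pos : ∀ i → σ ≤ E (A i) (λ v → ⟦ lookup us i v ⟧)
    pos i = ℚₚ.≤-trans σ≤M (mass≤ A us i)
    A′ : Fin m → Mean V
    A′ i = cond (A i) (lookup us i) (ℚₚ.<-≤-trans 0σ (pos i))
    b : Box σ A′ A
    b i = sub (lookup us i) (pos i) (E-cond (A i) (lookup us i) (ℚₚ.<-≤-trans 0σ (pos i)))
    eq : E (Π A′) φ * M ≡ E (Π A) (λ x → ind us x * φ x)
    eq = subst (λ w → E (Π A′) φ * mass A w ≡ E (Π A) (λ x → ind w x * φ x)) (Vecₚ.tabulate∘lookup us) (box-law b φ)
    drop : E (Π A′) φ ≤ e - ξ
    drop = *-cancel (ℚₚ.<-≤-trans 0σ σ≤M) (≤-by (ℚₚ.<⇒≤ viol ⊕ (ℚₚ.<⇒≤ 0ξ ⊗ mass≤1 A us))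
      (trans (cong (λ t → M * (e - ξ) - t) (trans (ℚₚ.*-comm M _) eq))
       (solve 4 (λ t e M ξ → M :* (e :- ξ) :- t := ((e :* M :- ξ) :+ ξ :* con 1ℚ) :- (t :+ ξ :* M)) refl (E (Π A) (λ x → ind us x * φ x)) e M ξ)))
    go : ∀ k → e ≤ ι k * ξ → (∀ A′ → Box (σ ^ k) A′ A → E (Π A′) φ ≤ E (Π A) φ → Low ξ A′ φ → ⊥) → ⊥
    go zero h cont = <≤⊥ 0ξ (ℚₚ.≤-trans ξ≤ (subst (e * M ≤_) (ℚₚ.*-zeroʳ M) (subst (_≤ M * 0ℚ) (ℚₚ.*-comm M e) (0≤mass A us ⊗ subst (e ≤_) (ℚₚ.*-zeroˡ ξ) h))))
    go (suc k) h cont = lower 0ξ 0σ σ1 2σ φ φ0 φ2 k A′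
      (≤-by (drop ⊕ h) (solve 4 (λ x e i ξ → i :* ξ :- x := ((e :- ξ) :+ (i :+ con 1ℚ) :* ξ) :- (x :+ e)) refl (E (Π A′) φ) e (ι k) ξ))
      (λ A″ b″ le → cont A″ (subst (λ t → Box t A″ A) (ℚₚ.*-comm (σ ^ k) σ) (Box-trans (ℚₚ.<⇒≤ (0<^ 0σ k)) (ℚₚ.<⇒≤ 0σ) b″ b))
        (ℚₚ.≤-trans le (≤-by (drop ⊕ ℚₚ.<⇒≤ 0ξ) (solve 3 (λ x e ξ → e :- x := ((e :- ξ) :+ ξ) :- (x :+ con 0ℚ)) refl (E (Π A′) φ) e ξ))))

opaque
  regularize : ∀ m {α ξ} → 0ℚ < α → 0ℚ < ξ → Σ ℚ λ s → 0ℚ < s × s ≤ 1ℚ ×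
    (∀ {V} (A : Fin m → Mean V) (φ : Vec V m → ℚ) → (∀ x → 0ℚ ≤ φ x) → (∀ x → φ x ≤ 2ℚ) →
      (∀ A′ → Box s A′ A → E (Π A′) φ ≤ E (Π A) φ → Reg α ξ A′ φ → ⊥) → ⊥)
  regularize m {α} {ξ} 0α 0ξ =
    let (r , 0r , er) = inverse (0<ι m)
        αm = 0<^ 0α m
        -- `r` is 1/(m + 1), so both m ξ′ and ξ′ stay below `α ^ m * ξ`, as `low⇒reg` requires.
        ξ′ = α ^ m * ξ * r
        0ξ′ : 0ℚ < ξ′
        0ξ′ = 0<* (0<* αm 0ξ) 0r
        (h , 0h , eh) = half ξ′ 0ξ′
        (σ , 0σ , σh , σ1) = min₂ 0h 0<1
        (k , hk) = archimedean⁻¹ 0ξ′ 2ℚ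
        2σ : σ + σ ≤ ξ′
        2σ = ℚₚ.≤-trans (σh ⊕ σh) (ℚₚ.≤-reflexive eh)
        p = α ^ m * ξ
        p0 = 0<* αm 0ξ
        er′ : p * (ι (suc m) * r) ≡ p
        er′ = trans (cong (p *_) er) (ℚₚ.*-identityʳ p)
        c₁ : ι m * ξ′ ≤ p
        c₁ = ≤-by (ℚₚ.<⇒≤ 0ξ′) (trans (cong (_- ι m * ξ′) (sym er′)) (solve 3 (λ p i r → p :* ((i :+ con 1ℚ) :* r) :- i :* (p :* r) := p :* r :- con 0ℚ) refl p (ι m) r))
        c₂ : ξ′ ≤ p
        c₂ = ≤-by (0≤ι m ⊛ ℚₚ.<⇒≤ 0ξ′) (trans (cong (_- ξ′) (sym er′)) (solve 3 (λ p i r → p :* ((i :+ con 1ℚ) :* r) :- p :* r := i :* (p :* r) :- con 0ℚ) refl p (ι m) r))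
    in σ ^ k , 0<^ 0σ k , proj₁ (^≤1 (ℚₚ.<⇒≤ 0σ) σ1 k) ,
       λ A φ φ0 φ2 cont → lower 0ξ′ 0σ σ1 2σ φ φ0 φ2 k A (ℚₚ.≤-trans (E-≤c (Π A) φ2) hk)
         (λ A′ b le low → cont A′ b le (low⇒reg (ℚₚ.<⇒≤ 0α) αm c₁ c₂ (ℚₚ.<⇒≤ 0ξ) A′ φ low))

  -- One function at a time. The first is made regular for boxes of size `α * s₂`, hence it stays
  -- regular inside the box cut out for the others. There, two boxes are compared through the first
  -- box, which costs ξ/2 twice.
  regularizeAll : ∀ m c {α ξ} → 0ℚ < α → α ≤ 1ℚ → 0ℚ < ξ → Σ ℚ λ s → 0ℚ < s × s ≤ 1ℚ ×
    (∀ {V} (A : Fin m → Mean V) (φs : List (Vec V m → ℚ)) → length φs ≡ c →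
      All (λ φ → ∀ x → 0ℚ ≤ φ x × φ x ≤ 2ℚ) φs →
      (∀ A′ → Box s A′ A → All (Reg α ξ A′) φs → ⊥) → ⊥)
  regularizeAll m zero 0α α1 0ξ = 1ℚ , 0<1 , ℚₚ.≤-refl , λ { A [] _ _ cont → cont A (Box-refl A ℚₚ.≤-refl) [] }
  regularizeAll m (suc c) {α} {ξ} 0α α1 0ξ =
    let (s₂ , 0s₂ , s₂1 , rest) = regularizeAll m c 0α α1 0ξ
        (h , 0h , eh) = half ξ 0ξ
        0αs = 0<* 0α 0s₂
        (s₁ , 0s₁ , s₁1 , first) = regularize m 0αs 0h
    in s₂ * s₁ , 0<* 0s₂ 0s₁ , *-mono (ℚₚ.<⇒≤ 0s₂) 0≤1 s₂1 s₁1 ,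
       λ { A (φ ∷ φs) len (bd ∷ bds) cont →
         first A φ (λ x → proj₁ (bd x)) (λ x → proj₂ (bd x)) λ A₁ b₁ _ reg →
         rest A₁ φs (ℕₚ.suc-injective len) bds λ A₂ b₂ regs →
         cont A₂ (Box-trans (ℚₚ.<⇒≤ 0s₂) (ℚₚ.<⇒≤ 0s₁) b₂ b₁)
           ((λ A₃ b₃ →
              let (u₃ , d₃) = reg A₃ (Box-trans (ℚₚ.<⇒≤ 0α) (ℚₚ.<⇒≤ 0s₂) b₃ b₂)
                  (u₂ , d₂) = reg A₂ (Box-weaken (subst (α * s₂ ≤_) (ℚₚ.*-identityˡ s₂) (*-mono (ℚₚ.<⇒≤ 0α) (ℚₚ.<⇒≤ 0s₂) α1 ℚₚ.≤-refl)) b₂)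
                  e₁ = E (Π A₁) φ
                  e₂ = E (Π A₂) φ
                  e₃ = E (Π A₃) φ
              in ≤-by (u₃ ⊕ d₂) (trans (cong (λ t → e₂ + t - e₃) (sym eh)) (solve 4 (λ e₁ e₂ e₃ h → e₂ :+ (h :+ h) :- e₃ := (e₁ :+ h :+ (e₂ :+ h)) :- (e₃ :+ e₁)) refl e₁ e₂ e₃ h)) ,
                 ≤-by (u₂ ⊕ d₃) (trans (cong (λ t → e₃ + t - e₂) (sym eh)) (solve 4 (λ e₁ e₂ e₃ h → e₃ :+ (h :+ h) :- e₂ := (e₁ :+ h :+ (e₃ :+ h)) :- (e₂ :+ e₁)) refl e₁ e₂ e₃ h)))
            ∷ regs) }

-- Finite sums over `Fin n`

ΣF : ∀ n → (Fin n → ℚ) → ℚ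
ΣF zero f = 0ℚ
ΣF (suc n) f = f F.zero + ΣF n (f ∘ F.suc)

ΣF-cong : ∀ n {f g : Fin n → ℚ} → (∀ i → f i ≡ g i) → ΣF n f ≡ ΣF n g
ΣF-cong zero h = refl
ΣF-cong (suc n) h = cong₂ _+_ (h F.zero) (ΣF-cong n (h ∘ F.suc))

ΣF-mono : ∀ n {f g : Fin n → ℚ} → (∀ i → f i ≤ g i) → ΣF n f ≤ ΣF n g
ΣF-mono zero h = ℚₚ.≤-refl
ΣF-mono (suc n) h = h F.zero ⊕ ΣF-mono n (h ∘ F.suc)

ΣF-+ : ∀ n (f g : Fin n → ℚ) → ΣF n (λ i → f i + g i) ≡ ΣF n f + ΣF n g
ΣF-+ zero f g = refl
ΣF-+ (suc n) f g = trans (cong (λ z → f F.zero + g F.zero + z) (ΣF-+ n (f ∘ F.suc) (g ∘ F.suc)))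
  (solve 4 (λ a b s t → (a :+ b) :+ (s :+ t) := (a :+ s) :+ (b :+ t)) refl (f F.zero) (g F.zero) (ΣF n (f ∘ F.suc)) (ΣF n (g ∘ F.suc)))

ΣF-* : ∀ n (c : ℚ) (f : Fin n → ℚ) → ΣF n (λ i → c * f i) ≡ c * ΣF n f
ΣF-* zero c f = sym (ℚₚ.*-zeroʳ c)
ΣF-* (suc n) c f = trans (cong (λ z → c * f F.zero + z) (ΣF-* n c (f ∘ F.suc))) (sym (ℚₚ.*-distribˡ-+ c (f F.zero) (ΣF n (f ∘ F.suc))))

ΣF-const : ∀ n (c : ℚ) → ΣF n (λ _ → c) ≡ ι n * c
ΣF-const zero c = sym (ℚₚ.*-zeroˡ c)
ΣF-const (suc n) c = trans (cong (λ z → c + z) (ΣF-const n c)) (solve 2 (λ c i → c :+ i :* c := (i :+ con 1ℚ) :* c) refl c (ι n))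

ΣF-0 : ∀ n {f : Fin n → ℚ} → (∀ i → f i ≡ 0ℚ) → ΣF n f ≡ 0ℚ
ΣF-0 n h = trans (ΣF-cong n h) (trans (ΣF-const n 0ℚ) (ℚₚ.*-zeroʳ (ι n)))

ΣF-nonneg : ∀ n {f : Fin n → ℚ} → (∀ i → 0ℚ ≤ f i) → 0ℚ ≤ ΣF n f
ΣF-nonneg n {f} h = subst (_≤ ΣF n f) (ΣF-0 n {λ _ → 0ℚ} (λ _ → refl)) (ΣF-mono n h)

does-refl : ∀ {n} (i : Fin n) → does (i F.≟ i) ≡ true
does-refl i with i F.≟ i
... | yes _ = refl
... | no h = ⊥-elim (h refl)

does-≢ : ∀ {n} {i j : Fin n} → i ≢ j → does (i F.≟ j) ≡ false
does-≢ {i = i} {j} ne with i F.≟ j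
... | yes e = ⊥-elim (ne e)
... | no _ = refl

ΣF-δ : ∀ n (j : Fin n) (f : Fin n → ℚ) → ΣF n (λ i → ⟦ does (i F.≟ j) ⟧ * f i) ≡ f j
ΣF-δ (suc n) F.zero f = trans (cong₂ _+_ (ℚₚ.*-identityˡ (f F.zero)) (ΣF-0 n (λ i → ℚₚ.*-zeroˡ (f (F.suc i))))) (ℚₚ.+-identityʳ (f F.zero))
ΣF-δ (suc n) (F.suc j) f = trans (cong₂ _+_ (ℚₚ.*-zeroˡ (f F.zero)) (trans (ΣF-cong n (λ i → cong (λ b → ⟦ b ⟧ * f (F.suc i)) (lem i))) (ΣF-δ n j (f ∘ F.suc))))
  (ℚₚ.+-identityˡ (f (F.suc j)))
  where
  lem : ∀ i → does (F.suc i F.≟ F.suc j) ≡ does (i F.≟ j)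
  lem i with i F.≟ j
  ... | yes _ = refl
  ... | no _ = refl

E-ΣF : (μ : Mean V) → ∀ n (f : Fin n → V → ℚ) → E μ (λ v → ΣF n (λ i → f i v)) ≡ ΣF n (λ i → E μ (f i))
E-ΣF μ zero f = E-const μ 0ℚ
E-ΣF μ (suc n) f = trans (E-+ μ (f F.zero) _) (cong (λ z → E μ (f F.zero) + z) (E-ΣF μ n (f ∘ F.suc)))

-- Removal of boxes of low density

module Rounds {V Test : Set} {M N : ℕ} (X : Fin N → Vec V M → Bool) (ev : Fin N → Test → Vec V M → Bool) (κ : ℚ) where

  -- bs lists the boxes found so far; G is the region of the triple e that they leave uncovered.
  G : List (Fin N × Test) → Fin N → Vec V M → Bool
  G [] e x = true
  G ((e′ , u) ∷ bs) e x = G bs e x ∧ not (does (e F.≟ e′) ∧ ev e′ u x)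

  -- The deviation from density κ on what the box of `u` would remove from the current region; the
  -- removal adds exactly this to `excess`.
  Φ : List (Fin N × Test) → Fin N → Test → Vec V M → ℚ
  Φ bs e u x = (⟦ X e x ⟧ - κ) * (⟦ G bs e x ⟧ * ⟦ ev e u x ⟧)

  excess : List (Fin N × Test) → Fin N → Vec V M → ℚ
  excess bs e x = (⟦ X e x ⟧ - κ) * (1ℚ - ⟦ G bs e x ⟧)

  excess-∷ : ∀ bs e′ u e x → excess ((e′ , u) ∷ bs) e x ≡ excess bs e x + ⟦ does (e F.≟ e′) ⟧ * Φ bs e u x
  excess-∷ bs e′ u e x with e F.≟ e′
  ... | yes refl = trans (cong (λ t → (⟦ X e x ⟧ - κ) * (1ℚ - t)) (trans (⟦∧⟧ (G bs e x) (not (ev e u x))) (cong (⟦ G bs e x ⟧ *_) (⟦not⟧ (ev e u x)))))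
    (solve 3 (λ y g v → y :* (con 1ℚ :- g :* (con 1ℚ :- v)) := y :* (con 1ℚ :- g) :+ con 1ℚ :* (y :* (g :* v))) refl (⟦ X e x ⟧ - κ) ⟦ G bs e x ⟧ ⟦ ev e u x ⟧)
  ... | no _ = trans (cong (λ t → (⟦ X e x ⟧ - κ) * (1ℚ - ⟦ t ⟧)) (Boolₚ.∧-identityʳ (G bs e x)))
    (solve 2 (λ y p → y := y :+ con 0ℚ :* p) refl (excess bs e x) (Φ bs e u x))

  Neg : ℚ → (Fin M → Mean V) → List (Fin N × Test) → Set
  Neg h A [] = ⊤
  Neg h A ((e , u) ∷ bs) = Neg h A bs × E (Π A) (Φ bs e u) ≤ - h

  -- Later rounds shrink `A`, so the gain from the boxes already removed must persist on all large
  -- sub-boxes.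
  Her : ℚ → ℚ → (Fin M → Mean V) → List (Fin N × Test) → Set
  Her s h A bs = ∀ A′ → Box s A′ A → Neg h A′ bs

  -- The pieces removed from one triple are disjoint and each has density at most κ. Passing from
  -- `X` to the remaining region `G` therefore loses at most κ.
  excess≤0 : ∀ {h A} → 0ℚ ≤ h → ∀ bs → Neg h A bs → ∀ e → E (Π A) (excess bs e) ≤ 0ℚ
  excess≤0 {A = A} 0h [] _ e = ℚₚ.≤-reflexive (trans (E-cong (Π A) (λ x → solve 1 (λ y → y :* (con 1ℚ :- con 1ℚ) := con 0ℚ) refl (⟦ X e x ⟧ - κ))) (E-const (Π A) 0ℚ))
  excess≤0 {h} {A} 0h ((e′ , u) ∷ bs) (ng , le) e = subst (_≤ 0ℚ) (sym (trans (E-cong (Π A) (excess-∷ bs e′ u e)) (trans (E-+ (Π A) _ _) (cong (λ z → E (Π A) (excess bs e) + z) (E-* (Π A) ⟦ does (e F.≟ e′) ⟧ (Φ bs e u))))))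
    (≤-by (excess≤0 0h bs ng e ⊕ part) (solve 2 (λ s t → con 0ℚ :- (s :+ t) := (con 0ℚ :+ con 0ℚ) :- (s :+ t)) refl (E (Π A) (excess bs e)) (⟦ does (e F.≟ e′) ⟧ * E (Π A) (Φ bs e u))))
    where
    part : ⟦ does (e F.≟ e′) ⟧ * E (Π A) (Φ bs e u) ≤ 0ℚ
    part with e F.≟ e′
    ... | yes refl = subst (_≤ 0ℚ) (sym (ℚₚ.*-identityˡ _)) (ℚₚ.≤-trans le (≤-by 0h (solve 1 (λ h → con 0ℚ :- (:- h) := h :- con 0ℚ) refl h)))
    ... | no _ = ℚₚ.≤-reflexive (ℚₚ.*-zeroˡ (E (Π A) (Φ bs e u)))

  Ψ : (Fin M → Mean V) → List (Fin N × Test) → ℚ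
  Ψ A bs = ΣF N (λ e → E (Π A) (excess bs e))

  Ψ≤ : ∀ {h A} bs → Neg h A bs → Ψ A bs ≤ - (ι (length bs) * h)
  Ψ≤ {h} {A} [] _ = ℚₚ.≤-reflexive (trans (ΣF-0 N (λ e → trans (E-cong (Π A) (λ x → solve 1 (λ y → y :* (con 1ℚ :- con 1ℚ) := con 0ℚ) refl (⟦ X e x ⟧ - κ))) (E-const (Π A) 0ℚ)))
    (solve 1 (λ h → con 0ℚ := :- (con 0ℚ :* h)) refl h))
  Ψ≤ {h} {A} ((e′ , u) ∷ bs) (ng , le) = subst (_≤ - (ι (suc (length bs)) * h))
    (sym (trans (ΣF-cong N (λ e → trans (E-cong (Π A) (excess-∷ bs e′ u e)) (trans (E-+ (Π A) _ _) (cong (λ z → E (Π A) (excess bs e) + z) (E-* (Π A) ⟦ does (e F.≟ e′) ⟧ (Φ bs e u))))))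
      (trans (ΣF-+ N _ _) (cong (λ z → Ψ A bs + z) (ΣF-δ N e′ (λ e → E (Π A) (Φ bs e u)))))))
    (≤-by (Ψ≤ bs ng ⊕ le) (solve 4 (λ i h s t → (:- ((i :+ con 1ℚ) :* h)) :- (s :+ t) := (:- (i :* h) :+ (:- h)) :- (s :+ t)) refl (ι (length bs)) h (Ψ A bs) (E (Π A) (Φ bs e′ u))))

  module _ (0κ : 0ℚ ≤ κ) (κ1 : κ ≤ 1ℚ) where

    -1≤X : ∀ e x → - 1ℚ ≤ ⟦ X e x ⟧ - κ
    -1≤X e x = ≤-by (0≤⟦⟧ (X e x) ⊕ κ1) (solve 2 (λ t k → (t :- k) :- (:- con 1ℚ) := (t :+ con 1ℚ) :- (con 0ℚ :+ k)) refl ⟦ X e x ⟧ κ)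

    X≤1 : ∀ e x → ⟦ X e x ⟧ - κ ≤ 1ℚ
    X≤1 e x = ≤-by (⟦⟧≤1 (X e x) ⊕ 0κ) (solve 2 (λ t k → con 1ℚ :- (t :- k) := (con 1ℚ :+ k) :- (t :+ con 0ℚ)) refl ⟦ X e x ⟧ κ)

    scaled : ∀ {t w} → - 1ℚ ≤ t → t ≤ 1ℚ → 0ℚ ≤ w → w ≤ 1ℚ → - 1ℚ ≤ t * w × t * w ≤ 1ℚ
    scaled {t} {w} u v 0w w1 =
      ≤-by ((0w ⊗ u) ⊕ w1) (solve 2 (λ t w → t :* w :- (:- con 1ℚ) := (w :* t :+ con 1ℚ) :- (w :* (:- con 1ℚ) :+ w)) refl t w) ,
      ≤-by ((0w ⊗ v) ⊕ w1) (solve 2 (λ t w → con 1ℚ :- t :* w := (w :* con 1ℚ :+ con 1ℚ) :- (w :* t :+ w)) refl t w)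

    Φ-bounds : ∀ bs e u x → 0ℚ ≤ Φ bs e u x + 1ℚ × Φ bs e u x + 1ℚ ≤ 2ℚ
    Φ-bounds bs e u x =
      let (lo , hi) = scaled (-1≤X e x) (X≤1 e x) (0≤⟦⟧ (G bs e x) ⊛ 0≤⟦⟧ (ev e u x)) (ℚₚ.≤-trans (*⟦⟧≤ (G bs e x) (0≤⟦⟧ (ev e u x))) (⟦⟧≤1 (ev e u x)))
      in ≤-by lo (solve 1 (λ t → (t :+ con 1ℚ) :- con 0ℚ := t :- (:- con 1ℚ)) refl (Φ bs e u x)) , (hi ⊕ ℚₚ.≤-refl)

    Ψ≥ : ∀ A bs → - ι N ≤ Ψ A bs
    Ψ≥ A bs = subst (_≤ Ψ A bs) (trans (ΣF-const N (- 1ℚ)) (solve 1 (λ n → n :* (:- con 1ℚ) := :- n) refl (ι N)))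
      (ΣF-mono N (λ e → E-≥c (Π A) (λ x → proj₁ (scaled (-1≤X e x) (X≤1 e x)
        (0≤- (⟦⟧≤1 (G bs e x))) (≤-by (0≤⟦⟧ (G bs e x)) (solve 1 (λ g → con 1ℚ :- (con 1ℚ :- g) := g :- con 0ℚ) refl ⟦ G bs e x ⟧))))))

  Tight : ℚ → (Fin M → Mean V) → List (Fin N × Test) → Set
  Tight δ A bs = ∀ e u → - δ ≤ E (Π A) (Φ bs e u)

-- Every box violating Tight lowers Ψ by at least h, for this and all later sub-boxes,
-- while Ψ ≥ - N: so the process stops after at most N / h rounds.
opaque
  rounds : ∀ M N {δ h} (c : ℕ → ℕ) (α ζ : ℕ → ℚ) → 0ℚ < h → h + h ≡ δ →
    (∀ q → 0ℚ < α q) → (∀ q → α q ≤ 1ℚ) → (∀ q → 0ℚ < ζ q) →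
    ∀ k q → ι N < ι (q ℕ.+ k) * h → Σ ℚ λ s → 0ℚ < s × s ≤ 1ℚ ×
    (∀ {V Test : Set} (X : Fin N → Vec V M → Bool) (ev : Fin N → Test → Vec V M → Bool) (κ : ℚ) → 0ℚ ≤ κ → κ ≤ 1ℚ →
      (cols : List (Fin N × Test) → List (Vec V M → ℚ)) → (∀ bs → length (cols bs) ≡ c (length bs)) →
      (∀ bs → All (λ φ → ∀ x → 0ℚ ≤ φ x × φ x ≤ 2ℚ) (cols bs)) →
      ∀ A bs → length bs ≡ q → Rounds.Her X ev κ s h A bs →
      (∀ A′ bs′ → Box s A′ A → Rounds.Tight X ev κ δ A′ bs′ → All (Reg (α (length bs′)) (ζ (length bs′)) A′) (cols bs′) →
         (∀ e → E (Π A′) (Rounds.excess X ev κ bs′ e) ≤ 0ℚ) → ⊥) → ⊥)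
  rounds M N {δ} {h} c α ζ 0h eh 0α α1 0ζ zero q big = 1ℚ , 0<1 , ℚₚ.≤-refl ,
    λ { X ev κ 0κ κ1 cols _ _ A bs refl her cont →
      <≤⊥ big (≤-by (Rounds.Ψ≥ X ev κ 0κ κ1 A bs ⊕ Rounds.Ψ≤ X ev κ bs (her A (Box-refl A ℚₚ.≤-refl)))
        (trans (cong (λ z → ι N - ι z * h) (ℕₚ.+-identityʳ (length bs))) (solve 3 (λ n i p → n :- i := (p :+ (:- i)) :- ((:- n) :+ p)) refl (ι N) (ι (length bs) * h) (Rounds.Ψ X ev κ A bs)))) }
  rounds M N {δ} {h} c α ζ 0h eh 0α α1 0ζ (suc k) q big =
    -- The remaining rounds come first, since their box size `s` determines how regular Φ must be
    -- made now. The parameters of the colours are indexed by the number of boxes because each new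
    -- box refines the colours.
    let (s , 0s , s1 , rest) = rounds M N {δ} {h} c α ζ 0h eh 0α α1 0ζ k (suc q) (subst (λ z → ι N < ι z * h) (ℕₚ.+-suc q k) big)
        (sβ , 0sβ , sβ1 , regs) = regularizeAll M (c q) (0α q) (α1 q) (0ζ q)
        (sγ , 0sγ , sγ1 , reg) = regularize M 0s 0h
        sγβ = sγ * sβ
        0sγβ = 0<* 0sγ 0sβ
        sγβ≤sβ : sγβ ≤ sβ
        sγβ≤sβ = subst (sγβ ≤_) (ℚₚ.*-identityˡ sβ) (*-mono (ℚₚ.<⇒≤ 0sγ) (ℚₚ.<⇒≤ 0sβ) sγ1 ℚₚ.≤-refl)
        t = s * sγβ
        t≤ : t ≤ sγβ
        t≤ = subst (t ≤_) (ℚₚ.*-identityˡ sγβ) (*-mono (ℚₚ.<⇒≤ 0s) (ℚₚ.<⇒≤ 0sγβ) s1 ℚₚ.≤-refl)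
        t≤β = ℚₚ.≤-trans t≤ sγβ≤sβ
    in t , 0<* 0s 0sγβ , ℚₚ.≤-trans t≤β sβ1 ,
       λ { {V} {Test} X ev κ 0κ κ1 cols lens bds A bs refl her cont →
         let open Rounds X ev κ in
         regs A (cols bs) (lens bs) (bds bs) λ A₁ b₁ colreg →
         cont A₁ bs (Box-weaken t≤β b₁) (λ e u → ≤-stable λ viol →
           -- Adding 1 moves Φ into [0, 2], the range that `regularize` accepts.
           reg A₁ (λ x → Φ bs e u x + 1ℚ) (λ x → proj₁ (Φ-bounds 0κ κ1 bs e u x)) (λ x → proj₂ (Φ-bounds 0κ κ1 bs e u x)) λ A₂ b₂ le hr →
           let b₂₁ : Box sγβ A₂ A
               b₂₁ = Box-trans (ℚₚ.<⇒≤ 0sγ) (ℚₚ.<⇒≤ 0sβ) b₂ b₁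
               e₁ = E (Π A₁) (Φ bs e u)
               -- A violation of `Tight` means a mean below -2h. `regularize` has not raised it, and
               -- on s-large sub-boxes it grows by at most h.
               drop : ∀ A₃ → Box s A₃ A₂ → E (Π A₃) (Φ bs e u) ≤ - h
               drop A₃ b₃ = ≤-by (ℚₚ.<⇒≤ (ℚₚ.≰⇒> viol) ⊕ subst₂ _≤_ (E-+c (Π A₂) (Φ bs e u) 1ℚ) (E-+c (Π A₁) (Φ bs e u) 1ℚ) le
                   ⊕ subst₂ (λ a b → a ≤ b + h) (E-+c (Π A₃) (Φ bs e u) 1ℚ) (E-+c (Π A₂) (Φ bs e u) 1ℚ) (proj₁ (hr A₃ b₃)))
                 (trans (solve 4 (λ e₁ e₂ e₃ h → (:- h) :- e₃ := ((:- (h :+ h)) :+ ((e₁ :+ con 1ℚ) :+ (e₂ :+ con 1ℚ :+ h))) :- (e₁ :+ ((e₂ :+ con 1ℚ) :+ (e₃ :+ con 1ℚ)))) refl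
                    e₁ (E (Π A₂) (Φ bs e u)) (E (Π A₃) (Φ bs e u)) h)
                   (cong (λ z → (- z + (e₁ + 1ℚ + (E (Π A₂) (Φ bs e u) + 1ℚ + h))) - (e₁ + (E (Π A₂) (Φ bs e u) + 1ℚ + (E (Π A₃) (Φ bs e u) + 1ℚ)))) eh))
           in rest X ev κ 0κ κ1 cols lens bds A₂ ((e , u) ∷ bs) refl
                (λ A₃ b₃ → her A₃ (Box-trans (ℚₚ.<⇒≤ 0s) (ℚₚ.<⇒≤ 0sγβ) b₃ b₂₁) , drop A₃ b₃)
                (λ A′ bs′ b′ → cont A′ bs′ (Box-trans (ℚₚ.<⇒≤ 0s) (ℚₚ.<⇒≤ 0sγβ) b′ b₂₁)))
           colreg (excess≤0 (ℚₚ.<⇒≤ 0h) bs (her A₁ (Box-weaken t≤β b₁))) }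

-- Functions of a triple as tests on pairs

set₃ : Vec V m → (i j k : Fin m) → V → V → V → Vec V m
set₃ x i j k a b c = ((x [ i ]≔ a) [ j ]≔ b) [ k ]≔ c

_∈₃_ : ∀ {n} → Fin n → Fin n × Fin n × Fin n → Set
l ∈₃ (i , j , k) = (l ≡ i) ⊎ (l ≡ j) ⊎ (l ≡ k)

∈₃? : ∀ {n} (l : Fin n) t → Dec (l ∈₃ t)
∈₃? l (i , j , k) = (l F.≟ i) ⊎-dec ((l F.≟ j) ⊎-dec (l F.≟ k))

Increasing : ∀ {n} → Fin n × Fin n × Fin n → Set
Increasing (i , j , k) = i F.< j × j F.< k

<⇒≢F : ∀ {n} {i j : Fin n} → i F.< j → i ≢ j
<⇒≢F h refl = ℕₚ.<-irrefl refl h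

∈₃-bounds : ∀ {n} {l : Fin n} {t} → Increasing t → l ∈₃ t → proj₁ t F.≤ l × l F.≤ proj₂ (proj₂ t)
∈₃-bounds (p , q) (inj₁ refl) = ℕₚ.≤-refl , ℕₚ.<⇒≤ (ℕₚ.<-trans p q)
∈₃-bounds (p , q) (inj₂ (inj₁ refl)) = ℕₚ.<⇒≤ p , ℕₚ.<⇒≤ q
∈₃-bounds (p , q) (inj₂ (inj₂ refl)) = ℕₚ.<⇒≤ (ℕₚ.<-trans p q) , ℕₚ.≤-refl

∈₃-unique : ∀ {n} {i j k : Fin n} {t} → Increasing (i , j , k) → Increasing t → i ∈₃ t → j ∈₃ t → k ∈₃ t → (i , j , k) ≡ t
∈₃-unique {i = i} {j} {k} {i′ , j′ , k′} (p , q) (p′ , q′) mi mj mk = cong₂ _,_ ei (cong₂ _,_ ej ek)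
  where
  lo = proj₁ (∈₃-bounds (p′ , q′) mi)
  hi = proj₂ (∈₃-bounds (p′ , q′) mk)
  get-j : j ∈₃ (i′ , j′ , k′) → j ≡ j′
  get-j (inj₁ refl) = ⊥-elim (ℕₚ.<⇒≱ p lo)
  get-j (inj₂ (inj₁ e)) = e
  get-j (inj₂ (inj₂ refl)) = ⊥-elim (ℕₚ.<⇒≱ q hi)
  ej = get-j mj
  get-i : i ∈₃ (i′ , j′ , k′) → i ≡ i′
  get-i (inj₁ e) = e
  get-i (inj₂ (inj₁ e)) = ⊥-elim (<⇒≢F p (trans e (sym ej)))
  get-i (inj₂ (inj₂ e)) = ⊥-elim (ℕₚ.<-asym (subst₂ F._<_ e ej p) q′)
  ei = get-i mi
  get-k : k ∈₃ (i′ , j′ , k′) → k ≡ k′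
  get-k (inj₁ e) = ⊥-elim (ℕₚ.<-asym (subst₂ F._<_ ej e q) p′)
  get-k (inj₂ (inj₁ e)) = ⊥-elim (<⇒≢F q (trans ej (sym e)))
  get-k (inj₂ (inj₂ e)) = e
  ek = get-k mk

set-other : ∀ {l j : Fin m} (x y : Vec V m) (b c : V) → l ≢ j → lookup x l ≡ lookup y l → lookup (x [ j ]≔ b) l ≡ lookup (y [ j ]≔ c) l
set-other x y b c ne e = trans (Vecₚ.lookup∘update′ ne x b) (trans e (sym (Vecₚ.lookup∘update′ ne y c)))

set-same : ∀ {l : Fin m} (j : Fin m) (x y : Vec V m) (b : V) → lookup x l ≡ lookup y l → lookup (x [ j ]≔ b) l ≡ lookup (y [ j ]≔ b) l
set-same {l = l} j x y b e with l F.≟ j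
... | yes refl = trans (Vecₚ.lookup∘update l x b) (sym (Vecₚ.lookup∘update l y b))
... | no ne = set-other x y b b ne e

Depends : ∀ {V m} → Fin m × Fin m × Fin m → (Vec V m → Bool) → Set
Depends t w = ∀ x y → (∀ l → l ∈₃ t → lookup x l ≡ lookup y l) → w x ≡ w y

Test₃ : Set → Set
Test₃ V = (V → V → Bool) × (V → V → Bool) × (V → V → Bool)

apply₃ : Test₃ V → V → V → V → Bool
apply₃ (u₁ , u₂ , u₃) a b c = u₁ a b ∧ (u₂ a c ∧ u₃ b c)

-- With the vertices outside `t` frozen, `w` has the form of the tests against which the region was
-- made tight. Hence factors belonging to other triples can be absorbed into the test.
record Nice {V : Set} {m : ℕ} (t : Fin m × Fin m × Fin m) (w : Vec V m → Bool) : Set where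
  constructor nice
  field
    split : ∀ x → Σ (Test₃ V) λ u → ∀ a b c → w (set₃ x (proj₁ t) (proj₁ (proj₂ t)) (proj₂ (proj₂ t)) a b c) ≡ apply₃ u a b c

∧-interchange : ∀ p q r s → (p ∧ q) ∧ (r ∧ s) ≡ (p ∧ r) ∧ (q ∧ s)
∧-interchange false q r s = refl
∧-interchange true true r s = refl
∧-interchange true false true s = refl
∧-interchange true false false s = refl

nice-∧ : ∀ t {w w′ : Vec V m → Bool} → Nice t w → Nice t w′ → Nice t (λ x → w x ∧ w′ x)
nice-∧ t n n′ = nice λ x →
  let ((u₁ , u₂ , u₃) , e) = Nice.split n x
      ((v₁ , v₂ , v₃) , e′) = Nice.split n′ x
  in ((λ a b → u₁ a b ∧ v₁ a b) , (λ a b → u₂ a b ∧ v₂ a b) , (λ a b → u₃ a b ∧ v₃ a b)) ,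
     λ a b c → trans (cong₂ _∧_ (e a b c) (e′ a b c)) (trans (∧-interchange (u₁ a b) (u₂ a c ∧ u₃ b c) (v₁ a b) (v₂ a c ∧ v₃ b c))
       (cong ((u₁ a b ∧ v₁ a b) ∧_) (∧-interchange (u₂ a c) (u₃ b c) (v₂ a c) (v₃ b c))))

nice-true : ∀ t → Nice {V} {m} t (λ _ → true)
nice-true t = nice λ x → ((λ _ _ → true) , (λ _ _ → true) , (λ _ _ → true)) , λ _ _ _ → refl

-- Two distinct triples share at most two vertices, so a function of one of them is
-- a function of at most two of the vertices of the other.
nice-other : ∀ {t t′} {w : Vec V m → Bool} → Increasing t → Increasing t′ → t ≢ t′ → Depends t′ w → Nice t w
nice-other {t = i , j , k} {t′} {w} inc inc′ ne dep with ∈₃? i t′ | ∈₃? j t′ | ∈₃? k t′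
... | yes mi | yes mj | yes mk = ⊥-elim (ne (∈₃-unique inc inc′ mi mj mk))
... | no ni | _ | _ = nice λ x → ((λ _ _ → true) , (λ _ _ → true) , (λ b c → w (set₃ x i j k (lookup x i) b c))) ,
  λ a b c → dep _ _ (λ l ml → set-same k ((x [ i ]≔ a) [ j ]≔ b) ((x [ i ]≔ lookup x i) [ j ]≔ b) c (set-same j (x [ i ]≔ a) (x [ i ]≔ lookup x i) b (set-other x x a (lookup x i) (λ { refl → ni ml }) refl)))
... | yes _ | no nj | _ = nice λ x → ((λ _ _ → true) , (λ a c → w (set₃ x i j k a (lookup x j) c)) , (λ _ _ → true)) ,
  λ a b c → trans (dep _ _ (λ l ml → set-same k ((x [ i ]≔ a) [ j ]≔ b) ((x [ i ]≔ a) [ j ]≔ lookup x j) c (set-other (x [ i ]≔ a) (x [ i ]≔ a) b (lookup x j) (λ { refl → nj ml }) refl))) (sym (Boolₚ.∧-identityʳ _))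
... | yes _ | yes _ | no nk = nice λ x → ((λ a b → w (set₃ x i j k a b (lookup x k))) , (λ _ _ → true) , (λ _ _ → true)) ,
  λ a b c → trans (dep _ _ (λ l ml → set-other ((x [ i ]≔ a) [ j ]≔ b) ((x [ i ]≔ a) [ j ]≔ b) c (lookup x k) (λ { refl → nk ml }) refl)) (sym (Boolₚ.∧-identityʳ _))

co : ∀ {M} → Fin (M ℕ.* (M ℕ.* M)) → Fin M × Fin M × Fin M
co {M} e = proj₁ (F.remQuot (M ℕ.* M) e) , F.remQuot M (proj₂ (F.remQuot {M} (M ℕ.* M) e))

tri : ∀ {M} → Fin M × Fin M × Fin M → Fin (M ℕ.* (M ℕ.* M))
tri (i , j , k) = F.combine i (F.combine j k)

co-tri : ∀ {M} (t : Fin M × Fin M × Fin M) → co (tri t) ≡ t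
co-tri {M} (i , j , k) = trans (cong (λ z → proj₁ z , F.remQuot M (proj₂ z)) (Fₚ.remQuot-combine i (F.combine j k)))
  (cong (i ,_) (Fₚ.remQuot-combine j k))

tri-co : ∀ {M} (e : Fin (M ℕ.* (M ℕ.* M))) → tri (co {M} e) ≡ e
tri-co {M} e = trans (cong (F.combine (proj₁ (co {M} e))) (Fₚ.combine-remQuot {M} M (proj₂ (F.remQuot {M} (M ℕ.* M) e)))) (Fₚ.combine-remQuot {M} (M ℕ.* M) e)

at₃ : ∀ {A : Set} → (V → V → V → A) → Fin m × Fin m × Fin m → Vec V m → A
at₃ f (i , j , k) x = f (lookup x i) (lookup x j) (lookup x k)

at₃-depends : ∀ (f : V → V → V → Bool) (t : Fin m × Fin m × Fin m) → Depends t (at₃ f t)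
at₃-depends f (i , j , k) x y h = trans (cong₂ (λ p q → f p q (lookup x k)) (h i (inj₁ refl)) (h j (inj₂ (inj₁ refl)))) (cong (f (lookup y i) (lookup y j)) (h k (inj₂ (inj₂ refl))))

at₃-set₃ : ∀ (f : V → V → V → Bool) {t : Fin m × Fin m × Fin m} → Increasing t → ∀ x a b c →
  at₃ f t (set₃ x (proj₁ t) (proj₁ (proj₂ t)) (proj₂ (proj₂ t)) a b c) ≡ f a b c
at₃-set₃ f {i , j , k} (p , q) x a b c =
  let (e₁ , e₂ , e₃) = lookup₃ (<⇒≢F p) (<⇒≢F (ℕₚ.<-trans p q)) (<⇒≢F q) x a b c
  in trans (cong₂ (λ s t → f s t (lookup (set₃ x i j k a b c) k)) e₁ e₂) (cong (f a b) e₃)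

every : List Z → (Z → Bool) → Bool
every [] f = true
every (z ∷ zs) f = f z ∧ every zs f

every-intro : ∀ (l : List Z) {f : Z → Bool} → (∀ {z} → z ∈ l → f z ≡ true) → every l f ≡ true
every-intro [] h = refl
every-intro (z ∷ l) h = cong₂ _∧_ (h (here refl)) (every-intro l (h ∘ there))

∧-true : ∀ {p q} → p ∧ q ≡ true → p ≡ true × q ≡ true
∧-true {true} {true} h = refl , refl

every-elim : ∀ (l : List Z) {f : Z → Bool} → every l f ≡ true → ∀ {z} → z ∈ l → f z ≡ true
every-elim (z ∷ l) h (here refl) = proj₁ (∧-true h)
every-elim (z ∷ l) h (there m) = every-elim l (proj₂ (∧-true h)) m

Distinct : List Z → Set
Distinct [] = ⊤
Distinct (z ∷ zs) = All (λ z′ → z ≢ z′) zs × Distinct zs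

module Removal {V : Set} {M : ℕ} (Y : Fin M × Fin M × Fin M → V → V → V → Bool) (κ : ℚ) where

  N₃ : ℕ
  N₃ = M ℕ.* (M ℕ.* M)

  X : Fin N₃ → Vec V M → Bool
  X e = at₃ (Y (co {M} e)) (co {M} e)

  ev : Fin N₃ → Test₃ V → Vec V M → Bool
  ev e u = at₃ (apply₃ u) (co {M} e)

  open Rounds X ev κ public

  G-depends : ∀ bs e → Depends (co {M} e) (G bs e)
  G-depends [] e x y h = refl
  G-depends ((e′ , u) ∷ bs) e x y h with e F.≟ e′
  ... | yes refl = cong₂ (λ p q → p ∧ not q) (G-depends bs e x y h) (at₃-depends (apply₃ u) (co {M} e) x y h)
  ... | no _ = cong (_∧ true) (G-depends bs e x y h)

  module _ (A : Fin M → Mean V) (bs : List (Fin N₃ × Test₃ V)) {δ : ℚ} (tight : Tight δ A bs) where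

    -- For each choice of the vertices outside the triple, `w` becomes a test `u`, while `X` and `G`
    -- see only the triple. The mean over the triple is then the mean of Φ for `u`; `Tight` bounds
    -- it before the other vertices are averaged.
    tight-nice : ∀ e (w : Vec V M → Bool) → Increasing (co {M} e) → Nice (co {M} e) w →
      - δ ≤ E (Π A) (λ x → (⟦ X e x ⟧ - κ) * (⟦ G bs e x ⟧ * ⟦ w x ⟧))
    tight-nice e w inc nc = subst (- δ ≤_) (sym (resample₃ A i j k f)) (E-≥c (Π A) λ x →
        let (u , hu) = Nice.split nc x
            g : Vec V M → ℚ
            g z = (⟦ X e z ⟧ - κ) * ⟦ G bs e z ⟧
            g-agree : ∀ z a b c → g (s x a b c) ≡ g (s z a b c)
            g-agree z a b c = cong₂ (λ p q → (⟦ p ⟧ - κ) * ⟦ q ⟧) (at₃-depends (Y (co {M} e)) (co {M} e) (s x a b c) (s z a b c) (agree x z a b c)) (G-depends bs e (s x a b c) (s z a b c) (agree x z a b c))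
            inner : ∀ z a b c → f (s x a b c) ≡ Φ bs e u (s z a b c)
            inner z a b c = trans (sym (ℚₚ.*-assoc (⟦ X e (s x a b c) ⟧ - κ) ⟦ G bs e (s x a b c) ⟧ ⟦ w (s x a b c) ⟧))
              (trans (cong₂ _*_ (g-agree z a b c) (cong ⟦_⟧ (trans (hu a b c) (sym (at₃-set₃ (apply₃ u) inc z a b c)))))
                (ℚₚ.*-assoc (⟦ X e (s z a b c) ⟧ - κ) ⟦ G bs e (s z a b c) ⟧ ⟦ ev e u (s z a b c) ⟧))
        in subst (- δ ≤_) (trans (resample₃ A i j k (Φ bs e u)) (trans (E-cong (Π A) (λ z →
              E-cong (A i) (λ a → E-cong (A j) (λ b → E-cong (A k) (λ c → sym (inner z a b c)))))) (E-const (Π A) _))) (tight e u))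
      where
      i = proj₁ (co {M} e)
      j = proj₁ (proj₂ (co {M} e))
      k = proj₂ (proj₂ (co {M} e))
      s : Vec V M → V → V → V → Vec V M
      s x = set₃ x i j k
      f : Vec V M → ℚ
      f x = (⟦ X e x ⟧ - κ) * (⟦ G bs e x ⟧ * ⟦ w x ⟧)
      agree : ∀ x z a b c l → l ∈₃ co {M} e → lookup (s x a b c) l ≡ lookup (s z a b c) l
      agree x z a b c l ml =
        let (p , q) = inc
            (e₁ , e₂ , e₃) = lookup₃ (<⇒≢F p) (<⇒≢F (ℕₚ.<-trans p q)) (<⇒≢F q) x a b c
            (d₁ , d₂ , d₃) = lookup₃ (<⇒≢F p) (<⇒≢F (ℕₚ.<-trans p q)) (<⇒≢F q) z a b c
        in agree′ ml e₁ e₂ e₃ d₁ d₂ d₃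
        where
        agree′ : l ∈₃ co {M} e → lookup (s x a b c) i ≡ a → lookup (s x a b c) j ≡ b → lookup (s x a b c) k ≡ c →
          lookup (s z a b c) i ≡ a → lookup (s z a b c) j ≡ b → lookup (s z a b c) k ≡ c → lookup (s x a b c) l ≡ lookup (s z a b c) l
        agree′ (inj₁ refl) e₁ e₂ e₃ d₁ d₂ d₃ = trans e₁ (sym d₁)
        agree′ (inj₂ (inj₁ refl)) e₁ e₂ e₃ d₁ d₂ d₃ = trans e₂ (sym d₂)
        agree′ (inj₂ (inj₂ refl)) e₁ e₂ e₃ d₁ d₂ d₃ = trans e₃ (sym d₃)

    nice-every : ∀ e → Increasing (co {M} e) → ∀ es → All (λ e′ → Increasing (co {M} e′)) es → All (e ≢_) es →
      Nice (co {M} e) (λ x → every es (λ e′ → G bs e′ x))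
    nice-every e inc [] [] [] = nice-true (co {M} e)
    nice-every e inc (e′ ∷ es) (i ∷ is) (n ∷ ns) = nice-∧ (co {M} e) (nice-other inc i (λ h → n (trans (sym (tri-co {M} e)) (trans (cong tri h) (tri-co {M} e′)))) (G-depends bs e′)) (nice-every e inc es is ns)

    -- The factors X are replaced by κ one at a time: by nice-every the remaining factors
    -- form a test for the triple of the current one.
    remove : 0ℚ ≤ κ → κ ≤ 1ℚ → 0ℚ ≤ δ → ∀ es → All (λ e → Increasing (co {M} e)) es → Distinct es →
      ∀ w → All (λ e → Nice (co {M} e) w) es →
      κ ^ length es * E (Π A) (λ x → ⟦ w x ∧ every es (λ e → G bs e x) ⟧)
        ≤ E (Π A) (λ x → ⟦ w x ∧ every es (λ e → X e x ∧ G bs e x) ⟧) + ι (length es) * δ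
    remove 0κ κ1 0δ [] _ _ w _ = ℚₚ.≤-reflexive (trans (ℚₚ.*-identityˡ e₀) (solve 2 (λ e d → e := e :+ con 0ℚ :* d) refl e₀ δ))
      where e₀ = E (Π A) (λ x → ⟦ w x ∧ true ⟧)
    remove 0κ κ1 0δ (e ∷ es) (inc ∷ incs) (ne , dis) w (n ∷ ns) =
      -- Replacing the current factor costs K δ, at most δ because K is a power of κ ≤ 1. The
      -- induction hypothesis is used with `w₁`, which has absorbed this factor.
      ≤-by ((p0 ⊗ tight-nice e w₀ inc (nice-∧ (co {M} e) n (nice-every e inc es incs ne)))
            ⊕ (0δ ⊗ p1) ⊕ remove 0κ κ1 0δ es incs dis w₁ nices)
        (trans (cong₂ (λ u v → u + (ι (length es) + 1ℚ) * δ - (κ * K) * v) E₃≡ E₀≡)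
          (trans (solve 7 (λ K κ b a c i δ → c :+ (i :+ con 1ℚ) :* δ :- (κ :* K) :* b :=
                 (K :* (a :- κ :* b) :+ (δ :* con 1ℚ :+ (c :+ i :* δ))) :- (K :* (:- δ) :+ (δ :* K :+ K :* a))) refl K κ B₀ B₁ B₃ (ι (length es)) δ)
            (cong (λ u → (K * u + (δ * 1ℚ + (B₃ + ι (length es) * δ))) - (K * (- δ) + (δ * K + K * B₁))) (sym mid))))
      where
      K = κ ^ length es
      p0 = proj₂ (^≤1 0κ κ1 (length es))
      p1 = proj₁ (^≤1 0κ κ1 (length es))
      w₀ : Vec V M → Bool
      w₀ x = w x ∧ every es (λ e′ → G bs e′ x)
      w₁ : Vec V M → Bool
      w₁ x = w x ∧ (X e x ∧ G bs e x)
      E₀ = E (Π A) (λ x → ⟦ w x ∧ (G bs e x ∧ every es (λ e′ → G bs e′ x)) ⟧)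
      E₃ = E (Π A) (λ x → ⟦ w x ∧ ((X e x ∧ G bs e x) ∧ every es (λ e′ → X e′ x ∧ G bs e′ x)) ⟧)
      B₀ = E (Π A) (λ x → ⟦ G bs e x ⟧ * ⟦ w₀ x ⟧)
      B₁ = E (Π A) (λ x → ⟦ w₁ x ∧ every es (λ e′ → G bs e′ x) ⟧)
      B₃ = E (Π A) (λ x → ⟦ w₁ x ∧ every es (λ e′ → X e′ x ∧ G bs e′ x) ⟧)
      E₃≡ : E₃ ≡ B₃
      E₃≡ = E-cong (Π A) (λ x → cong ⟦_⟧ (sym (Boolₚ.∧-assoc (w x) (X e x ∧ G bs e x) _)))
      comm3 : ∀ p q r → p ∧ (q ∧ r) ≡ q ∧ (p ∧ r)
      comm3 true true r = refl
      comm3 true false r = refl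
      comm3 false true r = refl
      comm3 false false r = refl
      E₀≡ : E₀ ≡ B₀
      E₀≡ = E-cong (Π A) (λ x → trans (cong ⟦_⟧ (comm3 (w x) (G bs e x) _)) (⟦∧⟧ (G bs e x) (w₀ x)))
      mid : E (Π A) (λ x → (⟦ X e x ⟧ - κ) * (⟦ G bs e x ⟧ * ⟦ w₀ x ⟧)) ≡ B₁ - κ * B₀
      mid = trans (E-cong (Π A) (λ x → trans (solve 4 (λ y k g w → (y :- k) :* (g :* w) := y :* (g :* w) :- k :* (g :* w)) refl ⟦ X e x ⟧ κ ⟦ G bs e x ⟧ ⟦ w₀ x ⟧)
                (cong (_- κ * (⟦ G bs e x ⟧ * ⟦ w₀ x ⟧)) (trans (cong (⟦ X e x ⟧ *_) (sym (⟦∧⟧ (G bs e x) (w₀ x)))) (trans (sym (⟦∧⟧ (X e x) (G bs e x ∧ w₀ x)))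
                  (cong ⟦_⟧ (perm (X e x) (G bs e x) (w x) _)))))))
              (trans (E-neg (Π A) _ _) (cong (λ z → B₁ - z) (E-* (Π A) κ (λ x → ⟦ G bs e x ⟧ * ⟦ w₀ x ⟧))))
        where
        perm : ∀ a g w h → a ∧ (g ∧ (w ∧ h)) ≡ (w ∧ (a ∧ g)) ∧ h
        perm true true true h = refl
        perm true true false h = refl
        perm true false true h = refl
        perm true false false h = refl
        perm false g true h = refl
        perm false g false h = refl
      nices : All (λ e′ → Nice (co {M} e′) w₁) es
      nices = go es incs ne ns
        where
        go : ∀ es → All (λ e → Increasing (co {M} e)) es → All (e ≢_) es → All (λ e → Nice (co {M} e) w) es → All (λ e′ → Nice (co {M} e′) w₁) es
        go [] [] [] [] = []
        go (e′ ∷ es) (i ∷ is) (n ∷ ns) (c ∷ cs) =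
          let ne′ = λ h → n (sym (trans (sym (tri-co {M} e′)) (trans (cong tri h) (tri-co {M} e))))
          in nice-∧ (co {M} e′) c (nice-∧ (co {M} e′) (nice-other i inc ne′ (at₃-depends (Y (co {M} e)) (co {M} e))) (nice-other i inc ne′ (G-depends bs e))) ∷ go es is ns cs

-- Sums over lists and finite sets of colours

ΣL : List Z → (Z → ℚ) → ℚ
ΣL [] f = 0ℚ
ΣL (z ∷ zs) f = f z + ΣL zs f

ΣL-cong : (l : List Z) {f g : Z → ℚ} → (∀ z → f z ≡ g z) → ΣL l f ≡ ΣL l g
ΣL-cong [] h = refl
ΣL-cong (z ∷ l) h = cong₂ _+_ (h z) (ΣL-cong l h)

ΣL-mono : (l : List Z) {f g : Z → ℚ} → (∀ z → f z ≤ g z) → ΣL l f ≤ ΣL l g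
ΣL-mono [] h = ℚₚ.≤-refl
ΣL-mono (z ∷ l) h = h z ⊕ ΣL-mono l h

ΣL-* : (l : List Z) (c : ℚ) (f : Z → ℚ) → ΣL l (λ z → c * f z) ≡ c * ΣL l f
ΣL-* [] c f = sym (ℚₚ.*-zeroʳ c)
ΣL-* (z ∷ l) c f = trans (cong (λ s → c * f z + s) (ΣL-* l c f)) (sym (ℚₚ.*-distribˡ-+ c (f z) (ΣL l f)))

ΣL-+ : (l : List Z) (f g : Z → ℚ) → ΣL l (λ z → f z + g z) ≡ ΣL l f + ΣL l g
ΣL-+ [] f g = refl
ΣL-+ (z ∷ l) f g = trans (cong (λ s → f z + g z + s) (ΣL-+ l f g))
  (solve 4 (λ a b s t → (a :+ b) :+ (s :+ t) := (a :+ s) :+ (b :+ t)) refl (f z) (g z) (ΣL l f) (ΣL l g))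

ΣL-const : (l : List Z) (c : ℚ) → ΣL l (λ _ → c) ≡ ι (length l) * c
ΣL-const [] c = sym (ℚₚ.*-zeroˡ c)
ΣL-const (z ∷ l) c = trans (cong (λ s → c + s) (ΣL-const l c)) (solve 2 (λ c i → c :+ i :* c := (i :+ con 1ℚ) :* c) refl c (ι (length l)))

ΣL-++ : (l k : List Z) (f : Z → ℚ) → ΣL (l ++ k) f ≡ ΣL l f + ΣL k f
ΣL-++ [] k f = sym (ℚₚ.+-identityˡ _)
ΣL-++ (z ∷ l) k f = trans (cong (λ s → f z + s) (ΣL-++ l k f)) (sym (ℚₚ.+-assoc (f z) (ΣL l f) (ΣL k f)))

ΣL-map : (h : W → Z) (l : List W) (f : Z → ℚ) → ΣL (map h l) f ≡ ΣL l (f ∘ h)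
ΣL-map h [] f = refl
ΣL-map h (w ∷ l) f = cong (λ s → f (h w) + s) (ΣL-map h l f)

ΣL-concatMap : (h : W → List Z) (l : List W) (f : Z → ℚ) → ΣL (concatMap h l) f ≡ ΣL l (λ w → ΣL (h w) f)
ΣL-concatMap h [] f = refl
ΣL-concatMap h (w ∷ l) f = trans (ΣL-++ (h w) (concatMap h l) f) (cong (λ s → ΣL (h w) f + s) (ΣL-concatMap h l f))

E-ΣL : (μ : Mean V) (l : List Z) (f : Z → V → ℚ) → E μ (λ v → ΣL l (λ z → f z v)) ≡ ΣL l (λ z → E μ (f z))
E-ΣL μ [] f = E-const μ 0ℚ
E-ΣL μ (z ∷ l) f = trans (E-+ μ (f z) _) (cong (λ s → E μ (f z) + s) (E-ΣL μ l f))

ΣL-∈ : (l : List Z) {f : Z → ℚ} → (∀ z → 0ℚ ≤ f z) → ∀ {z} → z ∈ l → f z ≤ ΣL l f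
ΣL-∈ (z ∷ l) {f} h (here refl) = ≤-by (subst (_≤ ΣL l f) (trans (ΣL-const l 0ℚ) (ℚₚ.*-zeroʳ (ι (length l)))) (ΣL-mono l h))
  (solve 2 (λ a s → (a :+ s) :- a := s :- con 0ℚ) refl (f z) (ΣL l f))
ΣL-∈ (z ∷ l) {f} h (there {xs = .l} m) = ℚₚ.≤-trans (ΣL-∈ l h m) (≤-by (h z) (solve 2 (λ a s → (a :+ s) :- s := a :- con 0ℚ) refl (f z) (ΣL l f)))

Bits : ℕ → Set
Bits n = Vec Bool n

eqᵇ : Bool → Bool → Bool
eqᵇ true b = b
eqᵇ false b = not b

eqᵇ-sound : ∀ a b → eqᵇ a b ≡ true → a ≡ b
eqᵇ-sound true true h = refl
eqᵇ-sound false false h = refl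

allVecs : List Z → ∀ n → List (Vec Z n)
allVecs l zero = [] ∷ []
allVecs l (suc n) = concatMap (λ c → map (c ∷_) (allVecs l n)) l

∈-allVecs : {l : List Z} → (∀ z → z ∈ l) → ∀ {n} (v : Vec Z n) → v ∈ allVecs l n
∈-allVecs h [] = here refl
∈-allVecs {l = l} h {suc n} (z ∷ v) = Memₚ.∈-concatMap⁺ (λ c → map (c ∷_) (allVecs l n)) (lose (h z) (Memₚ.∈-map⁺ (z ∷_) (∈-allVecs h v)))

-- `part` says that each element is listed exactly once, as an identity of sums; this is what
-- expands a function of colours into indicators.
record Enumerated (C : Set) : Set where
  field
    eq : C → C → Bool
    all : List C
    sound : ∀ d c → eq d c ≡ true → d ≡ c
    part : ∀ d → ΣL all (λ c → ⟦ eq d c ⟧) ≡ 1ℚ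
    complete : ∀ c → c ∈ all

module _ {C : Set} (𝒞 : Enumerated C) where
  open Enumerated 𝒞

  eqV : ∀ {n} → Vec C n → Vec C n → Bool
  eqV [] [] = true
  eqV (d ∷ ds) (c ∷ cs) = eq d c ∧ eqV ds cs

  allV : ∀ n → List (Vec C n)
  allV = allVecs all

  soundV : ∀ {n} (ds cs : Vec C n) → eqV ds cs ≡ true → ds ≡ cs
  soundV [] [] h = refl
  soundV (d ∷ ds) (c ∷ cs) h = let (h₁ , h₂) = ∧-true h in cong₂ _∷_ (sound d c h₁) (soundV ds cs h₂)

  expand : ∀ n (d : Vec C n) (f : Vec C n → ℚ) → ΣL (allV n) (λ cs → f cs * ⟦ eqV d cs ⟧) ≡ f d
  expand zero [] f = trans (ℚₚ.+-identityʳ (f [] * 1ℚ)) (ℚₚ.*-identityʳ (f []))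
  expand (suc n) (d ∷ ds) f = trans (ΣL-concatMap (λ c → map (c ∷_) (allV n)) all _)
    (trans (ΣL-cong all (λ c → trans (ΣL-map (c ∷_) (allV n) _) (trans (ΣL-cong (allV n) (λ cs →
        trans (cong (f (c ∷ cs) *_) (⟦∧⟧ (eq d c) (eqV ds cs))) (solve 3 (λ f a b → f :* (a :* b) := a :* (f :* b)) refl (f (c ∷ cs)) ⟦ eq d c ⟧ ⟦ eqV ds cs ⟧)))
        (trans (ΣL-* (allV n) ⟦ eq d c ⟧ _) (trans (cong (⟦ eq d c ⟧ *_) (expand n ds (λ cs → f (c ∷ cs)))) (pick c)))))) 
      (trans (ΣL-* all (f (d ∷ ds)) (λ c → ⟦ eq d c ⟧)) (trans (cong (f (d ∷ ds) *_) (part d)) (ℚₚ.*-identityʳ _))))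
    where
    pick : ∀ c → ⟦ eq d c ⟧ * f (c ∷ ds) ≡ f (d ∷ ds) * ⟦ eq d c ⟧
    pick c with eq d c in e
    ... | true = trans (ℚₚ.*-comm 1ℚ (f (c ∷ ds))) (cong (λ z → f (z ∷ ds) * 1ℚ) (sym (sound d c e)))
    ... | false = trans (ℚₚ.*-zeroˡ (f (c ∷ ds))) (sym (ℚₚ.*-zeroʳ (f (d ∷ ds))))

  completeV : ∀ {n} (cs : Vec C n) → cs ∈ allV n
  completeV = ∈-allVecs complete

  enumV : ∀ n → Enumerated (Vec C n)
  enumV n = record { eq = eqV ; all = allV n ; sound = soundV ; complete = completeV
    ; part = λ d → trans (ΣL-cong (allV n) (λ cs → sym (ℚₚ.*-identityˡ _))) (expand n d (λ _ → 1ℚ)) }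

enumBool : Enumerated Bool
enumBool = record { eq = eqᵇ ; all = true ∷ false ∷ [] ; sound = eqᵇ-sound ; part = λ { true → refl ; false → refl }
  ; complete = λ { true → here refl ; false → there (here refl) } }

-- If `u` or `v` has mass at most ζ, the left side is at most ζ. Otherwise conditioning coordinates
-- `i` and `j` on them, and leaving the others alone, gives a large sub-box to which regularity
-- applies.
pairReg : ∀ {A : Fin m → Mean V} {ζ} (i j : Fin m) → i ≢ j → 0ℚ < ζ → ζ ≤ 1ℚ → (φ : V → V → ℚ) → (∀ a b → 0ℚ ≤ φ a b) → (∀ a b → φ a b ≤ 1ℚ) →
  Reg ζ ζ A (λ x → φ (lookup x i) (lookup x j)) → ∀ (u v : V → Bool) →
  E (A i) (λ a → E (A j) (φ a)) * (E (A i) (λ a → ⟦ u a ⟧) * E (A j) (λ b → ⟦ v b ⟧)) ≤ E (A i) (λ a → E (A j) (λ b → φ a b * (⟦ u a ⟧ * ⟦ v b ⟧))) + ζ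
pairReg {m = m} {V = V} {A = A} {ζ} i j ne 0ζ ζ1 φ φ0 φ1 reg u v = go (ℚₚ.≤-total ζ p) (ℚₚ.≤-total ζ q)
  where
  p = E (A i) (λ a → ⟦ u a ⟧)
  q = E (A j) (λ b → ⟦ v b ⟧)
  e = E (A i) (λ a → E (A j) (φ a))
  t = E (A i) (λ a → E (A j) (λ b → φ a b * (⟦ u a ⟧ * ⟦ v b ⟧)))
  0p : 0ℚ ≤ p
  0p = E-nonneg (A i) (λ a → 0≤⟦⟧ (u a))
  0q : 0ℚ ≤ q
  0q = E-nonneg (A j) (λ b → 0≤⟦⟧ (v b))
  p1 : p ≤ 1ℚ
  p1 = E-≤c (A i) (λ a → ⟦⟧≤1 (u a))
  q1 : q ≤ 1ℚ
  q1 = E-≤c (A j) (λ b → ⟦⟧≤1 (v b))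
  0e : 0ℚ ≤ e
  0e = E-nonneg (A i) (λ a → E-nonneg (A j) (φ0 a))
  e1 : e ≤ 1ℚ
  e1 = E-≤c (A i) (λ a → E-≤c (A j) (φ1 a))
  0t : 0ℚ ≤ t
  0t = E-nonneg (A i) (λ a → E-nonneg (A j) (λ b → φ0 a b ⊛ 0≤⟦⟧ (u a) ⊛ 0≤⟦⟧ (v b)))
  small : p * q ≤ ζ → e * (p * q) ≤ t + ζ
  small h = ≤-by (*-mono 0e (0p ⊛ 0q) e1 (ℚₚ.≤-refl {p * q}) ⊕ h ⊕ 0t) (solve 4 (λ e r t z → (t :+ z) :- e :* r := (con 1ℚ :* r :+ (z :+ t)) :- (e :* r :+ (r :+ con 0ℚ))) refl e (p * q) t ζ)
  go : (ζ ≤ p) ⊎ (p ≤ ζ) → (ζ ≤ q) ⊎ (q ≤ ζ) → e * (p * q) ≤ t + ζ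
  go (inj₂ h) _ = small (ℚₚ.≤-trans (*-mono 0p 0≤1 (ℚₚ.≤-refl {p}) q1) (ℚₚ.≤-trans (ℚₚ.≤-reflexive (ℚₚ.*-identityʳ p)) h))
  go (inj₁ _) (inj₂ h) = small (ℚₚ.≤-trans (*-mono 0p 0q p1 (ℚₚ.≤-refl {q})) (ℚₚ.≤-trans (ℚₚ.≤-reflexive (ℚₚ.*-identityˡ q)) h))
  go (inj₁ hp) (inj₁ hq) = ≤-by (0pq ⊗ proj₂ (reg A′ box) ⊕ (ℚₚ.<⇒≤ 0ζ ⊗ pq1))
      (trans (cong (λ x → (x + ζ) - e * (p * q)) (sym eqt))
      (trans (solve 4 (λ r e e′ z → (r :* e′ :+ z) :- e :* r := (r :* (e′ :+ z) :+ z :* con 1ℚ) :- (r :* e :+ z :* r)) refl (p * q) e e′ ζ)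
        (cong₂ (λ x y → (p * q * (x + ζ) + ζ * 1ℚ) - (p * q * y + ζ * (p * q))) (sym m′) (sym m₀))))
    where
    0pq = 0p ⊛ 0q
    pq1 : p * q ≤ 1ℚ
    pq1 = ℚₚ.≤-trans (*-mono 0p 0≤1 p1 q1) ℚₚ.≤-refl
    Ai = cond (A i) u (ℚₚ.<-≤-trans 0ζ hp)
    Aj = cond (A j) v (ℚₚ.<-≤-trans 0ζ hq)
    subi : Sub ζ Ai (A i)
    subi = sub u hp (E-cond (A i) u (ℚₚ.<-≤-trans 0ζ hp))
    subj : Sub ζ Aj (A j)
    subj = sub v hq (E-cond (A j) v (ℚₚ.<-≤-trans 0ζ hq))
    pick : ∀ k → Dec (k ≡ i) → Dec (k ≡ j) → Mean V
    pick k (yes _) _ = Ai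
    pick k (no _) (yes _) = Aj
    pick k (no _) (no _) = A k
    A′ : Fin m → Mean V
    A′ k = pick k (k F.≟ i) (k F.≟ j)
    box : Box ζ A′ A
    box k with k F.≟ i | k F.≟ j
    ... | yes refl | _ = subi
    ... | no _ | yes refl = subj
    ... | no _ | no _ = Sub-weaken ζ1 (Sub-refl (A k))
    A′i : A′ i ≡ Ai
    A′i with i F.≟ i
    ... | yes _ = refl
    ... | no h = ⊥-elim (h refl)
    A′j : A′ j ≡ Aj
    A′j with j F.≟ i | j F.≟ j
    ... | yes h | _ = ⊥-elim (ne (sym h))
    ... | no _ | yes _ = refl
    ... | no _ | no h = ⊥-elim (h refl)
    e′ = E Ai (λ a → E Aj (φ a))
    m₀ : E (Π A) (λ x → φ (lookup x i) (lookup x j)) ≡ e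
    m₀ = marginal₂ A ne φ
    m′ : E (Π A′) (λ x → φ (lookup x i) (lookup x j)) ≡ e′
    m′ = trans (marginal₂ A′ ne φ) (cong₂ (λ α β → E α (λ a → E β (φ a))) A′i A′j)
    eqt : (p * q) * e′ ≡ t
    eqt = trans (solve 3 (λ p q e → (p :* q) :* e := (e :* p) :* q) refl p q e′)
      (trans (cong (_* q) (E-cond (A i) u (ℚₚ.<-≤-trans 0ζ hp) (λ a → E Aj (φ a))))
      (trans (sym (E-*ʳ (A i) q _)) (E-cong (A i) (λ a → trans (ℚₚ.*-assoc ⟦ u a ⟧ (E Aj (φ a)) q)
        (trans (cong (⟦ u a ⟧ *_) (E-cond (A j) v (ℚₚ.<-≤-trans 0ζ hq) (φ a)))
        (trans (sym (E-* (A j) ⟦ u a ⟧ _)) (E-cong (A j) (λ b → solve 3 (λ u v f → u :* (v :* f) := f :* (u :* v)) refl ⟦ u a ⟧ ⟦ v b ⟧ (φ a b)))))))))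

-- Independent labels in place of coloured pairs

Inc₂ : Fin m × Fin m → Set
Inc₂ (i , j) = i F.< j

opaque
  inc₂? : (p : Fin m × Fin m) → Dec (Inc₂ p)
  inc₂? (i , j) = i Fₚ.<? j

module Decouple {V C : Set} {M : ℕ} (𝒞 : Enumerated C) (A : Fin M → Mean V) (cl : V × V → C) (c₀ : C) {ζ : ℚ} (0ζ : 0ℚ < ζ)
  (reg : ∀ i j → i F.< j → ∀ c (u v : V → Bool) →
    E (A i) (λ a → E (A j) (λ b → ⟦ Enumerated.eq 𝒞 (cl (a , b)) c ⟧)) * (E (A i) (λ a → ⟦ u a ⟧) * E (A j) (λ b → ⟦ v b ⟧))
      ≤ E (A i) (λ a → E (A j) (λ b → ⟦ Enumerated.eq 𝒞 (cl (a , b)) c ⟧ * (⟦ u a ⟧ * ⟦ v b ⟧))) + ζ) where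
  open Enumerated 𝒞

  -- Only increasing pairs are coloured; all other pairs get the colour c₀.
  col : Fin M × Fin M → V × V → C
  col p y = if does (inc₂? p) then cl y else c₀

  pairOf : Fin M × Fin M → Vec V M → V × V
  pairOf (i , j) x = lookup x i , lookup x j

  colsX : ∀ {n} → (Fin n → Fin M × Fin M) → Vec V M → Vec C n
  colsX {zero} pr x = []
  colsX {suc n} pr x = col (pr F.zero) (pairOf (pr F.zero) x) ∷ colsX (pr ∘ F.suc) x

  colsY : ∀ {n} → (Fin n → Fin M × Fin M) → Vec (V × V) n → Vec C n
  colsY pr [] = []
  colsY pr (y ∷ ys) = col (pr F.zero) y ∷ colsY (pr ∘ F.suc) ys

  -- Each pair receives its own fresh endpoints, so the colours of different pairs are independent
  -- under `Π (ν ∘ pr)`.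
  ν : Fin M × Fin M → Mean (V × V)
  ν (i , j) = A i ⊠ A j

  record Splits (p : Fin M × Fin M) (w : Vec V M → Bool) : Set where
    constructor splits
    field
      parts : ∀ x → Σ (V → Bool) λ u → Σ (V → Bool) λ v → ∀ a b → w ((x [ proj₁ p ]≔ a) [ proj₂ p ]≔ b) ≡ u a ∧ v b

  -- Two different increasing pairs share at most one vertex. With the rest frozen, the colour of
  -- one therefore depends on at most one endpoint of the other.
  splits-factor : ∀ p p′ → Inc₂ p → (Inc₂ p′ → p ≢ p′) → ∀ c → Splits p (λ x → eq (col p′ (pairOf p′ x)) c)
  splits-factor (i , j) (k , l) inc ne c with inc₂? (k , l)
  ... | no _ = splits λ x → (λ _ → eq c₀ c) , (λ _ → true) , λ a b → sym (Boolₚ.∧-identityʳ (eq c₀ c))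
  ... | yes inc′ with (j F.≟ k) ⊎-dec (j F.≟ l)
  ... | no nj = splits λ x → (λ a → eq (cl (pairOf (k , l) ((x [ i ]≔ a) [ j ]≔ lookup x j))) c) , (λ _ → true) ,
    λ a b → trans (cong₂ (λ s t → eq (cl (s , t)) c)
        (set-other (x [ i ]≔ a) (x [ i ]≔ a) b (lookup x j) (λ h → nj (inj₁ (sym h))) refl)
        (set-other (x [ i ]≔ a) (x [ i ]≔ a) b (lookup x j) (λ h → nj (inj₂ (sym h))) refl))
      (sym (Boolₚ.∧-identityʳ _))
  ... | yes mj = splits λ x → (λ _ → true) , (λ b → eq (cl (pairOf (k , l) ((x [ i ]≔ lookup x i) [ j ]≔ b))) c) ,
    λ a b → cong₂ (λ s t → eq (cl (s , t)) c)
        (set-same j (x [ i ]≔ a) (x [ i ]≔ lookup x i) b (set-other x x a (lookup x i) (λ h → ni (inj₁ (sym h))) refl))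
        (set-same j (x [ i ]≔ a) (x [ i ]≔ lookup x i) b (set-other x x a (lookup x i) (λ h → ni (inj₂ (sym h))) refl))
    where
    ni′ : (j ≡ k) ⊎ (j ≡ l) → (i ≡ k) ⊎ (i ≡ l) → ⊥
    ni′ (inj₁ refl) (inj₁ refl) = ℕₚ.<-irrefl refl inc
    ni′ (inj₁ refl) (inj₂ refl) = ℕₚ.<-asym inc inc′
    ni′ (inj₂ refl) (inj₁ refl) = ne inc′ refl
    ni′ (inj₂ refl) (inj₂ refl) = ℕₚ.<-irrefl refl inc
    ni : (i ≡ k) ⊎ (i ≡ l) → ⊥
    ni = ni′ mj

  splits-∧ : ∀ p {w w′} → Splits p w → Splits p w′ → Splits p (λ x → w x ∧ w′ x)
  splits-∧ p s s′ = splits λ x →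
    let (u , v , h) = Splits.parts s x
        (u′ , v′ , h′) = Splits.parts s′ x
    in (λ a → u a ∧ u′ a) , (λ b → v b ∧ v′ b) , λ a b → trans (cong₂ _∧_ (h a b) (h′ a b)) (∧-interchange (u a) (v b) (u′ a) (v′ b))

  splits-cols : ∀ {n} p → Inc₂ p → (pr : Fin n → Fin M × Fin M) → (∀ q → Inc₂ (pr q) → p ≢ pr q) → (cs : Vec C n) →
    Splits p (λ x → eqV 𝒞 (colsX pr x) cs)
  splits-cols p inc pr ne [] = splits λ x → (λ _ → true) , (λ _ → true) , λ _ _ → refl
  splits-cols p inc pr ne (c ∷ cs) = splits-∧ p (splits-factor p (pr F.zero) inc (ne F.zero) c) (splits-cols p inc (pr ∘ F.suc) (ne ∘ F.suc) cs)

  Inj : ∀ {n} → (Fin n → Fin M × Fin M) → Set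
  Inj pr = ∀ q q′ → Inc₂ (pr q) → pr q ≡ pr q′ → q ≡ q′

  -- Induction on the pairs. With all other vertices frozen, the pattern of the remaining pairs is a
  -- product of tests on the two endpoints of the first pair, so regularity splits off the colour of
  -- that pair at the price ζ.
  product : ∀ {n} (pr : Fin n → Fin M × Fin M) → Inj pr → (cs : Vec C n) →
    E (Π (ν ∘ pr)) (λ y → ⟦ eqV 𝒞 (colsY pr y) cs ⟧) ≤ E (Π A) (λ x → ⟦ eqV 𝒞 (colsX pr x) cs ⟧) + ι n * ζ
  product {zero} pr inj [] = ℚₚ.≤-reflexive (trans (E-cong (Π (ν ∘ pr)) {g = λ _ → 1ℚ} (λ { [] → refl }))
    (trans (E-const (Π (ν ∘ pr)) 1ℚ) (sym (trans (cong (_+ 0ℚ * ζ) (E-const (Π A) 1ℚ)) (solve 1 (λ z → con 1ℚ :+ con 0ℚ :* z := con 1ℚ) refl ζ)))))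
  product {suc n} pr inj (c ∷ cs) = subst (_≤ E (Π A) (λ x → ⟦ eqV 𝒞 (colsX pr x) (c ∷ cs) ⟧) + ι (suc n) * ζ) (sym factorY)
      (main (inc₂? p) refl)
    where
    p = pr F.zero
    pr′ = pr ∘ F.suc
    inj′ : Inj pr′
    inj′ q q′ h e = Fₚ.suc-injective (inj (F.suc q) (F.suc q′) h e)
    e₀ = E (ν p) (λ y → ⟦ eq (col p y) c ⟧)
    eY = E (Π (ν ∘ pr′)) (λ y → ⟦ eqV 𝒞 (colsY pr′ y) cs ⟧)
    eX = E (Π A) (λ x → ⟦ eqV 𝒞 (colsX pr′ x) cs ⟧)
    ih : eY ≤ eX + ι n * ζ
    ih = product pr′ inj′ cs
    0e₀ : 0ℚ ≤ e₀
    0e₀ = E-nonneg (ν p) (λ y → 0≤⟦⟧ (eq (col p y) c))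
    e₀1 : e₀ ≤ 1ℚ
    e₀1 = E-≤c (ν p) (λ y → ⟦⟧≤1 (eq (col p y) c))
    factorY : E (Π (ν ∘ pr)) (λ y → ⟦ eqV 𝒞 (colsY pr y) (c ∷ cs) ⟧) ≡ e₀ * eY
    factorY = trans (E-Π (ν ∘ pr) _) (trans (E-cong (ν p) (λ y → trans (E-cong (Π (ν ∘ pr′)) (λ ys → ⟦∧⟧ (eq (col p y) c) (eqV 𝒞 (colsY pr′ ys) cs)))
      (E-* (Π (ν ∘ pr′)) ⟦ eq (col p y) c ⟧ _))) (E-*ʳ (ν p) eY _))
    combine : e₀ * eX ≤ E (Π A) (λ x → ⟦ eq (col p (pairOf p x)) c ⟧ * ⟦ eqV 𝒞 (colsX pr′ x) cs ⟧) + ζ →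
      e₀ * eY ≤ E (Π A) (λ x → ⟦ eqV 𝒞 (colsX pr x) (c ∷ cs) ⟧) + ι (suc n) * ζ
    combine h = ≤-by (h ⊕ (0e₀ ⊗ ih) ⊕ ((0≤ι n ⊛ ℚₚ.<⇒≤ 0ζ) ⊗ e₀1))
      (trans (cong (λ z → z + (ι n + 1ℚ) * ζ - e₀ * eY) (E-cong (Π A) (λ x → ⟦∧⟧ (eq (col p (pairOf p x)) c) (eqV 𝒞 (colsX pr′ x) cs))))
        (solve 6 (λ s n z e y x → s :+ (n :+ con 1ℚ) :* z :- e :* y :=
           (s :+ z :+ (e :* (x :+ n :* z) :+ n :* z :* con 1ℚ)) :- (e :* x :+ (e :* y :+ n :* z :* e))) refl
           (E (Π A) (λ x → ⟦ eq (col p (pairOf p x)) c ⟧ * ⟦ eqV 𝒞 (colsX pr′ x) cs ⟧)) (ι n) ζ e₀ eY eX))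
    main : (d : Dec (Inc₂ p)) → inc₂? p ≡ d → e₀ * eY ≤ E (Π A) (λ x → ⟦ eqV 𝒞 (colsX pr x) (c ∷ cs) ⟧) + ι (suc n) * ζ
    main (no ni) hd = combine (≤-by (ℚₚ.<⇒≤ 0ζ) (trans (cong₂ (λ s t → s + ζ - t * eX)
          (trans (E-cong (Π A) (λ x → cong (λ z → ⟦ eq z c ⟧ * ⟦ eqV 𝒞 (colsX pr′ x) cs ⟧) (col-no (pairOf p x)))) (E-* (Π A) ⟦ eq c₀ c ⟧ _))
          (trans (E-cong (ν p) (λ y → cong (λ z → ⟦ eq z c ⟧) (col-no y))) (E-const (ν p) ⟦ eq c₀ c ⟧)))
        (solve 3 (λ k x z → (k :* x :+ z) :- k :* x := z :- con 0ℚ) refl ⟦ eq c₀ c ⟧ eX ζ)))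
      where
      col-no : ∀ y → col p y ≡ c₀
      col-no y = cong (λ d → if does d then cl y else c₀) hd
    main (yes inc) hd = combine (subst₂ _≤_ lhs rhs (E-mono (Π A) pointwise))
      where
      i = proj₁ p
      j = proj₂ p
      col-yes : ∀ y → col p y ≡ cl y
      col-yes y = cong (λ d → if does d then cl y else c₀) hd
      rest : Vec V M → ℚ
      rest x = ⟦ eqV 𝒞 (colsX pr′ x) cs ⟧
      sp : Splits p (λ x → eqV 𝒞 (colsX pr′ x) cs)
      sp = splits-cols p inc pr′ (λ q h e → Fₚ.0≢1+n (inj F.zero (F.suc q) inc e)) cs
      φ : V → V → ℚ
      φ a b = ⟦ eq (cl (a , b)) c ⟧
      ne : i ≢ j
      ne = <⇒≢F inc
      set : Vec V M → V → V → Vec V M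
      set x a b = (x [ i ]≔ a) [ j ]≔ b
      pointwise : ∀ x → E (A i) (λ a → E (A j) (φ a)) * E (A i) (λ a → E (A j) (λ b → rest (set x a b)))
        ≤ E (A i) (λ a → E (A j) (λ b → φ a b * rest (set x a b))) + ζ
      pointwise x =
        let (u , v , h) = Splits.parts sp x
            h′ : ∀ a b → rest (set x a b) ≡ ⟦ u a ⟧ * ⟦ v b ⟧
            h′ a b = trans (cong ⟦_⟧ (h a b)) (⟦∧⟧ (u a) (v b))
        in subst₂ (λ s t → E (A i) (λ a → E (A j) (φ a)) * s ≤ t + ζ)
             (sym (trans (E-cong (A i) (λ a → trans (E-cong (A j) (h′ a)) (E-* (A j) ⟦ u a ⟧ _))) (E-*ʳ (A i) _ _)))
             (sym (E-cong (A i) (λ a → E-cong (A j) (λ b → cong (φ a b *_) (h′ a b)))))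
             (reg i j inc c u v)
      lhs : E (Π A) (λ x → E (A i) (λ a → E (A j) (φ a)) * E (A i) (λ a → E (A j) (λ b → rest (set x a b)))) ≡ e₀ * eX
      lhs = trans (E-* (Π A) (E (A i) (λ a → E (A j) (φ a))) (λ x → E (A i) (λ a → E (A j) (λ b → rest (set x a b))))) (cong₂ _*_ (trans (sym (E-⊠ (A i) (A j) (λ y → ⟦ eq (cl y) c ⟧)))
              (E-cong (ν p) (λ y → cong (λ z → ⟦ eq z c ⟧) (sym (col-yes y))))) (sym (resample₂ A i j rest)))
      rhs : E (Π A) (λ x → E (A i) (λ a → E (A j) (λ b → φ a b * rest (set x a b))) + ζ) ≡ E (Π A) (λ x → ⟦ eq (col p (pairOf p x)) c ⟧ * rest x) + ζ
      rhs = trans (E-+c (Π A) _ ζ) (cong (_+ ζ) (sym (trans (resample₂ A i j _) (E-cong (Π A) (λ x → E-cong (A i) (λ a → E-cong (A j) (λ b →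
          cong (λ z → ⟦ eq z c ⟧ * rest (set x a b)) (trans (col-yes _) (cong cl (cong₂ _,_
            (trans (Vecₚ.lookup∘update′ ne (x [ i ]≔ a) b) (Vecₚ.lookup∘update i x a)) (Vecₚ.lookup∘update j (x [ i ]≔ a) b)))))))))))

  -- Summing `product` over all colour patterns passes from one pattern to any `f`. The bound is
  -- one-sided; applied to 1 - f it gives the converse.
  decouple : ∀ {n} (pr : Fin n → Fin M × Fin M) → Inj pr → (f : Vec C n → ℚ) → (∀ c → 0ℚ ≤ f c) → (∀ c → f c ≤ 1ℚ) →
    E (Π (ν ∘ pr)) (λ y → f (colsY pr y)) ≤ E (Π A) (λ x → f (colsX pr x)) + ι (length (allV 𝒞 n)) * (ι n * ζ)
  decouple {n} pr inj f f0 f1 = subst₂ _≤_ (sym (by (Π (ν ∘ pr)) (colsY pr)))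
      (trans (ΣL-+ (allV 𝒞 n) _ _) (cong₂ _+_ (sym (by (Π A) (colsX pr))) (ΣL-const (allV 𝒞 n) (ι n * ζ))))
      (ΣL-mono (allV 𝒞 n) (λ cs → ≤-by ((f0 cs ⊗ product pr inj cs) ⊕ (0nζ ⊗ f1 cs))
        (solve 4 (λ f x y z → (f :* x :+ z) :- f :* y := (f :* (x :+ z) :+ z :* con 1ℚ) :- (f :* y :+ z :* f)) refl
          (f cs) (E (Π A) (λ x → ⟦ eqV 𝒞 (colsX pr x) cs ⟧)) (E (Π (ν ∘ pr)) (λ y → ⟦ eqV 𝒞 (colsY pr y) cs ⟧)) (ι n * ζ))))
    where
    0nζ : 0ℚ ≤ ι n * ζ
    0nζ = 0≤ι n ⊛ ℚₚ.<⇒≤ 0ζ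
    by : ∀ {U : Set} (μ : Mean U) (d : U → Vec C n) → E μ (λ x → f (d x)) ≡ ΣL (allV 𝒞 n) (λ cs → f cs * E μ (λ x → ⟦ eqV 𝒞 (d x) cs ⟧))
    by μ d = trans (E-cong μ (λ x → sym (expand 𝒞 n (d x) f))) (trans (E-ΣL μ (allV 𝒞 n) _) (ΣL-cong (allV 𝒞 n) (λ cs → E-* μ (f cs) _)))

-- Sampling

²-cancel : ∀ {x y} → 0ℚ ≤ y → x * x ≤ y * y → x ≤ y
²-cancel {x} {y} 0y h with ℚₚ.≤-total x y
... | inj₁ le = le
... | inj₂ ge with ℚₚ.≤-total x 0ℚ
...   | inj₁ x0 = ℚₚ.≤-trans x0 0y
...   | inj₂ 0x with x ℚₚ.≤? y
...     | yes le = le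
...     | no nle = ⊥-elim (<≤⊥ (0<* 0<xy (ℚₚ.+-mono-<-≤ 0<xy (0y ⊕ 0y))) (≤-by h
            (solve 2 (λ x y → con 0ℚ :- (x :- y) :* ((x :- y) :+ (y :+ y)) := y :* y :- x :* x) refl x y)))
  where
  0<xy : 0ℚ < x - y
  0<xy = 0<-by (ℚₚ.≰⇒> nle)

-- The deviation `E μ g - g v` has mean zero, so the cross term drops out, and its square is at most
-- 1.
variance : (μ : Mean V) (g : V → ℚ) → (∀ v → 0ℚ ≤ g v) → (∀ v → g v ≤ 1ℚ) → ∀ s →
  E μ (λ v → (s + (E μ g - g v)) * (s + (E μ g - g v))) ≤ s * s + 1ℚ
variance μ g g0 g1 s = ≤-by (E-≤c μ {f = λ v → (e - g v) * (e - g v)} {c = 1ℚ} (λ v → sq v))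
    (trans (cong (λ z → s * s + 1ℚ - z) expand²) (solve 2 (λ s v → s :* s :+ con 1ℚ :- (s :* s :+ v) := con 1ℚ :- v) refl s (E μ (λ v → (e - g v) * (e - g v)))))
  where
  e = E μ g
  e0 : 0ℚ ≤ e
  e0 = E-nonneg μ g0
  e1 : e ≤ 1ℚ
  e1 = E-≤c μ g1
  sq : ∀ v → (e - g v) * (e - g v) ≤ 1ℚ
  sq v = ≤-by ((0≤- e1 ⊕ g0 v) ⊛ (0≤- (g1 v) ⊕ e0))
    (solve 2 (λ e g → con 1ℚ :- (e :- g) :* (e :- g) := ((con 1ℚ :- e) :+ g) :* ((con 1ℚ :- g) :+ e) :- con 0ℚ) refl e (g v))
  expand² : E μ (λ v → (s + (e - g v)) * (s + (e - g v))) ≡ s * s + E μ (λ v → (e - g v) * (e - g v))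
  expand² = trans (E-cong μ (λ v → solve 3 (λ s e g → (s :+ (e :- g)) :* (s :+ (e :- g)) := ((s :+ s) :* (e :- g)) :+ (s :* s :+ (e :- g) :* (e :- g))) refl s e (g v)))
    (trans (E-+ μ (λ v → (s + s) * (e - g v)) (λ v → s * s + (e - g v) * (e - g v)))
    (trans (cong₂ _+_ (trans (E-* μ (s + s) (λ v → e - g v)) (cong ((s + s) *_) (trans (E-neg μ (λ _ → e) g) (trans (cong (_- e) (E-const μ e)) (ℚₚ.+-inverseʳ e)))))
        (trans (E-+ μ (λ _ → s * s) (λ v → (e - g v) * (e - g v))) (cong (_+ E μ (λ v → (e - g v) * (e - g v))) (E-const μ (s * s)))))
      (solve 2 (λ s v → (s :+ s) :* con 0ℚ :+ (s :* s :+ v) := s :* s :+ v) refl s (E μ (λ v → (e - g v) * (e - g v))))))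

-- The sample is built greedily: the next point keeps the sum of the squared
-- deviations plus a multiple of the sum of h below its expected value.
sample-greedy : ∀ (μ : Mean V) n (g : Fin n → V → ℚ) → (∀ i v → 0ℚ ≤ g i v) → (∀ i v → g i v ≤ 1ℚ) →
  (h : V → ℚ) (ρ τ : ℚ) → 0ℚ ≤ ρ → E μ h ≤ τ → ∀ k → Σ (Vec V k) λ ys →
    ΣF n (λ i → (ι k * E μ (g i) - sumV ys (g i)) * (ι k * E μ (g i) - sumV ys (g i))) + ρ * sumV ys h ≤ ι k * (ι n + ρ * τ)
sample-greedy μ n g g0 g1 h ρ τ 0ρ hτ zero = [] , ℚₚ.≤-reflexive
  (trans (cong₂ _+_ (ΣF-0 n (λ i → trans (cong (λ z → (0ℚ * E μ (g i) - z) * (0ℚ * E μ (g i) - z)) (sumV-[] (g i))) (solve 1 (λ e → (con 0ℚ :* e :- con 0ℚ) :* (con 0ℚ :* e :- con 0ℚ) := con 0ℚ) refl (E μ (g i))))) (cong (ρ *_) (sumV-[] h)))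
    (solve 2 (λ r x → con 0ℚ :+ r :* con 0ℚ := con 0ℚ :* x) refl ρ (ι n + ρ * τ)))
sample-greedy {V} μ n g g0 g1 h ρ τ 0ρ hτ (suc k) = (y ∷ ys) , subst (_≤ ι (suc k) * (ι n + ρ * τ)) (sym potential)
    (≤-by (≤y ⊕ EP ⊕ ih ⊕ (0ρ ⊗ hτ))
      (solve 9 (λ i n r t p d s x e → (i :+ con 1ℚ) :* (n :+ r :* t) :- p :=
         (d :+ (((s :+ n) :+ r :* (x :+ e)) :+ (i :* (n :+ r :* t) :+ r :* t))) :- (p :+ (d :+ ((s :+ r :* x) :+ r :* e)))) refl
         (ι k) (ι n) ρ τ (P y) (E μ P) S H (E μ h)))
  where
  prev = sample-greedy μ n g g0 g1 h ρ τ 0ρ hτ k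
  ys = proj₁ prev
  s : Fin n → ℚ
  s i = ι k * E μ (g i) - sumV ys (g i)
  S = ΣF n (λ i → s i * s i)
  H = sumV ys h
  P : V → ℚ
  P v = ΣF n (λ i → (s i + (E μ (g i) - g i v)) * (s i + (E μ (g i) - g i v))) + ρ * (H + h v)
  y = proj₁ (E-∃ μ P)
  ≤y : P y ≤ E μ P
  ≤y = proj₂ (E-∃ μ P)
  ih : S + ρ * H ≤ ι k * (ι n + ρ * τ)
  ih = proj₂ prev
  EP : E μ P ≤ (S + ι n) + ρ * (H + E μ h)
  EP = subst₂ _≤_ (sym (trans (E-+ μ _ _) (cong₂ _+_ (E-ΣF μ n _) (trans (E-* μ ρ (λ v → H + h v)) (cong (ρ *_) (trans (E-+ μ (λ _ → H) h) (cong (_+ E μ h) (E-const μ H))))))))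
      (cong (_+ ρ * (H + E μ h)) (trans (ΣF-+ n (λ i → s i * s i) (λ _ → 1ℚ)) (cong (λ z → S + z) (trans (ΣF-const n 1ℚ) (ℚₚ.*-identityʳ (ι n))))))
      (ΣF-mono n (λ i → variance μ (g i) (g0 i) (g1 i) (s i)) ⊕ ℚₚ.≤-refl {ρ * (H + E μ h)})
  potential : ΣF n (λ i → (ι (suc k) * E μ (g i) - sumV (y ∷ ys) (g i)) * (ι (suc k) * E μ (g i) - sumV (y ∷ ys) (g i))) + ρ * sumV (y ∷ ys) h ≡ P y
  potential = cong₂ _+_ (ΣF-cong n (λ i → cong (λ z → z * z) (trans (cong (λ z → ι (suc k) * E μ (g i) - z) (sumV-∷ y ys (g i)))
      (solve 4 (λ k e a b → (k :+ con 1ℚ) :* e :- (a :+ b) := (k :* e :- b) :+ (e :- a)) refl (ι k) (E μ (g i)) (g i y) (sumV ys (g i))))))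
    (cong (ρ *_) (trans (sumV-∷ y ys h) (ℚₚ.+-comm (h y) H)))

ΣF-∈ : ∀ n {f : Fin n → ℚ} → (∀ i → 0ℚ ≤ f i) → ∀ i → f i ≤ ΣF n f
ΣF-∈ (suc n) {f} h F.zero = ≤-by (ΣF-nonneg n (h ∘ F.suc)) (solve 2 (λ a s → (a :+ s) :- a := s :- con 0ℚ) refl (f F.zero) (ΣF n (f ∘ F.suc)))
ΣF-∈ (suc n) {f} h (F.suc i) = ℚₚ.≤-trans (ΣF-∈ n (h ∘ F.suc) i) (≤-by (h F.zero) (solve 2 (λ a s → (a :+ s) :- s := a :- con 0ℚ) refl (f F.zero) (ΣF n (f ∘ F.suc))))

opaque
  sample-size : ∀ (n : ℕ) {θ} → 0ℚ < θ → Σ ℕ λ K → ι n + (ι n + 1ℚ) ≤ ι (suc K) * (θ * θ)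
  sample-size n {θ} 0θ = let (K , h) = archimedean⁻¹ (0<* 0θ 0θ) (ι n + (ι n + 1ℚ))
    in K , ℚₚ.≤-trans h (≤-by (0≤² θ) (solve 2 (λ k t → (k :+ con 1ℚ) :* t :- k :* t := t :- con 0ℚ) refl (ι K) (θ * θ)))

  -- The sample size is tied to `n` and θ alone, neither to the space nor to τ; so τ may be chosen
  -- after `K`.
  sample₁ : ∀ n K {θ} → 0ℚ < θ → ι n + (ι n + 1ℚ) ≤ ι (suc K) * (θ * θ) →
    (μ : Mean V) (g : Fin n → V → ℚ) → (∀ i v → 0ℚ ≤ g i v) → (∀ i v → g i v ≤ 1ℚ) →
    (h : V → ℚ) → (∀ v → 0ℚ ≤ h v) → ∀ {τ} → 0ℚ < τ → E μ h ≤ τ → Σ (Vec V (suc K)) λ ys →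
      (∀ i → E μ (g i) ≤ E (avg ys) (g i) + θ) × E (avg ys) h ≤ τ + τ
  sample₁ n K {θ} 0θ size μ g g0 g1 h h0 {τ} 0τ hτ =
    let (r , 0r , er) = inverse 0τ
        N1 = ι n + 1ℚ
        0N1 : 0ℚ < N1
        0N1 = 0<ι n
        -- With ρ τ = n + 1 the greedy bound is k (2n + 1). By `size` this keeps each deviation
        -- below k θ, and division by ρ keeps the sum of `h` below 2 k τ.
        ρ = N1 * r
        0ρ = 0<* 0N1 0r
        ρτ : ρ * τ ≡ N1
        ρτ = trans (solve 3 (λ a b c → (a :* b) :* c := a :* (c :* b)) refl N1 r τ) (trans (cong (N1 *_) er) (ℚₚ.*-identityʳ N1))
        (ys , bd) = sample-greedy μ n g g0 g1 h ρ τ (ℚₚ.<⇒≤ 0ρ) hτ (suc K)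
        k = ι (suc K)
        s = λ i → k * E μ (g i) - sumV ys (g i)
        S = ΣF n (λ i → s i * s i)
        H = sumV ys h
        0H : 0ℚ ≤ H
        0H = subst (0ℚ ≤_) (E-avg ys h) (ℚₚ.<⇒≤ (0<ι K) ⊛ E-nonneg (avg ys) h0)
        0S : 0ℚ ≤ S
        0S = ΣF-nonneg n (λ i → 0≤² (s i))
        bd′ : S + ρ * H ≤ k * (ι n + N1)
        bd′ = subst (λ z → S + ρ * H ≤ k * (ι n + z)) ρτ bd
        dev : ∀ i → s i ≤ k * θ
        dev i = ²-cancel (ℚₚ.<⇒≤ (0<ι K) ⊛ ℚₚ.<⇒≤ 0θ) (≤-by (ΣF-∈ n (λ i → 0≤² (s i)) i ⊕ (ℚₚ.<⇒≤ 0ρ ⊛ 0H) ⊕ bd′ ⊕ (ℚₚ.<⇒≤ (0<ι K) ⊗ size))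
          (solve 7 (λ k t x S r n z → (k :* t) :* (k :* t) :- x :=
             (S :+ (r :+ (k :* (n :+ z) :+ k :* (k :* (t :* t))))) :- (x :+ (con 0ℚ :+ ((S :+ r) :+ k :* (n :+ z))))) refl k θ (s i * s i) S (ρ * H) (ι n) N1))
    in ys , (λ i → *-cancel (0<ι K) (≤-by (dev i) (trans (solve 4 (λ k a t e → k :* (a :+ t) :- k :* e := k :* t :- (k :* e :- k :* a)) refl k (E (avg ys) (g i)) θ (E μ (g i)))
               (cong (λ z → k * θ - (k * E μ (g i) - z)) (E-avg ys (g i)))))) ,
       *-cancel (0<* 0ρ (0<ι K)) (≤-by (0S ⊕ bd′ ⊕ (ℚₚ.<⇒≤ (0<ι K) ⊛ 0≤1))
          (trans (trans (solve 4 (λ r k t e → (r :* k) :* (t :+ t) :- (r :* k) :* e := k :* (r :* t) :+ k :* (r :* t) :- r :* (k :* e)) refl ρ k τ (E (avg ys) h))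
              (cong₂ (λ x y → k * x + k * x - ρ * y) ρτ (E-avg ys h)))
            (solve 4 (λ k n S r → k :* (n :+ con 1ℚ) :+ k :* (n :+ con 1ℚ) :- r := (S :+ (k :* (n :+ (n :+ con 1ℚ)) :+ k :* con 1ℚ)) :- (con 0ℚ :+ ((S :+ r) :+ con 0ℚ))) refl k (ι n) S (ρ * H))))

-- One factor is sampled at a time while the others are averaged out: each replacement adds θ to the
-- error of every `g i` and at most doubles the bound for `h`.
sample : ∀ P n K {θ} → 0ℚ < θ → ι n + (ι n + 1ℚ) ≤ ι (suc K) * (θ * θ) →
  (ν : Fin P → Mean V) (g : Fin n → Vec V P → ℚ) → (∀ i v → 0ℚ ≤ g i v) → (∀ i v → g i v ≤ 1ℚ) →
  (h : Vec V P → ℚ) → (∀ v → 0ℚ ≤ h v) → ∀ {τ} → 0ℚ < τ → E (Π ν) h ≤ τ → Σ (Fin P → Vec V (suc K)) λ ys →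
    (∀ i → E (Π ν) (g i) ≤ E (Π (λ p → avg (ys p))) (g i) + ι P * θ) × E (Π (λ p → avg (ys p))) h ≤ 2ℚ ^ P * τ
sample zero n K {θ} 0θ size ν g g0 g1 h h0 {τ} 0τ hτ = (λ ()) ,
  (λ i → ℚₚ.≤-reflexive (trans (trans (E-pure [] (g i)) (sym (E-pure [] (g i)))) (solve 2 (λ e t → e := e :+ con 0ℚ :* t) refl (E (Π {m = zero} (λ ())) (g i)) θ))) ,
  subst₂ _≤_ (trans (E-pure [] h) (sym (E-pure [] h))) (sym (ℚₚ.*-identityˡ τ)) hτ
sample {V = V} (suc P) n K {θ} 0θ size ν g g0 g1 h h0 {τ} 0τ hτ =
  let ν′ = ν ∘ F.suc
      (y₀ , G₀ , H₀) = sample₁ n K 0θ size (ν F.zero) (λ i v → E (Π ν′) (λ y → g i (v ∷ y)))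
        (λ i v → E-nonneg (Π ν′) (λ y → g0 i (v ∷ y))) (λ i v → E-≤c (Π ν′) (λ y → g1 i (v ∷ y)))
        (λ v → E (Π ν′) (λ y → h (v ∷ y))) (λ v → E-nonneg (Π ν′) (λ y → h0 (v ∷ y))) 0τ (subst (_≤ τ) (E-Π ν h) hτ)
      μ₀ = avg y₀
      (ys , G₁ , H₁) = sample P n K 0θ size ν′ (λ i y → E μ₀ (λ v → g i (v ∷ y)))
        (λ i y → E-nonneg μ₀ (λ v → g0 i (v ∷ y))) (λ i y → E-≤c μ₀ (λ v → g1 i (v ∷ y)))
        (λ y → E μ₀ (λ v → h (v ∷ y))) (λ y → E-nonneg μ₀ (λ v → h0 (v ∷ y))) (0<+ 0τ 0τ)
        (subst (_≤ τ + τ) (E-swap μ₀ (Π ν′) (λ v y → h (v ∷ y))) H₀)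
      ys′ : Fin (suc P) → Vec V (suc K)
      ys′ = λ { F.zero → y₀ ; (F.suc p) → ys p }
      at : ∀ f → E (Π (λ p → avg (ys p))) (λ y → E μ₀ (λ v → f (v ∷ y))) ≡ E (Π (λ p → avg (ys′ p))) f
      at f = trans (E-swap (Π (λ p → avg (ys p))) μ₀ (λ y v → f (v ∷ y))) (sym (E-Π (λ p → avg (ys′ p)) f))
  in ys′ ,
     (λ i → ≤-by (G₀ i ⊕ G₁ i) (trans (cong₂ (λ a b → a + ι (suc P) * θ - b) (sym (at (g i))) (E-Π ν (g i)))
        (trans (solve 5 (λ a p t b c → a :+ (p :+ con 1ℚ) :* t :- b := ((c :+ t) :+ (a :+ p :* t)) :- (b :+ c)) refl
            (E (Π (λ p → avg (ys p))) (λ y → E μ₀ (λ v → g i (v ∷ y)))) (ι P) θ (E (ν F.zero) (λ v → E (Π ν′) (λ y → g i (v ∷ y)))) (E μ₀ (λ v → E (Π ν′) (λ y → g i (v ∷ y)))))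
          (cong (λ z → ((E μ₀ (λ v → E (Π ν′) (λ y → g i (v ∷ y))) + θ) + (E (Π (λ p → avg (ys p))) (λ y → E μ₀ (λ v → g i (v ∷ y))) + ι P * θ))
              - (E (ν F.zero) (λ v → E (Π ν′) (λ y → g i (v ∷ y))) + z)) (E-swap μ₀ (Π ν′) (λ v y → g i (v ∷ y))))))) ,
     subst₂ _≤_ (at h) (solve 2 (λ q t → q :* (t :+ t) := ((con 1ℚ :+ con 1ℚ) :* q) :* t) refl (2ℚ ^ P) τ) H₁

sumV-tabulate : ∀ {n} (h : Fin n → V) (f : V → ℚ) → sumV (Vec.tabulate h) f ≡ ΣF n (f ∘ h)
sumV-tabulate {n = zero} h f = sumV-[] f
sumV-tabulate {n = suc n} h f = trans (sumV-∷ (h F.zero) (Vec.tabulate (h ∘ F.suc)) f) (cong (λ z → f (h F.zero) + z) (sumV-tabulate (h ∘ F.suc) f))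

sumV-lookup : ∀ {n} (ys : Vec V n) (f : V → ℚ) → sumV ys f ≡ ΣF n (λ k → f (lookup ys k))
sumV-lookup ys f = trans (cong (λ z → sumV z f) (sym (Vecₚ.tabulate∘lookup ys))) (sumV-tabulate (lookup ys) f)

unif : ∀ n → Mean (Fin (suc n))
unif n = avg (Vec.tabulate id)

E-unif : ∀ n (f : Fin (suc n) → ℚ) → ι (suc n) * E (unif n) f ≡ ΣF (suc n) f
E-unif n f = trans (E-avg (Vec.tabulate id) f) (sumV-tabulate id f)

E-avg-unif : ∀ {n} (ys : Vec V (suc n)) (f : V → ℚ) → E (avg ys) f ≡ E (unif n) (λ k → f (lookup ys k))
E-avg-unif {n = n} ys f = ℚₚ.≤-antisym (*-cancel (0<ι n) (ℚₚ.≤-reflexive eq)) (*-cancel (0<ι n) (ℚₚ.≤-reflexive (sym eq)))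
  where
  eq : ι (suc n) * E (avg ys) f ≡ ι (suc n) * E (unif n) (λ k → f (lookup ys k))
  eq = trans (E-avg ys f) (trans (sumV-lookup ys f) (sym (E-unif n _)))

pick : ∀ {P n} → (Fin P → Vec V n) → Vec (Fin n) P → Vec V P
pick ys [] = []
pick ys (k ∷ ks) = lookup (ys F.zero) k ∷ pick (ys ∘ F.suc) ks

lookup-pick : ∀ {P n} (ys : Fin P → Vec V n) (ks : Vec (Fin n) P) (p : Fin P) → lookup (pick ys ks) p ≡ lookup (ys p) (lookup ks p)
lookup-pick ys (k ∷ ks) F.zero = refl
lookup-pick ys (k ∷ ks) (F.suc p) = lookup-pick (ys ∘ F.suc) ks p

-- A single choice of sample points has probability at least 1/(n + 1)^P. Hence a count of very
-- small mean vanishes at every choice.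
atom : ∀ {P n} (ys : Fin P → Vec V (suc n)) (f : Vec V P → ℚ) → (∀ v → 0ℚ ≤ f v) → ∀ ks →
  f (pick ys ks) ≤ ι (suc n) ^ P * E (Π (λ p → avg (ys p))) f
atom ys f f0 [] = ℚₚ.≤-reflexive (sym (trans (ℚₚ.*-identityˡ _) (E-pure [] f)))
atom {P = suc P} {n} ys f f0 (k ∷ ks) = ℚₚ.≤-trans (atom (ys ∘ F.suc) (λ v → f (lookup (ys F.zero) k ∷ v)) (λ v → f0 _) ks)
  (ℚₚ.≤-trans (ℚₚ.<⇒≤ (0<^ (0<ι n) P) ⊗ one) (ℚₚ.≤-reflexive (trans (solve 3 (λ a b c → a :* (b :* c) := (b :* a) :* c) refl (ι (suc n) ^ P) (ι (suc n)) _)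
     (cong (ι (suc n) ^ suc P *_) (sym (E-Π (λ p → avg (ys p)) f))))))
  where
  g : _ → ℚ
  g v = E (Π (λ p → avg (ys (F.suc p)))) (λ y → f (v ∷ y))
  one : g (lookup (ys F.zero) k) ≤ ι (suc n) * E (avg (ys F.zero)) g
  one = subst (g (lookup (ys F.zero) k) ≤_) (sym (trans (E-avg (ys F.zero) g) (sumV-lookup (ys F.zero) g)))
    (ΣF-∈ (suc n) (λ i → E-nonneg (Π (λ p → avg (ys (F.suc p)))) (λ y → f0 (lookup (ys F.zero) i ∷ y))) k)
-- Ramsey's theorem

Mono : ∀ {m n} → (Fin m → Fin n) → Set
Mono f = ∀ {i j} → i F.< j → f i F.< f j

Above : ∀ {n r} → Fin n → Vec (Fin n) r → Set
Above x [] = ⊤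
Above x (y ∷ ys) = x F.< y × Above x ys

Inc : ∀ {n r} → Vec (Fin n) r → Set
Inc [] = ⊤
Inc (x ∷ xs) = Above x xs × Inc xs

above-map : ∀ {n N r} {f : Fin n → Fin N} → Mono f → ∀ {x} (v : Vec (Fin n) r) → Above x v → Above (f x) (Vec.map f v)
above-map mf [] _ = tt
above-map mf (y ∷ v) (h , hs) = mf h , above-map mf v hs

inc-map : ∀ {n N r} {f : Fin n → Fin N} → Mono f → (v : Vec (Fin n) r) → Inc v → Inc (Vec.map f v)
inc-map mf [] _ = tt
inc-map mf (x ∷ v) (h , hs) = above-map mf v h , inc-map mf v hs

above-tabulate : ∀ {n r} (x : Fin n) (g : Fin r → Fin n) → (∀ j → x F.< g j) → Above x (Vec.tabulate g)
above-tabulate {r = zero} x g h = tt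
above-tabulate {r = suc r} x g h = h F.zero , above-tabulate x (g ∘ F.suc) (h ∘ F.suc)

inc-tabulate : ∀ {n r} (g : Fin r → Fin n) → Mono g → Inc (Vec.tabulate g)
inc-tabulate {r = zero} g mg = tt
inc-tabulate {r = suc r} g mg = above-tabulate (g F.zero) (g ∘ F.suc) (λ j → mg (s≤s z≤n)) , inc-tabulate (g ∘ F.suc) (λ h → mg (s≤s h))

predecessors : ∀ {n r} {x : Fin (suc n)} (v : Vec (Fin (suc n)) r) → Above x v → Σ (Vec (Fin n) r) λ v′ → v ≡ Vec.map F.suc v′
predecessors [] _ = [] , refl
predecessors {x = x} (F.zero ∷ v) (h , _) = ⊥-elim (ℕₚ.n≮0 {toℕ x} h)
predecessors {x = x} (F.suc y ∷ v) (_ , hs) = let (v′ , e) = predecessors {x = x} v hs in y ∷ v′ , cong (F.suc y ∷_) e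

above-pred : ∀ {n r} {x : Fin n} (v : Vec (Fin n) r) → Above (F.suc x) (Vec.map F.suc v) → Above x v
above-pred [] _ = tt
above-pred (y ∷ v) (s≤s h , hs) = h , above-pred v hs

inc-pred : ∀ {n r} (v : Vec (Fin n) r) → Inc (Vec.map F.suc v) → Inc v
inc-pred [] _ = tt
inc-pred (x ∷ v) (h , hs) = above-pred v h , inc-pred v hs

data Least {n r : ℕ} : Vec (Fin (suc n)) (suc r) → Set where
  at-zero : (v : Vec (Fin n) r) → Inc v → Least (F.zero ∷ Vec.map F.suc v)
  past-zero : (v : Vec (Fin n) (suc r)) → Inc v → Least (Vec.map F.suc v)

least : ∀ {n r} (v : Vec (Fin (suc n)) (suc r)) → Inc v → Least v
least (F.zero ∷ v) (h , hs) with predecessors {x = F.zero} v h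
... | v′ , refl = at-zero v′ (inc-pred v′ hs)
least (F.suc x ∷ v) (h , hs) with predecessors {x = F.suc x} v h
... | v′ , refl = past-zero (x ∷ v′) (above-pred v′ h , inc-pred v′ hs)

lift : ∀ {m n} → (Fin m → Fin n) → Fin (suc m) → Fin (suc n)
lift f F.zero = F.zero
lift f (F.suc i) = F.suc (f i)

lift-mono : ∀ {m n} {f : Fin m → Fin n} → Mono f → Mono (lift f)
lift-mono mf {F.zero} {F.suc j} h = s≤s z≤n
lift-mono mf {F.suc i} {F.suc j} (s≤s h) = s≤s (mf h)

map-lift : ∀ {m n r} (f : Fin m → Fin n) (v : Vec (Fin m) r) → Vec.map (lift f) (Vec.map F.suc v) ≡ Vec.map F.suc (Vec.map f v)
map-lift f [] = refl
map-lift f (x ∷ v) = cong (F.suc (f x) ∷_) (map-lift f v)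

Homogeneous : ∀ {n r} → (Vec (Fin n) r → Set) → Set
Homogeneous Q = (∀ v → Inc v → Q v) ⊎ (∀ v → Inc v → ¬ Q v)

hom-pull : ∀ {n n′ r s} {Q : Vec (Fin n) r → Set} {Q′ : Vec (Fin n′) s → Set} (t : Vec (Fin n′) s → Vec (Fin n) r) →
  (∀ v → Inc v → Inc (t v)) → (∀ v → Q (t v) → Q′ v) → (∀ v → Q′ v → Q (t v)) → Homogeneous Q → Homogeneous Q′
hom-pull t it to from (inj₁ h) = inj₁ (λ v iv → to v (h (t v) (it v iv)))
hom-pull t it to from (inj₂ h) = inj₂ (λ v iv q → h (t v) (it v iv) (from v q))

-- The truth of Q on an increasing tuple depends only on its first entry.
PreHom : ∀ {r} ℓ → (Vec (Fin ℓ) (suc r) → Set) → Set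
PreHom zero Q = ⊤
PreHom (suc ℓ) Q = Homogeneous (λ v → Q (F.zero ∷ Vec.map F.suc v)) × PreHom ℓ (λ v → Q (Vec.map F.suc v))

PreHom-resp : ∀ {r} ℓ {Q Q′ : Vec (Fin ℓ) (suc r) → Set} → (∀ v → Q v → Q′ v) → (∀ v → Q′ v → Q v) → PreHom ℓ Q → PreHom ℓ Q′
PreHom-resp zero to from _ = tt
PreHom-resp (suc ℓ) to from (inj₁ h , p) = inj₁ (λ v iv → to _ (h v iv)) , PreHom-resp ℓ (λ v → to _) (λ v → from _) p
PreHom-resp (suc ℓ) to from (inj₂ h , p) = inj₂ (λ v iv q → h v iv (from _ q)) , PreHom-resp ℓ (λ v → to _) (λ v → from _) p

-- Pigeonhole on the first entries: among a + b of them, `a` are of the positive kind or `b` of the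
-- negative kind. Keeping an entry lifts the map found in the remainder, dropping it shifts that
-- map.
select : ∀ {r} ℓ a b → a ℕ.+ b ℕ.≤ ℓ → (Q : Vec (Fin ℓ) (suc r) → Set) → PreHom ℓ Q →
  (Σ (Fin a → Fin ℓ) λ f → Mono f × (∀ v → Inc v → Q (Vec.map f v))) ⊎ (Σ (Fin b → Fin ℓ) λ f → Mono f × (∀ v → Inc v → ¬ Q (Vec.map f v)))
select ℓ zero b le Q p = inj₁ ((λ ()) , (λ {i} → λ { {j = ()} }) , λ { (() ∷ _) })
select ℓ (suc a) zero le Q p = inj₂ ((λ ()) , (λ {i} → λ { {j = ()} }) , λ { (() ∷ _) })
select {r} (suc ℓ) (suc a) (suc b) (s≤s le) Q (inj₁ h , p) with select ℓ a (suc b) le (λ v → Q (Vec.map F.suc v)) p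
... | inj₁ (f , mf , q) = inj₁ (lift f , lift-mono mf , λ v iv → go v (least v iv))
  where
  go : ∀ v → Least v → Q (Vec.map (lift f) v)
  go .(F.zero ∷ Vec.map F.suc v) (at-zero v iv) = subst (λ w → Q (F.zero ∷ w)) (sym (map-lift f v)) (h (Vec.map f v) (inc-map mf v iv))
  go .(Vec.map F.suc v) (past-zero v iv) = subst Q (sym (map-lift f v)) (q v iv)
... | inj₂ (f , mf , q) = inj₂ (F.suc ∘ f , (λ h → s≤s (mf h)) , λ v iv → subst (λ w → ¬ Q w) (sym (Vecₚ.map-∘ F.suc f v)) (q v iv))
select {r} (suc ℓ) (suc a) (suc b) (s≤s le) Q (inj₂ h , p) with select ℓ (suc a) b (subst (ℕ._≤ ℓ) (ℕₚ.+-suc a b) le) (λ v → Q (Vec.map F.suc v)) p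
... | inj₂ (f , mf , q) = inj₂ (lift f , lift-mono mf , λ v iv → go v (least v iv))
  where
  go : ∀ v → Least v → ¬ Q (Vec.map (lift f) v)
  go .(F.zero ∷ Vec.map F.suc v) (at-zero v iv) = subst (λ w → ¬ Q (F.zero ∷ w)) (sym (map-lift f v)) (h (Vec.map f v) (inc-map mf v iv))
  go .(Vec.map F.suc v) (past-zero v iv) = subst (λ w → ¬ Q w) (sym (map-lift f v)) (q v iv)
... | inj₁ (f , mf , q) = inj₁ (F.suc ∘ f , (λ h → s≤s (mf h)) , λ v iv → subst Q (sym (Vecₚ.map-∘ F.suc f v)) (q v iv))

-- `Q` is an arbitrary predicate, possibly undecidable, so the homogeneous set is asserted only up
-- to double negation.
Ramsey : ℕ → ℕ → ℕ → Set₁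
Ramsey r m N = ∀ (Q : Vec (Fin N) r → Set) → ¬ ¬ (Σ (Fin m → Fin N) λ f → Mono f × Homogeneous (λ v → Q (Vec.map f v)))

-- The Erdős-Rado argument: Ramsey's theorem for `r` makes the tuples beginning with the first
-- vertex homogeneous, and the rest of the sequence is found inside the set so obtained.
prehomogeneous : ∀ {r} → (∀ m → Σ ℕ (Ramsey r m)) → ∀ ℓ → Σ ℕ λ N → ∀ (Q : Vec (Fin N) (suc r) → Set) →
  ¬ ¬ (Σ (Fin ℓ → Fin N) λ f → Mono f × PreHom ℓ (λ v → Q (Vec.map f v)))
prehomogeneous ram zero = zero , λ Q k → k ((λ ()) , (λ {i} → λ { {j = ()} }) , tt)
prehomogeneous ram (suc ℓ) =
  let (n₁ , rest) = prehomogeneous ram ℓ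
      (n₂ , first) = ram n₁
  in suc n₂ , λ Q k → first (λ v → Q (F.zero ∷ Vec.map F.suc v)) λ (g , mg , hom) →
     rest (λ v → Q (Vec.map F.suc (Vec.map g v))) λ (f , mf , pre) →
     let gf = λ i → g (f i)
         path : ∀ {r} (v : Vec (Fin ℓ) r) → Vec.map F.suc (Vec.map g (Vec.map f v)) ≡ Vec.map (lift gf) (Vec.map F.suc v)
         path v = trans (cong (Vec.map F.suc) (sym (Vecₚ.map-∘ g f v))) (sym (map-lift gf v))
         hom′ : Homogeneous (λ v → Q (F.zero ∷ Vec.map (lift gf) (Vec.map F.suc v)))
         hom′ = hom-pull (Vec.map f) (inc-map mf) (λ v → subst (λ w → Q (F.zero ∷ w)) (path v)) (λ v → subst (λ w → Q (F.zero ∷ w)) (sym (path v))) hom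
     in k (lift gf , lift-mono (λ h → mg (mf h)) , hom′ , PreHom-resp ℓ (λ v → subst Q (path v)) (λ v → subst Q (sym (path v))) pre)

opaque
  ramsey : ∀ r m → Σ ℕ (Ramsey r m)
  -- There is only the empty tuple, so the claim is the double negation of excluded middle for
  -- `Q []`.
  ramsey zero m = m , λ Q k → k (id , id , inj₂ λ { [] _ q → k (id , id , inj₁ λ { [] _ → q }) })
  ramsey (suc r) m =
    let (N , pre) = prehomogeneous (ramsey r) (m ℕ.+ m)
    in N , λ Q k → pre Q λ (f , mf , p) →
       [ (λ { (g , mg , q) → k ((λ i → f (g i)) , (λ h → mf (mg h)) , inj₁ (λ v iv → subst Q (sym (Vecₚ.map-∘ f g v)) (q v iv))) }) ,
         (λ { (g , mg , q) → k ((λ i → f (g i)) , (λ h → mf (mg h)) , inj₂ (λ v iv → subst (λ w → ¬ Q w) (sym (Vecₚ.map-∘ f g v)) (q v iv))) }) ]′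
       (select (m ℕ.+ m) m m ℕₚ.≤-refl (λ v → Q (Vec.map f v)) p)

  ramseys : ∀ r m c → Σ ℕ λ N → ∀ (Q : Fin c → Vec (Fin N) r → Set) →
    ¬ ¬ (Σ (Fin m → Fin N) λ f → Mono f × (∀ q → Homogeneous (λ v → Q q (Vec.map f v))))
  ramseys r m zero = m , λ Q k → k (id , id , λ ())
  ramseys r m (suc c) =
    let (n₁ , rest) = ramseys r m c
        (n₂ , first) = ramsey r n₁
    in n₂ , λ Q k → first (Q F.zero) λ (f , mf , hom) → rest (λ q v → Q (F.suc q) (Vec.map f v)) λ (g , mg , homs) →
       k ((λ i → f (g i)) , (λ h → mf (mg h)) , λ
         { F.zero → hom-pull (Vec.map g) (inc-map mg) (λ v → subst (Q F.zero) (sym (Vecₚ.map-∘ f g v))) (λ v → subst (Q F.zero) (Vecₚ.map-∘ f g v)) hom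
         ; (F.suc q) → hom-pull id (λ v iv → iv) (λ v → subst (Q (F.suc q)) (sym (Vecₚ.map-∘ f g v))) (λ v → subst (Q (F.suc q)) (Vecₚ.map-∘ f g v)) (homs q) })

-- One label for all triples through a pair

choose-true : ∀ S (b : Fin S → Bool) m → ι m ≤ ΣF S (λ τ → ⟦ b τ ⟧) → Σ (Fin m → Fin S) λ h → Mono h × (∀ c → b (h c) ≡ true)
choose-true S b zero _ = (λ ()) , (λ {i} → λ { {j = ()} }) , λ ()
choose-true zero b (suc m) h = ⊥-elim (<≤⊥ (0<ι m) h)
choose-true (suc S) b (suc m) h with b F.zero in eq
... | true = let (g , mg , hg) = choose-true S (b ∘ F.suc) m (≤-by h (solve 2 (λ s i → s :- i := (con 1ℚ :+ s) :- (i :+ con 1ℚ)) refl (ΣF S (λ τ → ⟦ b (F.suc τ) ⟧)) (ι m)))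
  in lift g , lift-mono mg , λ { F.zero → eq ; (F.suc c) → hg c }
... | false = let (g , mg , hg) = choose-true S (b ∘ F.suc) (suc m) (subst (ι (suc m) ≤_) (ℚₚ.+-identityˡ _) h)
  in (λ c → F.suc (g c)) , (λ k → s≤s (mg k)) , hg

↑ˡ-mono : ∀ {S} K {i j : Fin S} → i F.< j → i F.↑ˡ K F.< j F.↑ˡ K
↑ˡ-mono K {i} {j} h = subst₂ ℕ._<_ (sym (Fₚ.toℕ-↑ˡ i K)) (sym (Fₚ.toℕ-↑ˡ j K)) h

↑ʳ-mono : ∀ S {K} {i j : Fin K} → i F.< j → S F.↑ʳ i F.< S F.↑ʳ j
↑ʳ-mono S {i = i} {j} h = subst₂ ℕ._<_ (sym (Fₚ.toℕ-↑ʳ S i)) (sym (Fₚ.toℕ-↑ʳ S j)) (ℕₚ.+-monoʳ-< S h)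

↑ˡ<↑ʳ : ∀ {S K} (i : Fin S) (j : Fin K) → i F.↑ˡ K F.< S F.↑ʳ j
↑ˡ<↑ʳ {S} {K} i j = subst₂ ℕ._<_ (sym (Fₚ.toℕ-↑ˡ i K)) (sym (Fₚ.toℕ-↑ʳ S j)) (ℕₚ.<-≤-trans (Fₚ.toℕ<n i) (ℕₚ.m≤m+n S (toℕ j)))

private
  module Spread (S m : ℕ) where
    K₂ = suc (S ℕ.+ m)
    K₁ = suc (S ℕ.+ K₂)
    size = S ℕ.+ K₁

    -- The layout in increasing order: S candidates below the pair, its lower vertex, S candidates
    -- between, its upper vertex, S candidates above, and m vertices for the final tuple.
    left mid right : Fin S → Fin size
    left τ = τ F.↑ˡ K₁
    mid τ = S F.↑ʳ F.suc (τ F.↑ˡ K₂)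
    right τ = S F.↑ʳ F.suc (S F.↑ʳ F.suc (τ F.↑ˡ m))

    first second : Fin size
    first = S F.↑ʳ F.zero
    second = S F.↑ʳ F.suc (S F.↑ʳ F.zero)

    last : Fin m → Fin size
    last c = S F.↑ʳ F.suc (S F.↑ʳ F.suc (S F.↑ʳ c))

    last-mono : Mono last
    last-mono h = ↑ʳ-mono S (s≤s (↑ʳ-mono S (s≤s (↑ʳ-mono S h))))

    data Place (a b c : Fin m) : Set where
      below : c F.< a → Place a b c
      at-a : c ≡ a → Place a b c
      between : a F.< c → c F.< b → Place a b c
      at-b : c ≡ b → Place a b c
      above : b F.< c → Place a b c

    place : ∀ a b c → Place a b c
    place a b c with Fₚ.<-cmp c a
    ... | tri< h _ _ = below h
    ... | tri≈ _ h _ = at-a h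
    ... | tri> _ _ h with Fₚ.<-cmp c b
    ...   | tri< k _ _ = between h k
    ...   | tri≈ _ k _ = at-b k
    ...   | tri> _ _ k = above k

    put : (Fin m → Fin S) → ∀ {a b c} → Place a b c → Fin size
    put h {c = c} (below _) = left (h c)
    put h (at-a _) = first
    put h {c = c} (between _ _) = mid (h c)
    put h (at-b _) = second
    put h {c = c} (above _) = right (h c)

    put-mono : ∀ h → Mono h → ∀ {a b} → a F.< b → ∀ {c d} → c F.< d → (p : Place a b c) (q : Place a b d) → put h p F.< put h q
    put-mono h mh ab cd (below _) (below _) = ↑ˡ-mono K₁ (mh cd)
    put-mono h mh ab cd (below _) (at-a _) = ↑ˡ<↑ʳ _ _
    put-mono h mh ab cd (below _) (between _ _) = ↑ˡ<↑ʳ _ _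
    put-mono h mh ab cd (below _) (at-b _) = ↑ˡ<↑ʳ _ _
    put-mono h mh ab cd (below _) (above _) = ↑ˡ<↑ʳ _ _
    put-mono h mh ab cd (at-a refl) (below q) = ⊥-elim (ℕₚ.<-asym cd q)
    put-mono h mh ab cd (at-a refl) (at-a refl) = ⊥-elim (ℕₚ.<-irrefl refl cd)
    put-mono h mh ab cd (at-a _) (between _ _) = ↑ʳ-mono S (s≤s z≤n)
    put-mono h mh ab cd (at-a _) (at-b _) = ↑ʳ-mono S (s≤s z≤n)
    put-mono h mh ab cd (at-a _) (above _) = ↑ʳ-mono S (s≤s z≤n)
    put-mono h mh ab cd (between p _) (below q) = ⊥-elim (ℕₚ.<-asym (ℕₚ.<-trans p cd) q)
    put-mono h mh ab cd (between p _) (at-a refl) = ⊥-elim (ℕₚ.<-asym p cd)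
    put-mono h mh ab cd (between _ _) (between _ _) = ↑ʳ-mono S (s≤s (↑ˡ-mono K₂ (mh cd)))
    put-mono h mh ab cd (between _ _) (at-b _) = ↑ʳ-mono S (s≤s (↑ˡ<↑ʳ _ _))
    put-mono h mh ab cd (between _ _) (above _) = ↑ʳ-mono S (s≤s (↑ˡ<↑ʳ _ _))
    put-mono h mh ab cd (at-b refl) (below q) = ⊥-elim (ℕₚ.<-asym (ℕₚ.<-trans ab cd) q)
    put-mono h mh ab cd (at-b refl) (at-a refl) = ⊥-elim (ℕₚ.<-asym ab cd)
    put-mono h mh ab cd (at-b refl) (between _ q) = ⊥-elim (ℕₚ.<-asym cd q)
    put-mono h mh ab cd (at-b refl) (at-b refl) = ⊥-elim (ℕₚ.<-irrefl refl cd)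
    put-mono h mh ab cd (at-b _) (above _) = ↑ʳ-mono S (s≤s (↑ʳ-mono S (s≤s z≤n)))
    put-mono h mh ab cd (above p) (below q) = ⊥-elim (ℕₚ.<-asym (ℕₚ.<-trans ab (ℕₚ.<-trans p cd)) q)
    put-mono h mh ab cd (above p) (at-a refl) = ⊥-elim (ℕₚ.<-asym ab (ℕₚ.<-trans p cd))
    put-mono h mh ab cd (above p) (between _ q) = ⊥-elim (ℕₚ.<-asym (ℕₚ.<-trans p cd) q)
    put-mono h mh ab cd (above p) (at-b refl) = ⊥-elim (ℕₚ.<-asym p cd)
    put-mono h mh ab cd (above _) (above _) = ↑ʳ-mono S (s≤s (↑ʳ-mono S (s≤s (↑ˡ-mono m (mh cd)))))

Sets : ℕ → Set → Set
Sets N Y = Fin N → Fin N → Fin N → Y → Bool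

-- One label y for the pair (i , j) that serves all thirds at once: among many
-- disjoint choices of thirds, some y is good for at least m of them.
Stage : ℕ → ℚ → ℕ → Set₁
Stage m β N = ∀ {Y : Set} (ν : Fin N → Fin N → Mean Y) (CR CT CL : Sets N Y) →
  (∀ k₁ i k₂ j k₃ → k₁ F.< i → i F.< k₂ → k₂ F.< j → j F.< k₃ → β ≤ E (ν i j) (λ y → ⟦ CR k₁ i j y ∧ (CT i k₂ j y ∧ CL i j k₃ y) ⟧)) →
  ¬ ¬ (Σ (Fin m → Fin N) λ f → Mono f × Σ (Fin m → Fin m → Y) λ lab → ∀ i j k → i F.< j → j F.< k →
    CR (f i) (f j) (f k) (lab j k) ≡ true × CT (f i) (f j) (f k) (lab i k) ≡ true × CL (f i) (f j) (f k) (lab i j) ≡ true)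

private
  ∧-true₃ : ∀ {p q r : Bool} → p ∧ (q ∧ r) ≡ true → p ≡ true × q ≡ true × r ≡ true
  ∧-true₃ e = let (e₁ , e₂) = ∧-true e in e₁ , ∧-true e₂

  module Serving {Y : Set} {N : ℕ} (m : ℕ) (CR CT CL : Sets N Y) where
    Serves : Fin m → Fin m → Vec (Fin N) m → Y → Set
    Serves a b v y = ∀ c →
      (c F.< a → CR (lookup v c) (lookup v a) (lookup v b) y ≡ true) ×
      (a F.< c → c F.< b → CT (lookup v a) (lookup v c) (lookup v b) y ≡ true) ×
      (b F.< c → CL (lookup v a) (lookup v b) (lookup v c) y ≡ true)

    Served : Fin m → Fin m → Vec (Fin N) m → Set
    Served a b v = a F.< b → Σ Y (Serves a b v)

  module Staging {Y : Set} {N : ℕ} (S m : ℕ) {β : ℚ} (hS : ι m ≤ ι S * β) (ν : Fin N → Fin N → Mean Y) (CR CT CL : Sets N Y)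
    (hyp : ∀ k₁ i k₂ j k₃ → k₁ F.< i → i F.< k₂ → k₂ F.< j → j F.< k₃ → β ≤ E (ν i j) (λ y → ⟦ CR k₁ i j y ∧ (CT i k₂ j y ∧ CL i j k₃ y) ⟧))
    (f : Fin (Spread.size S m) → Fin N) (mf : Mono f) where
    open Spread S m

    open Serving m CR CT CL

    good : Fin S → Y → Bool
    good τ y = CR (f (left τ)) (f first) (f second) y ∧ (CT (f first) (f (mid τ)) (f second) y ∧ CL (f first) (f second) (f (right τ)) y)

    popular : Σ Y λ y → ι m ≤ ΣF S (λ τ → ⟦ good τ y ⟧)
    popular = y , ≤-by (total ⊕ subst (- 1ℚ * ΣF S (λ τ → ⟦ good τ y ⟧) ≤_) (E-* μ (- 1ℚ) _) hy)
        (solve 3 (λ s e i → s :- i := (e :+ (:- con 1ℚ) :* e) :- (i :+ (:- con 1ℚ) :* s)) refl (ΣF S (λ τ → ⟦ good τ y ⟧)) (E μ (λ y → ΣF S (λ τ → ⟦ good τ y ⟧))) (ι m))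
      where
      μ = ν (f first) (f second)
      total : ι m ≤ E μ (λ y → ΣF S (λ τ → ⟦ good τ y ⟧))
      total = ℚₚ.≤-trans hS (subst₂ _≤_ (ΣF-const S β) (sym (E-ΣF μ S (λ τ y → ⟦ good τ y ⟧)))
        (ΣF-mono S (λ τ → hyp (f (left τ)) (f first) (f (mid τ)) (f second) (f (right τ)) (mf (↑ˡ<↑ʳ τ F.zero)) (mf (↑ʳ-mono S (s≤s z≤n)))
          (mf (↑ʳ-mono S (s≤s (↑ˡ<↑ʳ τ F.zero)))) (mf (↑ʳ-mono S (s≤s (↑ʳ-mono S (s≤s z≤n))))))))
      -- `E-∃` finds a value not above the mean; applied to the negated count, it finds a label
      -- whose count is not below the mean.
      y = proj₁ (E-∃ μ (λ y → - 1ℚ * ΣF S (λ τ → ⟦ good τ y ⟧)))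
      hy = proj₂ (E-∃ μ (λ y → - 1ℚ * ΣF S (λ τ → ⟦ good τ y ⟧)))

    -- Positions `a` and `b` go to `first` and `second`, and the other positions are filled with
    -- candidates for which the popular label is good. Such a tuple rules out the negative case of
    -- homogeneity.
    exhibit : ∀ a b → a F.< b → Σ (Vec (Fin size) m) λ v → Inc v × Σ Y (Serves a b (Vec.map f v))
    exhibit a b ab = v , inc-tabulate g (λ {c} {d} cd → put-mono h mh ab cd (place a b c) (place a b d)) , y , λ c →
        (λ ca → trans (cong₂ (λ s t → CR s t (lookup (Vec.map f v) b) y) (trans (val c) (cong f (w₁ c ca (place a b c)))) vi) (trans (cong (λ t → CR (f (left (h c))) (f first) t y) vj) (proj₁ (hg c)))) ,
        (λ ac cb → trans (cong₂ (λ s t → CT s t (lookup (Vec.map f v) b) y) vi (trans (val c) (cong f (w₂ c ac cb (place a b c))))) (trans (cong (λ t → CT (f first) (f (mid (h c))) t y) vj) (proj₁ (proj₂ (hg c))))) ,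
        (λ bc → trans (cong₂ (λ s t → CL s t (lookup (Vec.map f v) c) y) vi vj) (trans (cong (λ t → CL (f first) (f second) t y) (trans (val c) (cong f (w₃ c bc (place a b c))))) (proj₂ (proj₂ (hg c)))))
      where
      y = proj₁ popular
      chosen = choose-true S (λ τ → good τ y) m (proj₂ popular)
      h = proj₁ chosen
      mh : Mono h
      mh = proj₁ (proj₂ chosen)
      hh : ∀ c → good (h c) y ≡ true
      hh = proj₂ (proj₂ chosen)
      hg : ∀ c → _ × _ × _
      hg c = ∧-true₃ {CR (f (left (h c))) (f first) (f second) y} {CT (f first) (f (mid (h c))) (f second) y} {CL (f first) (f second) (f (right (h c))) y} (hh c)
      g : Fin m → Fin size
      g c = put h (place a b c)
      v = Vec.tabulate g
      val : ∀ c → lookup (Vec.map f v) c ≡ f (g c)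
      val c = trans (Vecₚ.lookup-map c f v) (cong f (Vecₚ.lookup∘tabulate g c))
      ga : ∀ (p : Place a b a) → put h p ≡ first
      ga (below q) = ⊥-elim (ℕₚ.<-irrefl refl q)
      ga (at-a _) = refl
      ga (between q _) = ⊥-elim (ℕₚ.<-irrefl refl q)
      ga (at-b refl) = ⊥-elim (ℕₚ.<-irrefl refl ab)
      ga (above q) = ⊥-elim (ℕₚ.<-asym ab q)
      gb : ∀ (p : Place a b b) → put h p ≡ second
      gb (below q) = ⊥-elim (ℕₚ.<-asym ab q)
      gb (at-a refl) = ⊥-elim (ℕₚ.<-irrefl refl ab)
      gb (between _ q) = ⊥-elim (ℕₚ.<-irrefl refl q)
      gb (at-b _) = refl
      gb (above q) = ⊥-elim (ℕₚ.<-irrefl refl q)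
      vi : lookup (Vec.map f v) a ≡ f first
      vi = trans (val a) (cong f (ga (place a b a)))
      vj : lookup (Vec.map f v) b ≡ f second
      vj = trans (val b) (cong f (gb (place a b b)))
      w₁ : ∀ c → c F.< a → (p : Place a b c) → put h p ≡ left (h c)
      w₁ c ca (below _) = refl
      w₁ c ca (at-a refl) = ⊥-elim (ℕₚ.<-irrefl refl ca)
      w₁ c ca (between q _) = ⊥-elim (ℕₚ.<-asym ca q)
      w₁ c ca (at-b refl) = ⊥-elim (ℕₚ.<-asym ca ab)
      w₁ c ca (above q) = ⊥-elim (ℕₚ.<-asym ca (ℕₚ.<-trans ab q))
      w₂ : ∀ c → a F.< c → c F.< b → (p : Place a b c) → put h p ≡ mid (h c)
      w₂ c ac cb (below q) = ⊥-elim (ℕₚ.<-asym ac q)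
      w₂ c ac cb (at-a refl) = ⊥-elim (ℕₚ.<-irrefl refl ac)
      w₂ c ac cb (between _ _) = refl
      w₂ c ac cb (at-b refl) = ⊥-elim (ℕₚ.<-irrefl refl cb)
      w₂ c ac cb (above q) = ⊥-elim (ℕₚ.<-asym cb q)
      w₃ : ∀ c → b F.< c → (p : Place a b c) → put h p ≡ right (h c)
      w₃ c bc (below q) = ⊥-elim (ℕₚ.<-asym bc (ℕₚ.<-trans q ab))
      w₃ c bc (at-a refl) = ⊥-elim (ℕₚ.<-asym bc ab)
      w₃ c bc (between _ q) = ⊥-elim (ℕₚ.<-asym bc q)
      w₃ c bc (at-b refl) = ⊥-elim (ℕₚ.<-irrefl refl bc)
      w₃ c bc (above _) = refl

    v₀ : Vec (Fin size) m
    v₀ = Vec.tabulate last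

    F₀ : Fin m → Fin N
    F₀ c = f (last c)

    val₀ : ∀ c → lookup (Vec.map f v₀) c ≡ F₀ c
    val₀ c = trans (Vecₚ.lookup-map c f v₀) (cong f (Vecₚ.lookup∘tabulate last c))

    module _ (homs : ∀ q → Homogeneous (λ v → Served (proj₁ (F.remQuot {m} m q)) (proj₂ (F.remQuot {m} m q)) (Vec.map f v))) where

      served : ∀ a b → Served a b (Vec.map f v₀)
      served a b = subst (λ z → Served (proj₁ z) (proj₂ z) (Vec.map f v₀)) (Fₚ.remQuot-combine a b) (decide (homs (F.combine a b)))
        where
        decide : ∀ {a b} → Homogeneous (λ v → Served a b (Vec.map f v)) → Served a b (Vec.map f v₀)
        decide (inj₁ pos) = pos v₀ (inc-tabulate last last-mono)
        decide (inj₂ neg) ab = let (v , iv , q) = exhibit _ _ ab in ⊥-elim (neg v iv (λ _ → q))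

      labD : ∀ a b → Dec (a F.< b) → Y
      labD a b (yes ab) = proj₁ (served a b ab)
      -- A default for the pairs that are not increasing; any label would do.
      labD a b (no _) = proj₁ popular

      good-lab : ∀ a b → a F.< b → (d : Dec (a F.< b)) → ∀ c →
        (c F.< a → CR (F₀ c) (F₀ a) (F₀ b) (labD a b d) ≡ true) ×
        (a F.< c → c F.< b → CT (F₀ a) (F₀ c) (F₀ b) (labD a b d) ≡ true) ×
        (b F.< c → CL (F₀ a) (F₀ b) (F₀ c) (labD a b d) ≡ true)
      good-lab a b ab (no n) c = ⊥-elim (n ab)
      good-lab a b _ (yes ab) c =
        (λ h → subst₂ (λ s t → CR s t (F₀ b) y ≡ true) (val₀ c) (val₀ a) (subst (λ t → CR (lookup (Vec.map f v₀) c) (lookup (Vec.map f v₀) a) t y ≡ true) (val₀ b) (proj₁ (hy c) h))) ,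
        (λ h h′ → subst₂ (λ s t → CT s t (F₀ b) y ≡ true) (val₀ a) (val₀ c) (subst (λ t → CT (lookup (Vec.map f v₀) a) (lookup (Vec.map f v₀) c) t y ≡ true) (val₀ b) (proj₁ (proj₂ (hy c)) h h′))) ,
        (λ h → subst₂ (λ s t → CL s t (F₀ c) y ≡ true) (val₀ a) (val₀ b) (subst (λ t → CL (lookup (Vec.map f v₀) a) (lookup (Vec.map f v₀) b) t y ≡ true) (val₀ c) (proj₂ (proj₂ (hy c)) h)))
        where
        y = proj₁ (served a b ab)
        hy = proj₂ (served a b ab)

      result : Σ (Fin m → Fin N) λ f → Mono f × Σ (Fin m → Fin m → Y) λ lab → ∀ i j k → i F.< j → j F.< k →
        CR (f i) (f j) (f k) (lab j k) ≡ true × CT (f i) (f j) (f k) (lab i k) ≡ true × CL (f i) (f j) (f k) (lab i j) ≡ true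
      result = F₀ , (λ h → mf (last-mono h)) , (λ a b → labD a b (a Fₚ.<? b)) , λ i j k ij jk →
        proj₁ (good-lab j k jk (j Fₚ.<? k) i) ij ,
        proj₁ (proj₂ (good-lab i k (ℕₚ.<-trans ij jk) (i Fₚ.<? k) j)) ij jk ,
        proj₂ (proj₂ (good-lab i j ij (i Fₚ.<? j) k)) jk

opaque
  stage : ∀ m {β} → 0ℚ < β → Σ ℕ (Stage m β)
  stage m {β} 0β =
    let (S , hS) = archimedean⁻¹ 0β (ι m)
        (N , ram) = ramseys m (Spread.size S m) (m ℕ.* m)
    in N , λ {Y} ν CR CT CL hyp k →
       ram (λ q v → Serving.Served m CR CT CL (proj₁ (F.remQuot {m} m q)) (proj₂ (F.remQuot {m} m q)) v)
         λ (f , mf , homs) → k (Staging.result S m hS ν CR CT CL hyp f mf homs)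
-- The reduced hypergraph

pr : ∀ {n} → Label → Fin n → Fin n → Fin n → Fin n × Fin n
pr L i j k = i , j
pr T i j k = i , k
pr R i j k = j , k

map₂ : ∀ {m n} → (Fin m → Fin n) → Fin m × Fin m → Fin n × Fin n
map₂ f (i , j) = f i , f j

pr-map : ∀ {m n} (f : Fin m → Fin n) ℓ i j k → pr ℓ (f i) (f j) (f k) ≡ map₂ f (pr ℓ i j k)
pr-map f L i j k = refl
pr-map f T i j k = refl
pr-map f R i j k = refl

RoleStage : ℕ → ℚ → ℕ → Set₁
RoleStage m β N = ∀ (ℓ : Label) {Y : Set} (ν : Fin N × Fin N → Mean Y) (B : Sets N Y) →
  (∀ i j k → i F.< j → j F.< k → β ≤ E (ν (pr ℓ i j k)) (λ y → ⟦ B i j k y ⟧)) →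
  ¬ ¬ (Σ (Fin m → Fin N) λ f → Mono f × Σ (Fin m × Fin m → Y) λ lab → ∀ i j k → i F.< j → j F.< k → B (f i) (f j) (f k) (lab (pr ℓ i j k)) ≡ true)

opaque
  role-stage : ∀ m {β} → 0ℚ < β → Σ ℕ (RoleStage m β)
  role-stage m {β} 0β = let (N , st) = stage m 0β in N , go N st
    where
    go : ∀ N → Stage m β N → RoleStage m β N
    go N st L ν B hyp k = st (λ i j → ν (i , j)) (λ _ _ _ _ → true) (λ _ _ _ _ → true) B
      (λ k₁ i k₂ j k₃ h₁ h₂ h₃ h₄ → hyp i j k₃ (Fₚ.<-trans h₂ h₃) h₄)
      λ (f , mf , lab , good) → k (f , mf , (λ (i , j) → lab i j) , λ i j k ij jk → proj₂ (proj₂ (good i j k ij jk)))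
    go N st T ν B hyp k = st (λ i j → ν (i , j)) (λ _ _ _ _ → true) B (λ _ _ _ _ → true)
      (λ k₁ i k₂ j k₃ h₁ h₂ h₃ h₄ → subst (β ≤_) (E-cong (ν (i , j)) (λ y → cong ⟦_⟧ (sym (Boolₚ.∧-identityʳ (B i k₂ j y))))) (hyp i k₂ j h₂ h₃))
      λ (f , mf , lab , good) → k (f , mf , (λ (i , j) → lab i j) , λ i j k ij jk → proj₁ (proj₂ (good i j k ij jk)))
    go N st R ν B hyp k = st (λ i j → ν (i , j)) B (λ _ _ _ _ → true) (λ _ _ _ _ → true)
      (λ k₁ i k₂ j k₃ h₁ h₂ h₃ h₄ → subst (β ≤_) (E-cong (ν (i , j)) (λ y → cong ⟦_⟧ (sym (Boolₚ.∧-identityʳ (B k₁ i j y))))) (hyp k₁ i j h₁ (Fₚ.<-trans h₂ h₃)))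
      λ (f , mf , lab , good) → k (f , mf , (λ (i , j) → lab i j) , λ i j k ij jk → proj₁ (good i j k ij jk))

opaque
  decide≤ : ∀ η d → Dec (η ≤ d)
  decide≤ = ℚₚ._≤?_

≥ᵇ : ℚ → ℚ → Bool
≥ᵇ η d = does (decide≤ η d)

≥ᵇ-true : ∀ {η d} → ≥ᵇ η d ≡ true → η ≤ d
≥ᵇ-true {η} {d} h with decide≤ η d
... | yes p = p

≥ᵇ-rest : ∀ {η} d → 0ℚ ≤ η → (1ℚ - ⟦ ≥ᵇ η d ⟧) * d ≤ η
≥ᵇ-rest {η} d h with decide≤ η d
... | yes _ = subst (_≤ η) (solve 1 (λ d → con 0ℚ := (con 1ℚ :- con 1ℚ) :* d) refl d) h
... | no n = subst (_≤ η) (solve 1 (λ d → d := (con 1ℚ :- con 0ℚ) :* d) refl d) (≰→≥ n)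

≤≥ᵇ : ∀ {η} d → 0ℚ ≤ η → d ≤ 1ℚ → d ≤ ⟦ ≥ᵇ η d ⟧ + η
≤≥ᵇ {η} d h d1 with decide≤ η d
... | yes _ = ≤-by (d1 ⊕ h) (solve 2 (λ d η → con 1ℚ :+ η :- d := (con 1ℚ :+ η) :- (d :+ con 0ℚ)) refl d η)
... | no n = ≤-by (≰→≥ n) (solve 2 (λ d η → con 0ℚ :+ η :- d := η :- d) refl d η)

TwoRoles : ℕ → ℚ → ℕ → Set₁
TwoRoles m β N = ∀ (ℓ ℓ′ : Label) {Y : Set} (ν : Fin N × Fin N → Mean Y) (D : Fin N → Fin N → Fin N → Y → Y → Bool) →
  (∀ i j k → i F.< j → j F.< k → β + β ≤ E (ν (pr ℓ i j k)) (λ y → E (ν (pr ℓ′ i j k)) (λ y′ → ⟦ D i j k y y′ ⟧))) →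
  ¬ ¬ (Σ (Fin m → Fin N) λ f → Mono f × Σ (Fin m × Fin m → Y) λ la → Σ (Fin m × Fin m → Y) λ lb →
     ∀ i j k → i F.< j → j F.< k → D (f i) (f j) (f k) (la (pr ℓ i j k)) (lb (pr ℓ′ i j k)) ≡ true)

opaque
  -- Degrees are at most 1, so a mean of 2β gives measure β to the labels of degree at least β. One
  -- stage fixes such labels in role `ℓ`; a second one, inside the tuple found, completes them in
  -- role `ℓ′`.
  two-roles : ∀ m {β} → 0ℚ < β → Σ ℕ (TwoRoles m β)
  two-roles m {β} 0β = proj₁ s₁ , go
    where
    s₂ : Σ ℕ (RoleStage m β)
    s₂ = role-stage m 0β
    s₁ : Σ ℕ (RoleStage (proj₁ s₂) β)
    s₁ = role-stage (proj₁ s₂) 0β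
    go : TwoRoles m β (proj₁ s₁)
    go ℓ ℓ′ {Y} ν D hyp k = proj₂ s₁ ℓ ν B large λ (f , mf , la , hla) →
        proj₂ s₂ ℓ′ (ν ∘ map₂ f) (λ i j k y′ → D (f i) (f j) (f k) (la (pr ℓ i j k)) y′)
          (λ i j k ij jk → subst (λ p → β ≤ E (ν p) (λ y′ → ⟦ D (f i) (f j) (f k) (la (pr ℓ i j k)) y′ ⟧)) (pr-map f ℓ′ i j k) (≥ᵇ-true (hla i j k ij jk)))
          λ (g , mg , lb , hlb) → k ((λ i → f (g i)) , (λ h → mf (mg h)) , la ∘ map₂ g , lb ,
            λ i j k ij jk → subst (λ p → D (f (g i)) (f (g j)) (f (g k)) (la p) (lb (pr ℓ′ i j k)) ≡ true) (pr-map g ℓ i j k) (hlb i j k ij jk))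
      where
      d : Fin (proj₁ s₁) → Fin (proj₁ s₁) → Fin (proj₁ s₁) → Y → ℚ
      d i j k y = E (ν (pr ℓ′ i j k)) (λ y′ → ⟦ D i j k y y′ ⟧)
      B : Sets (proj₁ s₁) Y
      B i j k y = ≥ᵇ β (d i j k y)
      large : ∀ i j k → i F.< j → j F.< k → β ≤ E (ν (pr ℓ i j k)) (λ y → ⟦ B i j k y ⟧)
      large i j k ij jk = ≤-by (hyp i j k ij jk ⊕ subst (E (ν (pr ℓ i j k)) (d i j k) ≤_) (E-+c (ν (pr ℓ i j k)) _ β)
          (E-mono (ν (pr ℓ i j k)) (λ y → ≤≥ᵇ (d i j k y) (ℚₚ.<⇒≤ 0β) (E-≤c (ν (pr ℓ′ i j k)) (λ y′ → ⟦⟧≤1 (D i j k y y′))))))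
        (solve 3 (λ b e s → s :- b := (e :+ (s :+ b)) :- ((b :+ b) :+ e)) refl β (E (ν (pr ℓ i j k)) (d i j k)) (E (ν (pr ℓ i j k)) (λ y → ⟦ B i j k y ⟧)))

oa ob : Label → Label
oa L = T
oa T = L
oa R = L
ob L = R
ob T = R
ob R = T

Reduced : ℕ → Set → Set
Reduced N Y = Fin N → Fin N → Fin N → Y → Y → Y → Bool

view : ∀ {Y : Set} → Label → (Y → Y → Y → Bool) → Y → Y → Y → Bool
view L G y y₁ y₂ = G y y₁ y₂
view T G y y₁ y₂ = G y₁ y y₂
view R G y y₁ y₂ = G y₁ y₂ y

assemble : ∀ {A : Set} → Label → A → A → A → Label → A
assemble L c a b = λ { L → c ; T → a ; R → b }
assemble T c a b = λ { L → a ; T → c ; R → b }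
assemble R c a b = λ { L → a ; T → b ; R → c }

assemble-self : ∀ {A : Set} ℓ (c a b : A) → assemble ℓ c a b ℓ ≡ c
assemble-self L c a b = refl
assemble-self T c a b = refl
assemble-self R c a b = refl

deg : ∀ {Y : Set} {N} → (Fin N × Fin N → Mean Y) → Reduced N Y → Label → Fin N → Fin N → Fin N → Y → ℚ
deg ν G ℓ i j k y = E (ν (pr (oa ℓ) i j k)) (λ y₁ → E (ν (pr (ob ℓ) i j k)) (λ y₂ → ⟦ view ℓ (G i j k) y y₁ y₂ ⟧))

Realized : ∀ {Y : Set} {m N} → Reduced N Y → (Fin m → Fin N) → (Label → Fin m × Fin m → Y) → Set
Realized G f g = ∀ i j k → i F.< j → j F.< k → G (f i) (f j) (f k) (g L (i , j)) (g T (i , k)) (g R (j , k)) ≡ true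

-- Labels fixed in one role are completed by labels in the other two. It is later applied twice to
-- the same `c`, read in two different roles.
Finish : ℕ → ℚ → ℕ → Set₁
Finish m β N = ∀ (ℓ : Label) {Y : Set} (ν : Fin N × Fin N → Mean Y) (G : Reduced N Y) (c : Fin N × Fin N → Y) →
  (∀ i j k → i F.< j → j F.< k → β + β ≤ deg ν G ℓ i j k (c (pr ℓ i j k))) →
  ¬ ¬ (Σ (Fin m → Fin N) λ f → Mono f × Σ (Label → Fin m × Fin m → Y) λ g → (∀ p → g ℓ p ≡ c (map₂ f p)) × Realized G f g)

realized : ∀ {Y : Set} {m N} (G : Reduced N Y) ℓ (c : Fin N × Fin N → Y) (f : Fin m → Fin N) (la lb : Fin m × Fin m → Y) →
  (∀ i j k → i F.< j → j F.< k → view ℓ (G (f i) (f j) (f k)) (c (pr ℓ (f i) (f j) (f k))) (la (pr (oa ℓ) i j k)) (lb (pr (ob ℓ) i j k)) ≡ true) →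
  Realized G f (λ ℓ′ p → assemble ℓ (c (map₂ f p)) (la p) (lb p) ℓ′)
realized G L c f la lb h = h
realized G T c f la lb h = h
realized G R c f la lb h = h

opaque
  finish : ∀ m {β} → 0ℚ < β → Σ ℕ (Finish m β)
  finish m {β} 0β = let (N , tr) = two-roles m 0β in N , go N tr
    where
    go : ∀ N → TwoRoles m β N → Finish m β N
    go N tr ℓ ν G c hyp k = tr (oa ℓ) (ob ℓ) ν (λ i j k y₁ y₂ → view ℓ (G i j k) (c (pr ℓ i j k)) y₁ y₂) hyp
      λ (f , mf , la , lb , h) → k (f , mf , (λ ℓ′ p → assemble ℓ (c (map₂ f p)) (la p) (lb p) ℓ′) ,
        (λ p → assemble-self ℓ (c (map₂ f p)) (la p) (lb p)) , realized G ℓ c f la lb h)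

Rounding : ℚ → ℕ → ℚ → ℕ → Set
Rounding γ m top N = ∀ (val : Fin N → Fin N → Fin N → ℚ) v → top ≤ v → (∀ i j k → i F.< j → j F.< k → v ≤ val i j k) → (∀ i j k → val i j k ≤ 1ℚ) →
  ¬ ¬ (Σ (Fin m → Fin N) λ f → Mono f × Σ ℚ λ v → ∀ i j k → i F.< j → j F.< k → v ≤ val (f i) (f j) (f k) × val (f i) (f j) (f k) ≤ v + γ)

opaque
  -- Ramsey's theorem for the threshold v + γ: if all triples reach it, `v` is raised by γ; if none
  -- does, the values lie in an interval of length γ. Values never exceed 1, so `t` bounds the
  -- number of raises.
  rounding : ∀ m {γ} → 0ℚ < γ → ∀ t → Σ ℕ (Rounding γ m (1ℚ - ι t * γ))
  rounding m {γ} 0γ zero = m , λ val v tv lo hi k → k (id , id , v , λ i j l ij jl → lo i j l ij jl ,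
    ≤-by (hi i j l ⊕ tv ⊕ ℚₚ.<⇒≤ 0γ) (solve 3 (λ x v g → v :+ g :- x := (con 1ℚ :+ (v :+ g)) :- (x :+ ((con 1ℚ :- con 0ℚ :* g) :+ con 0ℚ))) refl (val i j l) v γ))
  rounding m {γ} 0γ (suc t) =
    let (N₁ , rec) = rounding m 0γ t
        (N , ram) = ramsey 3 (N₁ ℕ.+ m)
    in N , λ val v tv lo hi k → ram (λ { (i ∷ j ∷ l ∷ []) → v + γ ≤ val i j l }) λ
       { (f , mf , inj₁ all) → rec (λ i j l → val (f (i F.↑ˡ m)) (f (j F.↑ˡ m)) (f (l F.↑ˡ m))) (v + γ)
           (≤-by tv (solve 3 (λ v t g → v :+ g :- (con 1ℚ :- t :* g) := v :- (con 1ℚ :- (t :+ con 1ℚ) :* g)) refl v (ι t) γ))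
           (λ i j l ij jl → all ((i F.↑ˡ m) ∷ (j F.↑ˡ m) ∷ (l F.↑ˡ m) ∷ []) ((↑ˡ-mono m ij , ↑ˡ-mono m (Fₚ.<-trans ij jl) , tt) , (↑ˡ-mono m jl , tt) , tt , tt))
           (λ i j l → hi _ _ _)
           λ (g , mg , w , hw) → k ((λ i → f (g i F.↑ˡ m)) , (λ h → mf (↑ˡ-mono m (mg h))) , w , hw)
       ; (f , mf , inj₂ none) → k ((λ i → f (N₁ F.↑ʳ i)) , (λ h → mf (↑ʳ-mono N₁ h)) , v , λ i j l ij jl →
           lo _ _ _ (mf (↑ʳ-mono N₁ ij)) (mf (↑ʳ-mono N₁ jl)) ,
           ≰→≥ (none ((N₁ F.↑ʳ i) ∷ (N₁ F.↑ʳ j) ∷ (N₁ F.↑ʳ l) ∷ []) ((↑ʳ-mono N₁ ij , ↑ʳ-mono N₁ (Fₚ.<-trans ij jl) , tt) , (↑ʳ-mono N₁ jl , tt) , tt , tt))) }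

-- With s = a + b + c, twice the difference of the sides is s ((a - b)² + (b - c)² + (c - a)²) + 6
-- (a (b - c)² + b (c - a)² + c (a - b)²).
amgm : ∀ {a b c} → 0ℚ ≤ a → 0ℚ ≤ b → 0ℚ ≤ c → ι 27 * (a * (b * c)) ≤ (a + b + c) * ((a + b + c) * (a + b + c))
amgm {a} {b} {c} 0a 0b 0c = *-cancel (0<ι 1) (≤-by
  (((0a ⊕ 0b ⊕ 0c) ⊛ (0≤² (a - b) ⊕ 0≤² (b - c) ⊕ 0≤² (c - a))) ⊕ (0≤ι 6 ⊛ ((0a ⊛ 0≤² (b - c)) ⊕ (0b ⊛ 0≤² (c - a)) ⊕ (0c ⊛ 0≤² (a - b)))))
  (solve 3 (λ a b c → con (ι 2) :* ((a :+ b :+ c) :* ((a :+ b :+ c) :* (a :+ b :+ c))) :- con (ι 2) :* (con (ι 27) :* (a :* (b :* c))) :=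
    ((a :+ (b :+ c)) :* ((a :- b) :* (a :- b) :+ ((b :- c) :* (b :- c) :+ (c :- a) :* (c :- a)))
     :+ con (ι 6) :* (a :* ((b :- c) :* (b :- c)) :+ (b :* ((c :- a) :* (c :- a)) :+ c :* ((a :- b) :* (a :- b))))) :- (con 0ℚ :+ con 0ℚ)) refl a b c))

-- Otherwise AM-GM and η ≤ 1 give 27 (q + η) ≤ (1 + η)³ ≤ 1 + 7η. Since 27 q = 1, this means 20 η ≤
-- 0.
large-sum : ∀ {a b c q η} → 0ℚ ≤ a → 0ℚ ≤ b → 0ℚ ≤ c → 0ℚ < η → η ≤ 1ℚ → ι 27 * q ≡ 1ℚ → q + η ≤ a * (b * c) → 1ℚ + η ≤ a + b + c
large-sum {a} {b} {c} {q} {η} 0a 0b 0c 0η η1 hq h with (1ℚ + η) ℚₚ.≤? (a + b + c)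
... | yes le = le
... | no nle = ⊥-elim (<≤⊥ 0η (*-cancel (0<ι 19) (≤-by
        ((0≤ι 27 ⊗ h) ⊕ amgm 0a 0b 0c ⊕ *-mono 0s (0≤1+ ⊛ 0≤1+) s≤ (*-mono 0s 0≤1+ s≤ s≤) ⊕ ((ℚₚ.<⇒≤ 0η ⊛ 0≤- η1) ⊕ (ℚₚ.<⇒≤ 0η ⊛ ℚₚ.<⇒≤ 0η ⊛ 0≤- η1) ⊕ (0≤ι 3 ⊛ ℚₚ.<⇒≤ 0η ⊛ 0≤- η1)))
        (trans (solve 1 (λ η → con (ι 20) :* con 0ℚ :- con (ι 20) :* η := ((con 1ℚ :+ η) :* ((con 1ℚ :+ η) :* (con 1ℚ :+ η)) :+ (η :* (con 1ℚ :- η) :+ (η :* (η :* (con 1ℚ :- η)) :+ con (ι 3) :* (η :* (con 1ℚ :- η))))) :- (con 1ℚ :+ con (ι 27) :* η)) refl η)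
          (trans (cong (λ z → (U * (U * U) + (η * (1ℚ - η) + (η * (η * (1ℚ - η)) + ι 3 * (η * (1ℚ - η))))) - (z + ι 27 * η)) (sym hq))
          (solve 6 (λ q η x s u w → (u :+ w) :- (con (ι 27) :* q :+ con (ι 27) :* η) := (con (ι 27) :* x :+ (s :+ (u :+ w))) :- (con (ι 27) :* (q :+ η) :+ (con (ι 27) :* x :+ (s :+ con 0ℚ)))) refl
             q η (a * (b * c)) (s * (s * s)) (U * (U * U)) (η * (1ℚ - η) + (η * (η * (1ℚ - η)) + ι 3 * (η * (1ℚ - η)))))))))) 
  where
  U = 1ℚ + η
  s = a + b + c
  0s : 0ℚ ≤ s
  0s = subst (0ℚ ≤_) (sym (ℚₚ.+-assoc a b c)) (0a ⊕ 0b ⊕ 0c)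
  0≤1+ : 0ℚ ≤ U
  0≤1+ = 0≤1 ⊕ ℚₚ.<⇒≤ 0η
  s≤ : s ≤ U
  s≤ = ≰→≥ nle

data Pattern : Label → Label → Set where
  RL : Pattern R L
  TL : Pattern T L
  TR : Pattern T R

pull : ∀ {Y : Set} {m N} → (Fin m → Fin N) → Reduced N Y → Reduced m Y
pull f G i j k = G (f i) (f j) (f k)

deg-map : ∀ {Y : Set} {m N} (f : Fin m → Fin N) (ν : Fin N × Fin N → Mean Y) (G : Reduced N Y) ℓ i j k y →
  deg ν G ℓ (f i) (f j) (f k) y ≡ deg (ν ∘ map₂ f) (pull f G) ℓ i j k y
deg-map f ν G L i j k y = refl
deg-map f ν G T i j k y = refl
deg-map f ν G R i j k y = refl

-- The target in the reduced hypergraph: one labelling for each part of the split of H₀, on the same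
-- vertices. `agree` is what the pairs common to both parts require.
record Found {Y : Set} (n : ℕ) {N : ℕ} (G : Reduced N Y) : Set where
  field
    {ℓ₁ ℓ₂} : Label
    pattern′ : Pattern ℓ₁ ℓ₂
    embed : Fin n → Fin N
    embed-mono : Mono embed
    g₁ g₂ : Label → Fin n × Fin n → Y
    agree : ∀ p → g₁ ℓ₁ p ≡ g₂ ℓ₂ p
    real₁ : Realized G embed g₁
    real₂ : Realized G embed g₂

Found-pull : ∀ {Y : Set} {n m N} (f : Fin m → Fin N) → Mono f → (G : Reduced N Y) → Found n (pull f G) → Found n G
Found-pull f mf G F = record { pattern′ = pattern′ ; embed = f ∘ embed ; embed-mono = λ h → mf (embed-mono h) ; g₁ = g₁ ; g₂ = g₂ ; agree = agree ; real₁ = real₁ ; real₂ = real₂ }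
  where open Found F

TwoFinishes : ℕ → ℚ → ℕ → Set₁
TwoFinishes n β N = ∀ {ℓ₁ ℓ₂} → Pattern ℓ₁ ℓ₂ → ∀ {Y : Set} (ν : Fin N × Fin N → Mean Y) (G : Reduced N Y) (c : Fin N × Fin N → Y) →
  (∀ i j k → i F.< j → j F.< k → β + β ≤ deg ν G ℓ₁ i j k (c (pr ℓ₁ i j k))) →
  (∀ i j k → i F.< j → j F.< k → β + β ≤ deg ν G ℓ₂ i j k (c (pr ℓ₂ i j k))) → ¬ ¬ Found n G

opaque
  two-finishes : ∀ n {β} → 0ℚ < β → Σ ℕ (TwoFinishes n β)
  two-finishes n {β} 0β = proj₁ F₁ , go
    where
    F₂ : Σ ℕ (Finish n β)
    F₂ = finish n 0β
    F₁ : Σ ℕ (Finish (proj₁ F₂) β)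
    F₁ = finish (proj₁ F₂) 0β
    go : TwoFinishes n β (proj₁ F₁)
    go {ℓ₁} {ℓ₂} P ν G c h₁ h₂ k = proj₂ F₁ ℓ₁ ν G c h₁ λ (f , mf , g₁ , c₁ , r₁) →
      proj₂ F₂ ℓ₂ (ν ∘ map₂ f) (pull f G) (c ∘ map₂ f)
        (λ i j l ij jl → subst (β + β ≤_) (trans (cong (λ p → deg ν G ℓ₂ (f i) (f j) (f l) (c p)) (pr-map f ℓ₂ i j l)) (deg-map f ν G ℓ₂ i j l (c (map₂ f (pr ℓ₂ i j l)))))
          (h₂ (f i) (f j) (f l) (mf ij) (mf jl)))
        λ (g , mg , g₂ , c₂ , r₂) → k (record { pattern′ = P ; embed = f ∘ g ; embed-mono = λ h → mf (mg h)
          ; g₁ = λ ℓ p → g₁ ℓ (map₂ g p) ; g₂ = g₂ ; agree = λ p → trans (c₁ (map₂ g p)) (sym (c₂ p))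
          ; real₁ = λ i j l ij jl → r₁ (g i) (g j) (g l) (mg ij) (mg jl) ; real₂ = r₂ })

heavy : ∀ {Y : Set} {N} → ℚ → (Fin N × Fin N → Mean Y) → Reduced N Y → Label → Sets N Y
heavy η ν G ℓ i j k y = ≥ᵇ η (deg ν G ℓ i j k y)

-- The trivial conjuncts give all three patterns the shape of the hypothesis of Stage.
doubly : ∀ {Y : Set} {N} → ℚ → (Fin N × Fin N → Mean Y) → Reduced N Y → ∀ {ℓ₁ ℓ₂} → Pattern ℓ₁ ℓ₂ → Fin N → Fin N → Fin N → Fin N → Fin N → Y → Bool
doubly η ν G RL k₁ i k₂ j k₃ y = heavy η ν G R k₁ i j y ∧ (true ∧ heavy η ν G L i j k₃ y)
doubly η ν G TL k₁ i k₂ j k₃ y = true ∧ (heavy η ν G T i k₂ j y ∧ heavy η ν G L i j k₃ y)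
doubly η ν G TR k₁ i k₂ j k₃ y = heavy η ν G R k₁ i j y ∧ (heavy η ν G T i k₂ j y ∧ true)

opaque
  from-doubly : ∀ n {β} → 0ℚ < β → Σ ℕ λ N → ∀ {ℓ₁ ℓ₂} (P : Pattern ℓ₁ ℓ₂) {Y : Set} (ν : Fin N × Fin N → Mean Y) (G : Reduced N Y) →
    (∀ k₁ i k₂ j k₃ → k₁ F.< i → i F.< k₂ → k₂ F.< j → j F.< k₃ → β ≤ E (ν (i , j)) (λ y → ⟦ doubly (β + β) ν G P k₁ i k₂ j k₃ y ⟧)) → ¬ ¬ Found n G
  from-doubly n {β} 0β = proj₁ st , go
    where
    tf : Σ ℕ (TwoFinishes n β)
    tf = two-finishes n 0β
    st : Σ ℕ (Stage (proj₁ tf) β)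
    st = stage (proj₁ tf) 0β
    N : ℕ
    N = proj₁ st
    next : ∀ {ℓ₁ ℓ₂} (P : Pattern ℓ₁ ℓ₂) {Y : Set} (ν : Fin N × Fin N → Mean Y) (G : Reduced N Y) (f : Fin (proj₁ tf) → Fin N) → Mono f →
      (c : Fin (proj₁ tf) × Fin (proj₁ tf) → Y) →
      (∀ i j k → i F.< j → j F.< k → heavy (β + β) ν G ℓ₁ (f i) (f j) (f k) (c (pr ℓ₁ i j k)) ≡ true) →
      (∀ i j k → i F.< j → j F.< k → heavy (β + β) ν G ℓ₂ (f i) (f j) (f k) (c (pr ℓ₂ i j k)) ≡ true) → ¬ ¬ Found n G
    next {ℓ₁} {ℓ₂} P ν G f mf c h₁ h₂ k = proj₂ tf P (ν ∘ map₂ f) (pull f G) c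
      (λ i j l ij jl → subst (β + β ≤_) (deg-map f ν G ℓ₁ i j l (c (pr ℓ₁ i j l))) (≥ᵇ-true (h₁ i j l ij jl)))
      (λ i j l ij jl → subst (β + β ≤_) (deg-map f ν G ℓ₂ i j l (c (pr ℓ₂ i j l))) (≥ᵇ-true (h₂ i j l ij jl)))
      λ F → k (Found-pull f mf G F)
    go : ∀ {ℓ₁ ℓ₂} (P : Pattern ℓ₁ ℓ₂) {Y : Set} (ν : Fin N × Fin N → Mean Y) (G : Reduced N Y) →
      (∀ k₁ i k₂ j k₃ → k₁ F.< i → i F.< k₂ → k₂ F.< j → j F.< k₃ → β ≤ E (ν (i , j)) (λ y → ⟦ doubly (β + β) ν G P k₁ i k₂ j k₃ y ⟧)) → ¬ ¬ Found n G
    go RL ν G hyp k = proj₂ st (λ i j → ν (i , j)) (heavy (β + β) ν G R) (λ _ _ _ _ → true) (heavy (β + β) ν G L) hyp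
      λ (f , mf , lab , h) → next RL ν G f mf (λ (i , j) → lab i j) (λ i j l ij jl → proj₁ (h i j l ij jl)) (λ i j l ij jl → proj₂ (proj₂ (h i j l ij jl))) k
    go TL ν G hyp k = proj₂ st (λ i j → ν (i , j)) (λ _ _ _ _ → true) (heavy (β + β) ν G T) (heavy (β + β) ν G L) hyp
      λ (f , mf , lab , h) → next TL ν G f mf (λ (i , j) → lab i j) (λ i j l ij jl → proj₁ (proj₂ (h i j l ij jl))) (λ i j l ij jl → proj₂ (proj₂ (h i j l ij jl))) k
    go TR ν G hyp k = proj₂ st (λ i j → ν (i , j)) (heavy (β + β) ν G R) (heavy (β + β) ν G T) (λ _ _ _ _ → true) hyp
      λ (f , mf , lab , h) → next TR ν G f mf (λ (i , j) → lab i j) (λ i j l ij jl → proj₁ (proj₂ (h i j l ij jl))) (λ i j l ij jl → proj₁ (h i j l ij jl)) k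

-- Indicators satisfy a + b + c ≤ 1 + ac + bc + ab pointwise. If two of the intersections are small,
-- the third takes what is left of the surplus.
three-events : ∀ {Y : Set} (μ : Mean Y) (A B C : Y → Bool) {β} → 1ℚ + (β + β + β) ≤ E μ (λ y → ⟦ A y ⟧) + E μ (λ y → ⟦ B y ⟧) + E μ (λ y → ⟦ C y ⟧) →
  ¬ (β ≤ E μ (λ y → ⟦ A y ∧ (true ∧ C y) ⟧)) → ¬ (β ≤ E μ (λ y → ⟦ true ∧ (B y ∧ C y) ⟧)) → β ≤ E μ (λ y → ⟦ A y ∧ (B y ∧ true) ⟧)
three-events μ A B C {β} h n₁ n₂ = ≤-by (h ⊕ total ⊕ ≰→≥ n₁ ⊕ ≰→≥ n₂)
    (solve 5 (λ s x y z b → z :- b := (s :+ (con 1ℚ :+ (x :+ (y :+ z)) :+ (b :+ b))) :- ((con 1ℚ :+ (b :+ b :+ b)) :+ (s :+ (x :+ y)))) refl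
      (E μ (λ y → ⟦ A y ⟧) + E μ (λ y → ⟦ B y ⟧) + E μ (λ y → ⟦ C y ⟧)) (E μ (λ y → ⟦ A y ∧ (true ∧ C y) ⟧)) (E μ (λ y → ⟦ true ∧ (B y ∧ C y) ⟧)) (E μ (λ y → ⟦ A y ∧ (B y ∧ true) ⟧)) β)
  where
  bit : ∀ a b c → ⟦ a ⟧ + ⟦ b ⟧ + ⟦ c ⟧ ≤ 1ℚ + (⟦ a ∧ (true ∧ c) ⟧ + (⟦ true ∧ (b ∧ c) ⟧ + ⟦ a ∧ (b ∧ true) ⟧))
  bit true true true = ι-mono {3} {4} (s≤s (s≤s (s≤s z≤n)))
  bit true true false = ℚₚ.≤-refl
  bit true false true = ℚₚ.≤-refl
  bit true false false = ℚₚ.≤-refl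
  bit false true true = ℚₚ.≤-refl
  bit false true false = ℚₚ.≤-refl
  bit false false true = ℚₚ.≤-refl
  bit false false false = 0≤1
  total : E μ (λ y → ⟦ A y ⟧) + E μ (λ y → ⟦ B y ⟧) + E μ (λ y → ⟦ C y ⟧) ≤ 1ℚ + (E μ (λ y → ⟦ A y ∧ (true ∧ C y) ⟧) + (E μ (λ y → ⟦ true ∧ (B y ∧ C y) ⟧) + E μ (λ y → ⟦ A y ∧ (B y ∧ true) ⟧)))
  total = subst₂ _≤_ (trans (E-+ μ _ _) (cong (_+ E μ (λ y → ⟦ C y ⟧)) (E-+ μ _ _)))
    (trans (E-+ μ _ _) (cong₂ _+_ (E-const μ 1ℚ) (trans (E-+ μ _ _) (cong (λ z → E μ (λ y → ⟦ A y ∧ (true ∧ C y) ⟧) + z) (E-+ μ _ _)))))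
    (E-mono μ (λ y → bit (A y) (B y) (C y)))

weight : ∀ {Y : Set} {N} → ℚ → (Fin N × Fin N → Mean Y) → Reduced N Y → Label → Fin N → Fin N → Fin N → ℚ
weight η ν G ℓ i j k = E (ν (pr ℓ i j k)) (λ y → ⟦ heavy η ν G ℓ i j k y ⟧)

E₃ : ∀ {Y : Set} {N} → (Fin N × Fin N → Mean Y) → Reduced N Y → Fin N → Fin N → Fin N → ℚ
E₃ ν G i j k = E (ν (i , j)) (λ x → E (ν (i , k)) (λ y → E (ν (j , k)) (λ z → ⟦ G i j k x y z ⟧)))

-- G ≤ ltr + (1 - l)G + (1 - t)G + (1 - r)G, and labels that are not heavy have degree at most η.
E₃≤ : ∀ {Y : Set} {N} {η} → 0ℚ ≤ η → (ν : Fin N × Fin N → Mean Y) (G : Reduced N Y) → ∀ i j k →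
  E₃ ν G i j k ≤ weight η ν G L i j k * (weight η ν G T i j k * weight η ν G R i j k) + (η + η + η)
E₃≤ {Y} {N} {η} 0η ν G i j k = ≤-by (bound ⊕ dl ⊕ dt ⊕ dr)
    (solve 6 (λ w η e l t r → w :+ (η :+ η :+ η) :- e := (w :+ (l :+ t :+ r) :+ (η :+ (η :+ η))) :- (e :+ (l :+ (t :+ r)))) refl Ω η (E₃ ν G i j k) Dl Dt Dr)
  where
  α = ν (i , j)
  β = ν (i , k)
  γ = ν (j , k)
  l t r : Y → ℚ
  l x = ⟦ heavy η ν G L i j k x ⟧
  t y = ⟦ heavy η ν G T i j k y ⟧
  r z = ⟦ heavy η ν G R i j k z ⟧
  g : Y → Y → Y → ℚ
  g x y z = ⟦ G i j k x y z ⟧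
  Ω = E α l * (E β t * E γ r)
  Dl = E α (λ x → (1ℚ - l x) * deg ν G L i j k x)
  Dt = E β (λ y → (1ℚ - t y) * deg ν G T i j k y)
  Dr = E γ (λ z → (1ℚ - r z) * deg ν G R i j k z)
  dl : Dl ≤ η
  dl = E-≤c α (λ x → ≥ᵇ-rest (deg ν G L i j k x) 0η)
  dt : Dt ≤ η
  dt = E-≤c β (λ y → ≥ᵇ-rest (deg ν G T i j k y) 0η)
  dr : Dr ≤ η
  dr = E-≤c γ (λ z → ≥ᵇ-rest (deg ν G R i j k z) 0η)
  bit : ∀ a b c d → ⟦ a ⟧ ≤ ⟦ b ⟧ * (⟦ c ⟧ * ⟦ d ⟧) + ((1ℚ - ⟦ b ⟧) * ⟦ a ⟧ + (1ℚ - ⟦ c ⟧) * ⟦ a ⟧ + (1ℚ - ⟦ d ⟧) * ⟦ a ⟧)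
  bit false true true true = 0≤1
  bit false true true false = ℚₚ.≤-refl
  bit false true false d = ≤-by (ℚₚ.≤-refl {0ℚ}) (solve 1 (λ d → (con 1ℚ :* (con 0ℚ :* d) :+ ((con 1ℚ :- con 1ℚ) :* con 0ℚ :+ (con 1ℚ :- con 0ℚ) :* con 0ℚ :+ (con 1ℚ :- d) :* con 0ℚ)) :- con 0ℚ := con 0ℚ :- con 0ℚ) refl ⟦ d ⟧)
  bit false false c d = ≤-by (ℚₚ.≤-refl {0ℚ}) (solve 2 (λ c d → (con 0ℚ :* (c :* d) :+ ((con 1ℚ :- con 0ℚ) :* con 0ℚ :+ (con 1ℚ :- c) :* con 0ℚ :+ (con 1ℚ :- d) :* con 0ℚ)) :- con 0ℚ := con 0ℚ :- con 0ℚ) refl ⟦ c ⟧ ⟦ d ⟧)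
  bit true true true true = ℚₚ.≤-refl
  bit true true true false = ℚₚ.≤-refl
  bit true true false true = ℚₚ.≤-refl
  bit true true false false = ι-mono {1} {2} (s≤s z≤n)
  bit true false true true = ℚₚ.≤-refl
  bit true false true false = ι-mono {1} {2} (s≤s z≤n)
  bit true false false true = ι-mono {1} {2} (s≤s z≤n)
  bit true false false false = ι-mono {1} {3} (s≤s z≤n)
  bound : E₃ ν G i j k ≤ Ω + (Dl + Dt + Dr)
  bound = subst (E₃ ν G i j k ≤_) split (E-mono α (λ x → E-mono β (λ y → E-mono γ (λ z → bit (G i j k x y z) (heavy η ν G L i j k x) (heavy η ν G T i j k y) (heavy η ν G R i j k z)))))
    where
    E³ : (Y → Y → Y → ℚ) → ℚ
    E³ f = E α (λ x → E β (λ y → E γ (f x y)))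
    E³-+ : ∀ f f′ → E³ (λ x y z → f x y z + f′ x y z) ≡ E³ f + E³ f′
    E³-+ f f′ = trans (E-cong α (λ x → trans (E-cong β (λ y → E-+ γ (f x y) (f′ x y))) (E-+ β _ _))) (E-+ α _ _)
    main : E³ (λ x y z → l x * (t y * r z)) ≡ Ω
    main = trans (E-cong α (λ x → trans (E-cong β (λ y → trans (E-* γ (l x) (λ z → t y * r z)) (cong (l x *_) (E-* γ (t y) r))))
      (trans (E-* β (l x) (λ y → t y * E γ r)) (cong (l x *_) (E-*ʳ β (E γ r) t))))) (E-*ʳ α (E β t * E γ r) l)
    left : E³ (λ x y z → (1ℚ - l x) * g x y z) ≡ Dl
    left = E-cong α (λ x → trans (E-cong β (λ y → E-* γ (1ℚ - l x) (g x y))) (E-* β (1ℚ - l x) _))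
    top : E³ (λ x y z → (1ℚ - t y) * g x y z) ≡ Dt
    top = trans (E-cong α (λ x → E-cong β (λ y → E-* γ (1ℚ - t y) (g x y)))) (trans (E-swap α β _) (E-cong β (λ y → E-* α (1ℚ - t y) _)))
    right : E³ (λ x y z → (1ℚ - r z) * g x y z) ≡ Dr
    right = trans (E-cong α (λ x → E-swap β γ _)) (trans (E-swap α γ _) (E-cong γ (λ z →
      trans (E-cong α (λ x → E-* β (1ℚ - r z) (λ y → g x y z))) (E-* α (1ℚ - r z) _))))
    split = trans (E³-+ (λ x y z → l x * (t y * r z)) _) (cong₂ _+_ main
      (trans (E³-+ (λ x y z → (1ℚ - l x) * g x y z + (1ℚ - t y) * g x y z) _) (cong₂ _+_ (trans (E³-+ _ _) (cong₂ _+_ left top)) right)))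

doubly-map : ∀ {Y : Set} {m N} η (f : Fin m → Fin N) (ν : Fin N × Fin N → Mean Y) (G : Reduced N Y) {ℓ₁ ℓ₂} (P : Pattern ℓ₁ ℓ₂) k₁ i k₂ j k₃ y →
  doubly η ν G P (f k₁) (f i) (f k₂) (f j) (f k₃) y ≡ doubly η (ν ∘ map₂ f) (pull f G) P k₁ i k₂ j k₃ y
doubly-map η f ν G RL k₁ i k₂ j k₃ y = refl
doubly-map η f ν G TL k₁ i k₂ j k₃ y = refl
doubly-map η f ν G TR k₁ i k₂ j k₃ y = refl

FromDoubly : ℕ → ℚ → ℕ → Set₁
FromDoubly n β N = ∀ {ℓ₁ ℓ₂} (P : Pattern ℓ₁ ℓ₂) {Y : Set} (ν : Fin N × Fin N → Mean Y) (G : Reduced N Y) →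
  (∀ k₁ i k₂ j k₃ → k₁ F.< i → i F.< k₂ → k₂ F.< j → j F.< k₃ → β ≤ E (ν (i , j)) (λ y → ⟦ doubly (β + β) ν G P k₁ i k₂ j k₃ y ⟧)) → ¬ ¬ Found n G

ReducedFor : ℕ → ℚ → ℕ → Set₁
ReducedFor n d N = ∀ {Y : Set} (ν : Fin N × Fin N → Mean Y) (G : Reduced N Y) →
  (∀ i j k → i F.< j → j F.< k → d ≤ E₃ ν G i j k) → ¬ ¬ Found n G

Increasing₅ : ∀ {N} → Fin N → Fin N → Fin N → Fin N → Fin N → Set
Increasing₅ k₁ i k₂ j k₃ = k₁ F.< i × i F.< k₂ × k₂ F.< j × j F.< k₃

inc₅ : ∀ {N} {k₁ i k₂ j k₃ : Fin N} → Increasing₅ k₁ i k₂ j k₃ → Inc (k₁ ∷ i ∷ k₂ ∷ j ∷ k₃ ∷ [])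
inc₅ {N} {k₁} {i} {k₂} {j} {k₃} (p , q , r , s) =
  (p , pq , Fₚ.<-trans pq r , Fₚ.<-trans pq rs , tt) , (q , Fₚ.<-trans q r , Fₚ.<-trans q rs , tt) , (r , rs , tt) , (s , tt) , tt , tt
  where
  pq : k₁ F.< k₂
  pq = Fₚ.<-trans p q
  rs : k₂ F.< k₃
  rs = Fₚ.<-trans r s

module Homogenize (n : ℕ) {g q : ℚ} (0g : 0ℚ < g) (6g : ι 6 * g ≤ 1ℚ) (hq : ι 27 * q ≡ 1ℚ) where
  η = g + g

  0η : 0ℚ ≤ η
  0η = ℚₚ.<⇒≤ 0g ⊕ ℚₚ.<⇒≤ 0g

  fd : Σ ℕ (FromDoubly n g)
  fd = from-doubly n 0g

  r₅ = ramseys 5 (proj₁ fd) 2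

  opaque
    cut : Σ ℕ λ t → 1ℚ ≤ ι t * g
    cut = archimedean⁻¹ 0g 1ℚ

  top = 1ℚ - ι (proj₁ cut) * g

  ℓR : Σ ℕ (Rounding g (proj₁ r₅) top)
  ℓR = rounding (proj₁ r₅) 0g (proj₁ cut)
  ℓT : Σ ℕ (Rounding g (proj₁ ℓR) top)
  ℓT = rounding (proj₁ ℓR) 0g (proj₁ cut)
  ℓL : Σ ℕ (Rounding g (proj₁ ℓT) top)
  ℓL = rounding (proj₁ ℓT) 0g (proj₁ cut)

  top≤0 : 1ℚ - ι (proj₁ cut) * g ≤ 0ℚ
  top≤0 = ≤-by (proj₂ cut) (solve 1 (λ x → con 0ℚ :- (con 1ℚ :- x) := x :- con 1ℚ) refl (ι (proj₁ cut) * g))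

  module _ {Y : Set} where

    0≤weight : ∀ {N} (ν : Fin N × Fin N → Mean Y) (G : Reduced N Y) ℓ i j k → 0ℚ ≤ weight η ν G ℓ i j k
    0≤weight ν G ℓ i j k = E-nonneg (ν (pr ℓ i j k)) (λ y → 0≤⟦⟧ (heavy η ν G ℓ i j k y))

    weight≤1 : ∀ {N} (ν : Fin N × Fin N → Mean Y) (G : Reduced N Y) ℓ i j k → weight η ν G ℓ i j k ≤ 1ℚ
    weight≤1 ν G ℓ i j k = E-≤c (ν (pr ℓ i j k)) (λ y → ⟦⟧≤1 (heavy η ν G ℓ i j k y))

    Rounded : ∀ {N} (ν : Fin N × Fin N → Mean Y) (G : Reduced N Y) (v : Label → ℚ) → Set
    Rounded {N} ν G v = ∀ ℓ i j k → i F.< j → j F.< k → v ℓ ≤ weight η ν G ℓ i j k × weight η ν G ℓ i j k ≤ v ℓ + g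

    -- Of the surplus 12g, the labels that are not heavy take 3η = 6g; the other 6g is the surplus
    -- handed to `large-sum`.
    dense-sum : ∀ {N} (ν : Fin N × Fin N → Mean Y) (G : Reduced N Y) i j k → q + ι 12 * g ≤ E₃ ν G i j k →
      1ℚ + ι 6 * g ≤ weight η ν G L i j k + weight η ν G T i j k + weight η ν G R i j k
    dense-sum ν G i j k h = large-sum {q = q} (0≤weight ν G L i j k) (0≤weight ν G T i j k) (0≤weight ν G R i j k) (0<* (0<ι 5) 0g) 6g hq
      (≤-by (h ⊕ E₃≤ 0η ν G i j k) (solve 4 (λ q g e w → w :- (q :+ con (ι 6) :* g) := (e :+ (w :+ ((g :+ g) :+ (g :+ g) :+ (g :+ g)))) :- ((q :+ con (ι 12) :* g) :+ e)) refl
        q g (E₃ ν G i j k) (weight η ν G L i j k * (weight η ν G T i j k * weight η ν G R i j k))))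

    -- The labels of (i, j) are heavy through three different triples, (k₁, i, j), (i, k₂, j) and
    -- (i, j, k₃), whereas `dense-sum` concerns a single one. Rounding makes the measure in each
    -- role independent of the triple up to g. This costs 2g of the 6g, and `three-events` takes 3g.
    at-five : ∀ {N} (ν : Fin N × Fin N → Mean Y) (G : Reduced N Y) v → Rounded ν G v → (∀ i j k → i F.< j → j F.< k → q + ι 12 * g ≤ E₃ ν G i j k) →
      ∀ {k₁ i k₂ j k₃} → Increasing₅ k₁ i k₂ j k₃ →
      ¬ (g ≤ E (ν (i , j)) (λ y → ⟦ doubly η ν G RL k₁ i k₂ j k₃ y ⟧)) → ¬ (g ≤ E (ν (i , j)) (λ y → ⟦ doubly η ν G TL k₁ i k₂ j k₃ y ⟧)) →
      g ≤ E (ν (i , j)) (λ y → ⟦ doubly η ν G TR k₁ i k₂ j k₃ y ⟧)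
    at-five ν G v rd hyp {k₁} {i} {k₂} {j} {k₃} (a , b , c , d) = three-events (ν (i , j)) (heavy η ν G R k₁ i j) (heavy η ν G T i k₂ j) (heavy η ν G L i j k₃)
      (≤-by (dense-sum ν G i k₂ j (hyp i k₂ j b c) ⊕ (proj₂ (rd L i k₂ j b c) ⊕ proj₂ (rd R i k₂ j b c)) ⊕ proj₁ (rd R k₁ i j a (Fₚ.<-trans b c)) ⊕ proj₁ (rd L i j k₃ (Fₚ.<-trans b c) d) ⊕ ℚₚ.<⇒≤ 0g)
        (solve 8 (λ g l t r vl vr r′ l′ → (r′ :+ t :+ l′) :- (con 1ℚ :+ (g :+ g :+ g)) :=
            ((l :+ t :+ r) :+ (((vl :+ g) :+ (vr :+ g)) :+ (r′ :+ (l′ :+ g)))) :- ((con 1ℚ :+ con (ι 6) :* g) :+ ((l :+ r) :+ (vr :+ (vl :+ con 0ℚ))))) refl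
            g (weight η ν G L i k₂ j) (weight η ν G T i k₂ j) (weight η ν G R i k₂ j) (v L) (v R) (weight η ν G R k₁ i j) (weight η ν G L i j k₃)))

    -- Ramsey's theorem on 5-tuples decides whether `RL` and `TL` hold everywhere or nowhere. If
    -- both hold nowhere, `at-five` yields `TR` everywhere.
    homogeneous : (ν : Fin (proj₁ r₅) × Fin (proj₁ r₅) → Mean Y) (G : Reduced (proj₁ r₅) Y) (v : Label → ℚ) → Rounded ν G v →
      (∀ i j k → i F.< j → j F.< k → q + ι 12 * g ≤ E₃ ν G i j k) → ¬ ¬ Found n G
    homogeneous ν G v rd hyp k = proj₂ r₅ (λ { F.zero → Q RL ; (F.suc _) → Q TL }) λ (f , mf , homs) → cases f mf (homs F.zero) (homs (F.suc F.zero))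
      where
      Q : ∀ {ℓ₁ ℓ₂} → Pattern ℓ₁ ℓ₂ → Vec (Fin (proj₁ r₅)) 5 → Set
      Q P (k₁ ∷ i ∷ k₂ ∷ j ∷ k₃ ∷ []) = g ≤ E (ν (i , j)) (λ y → ⟦ doubly η ν G P k₁ i k₂ j k₃ y ⟧)
      module _ (f : Fin (proj₁ fd) → Fin (proj₁ r₅)) (mf : Mono f) where
        use : ∀ {ℓ₁ ℓ₂} (P : Pattern ℓ₁ ℓ₂) → (∀ k₁ i k₂ j k₃ → Increasing₅ k₁ i k₂ j k₃ → g ≤ E (ν (f i , f j)) (λ y → ⟦ doubly η ν G P (f k₁) (f i) (f k₂) (f j) (f k₃) y ⟧)) → ⊥
        use P h = proj₂ fd P (ν ∘ map₂ f) (pull f G)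
          (λ k₁ i k₂ j k₃ a b c d → subst (g ≤_) (E-cong (ν (f i , f j)) (λ y → cong ⟦_⟧ (doubly-map η f ν G P k₁ i k₂ j k₃ y))) (h k₁ i k₂ j k₃ (a , b , c , d)))
          λ F → k (Found-pull f mf G F)
        cases : Homogeneous (λ w → Q RL (Vec.map f w)) → Homogeneous (λ w → Q TL (Vec.map f w)) → ⊥
        cases (inj₁ all) _ = use RL (λ k₁ i k₂ j k₃ h → all (k₁ ∷ i ∷ k₂ ∷ j ∷ k₃ ∷ []) (inc₅ h))
        cases (inj₂ _) (inj₁ all) = use TL (λ k₁ i k₂ j k₃ h → all (k₁ ∷ i ∷ k₂ ∷ j ∷ k₃ ∷ []) (inc₅ h))
        cases (inj₂ n₁) (inj₂ n₂) = use TR (λ k₁ i k₂ j k₃ h →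
          let (a , b , c , d) = h
          in at-five ν G v rd hyp (mf a , mf b , mf c , mf d) (n₁ (k₁ ∷ i ∷ k₂ ∷ j ∷ k₃ ∷ []) (inc₅ h)) (n₂ (k₁ ∷ i ∷ k₂ ∷ j ∷ k₃ ∷ []) (inc₅ h)))

    rounded : (ν : Fin (proj₁ ℓL) × Fin (proj₁ ℓL) → Mean Y) (G : Reduced (proj₁ ℓL) Y) →
      (∀ i j k → i F.< j → j F.< k → q + ι 12 * g ≤ E₃ ν G i j k) → ¬ ¬ Found n G
    rounded ν G hyp k =
      proj₂ ℓL (weight η ν G L) 0ℚ top≤0 (λ i j l _ _ → 0≤weight ν G L i j l) (weight≤1 ν G L) λ (f₁ , m₁ , v₁ , h₁) →
      proj₂ ℓT (λ i j l → weight η ν G T (f₁ i) (f₁ j) (f₁ l)) 0ℚ top≤0 (λ i j l _ _ → 0≤weight ν G T _ _ _) (λ i j l → weight≤1 ν G T _ _ _) λ (f₂ , m₂ , v₂ , h₂) →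
      proj₂ ℓR (λ i j l → weight η ν G R (f₁ (f₂ i)) (f₁ (f₂ j)) (f₁ (f₂ l))) 0ℚ top≤0 (λ i j l _ _ → 0≤weight ν G R _ _ _) (λ i j l → weight≤1 ν G R _ _ _) λ (f₃ , m₃ , v₃ , h₃) →
      homogeneous (ν ∘ map₂ (λ i → f₁ (f₂ (f₃ i)))) (pull (λ i → f₁ (f₂ (f₃ i))) G) (λ { L → v₁ ; T → v₂ ; R → v₃ })
        (λ { L i j l ij jl → h₁ (f₂ (f₃ i)) (f₂ (f₃ j)) (f₂ (f₃ l)) (m₂ (m₃ ij)) (m₂ (m₃ jl))
           ; T i j l ij jl → h₂ (f₃ i) (f₃ j) (f₃ l) (m₃ ij) (m₃ jl)
           ; R i j l ij jl → h₃ i j l ij jl })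
        (λ i j l ij jl → hyp _ _ _ (m₁ (m₂ (m₃ ij))) (m₁ (m₂ (m₃ jl))))
        λ F → k (Found-pull (λ i → f₁ (f₂ (f₃ i))) (λ h → m₁ (m₂ (m₃ h))) G F)

opaque
  reduced : ∀ n {g q} → 0ℚ < g → ι 6 * g ≤ 1ℚ → ι 27 * q ≡ 1ℚ → Σ ℕ (ReducedFor n (q + ι 12 * g))
  reduced n {g} {q} 0g 6g hq = proj₁ (Homogenize.ℓL n {g} {q} 0g 6g hq) , Homogenize.rounded n {g} {q} 0g 6g hq
-- From the reduced hypergraph to H₀

adj-swap₁₂ : ∀ {n} (H : 3Graph n) {x y z} → Adj H x y z → Adj H y x z
adj-swap₁₂ H (inj₁ h) = inj₂ (inj₂ (inj₁ h))
adj-swap₁₂ H (inj₂ (inj₁ h)) = inj₂ (inj₂ (inj₂ (inj₁ h)))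
adj-swap₁₂ H (inj₂ (inj₂ (inj₁ h))) = inj₁ h
adj-swap₁₂ H (inj₂ (inj₂ (inj₂ (inj₁ h)))) = inj₂ (inj₁ h)
adj-swap₁₂ H (inj₂ (inj₂ (inj₂ (inj₂ (inj₁ h))))) = inj₂ (inj₂ (inj₂ (inj₂ (inj₂ h))))
adj-swap₁₂ H (inj₂ (inj₂ (inj₂ (inj₂ (inj₂ h))))) = inj₂ (inj₂ (inj₂ (inj₂ (inj₁ h))))

adj-swap₂₃ : ∀ {n} (H : 3Graph n) {x y z} → Adj H x y z → Adj H x z y
adj-swap₂₃ H (inj₁ h) = inj₂ (inj₁ h)
adj-swap₂₃ H (inj₂ (inj₁ h)) = inj₁ h
adj-swap₂₃ H (inj₂ (inj₂ (inj₁ h))) = inj₂ (inj₂ (inj₂ (inj₂ (inj₁ h))))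
adj-swap₂₃ H (inj₂ (inj₂ (inj₂ (inj₁ h)))) = inj₂ (inj₂ (inj₂ (inj₂ (inj₂ h))))
adj-swap₂₃ H (inj₂ (inj₂ (inj₂ (inj₂ (inj₁ h))))) = inj₂ (inj₂ (inj₁ h))
adj-swap₂₃ H (inj₂ (inj₂ (inj₂ (inj₂ (inj₂ h))))) = inj₂ (inj₂ (inj₂ (inj₁ h)))

adj? : ∀ {n} (H : 3Graph n) x y z → Dec (Adj H x y z)
adj? H x y z = one x y z ⊎-dec (one x z y ⊎-dec (one y x z ⊎-dec (one y z x ⊎-dec (one z x y ⊎-dec one z y x))))
  where
  one : ∀ x y z → Dec (x F.< y × y F.< z × edge H x y z ≡ true)
  one x y z = (x Fₚ.<? y) ×-dec ((y Fₚ.<? z) ×-dec (edge H x y z Boolₚ.≟ true))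

opposite-< : ∀ {n} {i j : Fin n} → i F.< j → F.opposite j F.< F.opposite i
opposite-< {n} {i} {j} h = subst₂ ℕ._<_ (sym (Fₚ.opposite-prop j)) (sym (Fₚ.opposite-prop i)) (ℕₚ.∸-monoʳ-< (s≤s h) (Fₚ.toℕ<n j))

opposite-<⁻ : ∀ {n} {i j : Fin n} → F.opposite i F.< F.opposite j → j F.< i
opposite-<⁻ {n} {i} {j} h = subst₂ F._<_ (Fₚ.opposite-involutive j) (Fₚ.opposite-involutive i) (opposite-< h)

flip-label : Label → Label
flip-label L = R
flip-label T = T
flip-label R = L

-- Reversing the ordering exchanges left and right and keeps top.
reverse-vanishing : ∀ {n} (H : 3Graph n) (π : Ordering n) → Vanishing H π → Vanishing H (Perm.reverse Perm.∘ₚ π)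
reverse-vanishing H π (lab , v) = (λ i j → flip-label (lab (F.opposite j) (F.opposite i))) , λ i j k ij jk adj →
  let (l , t , r) = v (F.opposite k) (F.opposite j) (F.opposite i) (opposite-< jk) (opposite-< ij)
                      (adj-swap₁₂ H (adj-swap₂₃ H (adj-swap₁₂ H adj)))
  in cong flip-label r , cong flip-label t , cong flip-label l

reverse-split : ∀ {n} {H : 3Graph n} → SplitCondition H T L → SplitCondition H T R
reverse-split (H₁ , H₂ , π , part , v₁ , v₂ , cross) = H₁ , H₂ , Perm.reverse Perm.∘ₚ π , part , reverse-vanishing H₁ π v₁ , reverse-vanishing H₂ π v₂ ,
  λ i j k l ij a₁ a₂ →
    let ((p , q) , r) = cross (F.opposite j) (F.opposite i) (F.opposite k) (F.opposite l) (opposite-< ij) (adj-swap₁₂ H₁ a₁) (adj-swap₁₂ H₂ a₂)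
    in (opposite-<⁻ q , opposite-<⁻ p) , opposite-<⁻ r

splitFor : ∀ {n} {H : 3Graph n} → SplitCondition H R L → SplitCondition H T L → ∀ {ℓ₁ ℓ₂} → Pattern ℓ₁ ℓ₂ → SplitCondition H ℓ₁ ℓ₂
splitFor rl tl RL = rl
splitFor rl tl TL = tl
splitFor rl tl TR = reverse-split tl

orderingOf : ∀ {n} {H : 3Graph n} {ℓ₁ ℓ₂} → SplitCondition H ℓ₁ ℓ₂ → Ordering n
orderingOf (_ , _ , π , _) = π

role-label : ∀ {n} (H : 3Graph n) (π : Ordering n) ((lab , _) : Vanishing H π) ℓ {i j k : Fin n} → i F.< j → RoleIs i j k ℓ →
  Adj H (π ⟨$⟩ʳ i) (π ⟨$⟩ʳ j) (π ⟨$⟩ʳ k) → lab i j ≡ ℓ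
role-label H π (lab , v) L ij jk adj = proj₁ (v _ _ _ ij jk adj)
role-label H π (lab , v) T ij (ik , kj) adj = proj₁ (proj₂ (v _ _ _ ik kj (adj-swap₂₃ H adj)))
role-label H π (lab , v) R ij ki adj = proj₂ (proj₂ (v _ _ _ ki ij (adj-swap₁₂ H (adj-swap₂₃ H adj))))

-- A pair lying in an edge of H₁ gets its label from g₁, every other pair from g₂; on
-- pairs common to both parts the two choices agree by the split condition.
transfer : ∀ {n N} {Y : Set} {H₀ : 3Graph n} (G : Reduced N Y) {ℓ₁ ℓ₂} (S : SplitCondition H₀ ℓ₁ ℓ₂) (f : Fin n → Fin N) (g₁ g₂ : Label → Fin n × Fin n → Y) →
  (∀ p → g₁ ℓ₁ p ≡ g₂ ℓ₂ p) → Realized G f g₁ → Realized G f g₂ →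
  Σ (Fin n × Fin n → Y) λ lab → ∀ i j k → i F.< j → j F.< k → Adj H₀ (orderingOf S ⟨$⟩ʳ i) (orderingOf S ⟨$⟩ʳ j) (orderingOf S ⟨$⟩ʳ k) →
    G (f i) (f j) (f k) (lab (i , j)) (lab (i , k)) (lab (j , k)) ≡ true
transfer {n} {N} {Y} {H₀} G {ℓ₁} {ℓ₂} (H₁ , H₂ , π , part , v₁@(lab₁ , van₁) , v₂@(lab₂ , van₂) , cross) f g₁ g₂ agree r₁ r₂ =
    lab , λ i j k ij jk adj → [ edge₁ i j k ij jk , edge₂ i j k ij jk ]′ (Equivalence.to (proj₁ (part _ _ _)) adj)
  where
  Covered : Fin n × Fin n → Set
  Covered (i , j) = Σ (Fin n) λ k → Adj H₁ (π ⟨$⟩ʳ i) (π ⟨$⟩ʳ j) (π ⟨$⟩ʳ k)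
  covered? : ∀ p → Dec (Covered p)
  covered? (i , j) = Fₚ.any? (λ k → adj? H₁ (π ⟨$⟩ʳ i) (π ⟨$⟩ʳ j) (π ⟨$⟩ʳ k))
  labD : ∀ p → Dec (Covered p) → Y
  labD (i , j) (yes _) = g₁ (lab₁ i j) (i , j)
  labD (i , j) (no _) = g₂ (lab₂ i j) (i , j)
  lab : Fin n × Fin n → Y
  lab p = labD p (covered? p)
  from₁ : ∀ i j k → Adj H₁ (π ⟨$⟩ʳ i) (π ⟨$⟩ʳ j) (π ⟨$⟩ʳ k) → (d : Dec (Covered (i , j))) → labD (i , j) d ≡ g₁ (lab₁ i j) (i , j)
  from₁ i j k adj (yes _) = refl
  from₁ i j k adj (no h) = ⊥-elim (h (k , adj))
  from₂ : ∀ i j k → i F.< j → Adj H₂ (π ⟨$⟩ʳ i) (π ⟨$⟩ʳ j) (π ⟨$⟩ʳ k) → (d : Dec (Covered (i , j))) → labD (i , j) d ≡ g₂ (lab₂ i j) (i , j)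
  from₂ i j k ij adj (no _) = refl
  from₂ i j k ij adj (yes (k′ , adj′)) =
    let (ro₁ , ro₂) = cross i j k′ k ij adj′ adj
    in trans (cong (λ ℓ → g₁ ℓ (i , j)) (role-label H₁ π v₁ ℓ₁ ij ro₁ adj′)) (trans (agree (i , j)) (cong (λ ℓ → g₂ ℓ (i , j)) (sym (role-label H₂ π v₂ ℓ₂ ij ro₂ adj))))
  build : ∀ i j k {a b c a′ b′ c′ : Y} → a ≡ a′ → b ≡ b′ → c ≡ c′ → G (f i) (f j) (f k) a′ b′ c′ ≡ true → G (f i) (f j) (f k) a b c ≡ true
  build i j k refl refl refl h = h
  edge₁ : ∀ i j k → i F.< j → j F.< k → Adj H₁ (π ⟨$⟩ʳ i) (π ⟨$⟩ʳ j) (π ⟨$⟩ʳ k) → G (f i) (f j) (f k) (lab (i , j)) (lab (i , k)) (lab (j , k)) ≡ true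
  edge₁ i j k ij jk adj =
    let (l , t , r) = van₁ i j k ij jk adj
    in build i j k (trans (from₁ i j k adj (covered? (i , j))) (cong (λ ℓ → g₁ ℓ (i , j)) l))
         (trans (from₁ i k j (adj-swap₂₃ H₁ adj) (covered? (i , k))) (cong (λ ℓ → g₁ ℓ (i , k)) t))
         (trans (from₁ j k i (adj-swap₂₃ H₁ (adj-swap₁₂ H₁ adj)) (covered? (j , k))) (cong (λ ℓ → g₁ ℓ (j , k)) r)) (r₁ i j k ij jk)
  edge₂ : ∀ i j k → i F.< j → j F.< k → Adj H₂ (π ⟨$⟩ʳ i) (π ⟨$⟩ʳ j) (π ⟨$⟩ʳ k) → G (f i) (f j) (f k) (lab (i , j)) (lab (i , k)) (lab (j , k)) ≡ true
  edge₂ i j k ij jk adj =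
    let (l , t , r) = van₂ i j k ij jk adj
    in build i j k (trans (from₂ i j k ij adj (covered? (i , j))) (cong (λ ℓ → g₂ ℓ (i , j)) l))
         (trans (from₂ i k j (Fₚ.<-trans ij jk) (adj-swap₂₃ H₂ adj) (covered? (i , k))) (cong (λ ℓ → g₂ ℓ (i , k)) t))
         (trans (from₂ j k i jk (adj-swap₂₃ H₂ (adj-swap₁₂ H₂ adj)) (covered? (j , k))) (cong (λ ℓ → g₂ ℓ (j , k)) r)) (r₂ i j k ij jk)
-- Counting edges

ι-sum : ∀ {n} (f : Fin n → ℕ) m (g : Fin m → Fin n) → ι (sum (map f (List.tabulate g))) ≡ ΣF m (λ i → ι (f (g i)))
ι-sum f zero g = refl
ι-sum f (suc m) g = trans (ι-+ (f (g F.zero)) _) (cong (λ z → ι (f (g F.zero)) + z) (ι-sum f m (g ∘ F.suc)))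

sum³ : ∀ n → (Fin n → Fin n → Fin n → ℕ) → ℕ
sum³ n f = sum (map (λ a → sum (map (λ b → sum (map (λ c → f a b c) (List.allFin n))) (List.allFin n))) (List.allFin n))

ltᵇ′ : ∀ {n} → Fin n → Fin n → Bool
ltᵇ′ a b = toℕ a ℕ.<ᵇ toℕ b

-- The summand of edgesIn, whose ingredients are private to Defs.
summand : ∀ {n} (H : 3Graph n) (W : Subset n) → Σ (Fin n → Fin n → Fin n → ℕ) λ f → edgesIn H W ≡ sum³ n f
summand H W = _ , refl

if-ι : ∀ b → ι (if b then 1 else 0) ≡ ⟦ b ⟧
if-ι true = refl
if-ι false = refl

summand-value : ∀ {n} (H : 3Graph n) (W : Subset n) a b c →
  proj₁ (summand H W) a b c ≡ (if ltᵇ′ a b ∧ ltᵇ′ b c ∧ lookup W a ∧ lookup W b ∧ lookup W c ∧ edge H a b c then 1 else 0)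
summand-value H W a b c with lookup W a | lookup W b | lookup W c
... | true | true | true = refl
... | true | true | false = refl
... | true | false | true = refl
... | true | false | false = refl
... | false | true | true = refl
... | false | true | false = refl
... | false | false | true = refl
... | false | false | false = refl

-- Sums over increasing pairs and triples

O₂ : ∀ n → (Fin n → Fin n → ℚ) → ℚ
O₂ n f = ΣF n (λ b → ΣF n (λ c → ⟦ ltᵇ′ b c ⟧ * f b c))

O₃ : ∀ n → (Fin n → Fin n → Fin n → ℚ) → ℚ
O₃ n f = ΣF n (λ a → ΣF n (λ b → ΣF n (λ c → ⟦ ltᵇ′ a b ∧ ltᵇ′ b c ⟧ * f a b c)))

0+ : ∀ {s t u : ℚ} → s ≡ 0ℚ → t ≡ u → s + t ≡ u
0+ refl refl = ℚₚ.+-identityˡ _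

O₂-suc : ∀ n (f : Fin (suc n) → Fin (suc n) → ℚ) → O₂ (suc n) f ≡ ΣF n (λ c → f F.zero (F.suc c)) + O₂ n (λ b c → f (F.suc b) (F.suc c))
O₂-suc n f = cong₂ _+_ (0+ (ℚₚ.*-zeroˡ (f F.zero F.zero)) (ΣF-cong n (λ c → ℚₚ.*-identityˡ (f F.zero (F.suc c)))))
  (ΣF-cong n (λ b → 0+ (ℚₚ.*-zeroˡ (f (F.suc b) F.zero)) refl))

O₃-suc : ∀ n (f : Fin (suc n) → Fin (suc n) → Fin (suc n) → ℚ) →
  O₃ (suc n) f ≡ O₂ n (λ b c → f F.zero (F.suc b) (F.suc c)) + O₃ n (λ a b c → f (F.suc a) (F.suc b) (F.suc c))
O₃-suc n f = cong₂ _+_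
  (0+ (ΣF-0 (suc n) (λ c → ℚₚ.*-zeroˡ (f F.zero F.zero c))) (ΣF-cong n (λ b → 0+ (ℚₚ.*-zeroˡ (f F.zero (F.suc b) F.zero)) refl)))
  (ΣF-cong n (λ a → 0+ (ΣF-0 (suc n) (λ c → ℚₚ.*-zeroˡ (f (F.suc a) F.zero c)))
    (ΣF-cong n (λ b → 0+ (trans (cong (λ z → ⟦ z ⟧ * f (F.suc a) (F.suc b) F.zero) (Boolₚ.∧-zeroʳ (ltᵇ′ a b))) (ℚₚ.*-zeroˡ (f (F.suc a) (F.suc b) F.zero))) refl))))

O₂-cong : ∀ n {f g : Fin n → Fin n → ℚ} → (∀ b c → f b c ≡ g b c) → O₂ n f ≡ O₂ n g
O₂-cong n h = ΣF-cong n (λ b → ΣF-cong n (λ c → cong (⟦ ltᵇ′ b c ⟧ *_) (h b c)))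

O₃-cong : ∀ n {f g : Fin n → Fin n → Fin n → ℚ} → (∀ a b c → f a b c ≡ g a b c) → O₃ n f ≡ O₃ n g
O₃-cong n h = ΣF-cong n (λ a → ΣF-cong n (λ b → ΣF-cong n (λ c → cong (⟦ ltᵇ′ a b ∧ ltᵇ′ b c ⟧ *_) (h a b c))))

O₂-* : ∀ n k (f : Fin n → Fin n → ℚ) → O₂ n (λ b c → k * f b c) ≡ k * O₂ n f
O₂-* n k f = trans (ΣF-cong n (λ b → trans (ΣF-cong n (λ c → solve 3 (λ x k f → x :* (k :* f) := k :* (x :* f)) refl ⟦ ltᵇ′ b c ⟧ k (f b c))) (ΣF-* n k _))) (ΣF-* n k _)

O₃-+ : ∀ n (f g : Fin n → Fin n → Fin n → ℚ) → O₃ n (λ a b c → f a b c + g a b c) ≡ O₃ n f + O₃ n g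
O₃-+ n f g = trans (ΣF-cong n (λ a → trans (ΣF-cong n (λ b → trans (ΣF-cong n (λ c → ℚₚ.*-distribˡ-+ ⟦ ltᵇ′ a b ∧ ltᵇ′ b c ⟧ (f a b c) (g a b c))) (ΣF-+ n _ _))) (ΣF-+ n _ _))) (ΣF-+ n _ _)

O₃-* : ∀ n k (f : Fin n → Fin n → Fin n → ℚ) → O₃ n (λ a b c → k * f a b c) ≡ k * O₃ n f
O₃-* n k f = trans (ΣF-cong n (λ a → trans (ΣF-cong n (λ b → trans (ΣF-cong n (λ c → solve 3 (λ x k f → x :* (k :* f) := k :* (x :* f)) refl ⟦ ltᵇ′ a b ∧ ltᵇ′ b c ⟧ k (f a b c))) (ΣF-* n k _))) (ΣF-* n k _))) (ΣF-* n k _)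

inW³ : ∀ {n} → Vec Bool n → Fin n → Fin n → Fin n → ℚ
inW³ W a b c = ⟦ lookup W a ⟧ * (⟦ lookup W b ⟧ * ⟦ lookup W c ⟧)

count₁ : ∀ {n} (W : Vec Bool n) → ΣF n (λ a → ⟦ lookup W a ⟧) ≡ ι ∣ W ∣
count₁ [] = refl
count₁ (true ∷ W) = trans (cong (λ z → 1ℚ + z) (count₁ W)) (ℚₚ.+-comm 1ℚ (ι ∣ W ∣))
count₁ (false ∷ W) = trans (cong (λ z → 0ℚ + z) (count₁ W)) (ℚₚ.+-identityˡ (ι ∣ W ∣))

pascal : ∀ n k → ι (n choose k) + ι (n choose suc k) ≡ ι (suc n choose suc k)
pascal n k = trans (sym (ι-+ (n choose k) (n choose suc k))) (cong ι (nCk+nC[k+1]≡[n+1]C[k+1] n k))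

count₂ : ∀ {n} (W : Vec Bool n) → O₂ n (λ b c → ⟦ lookup W b ⟧ * ⟦ lookup W c ⟧) ≡ ι (∣ W ∣ choose 2)
count₂ [] = refl
count₂ {suc n} (true ∷ W) = trans (O₂-suc n (λ b c → ⟦ lookup (true ∷ W) b ⟧ * ⟦ lookup (true ∷ W) c ⟧)) (trans (cong₂ _+_ (trans (ΣF-cong n (λ c → ℚₚ.*-identityˡ ⟦ lookup W c ⟧)) (trans (count₁ W) (cong ι (sym (nC1≡n ∣ W ∣))))) (count₂ W)) (pascal ∣ W ∣ 1))
count₂ {suc n} (false ∷ W) = trans (O₂-suc n (λ b c → ⟦ lookup (false ∷ W) b ⟧ * ⟦ lookup (false ∷ W) c ⟧)) (trans (cong₂ _+_ (ΣF-0 n (λ c → ℚₚ.*-zeroˡ ⟦ lookup W c ⟧)) (count₂ W)) (ℚₚ.+-identityˡ (ι (∣ W ∣ choose 2))))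

count₃ : ∀ {n} (W : Vec Bool n) → O₃ n (inW³ W) ≡ ι (∣ W ∣ choose 3)
count₃ [] = refl
count₃ {suc n} (true ∷ W) = trans (O₃-suc n (inW³ (true ∷ W))) (trans (cong₂ _+_ (trans (O₂-cong n (λ b c → ℚₚ.*-identityˡ (⟦ lookup W b ⟧ * ⟦ lookup W c ⟧))) (count₂ W)) (count₃ W)) (pascal ∣ W ∣ 2))
count₃ {suc n} (false ∷ W) = trans (O₃-suc n (inW³ (false ∷ W))) (trans (cong₂ _+_ (trans (O₂-* n 0ℚ (λ b c → ⟦ lookup W b ⟧ * ⟦ lookup W c ⟧)) (ℚₚ.*-zeroˡ (O₂ n (λ b c → ⟦ lookup W b ⟧ * ⟦ lookup W c ⟧)))) (count₃ W)) (ℚₚ.+-identityˡ (ι (∣ W ∣ choose 3))))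

edges-O₃ : ∀ {n} (H : 3Graph n) (W : Subset n) → ℕtoℚ (edgesIn H W) ≡ O₃ n (λ a b c → inW³ W a b c * ⟦ edge H a b c ⟧)
edges-O₃ {n} H W = trans (ℕtoℚ≡ι (edgesIn H W)) (trans (cong ι (proj₂ (summand H W)))
  (trans (ι-sum _ n id) (ΣF-cong n (λ a → trans (ι-sum _ n id) (ΣF-cong n (λ b → trans (ι-sum _ n id) (ΣF-cong n (λ c →
    trans (cong ι (summand-value H W a b c)) (trans (if-ι (ltᵇ′ a b ∧ ltᵇ′ b c ∧ lookup W a ∧ lookup W b ∧ lookup W c ∧ edge H a b c)) (bits (ltᵇ′ a b) (ltᵇ′ b c) (lookup W a) (lookup W b) (lookup W c) (edge H a b c)))))))))))
  where
  bits : ∀ p q u v w e → ⟦ p ∧ q ∧ u ∧ v ∧ w ∧ e ⟧ ≡ ⟦ p ∧ q ⟧ * (⟦ u ⟧ * (⟦ v ⟧ * ⟦ w ⟧) * ⟦ e ⟧)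
  bits p q u v w e = trans (cong ⟦_⟧ (sym (Boolₚ.∧-assoc p q (u ∧ v ∧ w ∧ e)))) (trans (⟦∧⟧ (p ∧ q) (u ∧ v ∧ w ∧ e)) (cong (⟦ p ∧ q ⟧ *_)
    (trans (⟦∧⟧ u (v ∧ w ∧ e)) (trans (cong (⟦ u ⟧ *_) (trans (⟦∧⟧ v (w ∧ e)) (cong (⟦ v ⟧ *_) (⟦∧⟧ w e))))
      (solve 4 (λ u v w e → u :* (v :* (w :* e)) := u :* (v :* w) :* e) refl ⟦ u ⟧ ⟦ v ⟧ ⟦ w ⟧ ⟦ e ⟧)))))

-- Density in a form suited to averaging over `W`: on each triple of distinct vertices the summand
-- is multilinear in the indicator of `W`.
Dense-O₃ : ∀ {n} {H : 3Graph n} {d ε} → Dense H d ε → ∀ W → - (ε * ℕtoℚ (n ℕ.^ 3)) ≤ O₃ n (λ a b c → inW³ W a b c * (⟦ edge H a b c ⟧ - d))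
Dense-O₃ {n} {H} {d} {ε} dense W = ≤-by (dense W) (trans (cong (λ z → z - - (ε * ℕtoℚ (n ℕ.^ 3))) split)
    (solve 3 (λ e c x → (e :+ :- c) :- (:- x) := e :- (c :- x)) refl (ℕtoℚ (edgesIn H W)) (d * ℕtoℚ (∣ W ∣ choose 3)) (ε * ℕtoℚ (n ℕ.^ 3))))
  where
  split : O₃ n (λ a b c → inW³ W a b c * (⟦ edge H a b c ⟧ - d)) ≡ ℕtoℚ (edgesIn H W) + - (d * ℕtoℚ (∣ W ∣ choose 3))
  split = trans (O₃-cong n (λ a b c → solve 3 (λ i e d → i :* (e :- d) := i :* e :+ (:- d) :* i) refl (inW³ W a b c) ⟦ edge H a b c ⟧ d))
    (trans (O₃-+ n (λ a b c → inW³ W a b c * ⟦ edge H a b c ⟧) (λ a b c → - d * inW³ W a b c)) (cong₂ _+_ (sym (edges-O₃ H W))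
      (trans (O₃-* n (- d) (inW³ W)) (trans (cong (- d *_) (trans (count₃ W) (sym (ℕtoℚ≡ι (∣ W ∣ choose 3))))) (solve 2 (λ d x → :- d :* x := :- (d :* x)) refl d (ℕtoℚ (∣ W ∣ choose 3)))))))

pairs-count : ∀ n → ι 2 * O₂ n (λ _ _ → 1ℚ) ≡ ι n * ι n - ι n
pairs-count zero = refl
pairs-count (suc n) = trans (cong (ι 2 *_) (trans (O₂-suc n (λ _ _ → 1ℚ)) (cong (_+ O₂ n (λ _ _ → 1ℚ)) (trans (ΣF-const n 1ℚ) (ℚₚ.*-identityʳ (ι n))))))
  (trans (ℚₚ.*-distribˡ-+ (ι 2) (ι n) (O₂ n (λ _ _ → 1ℚ))) (trans (cong (λ z → ι 2 * ι n + z) (pairs-count n))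
    (solve 1 (λ i → con (ι 2) :* i :+ (i :* i :- i) := (i :+ con 1ℚ) :* (i :+ con 1ℚ) :- (i :+ con 1ℚ)) refl (ι n))))

triples-count : ∀ n → ι 6 * O₃ n (λ _ _ _ → 1ℚ) ≡ ι n * (ι n * ι n) - ι 3 * (ι n * ι n) + ι 2 * ι n
triples-count zero = refl
triples-count (suc n) = trans (cong (ι 6 *_) (O₃-suc n (λ _ _ _ → 1ℚ)))
  (trans (solve 2 (λ a b → con (ι 6) :* (a :+ b) := con (ι 3) :* (con (ι 2) :* a) :+ con (ι 6) :* b) refl (O₂ n (λ _ _ → 1ℚ)) (O₃ n (λ _ _ _ → 1ℚ)))
  (trans (cong₂ (λ x y → ι 3 * x + y) (pairs-count n) (triples-count n))
    (solve 1 (λ i → con (ι 3) :* (i :* i :- i) :+ (i :* (i :* i) :- con (ι 3) :* (i :* i) :+ con (ι 2) :* i) :=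
      (i :+ con 1ℚ) :* ((i :+ con 1ℚ) :* (i :+ con 1ℚ)) :- con (ι 3) :* ((i :+ con 1ℚ) :* (i :+ con 1ℚ)) :+ con (ι 2) :* (i :+ con 1ℚ)) refl (ι n))))

-- Random sets of vertices supported on blocks

opaque
  unfolding E
  bern : (p : ℚ) → 0ℚ ≤ p → p ≤ 1ℚ → Mean Bool
  bern p 0p p1 = mean ((p , true) ∷ (1ℚ - p , false) ∷ []) (0p ∷ 0≤- p1 ∷ []) (solve 1 (λ p → p :* con 1ℚ :+ ((con 1ℚ :- p) :* con 1ℚ :+ con 0ℚ) := con 1ℚ) refl p)

  E-bern : ∀ p 0p p1 → E (bern p 0p p1) ⟦_⟧ ≡ p
  E-bern p 0p p1 = solve 1 (λ p → p :* con 1ℚ :+ ((con 1ℚ :- p) :* con 0ℚ :+ con 0ℚ) := p) refl p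

ltᵇ-true : ∀ {n} {a b : Fin n} → ltᵇ′ a b ≡ true → a F.< b
ltᵇ-true {a = a} {b} e = ℕₚ.<ᵇ⇒< (toℕ a) (toℕ b) (Equivalence.from Boolₚ.T-≡ e)

ltᵇ-intro : ∀ {n} {a b : Fin n} → a F.< b → ltᵇ′ a b ≡ true
ltᵇ-intro h = Equivalence.to Boolₚ.T-≡ (ℕₚ.<⇒<ᵇ h)

ltᵇ-false : ∀ {n} {a b : Fin n} → ¬ (a F.< b) → ltᵇ′ a b ≡ false
ltᵇ-false {a = a} {b} h with ltᵇ′ a b in e
... | true = ⊥-elim (h (ltᵇ-true e))
... | false = refl

ΣF-swap : ∀ m n (f : Fin m → Fin n → ℚ) → ΣF m (λ i → ΣF n (f i)) ≡ ΣF n (λ j → ΣF m (λ i → f i j))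
ΣF-swap zero n f = sym (ΣF-0 n (λ _ → refl))
ΣF-swap (suc m) n f = trans (cong (λ z → ΣF n (f F.zero) + z) (ΣF-swap m n (f ∘ F.suc))) (sym (ΣF-+ n (f F.zero) _))

-- The hypothesis is averaged over the random set containing each v independently with probability p v.
bernoulli : ∀ {n} (p : Fin n → ℚ) → (∀ v → 0ℚ ≤ p v) → (∀ v → p v ≤ 1ℚ) → ∀ {c} (f : Fin n → Fin n → Fin n → ℚ) →
  (∀ (W : Vec Bool n) → c ≤ O₃ n (λ a b c → inW³ W a b c * f a b c)) → c ≤ O₃ n (λ a b c → p a * (p b * p c) * f a b c)
bernoulli {n} p p0 p1 {c} f h = subst (c ≤_) value (E-≥c (Π B) h)
  where
  B : Fin n → Mean Bool
  B v = bern (p v) (p0 v) (p1 v)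
  term : ∀ a b c → E (Π B) (λ W → ⟦ ltᵇ′ a b ∧ ltᵇ′ b c ⟧ * (inW³ W a b c * f a b c)) ≡ ⟦ ltᵇ′ a b ∧ ltᵇ′ b c ⟧ * (p a * (p b * p c) * f a b c)
  term a b c with ltᵇ′ a b ∧ ltᵇ′ b c in e
  ... | false = trans (E-cong (Π B) (λ W → ℚₚ.*-zeroˡ (inW³ W a b c * f a b c))) (trans (E-const (Π B) 0ℚ) (sym (ℚₚ.*-zeroˡ (p a * (p b * p c) * f a b c))))
  ... | true = trans (E-* (Π B) 1ℚ (λ W → inW³ W a b c * f a b c)) (cong (1ℚ *_) (trans (E-*ʳ (Π B) (f a b c) (λ W → inW³ W a b c)) (cong (_* f a b c)
      (trans (marginal₃ B (<⇒≢F ab) (<⇒≢F (Fₚ.<-trans ab bc)) (<⇒≢F bc) (λ x y z → ⟦ x ⟧ * (⟦ y ⟧ * ⟦ z ⟧)))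
      (trans (E-cong (B a) (λ x → trans (E-cong (B b) (λ y → trans (E-* (B c) ⟦ x ⟧ (λ z → ⟦ y ⟧ * ⟦ z ⟧)) (cong (⟦ x ⟧ *_) (trans (E-* (B c) ⟦ y ⟧ ⟦_⟧) (cong (⟦ y ⟧ *_) (E-bern (p c) (p0 c) (p1 c)))))))
        (trans (E-* (B b) ⟦ x ⟧ (λ y → ⟦ y ⟧ * p c)) (cong (⟦ x ⟧ *_) (trans (E-*ʳ (B b) (p c) ⟦_⟧) (cong (_* p c) (E-bern (p b) (p0 b) (p1 b))))))))
       (trans (E-*ʳ (B a) (p b * p c) ⟦_⟧) (cong (_* (p b * p c)) (E-bern (p a) (p0 a) (p1 a)))))))))
    where
    ab : a F.< b
    ab = ltᵇ-true (proj₁ (∧-true e))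
    bc : b F.< c
    bc = ltᵇ-true (proj₂ (∧-true e))
  value : E (Π B) (λ W → O₃ n (λ a b c → inW³ W a b c * f a b c)) ≡ O₃ n (λ a b c → p a * (p b * p c) * f a b c)
  value = trans (E-ΣF (Π B) n _) (ΣF-cong n (λ a → trans (E-ΣF (Π B) n _) (ΣF-cong n (λ b → trans (E-ΣF (Π B) n _) (ΣF-cong n (λ c → term a b c))))))

module Blocks {V : Set} {N m : ℕ} (vx : Fin m → V → Fin N) (ordered : ∀ {q q′} → q F.< q′ → ∀ u v → vx q u F.< vx q′ v)
  (B : Fin m → Mean V) (s : ℚ) (0s : 0ℚ ≤ s) where

  -- A vertex is weighted by the total mass that the block measures give it, scaled by `s`. By
  -- `spread`, sums over vertices then become means over the blocks.
  p : Fin N → ℚ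
  p v = s * ΣF m (λ q → E (B q) (λ u → ⟦ does (v F.≟ vx q u) ⟧))

  0≤p : ∀ v → 0ℚ ≤ p v
  0≤p v = 0s ⊛ ΣF-nonneg m (λ q → E-nonneg (B q) (λ u → 0≤⟦⟧ (does (v F.≟ vx q u))))

  𝔼 : (Fin N → ℚ) → ℚ
  𝔼 g = ΣF m (λ q → E (B q) (λ u → g (vx q u)))

  spread : ∀ (g : Fin N → ℚ) → ΣF N (λ v → p v * g v) ≡ s * 𝔼 g
  spread g = trans (ΣF-cong N (λ v → trans (solve 3 (λ s x g → s :* x :* g := s :* (g :* x)) refl s (ΣF m (λ q → E (B q) (λ u → ⟦ does (v F.≟ vx q u) ⟧))) (g v))
        (cong (s *_) (sym (ΣF-* m (g v) _)))))
    (trans (ΣF-* N s _) (cong (s *_) (trans (ΣF-swap N m _) (ΣF-cong m (λ q →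
      trans (ΣF-cong N (λ v → trans (sym (E-* (B q) (g v) _)) (E-cong (B q) (λ u → ℚₚ.*-comm (g v) ⟦ does (v F.≟ vx q u) ⟧))))
        (trans (sym (E-ΣF (B q) N (λ v u → ⟦ does (v F.≟ vx q u) ⟧ * g v))) (E-cong (B q) (λ u → ΣF-δ N (vx q u) g))))))))

  𝔼-* : ∀ c g → 𝔼 (λ v → c * g v) ≡ c * 𝔼 g
  𝔼-* c g = trans (ΣF-cong m (λ q → E-* (B q) c (λ u → g (vx q u)))) (ΣF-* m c _)

  module _ (f : Fin N → Fin N → Fin N → ℚ) (f≤1 : ∀ a b c → f a b c ≤ 1ℚ) {γ : ℚ}
    (low : ∀ q q′ q″ → q F.< q′ → q′ F.< q″ → E (B q) (λ u → E (B q′) (λ v → E (B q″) (λ w → f (vx q u) (vx q′ v) (vx q″ w)))) ≤ - γ) where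

    h : Fin N → Fin N → Fin N → ℚ
    h a b c = ⟦ ltᵇ′ a b ∧ ltᵇ′ b c ⟧ * f a b c

    O₃-blocks : O₃ N (λ a b c → p a * (p b * p c) * f a b c) ≡ s * (s * s) * 𝔼 (λ a → 𝔼 (λ b → 𝔼 (h a b)))
    O₃-blocks = trans (ΣF-cong N (λ a → trans (ΣF-cong N (λ b → trans (ΣF-cong N (λ c →
          solve 5 (λ x y z l f → l :* (x :* (y :* z) :* f) := (x :* y) :* (z :* (l :* f))) refl (p a) (p b) (p c) ⟦ ltᵇ′ a b ∧ ltᵇ′ b c ⟧ (f a b c)))
          (trans (ΣF-* N (p a * p b) _) (trans (cong (p a * p b *_) (spread (h a b))) (ℚₚ.*-assoc (p a) (p b) (s * 𝔼 (h a b)))))))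
        (trans (ΣF-* N (p a) _) (cong (p a *_) (trans (spread (λ b → s * 𝔼 (h a b))) (cong (s *_) (𝔼-* s (λ b → 𝔼 (h a b)))))))))
      (trans (spread (λ a → s * (s * 𝔼 (λ b → 𝔼 (h a b))))) (trans (cong (s *_) (trans (𝔼-* s (λ a → s * 𝔼 (λ b → 𝔼 (h a b)))) (cong (s *_) (𝔼-* s (λ a → 𝔼 (λ b → 𝔼 (h a b)))))))
        (solve 2 (λ s x → s :* (s :* (s :* x)) := s :* (s :* s) :* x) refl s (𝔼 (λ a → 𝔼 (λ b → 𝔼 (h a b)))))))

    -- Increasing triples of blocks contribute at most -γ, and triples out of order at most 0, since
    -- the blocks are ordered like their vertices. A coincidence of two neighbouring indices is
    -- allowed 1; each of the two kinds occurs m² times.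
    cap : Fin m → Fin m → Fin m → ℚ
    cap q q′ q″ = ⟦ ltᵇ′ q q′ ∧ ltᵇ′ q′ q″ ⟧ * (- γ) + (⟦ does (q F.≟ q′) ⟧ + ⟦ does (q′ F.≟ q″) ⟧)

    F³ : Fin m → Fin m → Fin m → ℚ
    F³ q q′ q″ = E (B q) (λ u → E (B q′) (λ v → E (B q″) (λ w → h (vx q u) (vx q′ v) (vx q″ w))))

    ≤const : ∀ q q′ q″ c → (∀ u v w → h (vx q u) (vx q′ v) (vx q″ w) ≤ c) → F³ q q′ q″ ≤ c
    ≤const q q′ q″ c k = E-≤c (B q) (λ u → E-≤c (B q′) (λ v → E-≤c (B q″) (k u v)))

    h≤1 : ∀ a b c → h a b c ≤ 1ℚ
    h≤1 a b c with ltᵇ′ a b ∧ ltᵇ′ b c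
    ... | true = subst (_≤ 1ℚ) (sym (ℚₚ.*-identityˡ (f a b c))) (f≤1 a b c)
    ... | false = subst (_≤ 1ℚ) (sym (ℚₚ.*-zeroˡ (f a b c))) 0≤1

    not-before : ∀ {q q′} → q′ F.< q → ∀ u v → ltᵇ′ (vx q u) (vx q′ v) ≡ false
    not-before lt u v = ltᵇ-false (λ k → Fₚ.<-asym k (ordered lt v u))

    h-zero₁ : ∀ {a b} c → ltᵇ′ a b ≡ false → h a b c ≤ 0ℚ
    h-zero₁ {a} {b} c e = ℚₚ.≤-reflexive (trans (cong (λ z → ⟦ z ∧ ltᵇ′ b c ⟧ * f a b c) e) (ℚₚ.*-zeroˡ (f a b c)))

    h-zero₂ : ∀ a {b c} → ltᵇ′ b c ≡ false → h a b c ≤ 0ℚ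
    h-zero₂ a {b} {c} e = ℚₚ.≤-reflexive (trans (cong (λ z → ⟦ z ⟧ * f a b c) (trans (cong (ltᵇ′ a b ∧_) e) (Boolₚ.∧-zeroʳ (ltᵇ′ a b)))) (ℚₚ.*-zeroˡ (f a b c)))

    cap-form : ∀ q q′ q″ {x y z c} → ltᵇ′ q q′ ∧ ltᵇ′ q′ q″ ≡ x → does (q F.≟ q′) ≡ y → does (q′ F.≟ q″) ≡ z → c ≤ ⟦ x ⟧ * (- γ) + (⟦ y ⟧ + ⟦ z ⟧) → c ≤ cap q q′ q″
    cap-form q q′ q″ refl refl refl k = k

    F³≤ : ∀ q q′ q″ → F³ q q′ q″ ≤ cap q q′ q″
    F³≤ q q′ q″ with Fₚ.<-cmp q q′ | Fₚ.<-cmp q′ q″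
    ... | tri< a ne _ | tri< b ne′ _ = cap-form q q′ q″ (cong₂ _∧_ (ltᵇ-intro a) (ltᵇ-intro b)) (does-≢ ne) (does-≢ ne′)
      (subst₂ _≤_ (sym (E-cong (B q) (λ u → E-cong (B q′) (λ v → E-cong (B q″) (λ w →
          trans (cong (λ z → ⟦ z ⟧ * f (vx q u) (vx q′ v) (vx q″ w)) (cong₂ _∧_ (ltᵇ-intro (ordered a u v)) (ltᵇ-intro (ordered b v w)))) (ℚₚ.*-identityˡ _))))))
        (solve 1 (λ g → (:- g) := con 1ℚ :* (:- g) :+ (con 0ℚ :+ con 0ℚ)) refl γ) (low q q′ q″ a b))
    ... | tri≈ na refl _ | _ = cap-form q q′ q″ (cong (_∧ ltᵇ′ q′ q″) (ltᵇ-false na)) (does-refl q) refl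
      (ℚₚ.≤-trans (≤const q q′ q″ 1ℚ (λ u v w → h≤1 (vx q u) (vx q v) (vx q″ w))) (≤-by (0≤⟦⟧ (does (q′ F.≟ q″))) (solve 2 (λ g e → (con 0ℚ :* (:- g) :+ (con 1ℚ :+ e)) :- con 1ℚ := e :- con 0ℚ) refl γ ⟦ does (q′ F.≟ q″) ⟧)))
    ... | tri< _ _ _ | tri≈ nb refl _ = cap-form q q′ q″ (trans (cong (ltᵇ′ q q′ ∧_) (ltᵇ-false nb)) (Boolₚ.∧-zeroʳ (ltᵇ′ q q′))) refl (does-refl q′)
      (ℚₚ.≤-trans (≤const q q′ q″ 1ℚ (λ u v w → h≤1 (vx q u) (vx q′ v) (vx q′ w))) (≤-by (0≤⟦⟧ (does (q F.≟ q′))) (solve 2 (λ g e → (con 0ℚ :* (:- g) :+ (e :+ con 1ℚ)) :- con 1ℚ := e :- con 0ℚ) refl γ ⟦ does (q F.≟ q′) ⟧)))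
    ... | tri> na _ a | _ = cap-form q q′ q″ (cong (_∧ ltᵇ′ q′ q″) (ltᵇ-false na)) refl refl
      (ℚₚ.≤-trans (≤const q q′ q″ 0ℚ (λ u v w → h-zero₁ {vx q u} {vx q′ v} (vx q″ w) (not-before a u v))) (≤-by (0≤⟦⟧ (does (q F.≟ q′)) ⊕ 0≤⟦⟧ (does (q′ F.≟ q″)))
        (solve 3 (λ g d e → (con 0ℚ :* (:- g) :+ (d :+ e)) :- con 0ℚ := (d :+ e) :- (con 0ℚ :+ con 0ℚ)) refl γ ⟦ does (q F.≟ q′) ⟧ ⟦ does (q′ F.≟ q″) ⟧)))
    ... | tri< _ _ _ | tri> nb _ b = cap-form q q′ q″ (trans (cong (ltᵇ′ q q′ ∧_) (ltᵇ-false nb)) (Boolₚ.∧-zeroʳ (ltᵇ′ q q′))) refl refl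
      (ℚₚ.≤-trans (≤const q q′ q″ 0ℚ (λ u v w → h-zero₂ (vx q u) {vx q′ v} {vx q″ w} (not-before b v w))) (≤-by (0≤⟦⟧ (does (q F.≟ q′)) ⊕ 0≤⟦⟧ (does (q′ F.≟ q″)))
        (solve 3 (λ g d e → (con 0ℚ :* (:- g) :+ (d :+ e)) :- con 0ℚ := (d :+ e) :- (con 0ℚ :+ con 0ℚ)) refl γ ⟦ does (q F.≟ q′) ⟧ ⟦ does (q′ F.≟ q″) ⟧)))

    𝔼³ : 𝔼 (λ a → 𝔼 (λ b → 𝔼 (h a b))) ≡ ΣF m (λ q → ΣF m (λ q′ → ΣF m (F³ q q′)))
    𝔼³ = ΣF-cong m (λ q → trans (E-ΣF (B q) m _) (ΣF-cong m (λ q′ →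
      trans (E-cong (B q) (λ u → E-ΣF (B q′) m (λ q″ v → E (B q″) (λ w → h (vx q u) (vx q′ v) (vx q″ w)))))
        (E-ΣF (B q) m (λ q″ u → E (B q′) (λ v → E (B q″) (λ w → h (vx q u) (vx q′ v) (vx q″ w))))))))

    diagonal : ΣF m (λ i → ΣF m (λ j → ⟦ does (i F.≟ j) ⟧)) ≡ ι m
    diagonal = trans (ΣF-swap m m _) (trans (ΣF-cong m (λ j → trans (ΣF-cong m (λ i → sym (ℚₚ.*-identityʳ _))) (ΣF-δ m j (λ _ → 1ℚ)))) (trans (ΣF-const m 1ℚ) (ℚₚ.*-identityʳ (ι m))))

    cap-total : ΣF m (λ q → ΣF m (λ q′ → ΣF m (cap q q′))) ≡ (- γ) * O₃ m (λ _ _ _ → 1ℚ) + (ι m * ι m + ι m * ι m)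
    cap-total = trans (ΣF-cong m (λ q → trans (ΣF-cong m (λ q′ → ΣF-+ m _ _)) (ΣF-+ m _ _))) (trans (ΣF-+ m _ _) (cong₂ _+_
        (trans (ΣF-cong m (λ q → ΣF-cong m (λ q′ → ΣF-cong m (λ q″ → cong (⟦ ltᵇ′ q q′ ∧ ltᵇ′ q′ q″ ⟧ *_) (sym (ℚₚ.*-identityʳ (- γ))))))) (O₃-* m (- γ) (λ _ _ _ → 1ℚ)))
        (trans (ΣF-cong m (λ q → trans (ΣF-cong m (λ q′ → ΣF-+ m _ _)) (ΣF-+ m _ _))) (trans (ΣF-+ m _ _) (cong₂ _+_
          (trans (ΣF-cong m (λ q → trans (ΣF-cong m (λ q′ → ΣF-const m ⟦ does (q F.≟ q′) ⟧)) (ΣF-* m (ι m) _))) (trans (ΣF-* m (ι m) _) (cong (ι m *_) diagonal)))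
          (trans (ΣF-cong m (λ q → diagonal)) (ΣF-const m (ι m))))))))

    -- By `many` the increasing block triples outweigh the 2m² coincidences by 1, so the weighted
    -- sum is at most -s³; by density the random set keeps it above -c.
    sparse : ∀ {c} → (∀ v → p v ≤ 1ℚ) → (∀ (W : Vec Bool N) → - c ≤ O₃ N (λ a b c → inW³ W a b c * f a b c)) →
      ι m * ι m + ι m * ι m + 1ℚ ≤ γ * O₃ m (λ _ _ _ → 1ℚ) → s * (s * s) ≤ c
    sparse {c} p≤1 dense many = ≤-by (subst (- c ≤_) O₃-blocks (bernoulli p 0≤p p≤1 f dense)
        ⊕ ((0s ⊛ 0s ⊛ 0s) ⊗ subst₂ _≤_ (sym 𝔼³) cap-total (ΣF-mono m (λ q → ΣF-mono m (λ q′ → ΣF-mono m (F³≤ q q′)))))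
        ⊕ ((0s ⊛ 0s ⊛ 0s) ⊗ many))
      (solve 6 (λ c s x g o i → c :- s := (s :* x :+ (s :* ((:- g) :* o :+ (i :+ i)) :+ s :* (g :* o))) :- ((:- c) :+ (s :* x :+ s :* (i :+ i :+ con 1ℚ)))) refl
        c (s * (s * s)) (𝔼 (λ a → 𝔼 (λ b → 𝔼 (h a b)))) γ (O₃ m (λ _ _ _ → 1ℚ)) (ι m * ι m))

-- The colours of pairs

un : (V → V → Bool) → V × V → Bool
un u y = u (proj₁ y) (proj₂ y)

triple : ℕ → ℕ
triple zero = zero
triple (suc q) = suc (suc (suc (triple q)))

module Colouring {V : Set} {M : ℕ} where

  Bounds : Set
  Bounds = List (Fin (M ℕ.* (M ℕ.* M)) × Test₃ V)

  -- One bit for each of the three pair tests of every removed box. These bits determine the region: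
  -- `GC` reads from each pair the bit of the role that it plays in the triple.
  cl : (bs : Bounds) → V × V → Bits (triple (length bs))
  cl [] y = []
  cl ((_ , u₁ , u₂ , u₃) ∷ bs) y = un u₁ y ∷ un u₂ y ∷ un u₃ y ∷ cl bs y

  GY : Bounds → Fin (M ℕ.* (M ℕ.* M)) → V × V → V × V → V × V → Bool
  GY [] e y₁ y₂ y₃ = true
  GY ((e′ , u₁ , u₂ , u₃) ∷ bs) e y₁ y₂ y₃ = GY bs e y₁ y₂ y₃ ∧ not (does (e F.≟ e′) ∧ (un u₁ y₁ ∧ (un u₂ y₂ ∧ un u₃ y₃)))

  GC : (bs : Bounds) → Fin (M ℕ.* (M ℕ.* M)) → (d₁ d₂ d₃ : Bits (triple (length bs))) → Bool
  GC [] e _ _ _ = true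
  GC ((e′ , _) ∷ bs) e (a ∷ _ ∷ _ ∷ as) (_ ∷ b ∷ _ ∷ bs′) (_ ∷ _ ∷ c ∷ cs) = GC bs e as bs′ cs ∧ not (does (e F.≟ e′) ∧ (a ∧ (b ∧ c)))

  GY≡GC : ∀ bs e y₁ y₂ y₃ → GY bs e y₁ y₂ y₃ ≡ GC bs e (cl bs y₁) (cl bs y₂) (cl bs y₃)
  GY≡GC [] e y₁ y₂ y₃ = refl
  GY≡GC ((e′ , u₁ , u₂ , u₃) ∷ bs) e y₁ y₂ y₃ = cong (_∧ not (does (e F.≟ e′) ∧ (un u₁ y₁ ∧ (un u₂ y₂ ∧ un u₃ y₃)))) (GY≡GC bs e y₁ y₂ y₃)

  module _ (Y : Fin M × Fin M × Fin M → V → V → V → Bool) (κ : ℚ) where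
    open Removal Y κ

    G≡GY : ∀ bs e x → let (i , j , k) = co {M} e in
      G bs e x ≡ GY bs e (lookup x i , lookup x j) (lookup x i , lookup x k) (lookup x j , lookup x k)
    G≡GY [] e x = refl
    G≡GY ((e′ , u) ∷ bs) e x with e F.≟ e′
    ... | yes refl = cong (λ z → z ∧ not (ev e u x)) (G≡GY bs e x)
    ... | no _ = cong (_∧ true) (G≡GY bs e x)

every-cong : (l : List Z) {f g : Z → Bool} → (∀ {z} → z ∈ l → f z ≡ g z) → every l f ≡ every l g
every-cong [] h = refl
every-cong (z ∷ l) h = cong₂ _∧_ (h (here refl)) (every-cong l (h ∘ there))

^-anti : ∀ {x} → 0ℚ ≤ x → x ≤ 1ℚ → ∀ {m n} → m ℕ.≤ n → x ^ n ≤ x ^ m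
^-anti h k {n = n} z≤n = proj₁ (^≤1 h k n)
^-anti h k (s≤s le) = h ⊗ ^-anti h k le

distinct : {l : List Z} → AllPairs _≢_ l → Distinct l
distinct [] = tt
distinct (h ∷ hs) = h , distinct hs

above? : ∀ {n r} (x : Fin n) (v : Vec (Fin n) r) → Dec (Above x v)
above? x [] = yes tt
above? x (y ∷ v) = (x Fₚ.<? y) ×-dec above? x v

inc? : ∀ {n r} (v : Vec (Fin n) r) → Dec (Inc v)
inc? [] = yes tt
inc? (x ∷ v) = above? x v ×-dec inc? v

inc-lookup : ∀ {n r} (v : Vec (Fin n) r) → Inc v → Mono (lookup v)
inc-lookup (x ∷ v) (h , hs) {F.zero} {F.suc j} _ = go v h j
  where
  go : ∀ {n r} {x : Fin n} (v : Vec (Fin n) r) → Above x v → ∀ j → x F.< lookup v j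
  go (y ∷ v) (h , _) F.zero = h
  go (y ∷ v) (_ , hs) (F.suc j) = go v hs j
inc-lookup (x ∷ v) (h , hs) {F.suc i} {F.suc j} (s≤s k) = inc-lookup v hs k

mono-injective : ∀ {m n} {f : Fin m → Fin n} → Mono f → ∀ {i j} → f i ≡ f j → i ≡ j
mono-injective mf {i} {j} e with Fₚ.<-cmp i j
... | tri< h _ _ = ⊥-elim (<⇒≢F (mf h) e)
... | tri≈ _ h _ = h
... | tri> _ _ h = ⊥-elim (<⇒≢F (mf h) (sym e))

sort₃ : ∀ {n} (Q : Fin n → Fin n → Fin n → Set) → (∀ {i j k} → Q i j k → Q j i k) → (∀ {i j k} → Q i j k → Q i k j) →
  (∀ i j k → i F.< j → j F.< k → Q i j k) → ∀ {i j k} → i ≢ j → j ≢ k → i ≢ k → Q i j k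
sort₃ Q s₁₂ s₂₃ h {i} {j} {k} ij jk ik with Fₚ.<-cmp i j | Fₚ.<-cmp j k | Fₚ.<-cmp i k
... | tri≈ _ e _ | _ | _ = ⊥-elim (ij e)
... | _ | tri≈ _ e _ | _ = ⊥-elim (jk e)
... | _ | _ | tri≈ _ e _ = ⊥-elim (ik e)
... | tri< a _ _ | tri< b _ _ | _ = h i j k a b
... | tri< a _ _ | tri> _ _ b | tri< c _ _ = s₂₃ (h i k j c b)
... | tri< a _ _ | tri> _ _ b | tri> _ _ c = s₂₃ (s₁₂ (h k i j c a))
... | tri> _ _ a | tri< b _ _ | tri< c _ _ = s₁₂ (h j i k a c)
... | tri> _ _ a | tri< b _ _ | tri> _ _ c = s₁₂ (s₂₃ (h j k i b c))
... | tri> _ _ a | tri> _ _ b | _ = s₁₂ (s₂₃ (s₁₂ (h k j i b a)))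

adj-distinct : ∀ {n} (H : 3Graph n) {x y z} → Adj H x y z → x ≢ y × y ≢ z × x ≢ z
adj-distinct H (inj₁ (a , b , _)) = <⇒≢F a , <⇒≢F b , <⇒≢F (Fₚ.<-trans a b)
adj-distinct H (inj₂ (inj₁ (a , b , _))) = <⇒≢F (Fₚ.<-trans a b) , ≢-sym (<⇒≢F b) , <⇒≢F a
adj-distinct H (inj₂ (inj₂ (inj₁ (a , b , _)))) = ≢-sym (<⇒≢F a) , <⇒≢F (Fₚ.<-trans a b) , <⇒≢F b
adj-distinct H (inj₂ (inj₂ (inj₂ (inj₁ (a , b , _))))) = ≢-sym (<⇒≢F (Fₚ.<-trans a b)) , <⇒≢F a , ≢-sym (<⇒≢F b)
adj-distinct H (inj₂ (inj₂ (inj₂ (inj₂ (inj₁ (a , b , _)))))) = <⇒≢F b , ≢-sym (<⇒≢F (Fₚ.<-trans a b)) , ≢-sym (<⇒≢F a)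
adj-distinct H (inj₂ (inj₂ (inj₂ (inj₂ (inj₂ (a , b , _)))))) = ≢-sym (<⇒≢F b) , ≢-sym (<⇒≢F a) , ≢-sym (<⇒≢F (Fₚ.<-trans a b))

contains-from : ∀ {n N} (H : 3Graph N) (H₀ : 3Graph n) (π : Ordering n) (F₀ : Fin n → Fin N) → Mono F₀ →
  (∀ i j k → i F.< j → j F.< k → Adj H₀ (π ⟨$⟩ʳ i) (π ⟨$⟩ʳ j) (π ⟨$⟩ʳ k) → Adj H (F₀ i) (F₀ j) (F₀ k)) → Contains H H₀
contains-from H H₀ π F₀ mf h = (λ x → F₀ (π ⟨$⟩ˡ x)) , (λ e → inj (mono-injective mf e)) ,
  λ x y z adj → let (xy , yz , xz) = adj-distinct H₀ adj in
    sort₃ (λ i j k → Adj H₀ (π ⟨$⟩ʳ i) (π ⟨$⟩ʳ j) (π ⟨$⟩ʳ k) → Adj H (F₀ i) (F₀ j) (F₀ k))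
      (λ q a → adj-swap₁₂ H (q (adj-swap₁₂ H₀ a))) (λ q a → adj-swap₂₃ H (q (adj-swap₂₃ H₀ a))) h
      (λ e → xy (inj e)) (λ e → yz (inj e)) (λ e → xz (inj e))
      (subst₂ (λ u v → Adj H₀ u v (π ⟨$⟩ʳ (π ⟨$⟩ˡ z))) (sym (Perm.inverseʳ π)) (sym (Perm.inverseʳ π)) (subst (Adj H₀ x y) (sym (Perm.inverseʳ π)) adj))
  where
  inj : ∀ {x y} → π ⟨$⟩ˡ x ≡ π ⟨$⟩ˡ y → x ≡ y
  inj {x} {y} e = trans (sym (Perm.inverseʳ π)) (trans (cong (π ⟨$⟩ʳ_) e) (Perm.inverseʳ π))

module Image {n M : ℕ} (H₀ : 3Graph n) (π : Ordering n) (f : Fin n → Fin M) where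

  Hit : Fin (M ℕ.* (M ℕ.* M)) → Set
  Hit e = Σ (Fin n) λ i → Σ (Fin n) λ j → Σ (Fin n) λ k → (i F.< j × j F.< k × Adj H₀ (π ⟨$⟩ʳ i) (π ⟨$⟩ʳ j) (π ⟨$⟩ʳ k)) × e ≡ tri (f i , f j , f k)

  hit? : ∀ e → Dec (Hit e)
  hit? e = Fₚ.any? λ i → Fₚ.any? λ j → Fₚ.any? λ k → ((i Fₚ.<? j) ×-dec ((j Fₚ.<? k) ×-dec adj? H₀ _ _ _)) ×-dec (e F.≟ tri (f i , f j , f k))

  -- The block triples that carry edges of the copy; filtering a list without repetitions keeps them
  -- distinct, as `remove` requires.
  image : List (Fin (M ℕ.* (M ℕ.* M)))
  image = List.filter hit? (List.allFin (M ℕ.* (M ℕ.* M)))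

  image-length : length image ℕ.≤ M ℕ.* (M ℕ.* M)
  image-length = ℕₚ.≤-trans (Listₚ.length-filter hit? (List.allFin _)) (ℕₚ.≤-reflexive (Listₚ.length-tabulate id))

  image-distinct : Distinct image
  image-distinct = distinct (Uniqueₚ.filter⁺ hit? (Uniqueₚ.allFin⁺ (M ℕ.* (M ℕ.* M))))

  image-hit : ∀ {e} → e ∈ image → Hit e
  image-hit m = proj₂ (Memₚ.∈-filter⁻ hit? {xs = List.allFin _} m)

  hit-image : ∀ {e} → Hit e → e ∈ image
  hit-image h = Memₚ.∈-filter⁺ hit? (Memₚ.∈-allFin _) h

  image-inc : Mono f → ∀ {e} → e ∈ image → Increasing (co {M} e)
  image-inc mf m with image-hit m
  ... | i , j , k , (ij , jk , _) , refl = subst Increasing (sym (co-tri (f i , f j , f k))) (mf ij , mf jk)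
-- The upper bound

module Coupled {V : Set} {M : ℕ} (Y : Fin M × Fin M × Fin M → V → V → V → Bool) (κ : ℚ) (A : Fin M → Mean V) where
  open Removal Y κ public
  open Colouring {V} {M} public

  P : ℕ
  P = M ℕ.* M

  colours : ∀ q → Enumerated (Bits (triple q))
  colours q = enumV enumBool (triple q)

  indices : ∀ q → List ((Fin M × Fin M) × Bits (triple q))
  indices q = List.cartesianProduct (List.cartesianProduct (List.allFin M) (List.allFin M)) (Enumerated.all (colours q))

  pairF : (bs : Bounds) → (Fin M × Fin M) × Bits (triple (length bs)) → Vec V M → ℚ
  pairF bs ((i , j) , c) x = ⟦ Enumerated.eq (colours (length bs)) (cl bs (lookup x i , lookup x j)) c ⟧

  cols : Bounds → List (Vec V M → ℚ)
  cols bs = map (pairF bs) (indices (length bs))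

  cols-length : ∀ bs → length (cols bs) ≡ length (indices (length bs))
  cols-length bs = Listₚ.length-map (pairF bs) (indices (length bs))

  cols-bounds : ∀ bs → All (λ φ → ∀ x → 0ℚ ≤ φ x × φ x ≤ 2ℚ) (cols bs)
  cols-bounds bs = Allₚ.map⁺ (All.universal (λ { ((i , j) , c) x →
    0≤⟦⟧ (Enumerated.eq (colours (length bs)) (cl bs (lookup x i , lookup x j)) c) ,
    ℚₚ.≤-trans (⟦⟧≤1 (Enumerated.eq (colours (length bs)) (cl bs (lookup x i , lookup x j)) c)) (ι-mono {1} {2} (s≤s z≤n)) }) (indices (length bs)))

  prs : Fin P → Fin M × Fin M
  prs = F.remQuot M

  -- The region for independent pairs: each pair of blocks has its own two points, which need not
  -- agree between pairs sharing a block.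
  GV : Bounds → Fin N₃ → Vec (V × V) P → Bool
  GV bs e y = GY bs e (lookup y (F.combine i j)) (lookup y (F.combine i k)) (lookup y (F.combine j k))
    where
    i = proj₁ (co {M} e)
    j = proj₁ (proj₂ (co {M} e))
    k = proj₂ (proj₂ (co {M} e))

  GCV : (bs : Bounds) → Fin N₃ → Vec (Bits (triple (length bs))) P → Bool
  GCV bs e d = GC bs e (lookup d (F.combine i j)) (lookup d (F.combine i k)) (lookup d (F.combine j k))
    where
    i = proj₁ (co {M} e)
    j = proj₁ (proj₂ (co {M} e))
    k = proj₂ (proj₂ (co {M} e))

  module _ (bs : Bounds) {ζ : ℚ} (0ζ : 0ℚ < ζ) (ζ1 : ζ ≤ 1ℚ) (regs : All (Reg ζ ζ A) (cols bs)) where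

    𝒞 = colours (length bs)

    c₀ : Bits (triple (length bs))
    c₀ = Vec.replicate _ false

    pair-regular : ∀ i j → i F.< j → ∀ c (u v : V → Bool) →
      E (A i) (λ a → E (A j) (λ b → ⟦ Enumerated.eq 𝒞 (cl bs (a , b)) c ⟧)) * (E (A i) (λ a → ⟦ u a ⟧) * E (A j) (λ b → ⟦ v b ⟧))
        ≤ E (A i) (λ a → E (A j) (λ b → ⟦ Enumerated.eq 𝒞 (cl bs (a , b)) c ⟧ * (⟦ u a ⟧ * ⟦ v b ⟧))) + ζ
    pair-regular i j ij c = pairReg i j (<⇒≢F ij) 0ζ ζ1 (λ a b → ⟦ Enumerated.eq 𝒞 (cl bs (a , b)) c ⟧)
      (λ a b → 0≤⟦⟧ (Enumerated.eq 𝒞 (cl bs (a , b)) c)) (λ a b → ⟦⟧≤1 (Enumerated.eq 𝒞 (cl bs (a , b)) c))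
      (All.lookup (Allₚ.map⁻ regs) {x = (i , j) , c} (Memₚ.∈-cartesianProduct⁺ (Memₚ.∈-cartesianProduct⁺ (Memₚ.∈-allFin i) (Memₚ.∈-allFin j)) (Enumerated.complete 𝒞 c)))

    open Decouple 𝒞 A (cl bs) c₀ 0ζ pair-regular

    prs-inj : Inj prs
    prs-inj p p′ _ e = trans (sym (Fₚ.combine-remQuot {M} M p)) (trans (cong (λ z → F.combine (proj₁ z) (proj₂ z)) e) (Fₚ.combine-remQuot {M} M p′))

    col-inc : ∀ p y → Inc₂ p → col p y ≡ cl bs y
    col-inc p y inc = go (inc₂? p)
      where
      go : (d : Dec (Inc₂ p)) → (if does d then cl bs y else c₀) ≡ cl bs y
      go (yes _) = refl
      go (no h) = ⊥-elim (h inc)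

    lookup-colsX : ∀ {n} (pr : Fin n → Fin M × Fin M) x p → lookup (colsX pr x) p ≡ col (pr p) (pairOf (pr p) x)
    lookup-colsX pr x F.zero = refl
    lookup-colsX pr x (F.suc p) = lookup-colsX (pr ∘ F.suc) x p

    lookup-colsY : ∀ {n} (pr : Fin n → Fin M × Fin M) (y : Vec (V × V) n) p → lookup (colsY pr y) p ≡ col (pr p) (lookup y p)
    lookup-colsY pr (y ∷ ys) F.zero = refl
    lookup-colsY pr (y ∷ ys) (F.suc p) = lookup-colsY (pr ∘ F.suc) ys p

    atX : ∀ {i j} → i F.< j → ∀ x → lookup (colsX prs x) (F.combine i j) ≡ cl bs (lookup x i , lookup x j)
    atX {i} {j} ij x = trans (lookup-colsX prs x (F.combine i j)) (trans (cong (λ p → col p (pairOf p x)) (Fₚ.remQuot-combine i j)) (col-inc (i , j) _ ij))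

    atY : ∀ {i j} → i F.< j → ∀ y → lookup (colsY prs y) (F.combine i j) ≡ cl bs (lookup y (F.combine i j))
    atY {i} {j} ij y = trans (lookup-colsY prs y (F.combine i j)) (trans (cong (λ p → col p (lookup y (F.combine i j))) (Fₚ.remQuot-combine i j)) (col-inc (i , j) _ ij))

    GCV-X : ∀ e → Increasing (co {M} e) → ∀ x → GCV bs e (colsX prs x) ≡ G bs e x
    GCV-X e (p , q) x = trans (trans (cong₂ (λ s t → GC bs e s t (lookup (colsX prs x) (F.combine j k))) (atX p x) (atX (Fₚ.<-trans p q) x)) (cong (GC bs e _ _) (atX q x)))
      (sym (trans (G≡GY Y κ bs e x) (GY≡GC bs e _ _ _)))
      where
      j = proj₁ (proj₂ (co {M} e))
      k = proj₂ (proj₂ (co {M} e))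

    GCV-Y : ∀ e → Increasing (co {M} e) → ∀ y → GCV bs e (colsY prs y) ≡ GV bs e y
    GCV-Y e (p , q) y = trans (trans (cong₂ (λ s t → GC bs e s t (lookup (colsY prs y) (F.combine j k))) (atY p y) (atY (Fₚ.<-trans p q) y)) (cong (GC bs e _ _) (atY q y)))
      (sym (GY≡GC bs e _ _ _))
      where
      j = proj₁ (proj₂ (co {M} e))
      k = proj₂ (proj₂ (co {M} e))

    labels : Mean (Vec (V × V) P)
    labels = Π (λ p → A (proj₁ (prs p)) ⊠ A (proj₂ (prs p)))

    error : ℚ
    error = ι (length (allV 𝒞 P)) * (ι P * ζ)

    all-G : ∀ (b : Bool) es → (∀ {e} → e ∈ es → Increasing (co {M} e)) →
      E labels (λ y → ⟦ b ∧ every es (λ e → GV bs e y) ⟧) ≤ E (Π A) (λ x → ⟦ b ∧ every es (λ e → G bs e x) ⟧) + error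
    all-G b es inc = subst₂ _≤_
      (E-cong labels (λ y → cong (λ z → ⟦ b ∧ z ⟧) (every-cong es (λ {e} m → GCV-Y e (inc m) y))))
      (cong (_+ error) (E-cong (Π A) (λ x → cong (λ z → ⟦ b ∧ z ⟧) (every-cong es (λ {e} m → GCV-X e (inc m) x)))))
      (decouple prs prs-inj (λ d → ⟦ b ∧ every es (λ e → GCV bs e d) ⟧) (λ d → 0≤⟦⟧ (b ∧ every es (λ e → GCV bs e d))) (λ d → ⟦⟧≤1 (b ∧ every es (λ e → GCV bs e d))))

    -- `decouple` applied to the negated indicator gives the direction opposite to `all-G`.
    one-G : ∀ e → Increasing (co {M} e) → E (Π A) (λ x → ⟦ G bs e x ⟧) ≤ E labels (λ y → ⟦ GV bs e y ⟧) + error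
    one-G e inc = ≤-by nots (solve 3 (λ a l r → (l :+ r) :- a := (con 1ℚ :- a :+ r) :- (con 1ℚ :- l)) refl (E (Π A) (λ x → ⟦ G bs e x ⟧)) (E labels (λ y → ⟦ GV bs e y ⟧)) error)
      where
      nots : 1ℚ - E labels (λ y → ⟦ GV bs e y ⟧) ≤ 1ℚ - E (Π A) (λ x → ⟦ G bs e x ⟧) + error
      nots = subst₂ _≤_
        (trans (E-cong labels (λ y → cong (λ z → ⟦ not z ⟧) (GCV-Y e inc y))) (E-not labels (GV bs e)))
        (cong (_+ error) (trans (E-cong (Π A) (λ x → cong (λ z → ⟦ not z ⟧) (GCV-X e inc x))) (E-not (Π A) (G bs e))))
        (decouple prs prs-inj (λ d → ⟦ not (GCV bs e d) ⟧) (λ d → 0≤⟦⟧ (not (GCV bs e d))) (λ d → ⟦⟧≤1 (not (GCV bs e d))))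

module Forbidden {V : Set} {n N M : ℕ} (H : 3Graph N) (H₀ : 3Graph n) (free : ¬ Contains H H₀)
  (vx : Fin M → V → Fin N) (ordered : ∀ {q q′} → q F.< q′ → ∀ u v → vx q u F.< vx q′ v)
  {κ : ℚ} (0κ : 0ℚ ≤ κ) (κ1 : κ ≤ 1ℚ) (A : Fin M → Mean V) where

  Y : Fin M × Fin M × Fin M → V → V → V → Bool
  Y (i , j , k) a b c = edge H (vx i a) (vx j b) (vx k c)

  open Coupled Y κ A public

  X-tri : ∀ i j k x → X (tri (i , j , k)) x ≡ edge H (vx i (lookup x i)) (vx j (lookup x j)) (vx k (lookup x k))
  X-tri i j k x = cong (λ t → at₃ (Y t) t x) (co-tri (i , j , k))

  no-copy : ∀ (π : Ordering n) (f : Fin n → Fin M) → Mono f → ∀ x → every (Image.image H₀ π f) (λ e → X e x) ≡ true → ⊥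
  no-copy π f mf x h = free (contains-from H H₀ π (λ i → vx (f i) (lookup x (f i))) (λ lt → ordered (mf lt) _ _)
    λ i j k ij jk adj → inj₁ (ordered (mf ij) _ _ , ordered (mf jk) _ _ ,
      trans (sym (X-tri (f i) (f j) (f k) x)) (every-elim (Image.image H₀ π f) h (Image.hit-image H₀ π f (i , j , k , (ij , jk , adj) , refl)))))

  every-X : ∀ bs es x → every es (λ e → X e x ∧ G bs e x) ≡ true → every es (λ e → X e x) ≡ true
  every-X bs es x h = every-intro es (λ m → proj₁ (∧-true (every-elim es h m)))

  -- In an H₀-free graph the product of the factors `X` vanishes identically. So `remove` bounds κ^l
  -- times this mean by l δ, where l, the number of triples hit, is at most `N₃`.
  rare : ∀ bs {δ ρ} → 0ℚ ≤ δ → Tight δ A bs → 0ℚ < κ → ι N₃ * δ ≤ κ ^ N₃ * ρ → ∀ (π : Ordering n) (f : Fin n → Fin M) → Mono f →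
    E (Π A) (λ x → ⟦ every (Image.image H₀ π f) (λ e → G bs e x) ⟧) ≤ ρ
  rare bs {δ} {ρ} 0δ tight 0<κ small π f mf = *-cancel (0<^ 0<κ N₃) (≤-by
      (subst (λ z → κ ^ length es * e₀ ≤ z + ι (length es) * δ) zero′ (remove A bs tight 0κ κ1 0δ es incs (Image.image-distinct H₀ π f) (λ _ → true) nices)
       ⊕ (0e₀ ⊗ ^-anti 0κ κ1 (Image.image-length H₀ π f)) ⊕ (0δ ⊗ ι-mono (Image.image-length H₀ π f)) ⊕ small)
      (solve 7 (λ k k′ e l d n r → k′ :* r :- k′ :* e := (con 0ℚ :+ l :* d :+ (e :* k :+ (d :* n :+ k′ :* r))) :- (k :* e :+ (e :* k′ :+ (d :* l :+ n :* d)))) refl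
        (κ ^ length es) (κ ^ N₃) e₀ (ι (length es)) δ (ι N₃) ρ))
    where
    es = Image.image H₀ π f
    e₀ = E (Π A) (λ x → ⟦ every es (λ e → G bs e x) ⟧)
    0e₀ : 0ℚ ≤ e₀
    0e₀ = E-nonneg (Π A) (λ x → 0≤⟦⟧ (every es (λ e → G bs e x)))
    incs : All (λ e → Increasing (co {M} e)) es
    incs = All.tabulate (Image.image-inc H₀ π f mf)
    nices : All (λ e → Nice (co {M} e) (λ (_ : Vec V M) → true)) es
    nices = All.universal (λ e → nice-true (co {M} e)) es
    zero′ : E (Π A) (λ x → ⟦ true ∧ every es (λ e → X e x ∧ G bs e x) ⟧) ≡ 0ℚ
    zero′ = trans (E-cong (Π A) (λ x → z x)) (E-const (Π A) 0ℚ)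
      where
      z : ∀ x → ⟦ every es (λ e → X e x ∧ G bs e x) ⟧ ≡ 0ℚ
      z x with every es (λ e → X e x ∧ G bs e x) in eq
      ... | true = ⊥-elim (no-copy π f mf x (every-X bs es x eq))
      ... | false = refl

  -- For indicators x and g, x ≤ g + κ + (x - κ)(1 - g); the last term is `excess`, whose mean is
  -- not positive.
  X≤G : ∀ bs e → E (Π A) (excess bs e) ≤ 0ℚ → E (Π A) (λ x → ⟦ X e x ⟧) ≤ E (Π A) (λ x → ⟦ G bs e x ⟧) + κ
  X≤G bs e h = ≤-by (mean-bound ⊕ h)
      (solve 4 (λ g k x z → (g :+ k) :- x := ((g :+ k :+ z) :+ con 0ℚ) :- (x :+ z)) refl
        (E (Π A) (λ x → ⟦ G bs e x ⟧)) κ (E (Π A) (λ x → ⟦ X e x ⟧)) (E (Π A) (excess bs e)))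
    where
    bit : ∀ x g → 0ℚ ≤ g → x ≤ 1ℚ → g ≤ 1ℚ → x ≤ (g + κ) + (x - κ) * (1ℚ - g)
    bit x g 0g x1 g1 = ≤-by ((0g ⊛ 0≤- x1) ⊕ (0κ ⊛ 0g)) (solve 3 (λ x g k → (g :+ k) :+ (x :- k) :* (con 1ℚ :- g) :- x := (g :* (con 1ℚ :- x) :+ k :* g) :- (con 0ℚ :+ con 0ℚ)) refl x g κ)
    mean-bound : E (Π A) (λ x → ⟦ X e x ⟧) ≤ (E (Π A) (λ x → ⟦ G bs e x ⟧) + κ) + E (Π A) (excess bs e)
    mean-bound = subst (E (Π A) (λ x → ⟦ X e x ⟧) ≤_) (trans (E-+ (Π A) (λ x → ⟦ G bs e x ⟧ + κ) (excess bs e)) (cong (_+ E (Π A) (excess bs e)) (E-+c (Π A) (λ x → ⟦ G bs e x ⟧) κ)))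
      (E-mono (Π A) (λ x → bit ⟦ X e x ⟧ ⟦ G bs e x ⟧ (0≤⟦⟧ (G bs e x)) (⟦⟧≤1 (X e x)) (⟦⟧≤1 (G bs e x))))

module Final {n : ℕ} (H₀ : 3Graph n) (rl : SplitCondition H₀ R L) (tl : SplitCondition H₀ T L) {g q d : ℚ} (0g : 0ℚ < g) (g1 : g ≤ 1ℚ) (0d : 0ℚ ≤ d)
  (gap : q + ι 16 * g ≤ d) (M₀ : ℕ) (red : ReducedFor n (q + ι 12 * g) M₀) (m₁ M : ℕ)
  (many : ι (M₀ ℕ.+ m₁) * ι (M₀ ℕ.+ m₁) + ι (M₀ ℕ.+ m₁) * ι (M₀ ℕ.+ m₁) + 1ℚ ≤ g * O₃ (M₀ ℕ.+ m₁) (λ _ _ _ → 1ℚ)) (ram : Ramsey 3 (M₀ ℕ.+ m₁) M) where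

  splitOf : ∀ {ℓ₁ ℓ₂} → Pattern ℓ₁ ℓ₂ → SplitCondition H₀ ℓ₁ ℓ₂
  splitOf = splitFor rl tl

  orderOf : ∀ {ℓ₁ ℓ₂} → Pattern ℓ₁ ℓ₂ → Ordering n
  orderOf {ℓ₁} {ℓ₂} Q = orderingOf {H = H₀} {ℓ₁} {ℓ₂} (splitOf Q)

  orders : List (Ordering n)
  orders = orderOf RL ∷ orderOf TL ∷ orderOf TR ∷ []

  order-∈ : ∀ {ℓ₁ ℓ₂} (Q : Pattern ℓ₁ ℓ₂) → orderOf Q ∈ orders
  order-∈ RL = here refl
  order-∈ TL = there (here refl)
  order-∈ TR = there (there (here refl))

  patterns : List (Ordering n × Vec (Fin M) n)
  patterns = List.cartesianProduct orders (allVecs (List.allFin M) n)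

  module _ {K : ℕ} {θ τ ρ δ : ℚ} (0θ : 0ℚ < θ)
    (size : ι (M ℕ.* (M ℕ.* M)) + (ι (M ℕ.* (M ℕ.* M)) + 1ℚ) ≤ ι (suc K) * (θ * θ)) (Pθ : ι (M ℕ.* M) * θ ≤ g)
    (0τ : 0ℚ < τ) (τ-small : ι (suc K) ^ (M ℕ.* M) * (2ℚ ^ (M ℕ.* M) * τ) < 1ℚ)
    (0ρ : 0ℚ ≤ ρ) (ρg : ρ ≤ g) (cnt : ι (length patterns) * (ρ + ρ) ≤ τ) (0δ : 0ℚ ≤ δ)
    (δ-small : ι (M ℕ.* (M ℕ.* M)) * δ ≤ g ^ (M ℕ.* (M ℕ.* M)) * ρ)
    {V : Set} {N : ℕ} (H : 3Graph N) (free : ¬ Contains H H₀) (vx : Fin M → V → Fin N) (ordered : ∀ {q q′} → q F.< q′ → ∀ u v → vx q u F.< vx q′ v)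
    (A : Fin M → Mean V) where

    open Forbidden H H₀ free vx ordered (ℚₚ.<⇒≤ 0g) g1 A

    module _ (bs : Bounds) (tight : Tight δ A bs) {ζ : ℚ} (0ζ : 0ℚ < ζ) (ζ1 : ζ ≤ 1ℚ) (regs : All (Reg ζ ζ A) (cols bs))
      (err : error bs 0ζ ζ1 regs ≤ ρ) (neg : ∀ e → E (Π A) (excess bs e) ≤ 0ℚ) where

      ν : Mean (Vec (V × V) P)
      ν = labels bs 0ζ ζ1 regs

      -- Tuples that are not increasing are switched off, so that `patterns` can simply list all
      -- tuples.
      hpat : Ordering n × Vec (Fin M) n → Vec (V × V) P → Bool
      hpat (π , v) y = does (inc? v) ∧ every (Image.image H₀ π (lookup v)) (λ e → GV bs e y)

      hpat-rare : ∀ z → E ν (λ y → ⟦ hpat z y ⟧) ≤ ρ + ρ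
      hpat-rare (π , v) = go (inc? v)
        where
        go : (D : Dec (Inc v)) → E ν (λ y → ⟦ does D ∧ every (Image.image H₀ π (lookup v)) (λ e → GV bs e y) ⟧) ≤ ρ + ρ
        go (yes inc) = ℚₚ.≤-trans (all-G bs 0ζ ζ1 regs true (Image.image H₀ π (lookup v)) (Image.image-inc H₀ π (lookup v) (inc-lookup v inc)))
          (rare bs 0δ tight 0g δ-small π (lookup v) (inc-lookup v inc) ⊕ err)
        go (no _) = ℚₚ.≤-trans (ℚₚ.≤-reflexive (E-const ν 0ℚ)) (0ρ ⊕ 0ρ)

      h : Vec (V × V) P → ℚ
      h y = ΣL patterns (λ z → ⟦ hpat z y ⟧)

      h0 : ∀ y → 0ℚ ≤ h y
      h0 y = subst (_≤ h y) (trans (ΣL-const patterns 0ℚ) (ℚₚ.*-zeroʳ (ι (length patterns)))) (ΣL-mono patterns (λ z → 0≤⟦⟧ (hpat z y)))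

      h-rare : E ν h ≤ τ
      h-rare = ℚₚ.≤-trans (subst₂ _≤_ (sym (E-ΣL ν patterns (λ z y → ⟦ hpat z y ⟧))) (ΣL-const patterns (ρ + ρ)) (ΣL-mono patterns hpat-rare)) cnt

      sampled : Σ (Fin P → Vec (V × V) (suc K)) λ ys →
        (∀ e → E ν (λ y → ⟦ GV bs e y ⟧) ≤ E (Π (λ p → avg (ys p))) (λ y → ⟦ GV bs e y ⟧) + ι P * θ) × E (Π (λ p → avg (ys p))) h ≤ 2ℚ ^ P * τ
      sampled = sample P N₃ K 0θ size (λ p → A (proj₁ (prs p)) ⊠ A (proj₂ (prs p))) (λ e y → ⟦ GV bs e y ⟧) (λ e y → 0≤⟦⟧ (GV bs e y)) (λ e y → ⟦⟧≤1 (GV bs e y)) h h0 0τ h-rare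

      ys = proj₁ sampled

      emp : Fin N₃ → ℚ
      emp e = E (Π (λ p → avg (ys p))) (λ y → ⟦ GV bs e y ⟧)

      -- `h` is a sum of indicators, so a value below 1 means that no pattern occurs at this choice
      -- of sample points.
      h-zero : ∀ ks → h (pick ys ks) < 1ℚ
      h-zero ks = ℚₚ.≤-<-trans (ℚₚ.≤-trans (atom ys h h0 ks) (ℚₚ.<⇒≤ (0<^ (0<ι K) P) ⊗ proj₂ (proj₂ sampled))) τ-small

      G′ : Reduced M (Fin (suc K))
      G′ i j k a b c = GY bs (tri (i , j , k)) (lookup (ys (F.combine i j)) a) (lookup (ys (F.combine i k)) b) (lookup (ys (F.combine j k)) c)

      GV-tri : ∀ (i j k : Fin M) y → GV bs (tri (i , j , k)) y ≡ GY bs (tri (i , j , k)) (lookup y (F.combine i j)) (lookup y (F.combine i k)) (lookup y (F.combine j k))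
      GV-tri i j k y = cong (λ t → GY bs (tri (i , j , k)) (lookup y (F.combine (proj₁ t) (proj₁ (proj₂ t)))) (lookup y (F.combine (proj₁ t) (proj₂ (proj₂ t)))) (lookup y (F.combine (proj₁ (proj₂ t)) (proj₂ (proj₂ t))))) (co-tri (i , j , k))

      emp≡E₃ : ∀ (i j k : Fin M) → i F.< j → j F.< k → emp (tri (i , j , k)) ≡ E (unif K) (λ a → E (unif K) (λ b → E (unif K) (λ c → ⟦ G′ i j k a b c ⟧)))
      emp≡E₃ i j k ij jk = trans (E-cong (Π (λ p → avg (ys p))) (λ y → cong ⟦_⟧ (GV-tri i j k y)))
        (trans (marginal₃ (λ p → avg (ys p)) {F.combine i j} {F.combine i k} {F.combine j k}
            (λ e → <⇒≢F jk (proj₂ (Fₚ.combine-injective i j i k e))) (λ e → <⇒≢F ij (proj₁ (Fₚ.combine-injective i j j k e))) (λ e → <⇒≢F ij (proj₁ (Fₚ.combine-injective i k j k e)))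
            (λ a b c → ⟦ GY bs (tri (i , j , k)) a b c ⟧))
        (trans (E-avg-unif (ys (F.combine i j)) _) (E-cong (unif K) (λ a → trans (E-avg-unif (ys (F.combine i k)) _) (E-cong (unif K) (λ b → E-avg-unif (ys (F.combine j k)) _))))))

      no-found : Found n G′ → ⊥
      no-found F = <≤⊥ (h-zero ks) (ℚₚ.≤-trans (ℚₚ.≤-reflexive (sym one)) (ΣL-∈ patterns {f = λ z → ⟦ hpat z (pick ys ks) ⟧} (λ z → 0≤⟦⟧ (hpat z (pick ys ks))) z∈))
        where
        open Found F
        π = orderOf pattern′
        tr = transfer {H₀ = H₀} G′ (splitOf pattern′) embed g₁ g₂ agree real₁ real₂
        lab = proj₁ tr
        v : Vec (Fin M) n
        v = Vec.tabulate embed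
        inc : Inc v
        inc = inc-tabulate embed embed-mono
        z∈ : (π , v) ∈ patterns
        z∈ = Memₚ.∈-cartesianProduct⁺ (order-∈ pattern′) (∈-allVecs Memₚ.∈-allFin v)
        index? : ∀ a → Dec (Σ (Fin n) λ i → embed i ≡ a)
        index? a = Fₚ.any? (λ i → embed i F.≟ a)
        at : ∀ {a b} → Dec (Σ (Fin n) λ i → embed i ≡ a) → Dec (Σ (Fin n) λ i → embed i ≡ b) → Fin (suc K)
        at (yes (i , _)) (yes (j , _)) = lab (i , j)
        -- Pairs of blocks outside the copy may take any sample point.
        at _ _ = F.zero
        at-embed : ∀ i j (da : Dec (Σ (Fin n) λ i′ → embed i′ ≡ embed i)) (db : Dec (Σ (Fin n) λ j′ → embed j′ ≡ embed j)) → at da db ≡ lab (i , j)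
        at-embed i j (yes (i′ , e)) (yes (j′ , e′)) = cong₂ (λ s t → lab (s , t)) (mono-injective embed-mono e) (mono-injective embed-mono e′)
        at-embed i j (no h) _ = ⊥-elim (h (i , refl))
        at-embed i j (yes _) (no h) = ⊥-elim (h (j , refl))
        ks : Vec (Fin (suc K)) P
        ks = Vec.tabulate (λ p → at (index? (proj₁ (prs p))) (index? (proj₂ (prs p))))
        ks-at : ∀ i j → lookup ks (F.combine (embed i) (embed j)) ≡ lab (i , j)
        ks-at i j = trans (Vecₚ.lookup∘tabulate _ (F.combine (embed i) (embed j)))
          (trans (cong (λ p → at (index? (proj₁ p)) (index? (proj₂ p))) (Fₚ.remQuot-combine (embed i) (embed j))) (at-embed i j (index? (embed i)) (index? (embed j))))
        y-at : ∀ i j → lookup (pick ys ks) (F.combine (embed i) (embed j)) ≡ lookup (ys (F.combine (embed i) (embed j))) (lab (i , j))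
        y-at i j = trans (lookup-pick ys ks (F.combine (embed i) (embed j))) (cong (lookup (ys (F.combine (embed i) (embed j)))) (ks-at i j))
        edge-ok : ∀ {e} → Image.Hit H₀ π (lookup v) e → GV bs e (pick ys ks) ≡ true
        edge-ok (i , j , k , (ij , jk , adj) , refl) = trans (cong (λ e → GV bs e (pick ys ks)) (cong (tri {M}) (cong₂ _,_ (Vecₚ.lookup∘tabulate embed i) (cong₂ _,_ (Vecₚ.lookup∘tabulate embed j) (Vecₚ.lookup∘tabulate embed k)))))
          (trans (GV-tri (embed i) (embed j) (embed k) (pick ys ks))
            (trans (trans (cong₂ (λ s t → GY bs (tri {M} (embed i , embed j , embed k)) s t (lookup (pick ys ks) (F.combine (embed j) (embed k)))) (y-at i j) (y-at i k)) (cong (GY bs (tri {M} (embed i , embed j , embed k)) _ _) (y-at j k)))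
              (proj₂ tr i j k ij jk adj)))
        one : ⟦ hpat (π , v) (pick ys ks) ⟧ ≡ 1ℚ
        one = cong ⟦_⟧ (cong₂ _∧_ (Dec.dec-true (inc? v) inc) (every-intro (Image.image H₀ π (lookup v)) (λ m → edge-ok (Image.image-hit H₀ π (lookup v) m))))

      m₂ : ℕ
      m₂ = M₀ ℕ.+ m₁

      -- The origin of 16 in `gap`: 12g for the reduced hypergraph, one g each for the removal (κ is
      -- g), the decoupling error and the sampling error, and one g left over as the deficit.
      X-small : ∀ (i j k : Fin M) → i F.< j → j F.< k → emp (tri (i , j , k)) ≤ q + ι 12 * g →
        E (A i) (λ a → E (A j) (λ b → E (A k) (λ c → ⟦ edge H (vx i a) (vx j b) (vx k c) ⟧ - d))) ≤ - g
      X-small i j k ij jk low = subst (_≤ - g) (sym value) (≤-by (X≤G bs e (neg e) ⊕ one-G bs 0ζ ζ1 regs e inc ⊕ proj₁ (proj₂ sampled) e ⊕ low ⊕ err ⊕ ρg ⊕ Pθ ⊕ gap)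
          (solve 10 (λ x G l m q g er ρ t d → (:- g) :- (x :- d) :=
              ((G :+ g) :+ ((l :+ er) :+ ((m :+ t) :+ ((q :+ con (ι 12) :* g) :+ (ρ :+ (g :+ (g :+ d))))))) :- (x :+ (G :+ (l :+ (m :+ (er :+ (ρ :+ (t :+ (q :+ con (ι 16) :* g))))))))) refl
            (E (Π A) (λ x → ⟦ X e x ⟧)) (E (Π A) (λ x → ⟦ G bs e x ⟧)) (E ν (λ y → ⟦ GV bs e y ⟧)) (emp e) q g (error bs 0ζ ζ1 regs) ρ (ι P * θ) d))
        where
        e = tri (i , j , k)
        inc : Increasing (co {M} e)
        inc = subst Increasing (sym (co-tri (i , j , k))) (ij , jk)
        value : E (A i) (λ a → E (A j) (λ b → E (A k) (λ c → ⟦ edge H (vx i a) (vx j b) (vx k c) ⟧ - d))) ≡ E (Π A) (λ x → ⟦ X e x ⟧) - d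
        value = trans (sym (marginal₃ A (<⇒≢F ij) (<⇒≢F (Fₚ.<-trans ij jk)) (<⇒≢F jk) (λ a b c → ⟦ edge H (vx i a) (vx j b) (vx k c) ⟧ - d)))
          (trans (E-+c (Π A) _ (- d)) (cong (_- d) (E-cong (Π A) (λ x → cong ⟦_⟧ (sym (X-tri i j k x))))))

      module _ {s ε : ℚ} (0s : 0ℚ ≤ s) (dense : Dense H d ε) (big : ε * ℕtoℚ (N ℕ.^ 3) < s * (s * s))
        (cap : ∀ (f : Fin m₂ → Fin M) → ∀ v → s * ΣF m₂ (λ q → E (A (f q)) (λ u → ⟦ does (v F.≟ vx (f q) u) ⟧)) ≤ 1ℚ) where

        Q : Vec (Fin M) 3 → Set
        Q (i ∷ j ∷ k ∷ []) = q + ι 12 * g ≤ emp (tri (i , j , k))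

        inc₃ : ∀ {r} {i j k : Fin r} → i F.< j → j F.< k → Inc (i ∷ j ∷ k ∷ [])
        inc₃ ij jk = (ij , Fₚ.<-trans ij jk , tt) , (jk , tt) , tt , tt

        cases : (f : Fin m₂ → Fin M) → Mono f → Homogeneous (λ v → Q (Vec.map f v)) → ⊥
        -- One Ramsey number serves both outcomes: the dense one uses the first `M₀` blocks, the
        -- sparse one all `m₂`.
        cases f mf (inj₁ all) = red {Fin (suc K)} (λ _ → unif K) (pull f′ G′)
            (λ i j k ij jk → subst (q + ι 12 * g ≤_) (emp≡E₃ (f′ i) (f′ j) (f′ k) (mf′ ij) (mf′ jk))
              (all ((i F.↑ˡ m₁) ∷ (j F.↑ˡ m₁) ∷ (k F.↑ˡ m₁) ∷ []) (inc₃ (↑ˡ-mono m₁ ij) (↑ˡ-mono m₁ jk))))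
            λ F → no-found (Found-pull f′ mf′ G′ F)
          where
          f′ : Fin M₀ → Fin M
          f′ i = f (i F.↑ˡ m₁)
          mf′ : Mono f′
          mf′ lt = mf (↑ˡ-mono m₁ lt)
        cases f mf (inj₂ none) = <≤⊥ big (Blocks.sparse (λ q → vx (f q)) (λ lt → ordered (mf lt)) (λ q → A (f q)) s 0s
          (λ a b c → ⟦ edge H a b c ⟧ - d) (λ a b c → ≤-by (⟦⟧≤1 (edge H a b c) ⊕ 0d) (solve 2 (λ x d → con 1ℚ :- (x :- d) := (con 1ℚ :+ d) :- (x :+ con 0ℚ)) refl ⟦ edge H a b c ⟧ d))
          (λ i j k ij jk → X-small (f i) (f j) (f k) (mf ij) (mf jk) (≰→≥ (none (i ∷ j ∷ k ∷ []) (inc₃ ij jk))))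
          (cap f) (Dense-O₃ {H = H} {d} {ε} dense) many)

        contradiction : ⊥
        contradiction = ram Q λ (f , mf , hom) → cases f mf hom

-- The choice of the constants

opaque
  -- Dividing by C + 1 instead of C covers the case C = 0.
  small-multiple : ∀ {C x b} → 0ℚ ≤ C → 0ℚ < x → 0ℚ < b → Σ ℚ λ ρ → 0ℚ < ρ × ρ ≤ b × C * ρ ≤ x
  small-multiple {C} {x} {b} 0C 0x 0b =
    let (r , 0r , e) = inverse {C + 1ℚ} (ℚₚ.+-mono-≤-< 0C 0<1)
        (ρ , 0ρ , ρb , ρx) = min₂ 0b (0<* 0x 0r)
    in ρ , 0ρ , ρb , ℚₚ.≤-trans (0C ⊗ ρx) (≤-by (ℚₚ.<⇒≤ (0<* 0x 0r))
         (trans (cong (λ z → z - C * (x * r)) (sym (trans (cong (x *_) e) (ℚₚ.*-identityʳ x)))) (solve 3 (λ c x r → x :* ((c :+ con 1ℚ) :* r) :- c :* (x :* r) := x :* r :- con 0ℚ) refl C x r)))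

-- The blocks fill at least half of the vertices, so N³ is at most a constant times the cube of the
-- block length.
quotient : ∀ k N → suc k ℕ.≤ N → Σ ℕ λ b → suc k ℕ.* suc b ℕ.≤ N × N ℕ.≤ (suc k ℕ.* suc b) ℕ.* 2
quotient k N le = go (N ℕD./ suc k) (ℕD.m≡m%n+[m/n]*n N (suc k)) (ℕD.m≥n⇒m/n>0 {N} {suc k} le)
  where
  go : ∀ d → N ≡ N ℕD.% suc k ℕ.+ d ℕ.* suc k → 0 ℕ.< d → Σ ℕ λ b → suc k ℕ.* suc b ℕ.≤ N × N ℕ.≤ (suc k ℕ.* suc b) ℕ.* 2
  go (suc b) eq _ = b , ℕₚ.≤-trans (ℕₚ.≤-reflexive (ℕₚ.*-comm (suc k) (suc b))) (subst (suc b ℕ.* suc k ℕ.≤_) (sym eq) (ℕₚ.m≤n+m _ (N ℕD.% suc k))) ,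
    ℕₚ.≤-trans (ℕₚ.≤-reflexive eq) (ℕₚ.≤-trans (ℕₚ.+-monoˡ-≤ (suc b ℕ.* suc k) (ℕₚ.≤-trans (ℕₚ.<⇒≤ (ℕD.m%n<n N (suc k))) (ℕₚ.m≤m+n (suc k) (b ℕ.* suc k))))
      (ℕₚ.≤-reflexive double))
    where
    double : suc b ℕ.* suc k ℕ.+ suc b ℕ.* suc k ≡ (suc k ℕ.* suc b) ℕ.* 2
    double = trans (cong₂ ℕ._+_ (ℕₚ.*-comm (suc b) (suc k)) (ℕₚ.*-comm (suc b) (suc k)))
      (trans (cong (suc k ℕ.* suc b ℕ.+_) (sym (ℕₚ.+-identityʳ _))) (ℕₚ.*-comm 2 (suc k ℕ.* suc b)))

injective-hits : ∀ {N} n (f : Fin n → Fin N) → (∀ {i j} → f i ≡ f j → i ≡ j) → ∀ v → ΣF n (λ i → ⟦ does (v F.≟ f i) ⟧) ≤ 1ℚ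
injective-hits zero f inj v = 0≤1
injective-hits (suc n) f inj v with v F.≟ f F.zero
... | no _ = subst (_≤ 1ℚ) (sym (ℚₚ.+-identityˡ _)) (injective-hits n (f ∘ F.suc) (λ e → Fₚ.suc-injective (inj e)) v)
... | yes refl = ℚₚ.≤-reflexive (trans (cong (λ z → 1ℚ + z) (ΣF-0 n (λ i → cong ⟦_⟧ (does-≢ (λ e → Fₚ.0≢1+n (inj e)))))) (ℚₚ.+-identityʳ 1ℚ))

-- Six times the difference of the sides is m² (m g - 18 - 3g) + 6 (m² - 1) + 2 g m, which explains
-- the hypothesis on m.
many-triples : ∀ {g} m → 0ℚ < g → ι 18 + ι 3 * g ≤ ι m * g → ι m * ι m + ι m * ι m + 1ℚ ≤ g * O₃ m (λ _ _ _ → 1ℚ)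
many-triples {g} m 0g h = *-cancel (0<ι 5) (≤-by
    (((0≤ι m ⊛ 0≤ι m) ⊛ 0≤- h) ⊕ (0≤ι 6 ⊛ 0≤- t1 ⊛ (0≤ι m ⊕ 0≤1)) ⊕ (0≤ι 2 ⊛ ℚₚ.<⇒≤ 0g ⊛ 0≤ι m))
    (trans (cong (λ z → z - ι 6 * (t * t + t * t + 1ℚ)) (trans (solve 2 (λ g o → con (ι 6) :* (g :* o) := g :* (con (ι 6) :* o)) refl g (O₃ m (λ _ _ _ → 1ℚ))) (cong (g *_) (triples-count m))))
      (solve 2 (λ t g → g :* (t :* (t :* t) :- con (ι 3) :* (t :* t) :+ con (ι 2) :* t) :- con (ι 6) :* (t :* t :+ t :* t :+ con 1ℚ) :=
         ((t :* t) :* (t :* g :- (con (ι 18) :+ con (ι 3) :* g)) :+ (con (ι 6) :* ((t :- con 1ℚ) :* (t :+ con 1ℚ)) :+ con (ι 2) :* (g :* t))) :- (con 0ℚ :+ (con 0ℚ :+ con 0ℚ))) refl t g)))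
  where
  t = ι m
  t1 : 1ℚ ≤ t
  t1 = *-cancel 0g (≤-by (h ⊕ 0≤ι 18 ⊕ (0≤ι 2 ⊛ ℚₚ.<⇒≤ 0g)) (solve 2 (λ g t → g :* t :- g :* con 1ℚ := (t :* g :+ (con (ι 18) :+ con (ι 2) :* g)) :- ((con (ι 18) :+ con (ι 3) :* g) :+ (con 0ℚ :+ con 0ℚ))) refl g t))

module Upper {n : ℕ} (H₀ : 3Graph n) (rl : SplitCondition H₀ R L) (tl : SplitCondition H₀ T L) {q d : ℚ} (hq : ι 27 * q ≡ 1ℚ) (0q : 0ℚ ≤ q) (qd : q < d) (d1 : d ≤ 1ℚ) where

  r₁₆ = inverse (0<ι 15)

  opaque
    g : ℚ
    g = (d - q) * proj₁ r₁₆

    0g : 0ℚ < g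
    0g = 0<* (0<-by qd) (proj₁ (proj₂ r₁₆))

    16g : ι 16 * g ≡ d - q
    16g = trans (solve 3 (λ a x r → a :* (x :* r) := x :* (a :* r)) refl (ι 16) (d - q) (proj₁ r₁₆)) (trans (cong ((d - q) *_) (proj₂ (proj₂ r₁₆))) (ℚₚ.*-identityʳ (d - q)))

  0≤g : 0ℚ ≤ g
  0≤g = ℚₚ.<⇒≤ 0g

  gap : q + ι 16 * g ≤ d
  gap = ℚₚ.≤-reflexive (trans (cong (λ z → q + z) 16g) (solve 2 (λ q d → q :+ (d :- q) := d) refl q d))

  6g : ι 6 * g ≤ 1ℚ
  6g = ≤-by (gap ⊕ d1 ⊕ 0q ⊕ (0≤ι 10 ⊛ 0≤g)) (solve 3 (λ q g d → con 1ℚ :- con (ι 6) :* g := (d :+ (con 1ℚ :+ (q :+ con (ι 10) :* g))) :- ((q :+ con (ι 16) :* g) :+ (d :+ (con 0ℚ :+ con 0ℚ)))) refl q g d)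

  g1 : g ≤ 1ℚ
  g1 = ≤-by (6g ⊕ (0≤ι 5 ⊛ 0≤g)) (solve 1 (λ g → con 1ℚ :- g := (con 1ℚ :+ con (ι 5) :* g) :- (con (ι 6) :* g :+ con 0ℚ)) refl g)

  0d : 0ℚ ≤ d
  0d = ℚₚ.≤-trans 0q (ℚₚ.<⇒≤ qd)

  red : Σ ℕ (ReducedFor n (q + ι 12 * g))
  red = reduced n {g} {q} 0g 6g hq

  blocks : Σ ℕ λ m → ι 18 + ι 3 * g ≤ ι m * g
  blocks = archimedean⁻¹ 0g (ι 18 + ι 3 * g)

  m₂ : ℕ
  m₂ = proj₁ red ℕ.+ proj₁ blocks

  m₂-large : ι 18 + ι 3 * g ≤ ι m₂ * g
  m₂-large = ≤-by (proj₂ blocks ⊕ (0≤ι (proj₁ red) ⊛ 0≤g)) (trans (cong (λ z → z * g - (ι 18 + ι 3 * g)) (ι-+ (proj₁ red) (proj₁ blocks)))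
    (solve 4 (λ a b g x → (a :+ b) :* g :- x := (b :* g :+ a :* g) :- (x :+ con 0ℚ)) refl (ι (proj₁ red)) (ι (proj₁ blocks)) g (ι 18 + ι 3 * g)))

  many : ι m₂ * ι m₂ + ι m₂ * ι m₂ + 1ℚ ≤ g * O₃ m₂ (λ _ _ _ → 1ℚ)
  many = many-triples m₂ 0g m₂-large

  0<m₂ : 0ℚ < ι m₂
  0<m₂ = ℚₚ.≰⇒> λ h → <≤⊥ (0<ι 17) (≤-by (m₂-large ⊕ (0≤g ⊗ h) ⊕ (0≤ι 3 ⊛ 0≤g)) (solve 2 (λ g t → con 0ℚ :- con (ι 18) := (t :* g :+ (g :* con 0ℚ :+ con (ι 3) :* g)) :- ((con (ι 18) :+ con (ι 3) :* g) :+ (g :* t :+ con 0ℚ))) refl g (ι m₂)))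

  ram : Σ ℕ (Ramsey 3 m₂)
  ram = ramsey 3 m₂

  M = proj₁ ram

  P N₃ : ℕ
  P = M ℕ.* M
  N₃ = M ℕ.* (M ℕ.* M)

  θs : Σ ℚ λ θ → 0ℚ < θ × θ ≤ 1ℚ × ι P * θ ≤ g
  θs = small-multiple (0≤ι P) 0g 0<1

  Ks : Σ ℕ λ K → ι N₃ + (ι N₃ + 1ℚ) ≤ ι (suc K) * (proj₁ θs * proj₁ θs)
  Ks = sample-size N₃ (proj₁ (proj₂ θs))

  D₁ : ℚ
  D₁ = ι (suc (proj₁ Ks)) ^ P * 2ℚ ^ P

  0D₁ : 0ℚ < D₁
  0D₁ = 0<* (0<^ (0<ι (proj₁ Ks)) P) (0<^ (0<ι 1) P)

  ½′ : Σ ℚ λ h → 0ℚ < h × h + h ≡ 1ℚ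
  ½′ = half 1ℚ 0<1

  ½<1 : proj₁ ½′ < 1ℚ
  ½<1 = subst₂ _<_ (ℚₚ.+-identityˡ _) (proj₂ (proj₂ ½′)) (ℚₚ.+-monoˡ-< (proj₁ ½′) (proj₁ (proj₂ ½′)))

  τs : Σ ℚ λ τ → 0ℚ < τ × τ ≤ 1ℚ × D₁ * τ ≤ proj₁ ½′
  τs = small-multiple (ℚₚ.<⇒≤ 0D₁) (proj₁ (proj₂ ½′)) 0<1

  τ-small : ι (suc (proj₁ Ks)) ^ P * (2ℚ ^ P * proj₁ τs) < 1ℚ
  τ-small = ℚₚ.≤-<-trans (subst (_≤ proj₁ ½′) (ℚₚ.*-assoc (ι (suc (proj₁ Ks)) ^ P) (2ℚ ^ P) (proj₁ τs)) (proj₂ (proj₂ (proj₂ τs)))) ½<1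

  patterns : List (Ordering n × Vec (Fin M) n)
  patterns = Final.patterns H₀ rl tl {g} {q} {d} 0g g1 0d gap (proj₁ red) (proj₂ red) (proj₁ blocks) M many (proj₂ ram)

  ρs : Σ ℚ λ ρ → 0ℚ < ρ × ρ ≤ g × ι (length patterns) * 2ℚ * ρ ≤ proj₁ τs
  ρs = small-multiple (0≤ι (length patterns) ⊛ 0≤ι 2) (proj₁ (proj₂ τs)) 0g

  ρ = proj₁ ρs

  cnt : ι (length patterns) * (ρ + ρ) ≤ proj₁ τs
  cnt = subst (_≤ proj₁ τs) (solve 2 (λ c r → c :* (con 1ℚ :+ con 1ℚ) :* r := c :* (r :+ r)) refl (ι (length patterns)) ρ) (proj₂ (proj₂ (proj₂ ρs)))

  hs : Σ ℚ λ h → 0ℚ < h × h ≤ 1ℚ × ι N₃ * 2ℚ * h ≤ g ^ N₃ * ρ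
  hs = small-multiple (0≤ι N₃ ⊛ 0≤ι 2) (0<* (0<^ 0g N₃) (proj₁ (proj₂ ρs))) 0<1

  δ : ℚ
  δ = proj₁ hs + proj₁ hs

  0δ : 0ℚ ≤ δ
  0δ = ℚₚ.<⇒≤ (0<+ (proj₁ (proj₂ hs)) (proj₁ (proj₂ hs)))

  δ-small : ι N₃ * δ ≤ g ^ N₃ * ρ
  δ-small = subst (_≤ g ^ N₃ * ρ) (solve 2 (λ c r → c :* (con 1ℚ :+ con 1ℚ) :* r := c :* (r :+ r)) refl (ι N₃) (proj₁ hs)) (proj₂ (proj₂ (proj₂ hs)))

  Qs : Σ ℕ λ Q → ι N₃ + 1ℚ ≤ ι Q * proj₁ hs
  Qs = archimedean⁻¹ (proj₁ (proj₂ hs)) (ι N₃ + 1ℚ)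

  many-rounds : ι N₃ < ι (proj₁ Qs) * proj₁ hs
  many-rounds = ℚₚ.<-≤-trans (subst (_< ι N₃ + 1ℚ) (ℚₚ.+-identityʳ (ι N₃)) (ℚₚ.+-monoʳ-< (ι N₃) 0<1)) (proj₂ Qs)

  size-of : ℕ → ℚ
  size-of k = ι (length (allV (enumV enumBool (triple k)) P)) * ι P

  ζs : ∀ k → Σ ℚ λ ζ → 0ℚ < ζ × ζ ≤ 1ℚ × size-of k * ζ ≤ ρ
  ζs k = small-multiple (0≤ι (length (allV (enumV enumBool (triple k)) P)) ⊛ 0≤ι P) (proj₁ (proj₂ ρs)) 0<1

  ζ : ℕ → ℚ
  ζ k = proj₁ (ζs k)

  number : ℕ → ℕ
  number k = length (List.cartesianProduct (List.cartesianProduct (List.allFin M) (List.allFin M)) (allV enumBool (triple k)))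

  process = rounds M N₃ {δ} {proj₁ hs} number ζ ζ (proj₁ (proj₂ hs)) refl (λ k → proj₁ (proj₂ (ζs k))) (λ k → proj₁ (proj₂ (proj₂ (ζs k)))) (λ k → proj₁ (proj₂ (ζs k))) (proj₁ Qs) 0 many-rounds

  s = proj₁ process

  0s : 0ℚ < s
  0s = proj₁ (proj₂ process)

  rm = inverse 0<m₂

  x : ℚ
  x = s * proj₁ rm

  0x : 0ℚ < x
  0x = 0<* 0s (proj₁ (proj₂ rm))

  D : ℚ
  D = ι (suc M) * 2ℚ

  0D : 0ℚ < D
  0D = 0<* (0<ι M) (0<ι 1)

  cube : ℚ → ℚ
  cube y = y * (y * y)

  0<cube : ∀ {y} → 0ℚ < y → 0ℚ < cube y
  0<cube h = 0<* h (0<* h h)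

  -- Since N is at most D β, this choice makes ε N³ at most half of s₀³.
  εs : Σ ℚ λ ε → 0ℚ < ε × ε ≤ 1ℚ × cube D * ε ≤ cube x * proj₁ ½′
  εs = small-multiple (ℚₚ.<⇒≤ (0<cube 0D)) (0<* (0<cube 0x) (proj₁ (proj₂ ½′))) 0<1

  ε = proj₁ εs

  module Host {N : ℕ} (H : 3Graph N) (dense : Dense H d ε) (free : ¬ Contains H H₀) (b : ℕ) (fits : suc M ℕ.* suc b ℕ.≤ N) (short : N ℕ.≤ (suc M ℕ.* suc b) ℕ.* 2) where

    β : ℚ
    β = ι (suc b)

    0β : 0ℚ < β
    0β = 0<ι b

    room : M ℕ.* suc b ℕ.≤ N
    room = ℕₚ.≤-trans (ℕₚ.m≤n+m (M ℕ.* suc b) (suc b)) fits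

    vx : Fin M → Fin (suc b) → Fin N
    vx p u = F.inject≤ (F.combine p u) room

    ordered : ∀ {p p′} → p F.< p′ → ∀ u v → vx p u F.< vx p′ v
    ordered {p} {p′} h u v = subst₂ ℕ._<_ (sym (Fₚ.toℕ-inject≤ (F.combine p u) room)) (sym (Fₚ.toℕ-inject≤ (F.combine p′ v) room)) (Fₚ.combine-monoˡ-< u v h)

    vx-inj : ∀ p {u v} → vx p u ≡ vx p v → u ≡ v
    vx-inj p {u} {v} e = proj₂ (Fₚ.combine-injective p u p v (Fₚ.inject≤-injective room room _ _ e))

    A₀ : Fin M → Mean (Fin (suc b))
    A₀ p = unif b

    s₀ : ℚ
    s₀ = x * β

    -- Inside the uniform measure on a block of β vertices, a measure of size `s` gives each vertex
    -- at most 1/(s β). Over `m₂` blocks this adds up to at most m₂/(s β), the reciprocal of `s₀`.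
    cap : ∀ A → Box s A A₀ → ∀ (f : Fin m₂ → Fin M) → ∀ v → s₀ * ΣF m₂ (λ k → E (A (f k)) (λ u → ⟦ does (v F.≟ vx (f k) u) ⟧)) ≤ 1ℚ
    cap A box f v = subst₂ _≤_ lhs (proj₂ (proj₂ rm)) (subst₂ _≤_ (ℚₚ.*-comm r _) (ℚₚ.*-comm r (ι m₂)) (ℚₚ.<⇒≤ (proj₁ (proj₂ rm)) ⊗ total′))
      where
      r = proj₁ rm
      e : Fin m₂ → ℚ
      e k = E (A (f k)) (λ u → ⟦ does (v F.≟ vx (f k) u) ⟧)
      each : ∀ k → (s * β) * e k ≤ 1ℚ
      each k = ℚₚ.≤-trans (subst₂ _≤_ (solve 3 (λ b s e → b :* (s :* e) := s :* b :* e) refl β s (e k)) (E-unif b _)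
          (ℚₚ.<⇒≤ 0β ⊗ Sub-dominated (box (f k)) (λ u → ⟦ does (v F.≟ vx (f k) u) ⟧) (λ u → 0≤⟦⟧ (does (v F.≟ vx (f k) u)))))
        (injective-hits (suc b) (vx (f k)) (vx-inj (f k)) v)
      total′ : (s * β) * ΣF m₂ e ≤ ι m₂
      total′ = subst₂ _≤_ (ΣF-* m₂ (s * β) e) (trans (ΣF-const m₂ 1ℚ) (ℚₚ.*-identityʳ (ι m₂))) (ΣF-mono m₂ each)
      lhs : (s * β) * ΣF m₂ e * r ≡ s₀ * ΣF m₂ e
      lhs = solve 4 (λ s b e r → s :* b :* e :* r := s :* r :* b :* e) refl s β (ΣF m₂ e) r

    size≤ : ℕtoℚ (N ℕ.^ 3) ≤ cube (D * β)
    size≤ = subst (_≤ cube (D * β)) (sym (trans (ℕtoℚ≡ι (N ℕ.^ 3)) (trans (ι-* N (N ℕ.* (N ℕ.* 1))) (cong (ι N *_) (trans (ι-* N (N ℕ.* 1)) (cong (λ z → ι N * ι z) (ℕₚ.*-identityʳ N)))))))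
        (*-mono (0≤ι N) (0≤Dβ ⊛ 0≤Dβ) ιN (*-mono (0≤ι N) 0≤Dβ ιN ιN))
      where
      0≤Dβ : 0ℚ ≤ D * β
      0≤Dβ = ℚₚ.<⇒≤ (0<* 0D 0β)
      ιN : ι N ≤ D * β
      ιN = subst (ι N ≤_) (trans (ι-* (suc M ℕ.* suc b) 2) (trans (cong (_* ι 2) (ι-* (suc M) (suc b))) (solve 2 (λ a b → a :* b :* con (ι 2) := a :* (con 1ℚ :+ con 1ℚ) :* b) refl (ι (suc M)) β))) (ι-mono short)

    big : ε * ℕtoℚ (N ℕ.^ 3) < s₀ * (s₀ * s₀)
    big = ℚₚ.≤-<-trans (ℚₚ.≤-trans (ℚₚ.<⇒≤ (proj₁ (proj₂ εs)) ⊗ size≤) (ℚₚ.≤-trans (ℚₚ.≤-reflexive (solve 3 (λ e d b → e :* (d :* b :* (d :* b :* (d :* b))) := b :* (b :* b) :* (d :* (d :* d) :* e)) refl ε D β))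
        (ℚₚ.<⇒≤ (0<cube 0β) ⊗ proj₂ (proj₂ (proj₂ εs)))))
      (0<-rev (subst (0ℚ <_) (trans (cong (λ z → cube β * (cube x * z)) ½eq) (solve 3 (λ x b h → b :* (b :* b) :* (x :* (x :* x) :* (con 1ℚ :- h)) := (x :* b) :* (x :* b :* (x :* b)) :- b :* (b :* b) :* (x :* (x :* x) :* h)) refl x β (proj₁ ½′)))
        (0<* (0<cube 0β) (0<* (0<cube 0x) (proj₁ (proj₂ ½′))))))
      where
      ½eq : proj₁ ½′ ≡ 1ℚ - proj₁ ½′
      ½eq = trans (solve 1 (λ h → h := h :+ h :- h) refl (proj₁ ½′)) (cong (_- proj₁ ½′) (proj₂ (proj₂ ½′)))
      0<-rev : ∀ {u v} → 0ℚ < v - u → u < v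
      0<-rev {u} {v} h = ℚₚ.≰⇒> λ k → <≤⊥ h (≤-by k (solve 2 (λ u v → con 0ℚ :- (v :- u) := u :- v) refl u v))

    Y : Fin M × Fin M × Fin M → Fin (suc b) → Fin (suc b) → Fin (suc b) → Bool
    Y = Forbidden.Y H H₀ free vx ordered 0≤g g1 A₀

    contradiction : ⊥
    contradiction = proj₂ (proj₂ (proj₂ process)) (Removal.X Y g) (Removal.ev Y g) g 0≤g g1 (Coupled.cols Y g A₀) (Coupled.cols-length Y g A₀) (Coupled.cols-bounds Y g A₀)
      A₀ [] refl (λ _ _ → tt) λ A bs box tight regs neg →
        Final.contradiction H₀ rl tl {g} {q} {d} 0g g1 0d gap (proj₁ red) (proj₂ red) (proj₁ blocks) M many (proj₂ ram)
          {proj₁ Ks} {proj₁ θs} {proj₁ τs} {ρ} {δ} (proj₁ (proj₂ θs)) (proj₂ Ks) (proj₂ (proj₂ (proj₂ θs))) (proj₁ (proj₂ τs)) τ-small (ℚₚ.<⇒≤ (proj₁ (proj₂ ρs))) (proj₁ (proj₂ (proj₂ ρs))) cnt 0δ δ-small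
          H free vx ordered A bs tight {ζ (length bs)} (proj₁ (proj₂ (ζs (length bs)))) (proj₁ (proj₂ (proj₂ (ζs (length bs))))) regs
          (ℚₚ.≤-trans (ℚₚ.≤-reflexive (sym (ℚₚ.*-assoc (ι (length (allV (enumV enumBool (triple (length bs))) P))) (ι P) (ζ (length bs))))) (proj₂ (proj₂ (proj₂ (ζs (length bs))))))
          neg {s₀} {ε} (ℚₚ.<⇒≤ (0<* 0x 0β)) dense big (cap A box)

  not-admissible : ¬ Admissible H₀ d
  not-admissible adm =
    -- At least M + 1 vertices make the blocks nonempty; M + 1 rather than M keeps the divisor
    -- positive.
    let (N , N≥ , H , dense , free) = adm ε (proj₁ (proj₂ εs)) (suc M)
        (b , fits , short) = quotient M N N≥
    in Host.contradiction H dense free b fits short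
-- The lower bound

min-arg : ∀ {n N} (f : Fin (suc n) → Fin N) → Σ (Fin (suc n)) λ a → ∀ b → f a F.≤ f b
min-arg {zero} f = F.zero , λ { F.zero → ℕₚ.≤-refl }
min-arg {suc n} f with min-arg (f ∘ F.suc)
... | a , h with ℕₚ.≤-total (toℕ (f F.zero)) (toℕ (f (F.suc a)))
... | inj₁ le = F.zero , λ { F.zero → ℕₚ.≤-refl ; (F.suc b) → ℕₚ.≤-trans le (h b) }
... | inj₂ ge = F.suc a , λ { F.zero → ge ; (F.suc b) → h b }

-- Selection sort: the argument of the least value is put first.
sorting : ∀ n {N} (f : Fin n → Fin N) → Injective _≡_ _≡_ f → Σ (Permutation′ n) λ π → Mono (λ i → f (π ⟨$⟩ʳ i))
sorting zero f inj = Perm.id , λ { {()} }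
sorting (suc n) {N} f inj = Perm.insert F.zero a π , mono
  where
  a = proj₁ (min-arg f)
  rec = sorting n (λ i → f (F.punchIn a i)) (λ e → Fₚ.punchIn-injective a _ _ (inj e))
  π = proj₁ rec
  at-suc : ∀ i → Perm.insert F.zero a π ⟨$⟩ʳ F.suc i ≡ F.punchIn a (π ⟨$⟩ʳ i)
  at-suc i = Perm.insert-punchIn F.zero a π i
  mono : Mono (λ i → f (Perm.insert F.zero a π ⟨$⟩ʳ i))
  mono {F.zero} {F.suc j} _ = subst (λ z → f a F.< f z) (sym (at-suc j))
    (ℕₚ.≤∧≢⇒< (proj₂ (min-arg f) (F.punchIn a (π ⟨$⟩ʳ j))) (λ e → Fₚ.punchInᵢ≢i a (π ⟨$⟩ʳ j) (sym (inj (Fₚ.toℕ-injective e)))))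
  mono {F.suc i} {F.suc j} (s≤s h) = subst₂ (λ u v → f u F.< f v) (sym (at-suc i)) (sym (at-suc j)) (proj₂ rec h)

adj-inc : ∀ {n} (H : 3Graph n) {a b c} → a F.< b → b F.< c → Adj H a b c → edge H a b c ≡ true
adj-inc H ab bc (inj₁ (_ , _ , e)) = e
adj-inc H ab bc (inj₂ (inj₁ (_ , cb , _))) = ⊥-elim (Fₚ.<-asym bc cb)
adj-inc H ab bc (inj₂ (inj₂ (inj₁ (ba , _)))) = ⊥-elim (Fₚ.<-asym ab ba)
adj-inc H ab bc (inj₂ (inj₂ (inj₂ (inj₁ (_ , ca , _))))) = ⊥-elim (Fₚ.<-asym (Fₚ.<-trans ab bc) ca)
adj-inc H ab bc (inj₂ (inj₂ (inj₂ (inj₂ (inj₁ (ca , _)))))) = ⊥-elim (Fₚ.<-asym (Fₚ.<-trans ab bc) ca)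
adj-inc H ab bc (inj₂ (inj₂ (inj₂ (inj₂ (inj₂ (cb , _)))))) = ⊥-elim (Fₚ.<-asym bc cb)

eqL : Label → Label → Bool
eqL L L = true
eqL T T = true
eqL R R = true
eqL _ _ = false

eqL-sound : ∀ c ℓ → eqL c ℓ ≡ true → c ≡ ℓ
eqL-sound L L _ = refl
eqL-sound T T _ = refl
eqL-sound R R _ = refl

module Colouring₃ {N : ℕ} (y : Fin N → Fin N → Label) where

  graph : 3Graph N
  graph = record { edge = λ a b c → eqL (y a b) L ∧ (eqL (y a c) T ∧ eqL (y b c) R) }

  vanishing-copy : ∀ {n} (H₀ : 3Graph n) → Contains graph H₀ → HasVanishingOrdering H₀
  vanishing-copy {n} H₀ (f , inj , emb) = π , (λ i j → y (f (π ⟨$⟩ʳ i)) (f (π ⟨$⟩ʳ j))) , λ i j k ij jk adj →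
      let e = adj-inc graph (proj₂ srt ij) (proj₂ srt jk) (emb _ _ _ adj)
          (e₁ , e₂₃) = ∧-true e
          (e₂ , e₃) = ∧-true e₂₃
      in eqL-sound _ L e₁ , eqL-sound _ T e₂ , eqL-sound _ R e₃
    where
    srt = sorting n f inj
    π = proj₁ srt

-- Cuts and 4-cycles

Abs≤1 : ℚ → Set
Abs≤1 x = (- 1ℚ ≤ x) × (x ≤ 1ℚ)

-- 2 + 2xy = (1 + x)(1 + y) + (1 - x)(1 - y), and the same identity with -y in place of y.
abs-* : ∀ {x y} → Abs≤1 x → Abs≤1 y → Abs≤1 (x * y)
abs-* {x} {y} (a , b) (c , d) =
  *-cancel (0<ι 1) (≤-by ((0≤- a ⊛ 0≤- c) ⊕ (0≤- b ⊛ 0≤- d)) (solve 2 (λ x y → con (ι 2) :* (x :* y) :- con (ι 2) :* (:- con 1ℚ) := ((x :- (:- con 1ℚ)) :* (y :- (:- con 1ℚ)) :+ (con 1ℚ :- x) :* (con 1ℚ :- y)) :- (con 0ℚ :+ con 0ℚ)) refl x y)) ,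
  *-cancel (0<ι 1) (≤-by ((0≤- a ⊛ 0≤- d) ⊕ (0≤- b ⊛ 0≤- c)) (solve 2 (λ x y → con (ι 2) :* con 1ℚ :- con (ι 2) :* (x :* y) := ((x :- (:- con 1ℚ)) :* (con 1ℚ :- y) :+ (con 1ℚ :- x) :* (y :- (:- con 1ℚ))) :- (con 0ℚ :+ con 0ℚ)) refl x y))

abs-⟦⟧ : ∀ b → Abs≤1 ⟦ b ⟧
abs-⟦⟧ b = ℚₚ.≤-trans (≤-by 0≤1 refl) (0≤⟦⟧ b) , ⟦⟧≤1 b

square-⟦⟧≤ : ∀ b x → (⟦ b ⟧ * x) * (⟦ b ⟧ * x) ≤ x * x
square-⟦⟧≤ true x = ℚₚ.≤-reflexive (solve 1 (λ x → (con 1ℚ :* x) :* (con 1ℚ :* x) := x :* x) refl x)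
square-⟦⟧≤ false x = subst (_≤ x * x) (solve 1 (λ x → con 0ℚ := (con 0ℚ :* x) :* (con 0ℚ :* x)) refl x) (0≤² x)

E² : (μ : Mean V) (f : V → ℚ) → E μ f * E μ f ≡ E μ (λ a → E μ (λ b → f a * f b))
E² μ f = trans (sym (E-*ʳ μ (E μ f) f)) (E-cong μ (λ a → sym (E-* μ (f a) f)))

-- Cauchy–Schwarz twice: the fourth power of a cut of G is at most the mean of G over 4-cycles.
module Cut {N : ℕ} (U : Mean (Fin N)) (G : Fin N → Fin N → ℚ) where

  rect : Fin N → Fin N → Fin N → Fin N → ℚ
  rect a a′ b b′ = (G a b * G a b′) * (G a′ b * G a′ b′)

  cycles : ℚ
  cycles = E U (λ b → E U (λ b′ → E U (λ a → E U (λ a′ → rect a a′ b b′))))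

  cut : (A B : Fin N → Bool) → ℚ
  cut A B = E U (λ a → E U (λ b → ⟦ A a ⟧ * (⟦ B b ⟧ * G a b)))

  cut⁴ : ∀ A B → (cut A B * cut A B) * (cut A B * cut A B) ≤ cycles
  cut⁴ A B = ℚₚ.≤-trans (*-mono (0≤² (cut A B)) (ℚₚ.≤-trans (0≤² (cut A B)) first) first first) second
    where
    C : Fin N → Fin N → ℚ
    C b b′ = E U (λ a → G a b * G a b′)
    h : Fin N → ℚ
    h a = E U (λ b → ⟦ B b ⟧ * G a b)
    w = E U (λ b → E U (λ b′ → ⟦ B b ⟧ * (⟦ B b′ ⟧ * C b b′)))
    first : cut A B * cut A B ≤ w
    first = ℚₚ.≤-trans (subst (λ z → z * z ≤ E U (λ a → (⟦ A a ⟧ * h a) * (⟦ A a ⟧ * h a))) (E-cong U (λ a → sym (E-* U ⟦ A a ⟧ _))) (cauchy U (λ a → ⟦ A a ⟧ * h a)))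
      (ℚₚ.≤-trans (E-mono U (λ a → square-⟦⟧≤ (A a) (h a))) (ℚₚ.≤-reflexive spelled))
      where
      spelled : E U (λ a → h a * h a) ≡ w
      spelled = trans (E-cong U (λ a → E² U (λ b → ⟦ B b ⟧ * G a b))) (trans (E-swap U U _) (E-cong U (λ b → trans (E-swap U U _) (E-cong U (λ b′ →
        trans (E-cong U (λ a → solve 4 (λ p x q y → (p :* x) :* (q :* y) := p :* (q :* (x :* y))) refl ⟦ B b ⟧ (G a b) ⟦ B b′ ⟧ (G a b′)))
          (trans (E-* U ⟦ B b ⟧ _) (cong (⟦ B b ⟧ *_) (E-* U ⟦ B b′ ⟧ _))))))))
    second : w * w ≤ cycles
    second = ℚₚ.≤-trans (cauchy U _) (ℚₚ.≤-trans (E-mono U (λ b → cauchy U _))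
      (ℚₚ.≤-trans (E-mono U (λ b → E-mono U (λ b′ → ℚₚ.≤-trans (square-⟦⟧≤ (B b) _) (square-⟦⟧≤ (B b′) (C b b′)))))
        (ℚₚ.≤-reflexive (E-cong U (λ b → E-cong U (λ b′ → E² U (λ a → G a b * G a b′)))))))

  cycles≥0 : 0ℚ ≤ cycles
  cycles≥0 = ℚₚ.≤-trans (0≤² (cut (λ _ → true) (λ _ → true) * cut (λ _ → true) (λ _ → true))) (cut⁴ (λ _ → true) (λ _ → true))

  cut≥ : ∀ {η} → 0ℚ ≤ η → cycles ≤ (η * η) * (η * η) → ∀ A B → - η ≤ cut A B
  cut≥ {η} 0η small A B = ≤-by (²-cancel {(- cut A B)} {η} 0η (subst (_≤ η * η) (solve 1 (λ c → c :* c := (:- c) :* (:- c)) refl (cut A B))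
      (²-cancel {cut A B * cut A B} {η * η} (0≤² η) (ℚₚ.≤-trans (cut⁴ A B) small))))
    (solve 2 (λ c η → c :- (:- η) := η :- (:- c)) refl (cut A B) η)

-- Allows the factor for a < c to be inserted or dropped, so that each term of `telescope` carries
-- the order factor of its own pair.
ltᵇ-trans : ∀ {n} (a b c : Fin n) → ⟦ ltᵇ′ a b ⟧ * ⟦ ltᵇ′ b c ⟧ * ⟦ ltᵇ′ a c ⟧ ≡ ⟦ ltᵇ′ a b ∧ ltᵇ′ b c ⟧
ltᵇ-trans a b c with ltᵇ′ a b in e | ltᵇ′ b c in e′
... | true | true = trans (cong (λ z → 1ℚ * 1ℚ * ⟦ z ⟧) (ltᵇ-intro (Fₚ.<-trans (ltᵇ-true {a = a} {b} e) (ltᵇ-true {a = b} {c} e′)))) refl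
... | true | false = solve 1 (λ x → con 1ℚ :* con 0ℚ :* x := con 0ℚ) refl ⟦ ltᵇ′ a c ⟧
... | false | true = solve 1 (λ x → con 0ℚ :* con 1ℚ :* x := con 0ℚ) refl ⟦ ltᵇ′ a c ⟧
... | false | false = solve 1 (λ x → con 0ℚ :* con 0ℚ :* x := con 0ℚ) refl ⟦ ltᵇ′ a c ⟧

-- A random colouring with few correlations

module Random (N′ : ℕ) {t : ℚ} (0t : 0ℚ ≤ t) (t1 : t ≤ 1ℚ) (3t : ι 3 * t ≡ 1ℚ) where

  N : ℕ
  N = suc N′

  U : Mean (Fin N)
  U = unif N′

  λ₃ : Mean Label
  λ₃ = avg (L ∷ T ∷ R ∷ [])

  g : Label → Label → ℚ
  g ℓ c = ⟦ eqL c ℓ ⟧ - t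

  g-bound : ∀ ℓ c → Abs≤1 (g ℓ c)
  g-bound ℓ c = ≤-by (0≤⟦⟧ (eqL c ℓ) ⊕ t1) (solve 2 (λ x t → (x :- t) :- (:- con 1ℚ) := (x :+ con 1ℚ) :- (con 0ℚ :+ t)) refl ⟦ eqL c ℓ ⟧ t) ,
    ≤-by (⟦⟧≤1 (eqL c ℓ) ⊕ 0t) (solve 2 (λ x t → con 1ℚ :- (x :- t) := (con 1ℚ :+ t) :- (x :+ con 0ℚ)) refl ⟦ eqL c ℓ ⟧ t)

  E-g : ∀ ℓ → E λ₃ (g ℓ) ≡ 0ℚ
  E-g ℓ = ℚₚ.≤-antisym (*-cancel (0<ι 2) (ℚₚ.≤-reflexive eq)) (*-cancel (0<ι 2) (ℚₚ.≤-reflexive (sym eq)))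
    where
    total : ∀ ℓ → g ℓ L + (g ℓ T + (g ℓ R + 0ℚ)) ≡ 1ℚ - ι 3 * t
    total L = solve 1 (λ t → (con 1ℚ :- t) :+ ((con 0ℚ :- t) :+ ((con 0ℚ :- t) :+ con 0ℚ)) := con 1ℚ :- con (ι 3) :* t) refl t
    total T = solve 1 (λ t → (con 0ℚ :- t) :+ ((con 1ℚ :- t) :+ ((con 0ℚ :- t) :+ con 0ℚ)) := con 1ℚ :- con (ι 3) :* t) refl t
    total R = solve 1 (λ t → (con 0ℚ :- t) :+ ((con 0ℚ :- t) :+ ((con 1ℚ :- t) :+ con 0ℚ)) := con 1ℚ :- con (ι 3) :* t) refl t
    eq : ι 3 * E λ₃ (g ℓ) ≡ ι 3 * 0ℚ
    eq = trans (E-avg (L ∷ T ∷ R ∷ []) (g ℓ)) (trans (sumV-∷ L (T ∷ R ∷ []) (g ℓ)) (trans (cong (λ z → g ℓ L + z) (trans (sumV-∷ T (R ∷ []) (g ℓ))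
      (cong (λ z → g ℓ T + z) (trans (sumV-∷ R [] (g ℓ)) (cong (λ z → g ℓ R + z) (sumV-[] (g ℓ))))))) (trans (total ℓ) (trans (cong (λ z → 1ℚ - z) 3t) refl))))

  Ω : Mean (Vec Label (N ℕ.* N))
  Ω = Π (λ _ → λ₃)

  colour : Vec Label (N ℕ.* N) → Fin N → Fin N → Label
  colour y a b = lookup y (F.combine a b)

  G : Label → Vec Label (N ℕ.* N) → Fin N → Fin N → ℚ
  G ℓ y a b = ⟦ ltᵇ′ a b ⟧ * g ℓ (colour y a b)

  G-bound : ∀ ℓ y a b → Abs≤1 (G ℓ y a b)
  G-bound ℓ y a b = abs-* (abs-⟦⟧ (ltᵇ′ a b)) (g-bound ℓ (colour y a b))

  u : ℚ
  u = proj₁ (inverse (0<ι N′))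

  Nu : ι N * u ≡ 1ℚ
  Nu = proj₂ (proj₂ (inverse (0<ι N′)))

  collide : ∀ a′ → E U (λ a → ⟦ does (a F.≟ a′) ⟧) ≡ u
  collide a′ = ℚₚ.≤-antisym (*-cancel (0<ι N′) (ℚₚ.≤-reflexive eq)) (*-cancel (0<ι N′) (ℚₚ.≤-reflexive (sym eq)))
    where
    eq : ι N * E U (λ a → ⟦ does (a F.≟ a′) ⟧) ≡ ι N * u
    eq = trans (E-unif N′ _) (trans (trans (ΣF-cong N (λ i → sym (ℚₚ.*-identityʳ ⟦ does (i F.≟ a′) ⟧))) (ΣF-δ N a′ (λ _ → 1ℚ))) (sym Nu))

  module _ (ℓ : Label) where
    rect : Vec Label (N ℕ.* N) → Fin N → Fin N → Fin N → Fin N → ℚ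
    rect y = Cut.rect U (G ℓ y)

    cycles : Vec Label (N ℕ.* N) → ℚ
    cycles y = Cut.cycles U (G ℓ y)

    -- If a ≠ a′ and b ≠ b′, the colour of (a, b) enters only one of the four factors, and that
    -- factor has mean 0 when the colour is drawn afresh. Otherwise the bound 1 on the product
    -- suffices.
    term : ∀ a a′ b b′ → E Ω (λ y → rect y a a′ b b′) ≤ ⟦ does (a F.≟ a′) ⟧ + ⟦ does (b F.≟ b′) ⟧
    term a a′ b b′ with a F.≟ a′ | b F.≟ b′
    ... | yes _ | D = ℚₚ.≤-trans bounded (≤-by (0≤⟦⟧ (does D)) (solve 1 (λ x → (con 1ℚ :+ x) :- con 1ℚ := x :- con 0ℚ) refl ⟦ does D ⟧))
      where
      bounded : E Ω (λ y → rect y a a′ b b′) ≤ 1ℚ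
      bounded = E-≤c Ω (λ y → proj₂ (abs-* (abs-* (G-bound ℓ y a b) (G-bound ℓ y a b′)) (abs-* (G-bound ℓ y a′ b) (G-bound ℓ y a′ b′))))
    ... | no _ | yes _ = E-≤c Ω (λ y → proj₂ (abs-* (abs-* (G-bound ℓ y a b) (G-bound ℓ y a b′)) (abs-* (G-bound ℓ y a′ b) (G-bound ℓ y a′ b′))))
    ... | no na | no nb = ℚₚ.≤-reflexive (trans (resample (λ _ → λ₃) (F.combine a b) _) (trans (E-cong Ω (λ y →
          trans (E-cong λ₃ (λ c → fixed y c)) (trans (E-*ʳ λ₃ (K y) (λ c → ⟦ ltᵇ′ a b ⟧ * g ℓ c)) (trans (cong (_* K y) (trans (E-* λ₃ ⟦ ltᵇ′ a b ⟧ (g ℓ)) (trans (cong (⟦ ltᵇ′ a b ⟧ *_) (E-g ℓ)) (ℚₚ.*-zeroʳ ⟦ ltᵇ′ a b ⟧)))) (ℚₚ.*-zeroˡ (K y)))))) (E-const Ω 0ℚ)))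
      where
      K : Vec Label (N ℕ.* N) → ℚ
      K y = G ℓ y a b′ * (G ℓ y a′ b * G ℓ y a′ b′)
      other : ∀ y c i j → F.combine i j ≢ F.combine a b → G ℓ (y [ F.combine a b ]≔ c) i j ≡ G ℓ y i j
      other y c i j ne = cong (λ z → ⟦ ltᵇ′ i j ⟧ * g ℓ z) (Vecₚ.lookup∘update′ ne y c)
      fixed : ∀ y c → rect (y [ F.combine a b ]≔ c) a a′ b b′ ≡ (⟦ ltᵇ′ a b ⟧ * g ℓ c) * K y
      fixed y c = trans (cong₂ _*_ (cong₂ _*_ (cong (λ z → ⟦ ltᵇ′ a b ⟧ * g ℓ z) (Vecₚ.lookup∘update (F.combine a b) y c))
            (other y c a b′ (λ e → nb (sym (proj₂ (Fₚ.combine-injective a b′ a b e))))))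
          (cong₂ _*_ (other y c a′ b (λ e → na (sym (proj₁ (Fₚ.combine-injective a′ b a b e))))) (other y c a′ b′ (λ e → na (sym (proj₁ (Fₚ.combine-injective a′ b′ a b e)))))))
        (ℚₚ.*-assoc (⟦ ltᵇ′ a b ⟧ * g ℓ c) (G ℓ y a b′) (G ℓ y a′ b * G ℓ y a′ b′))

    few-cycles : E Ω (λ y → cycles y) ≤ u + u
    few-cycles = subst₂ _≤_ (sym push) total (E-mono U (λ b → E-mono U (λ b′ → E-mono U (λ a → E-mono U (λ a′ → term a a′ b b′)))))
      where
      push : E Ω (λ y → cycles y) ≡ E U (λ b → E U (λ b′ → E U (λ a → E U (λ a′ → E Ω (λ y → rect y a a′ b b′)))))
      push = trans (E-swap Ω U _) (E-cong U (λ b → trans (E-swap Ω U _) (E-cong U (λ b′ → trans (E-swap Ω U _) (E-cong U (λ a → E-swap Ω U _))))))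
      total : E U (λ b → E U (λ b′ → E U (λ a → E U (λ a′ → ⟦ does (a F.≟ a′) ⟧ + ⟦ does (b F.≟ b′) ⟧)))) ≡ u + u
      total = trans (E-cong U (λ b → E-cong U (λ b′ → trans (E-cong U (λ a → E-+c U _ _)) (trans (E-+c U _ _) (cong (_+ ⟦ does (b F.≟ b′) ⟧) diag)))))
        (trans (E-cong U (λ b → trans (E-+ U (λ _ → u) _) (cong (_+ E U (λ b′ → ⟦ does (b F.≟ b′) ⟧)) (E-const U u)))) (trans (E-+ U (λ _ → u) _) (cong₂ _+_ (E-const U u) diag)))
        where
        diag : E U (λ a → E U (λ a′ → ⟦ does (a F.≟ a′) ⟧)) ≡ u
        diag = trans (E-swap U U _) (trans (E-cong U collide) (E-const U u))

  cyc : Label → Vec Label (N ℕ.* N) → ℚ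
  cyc ℓ y = Cut.cycles U (G ℓ y)

  -- The three cycle means are nonnegative, so a colouring with a small sum of them serves all
  -- labels at once.
  good : Σ (Vec Label (N ℕ.* N)) λ y → ∀ ℓ → cyc ℓ y ≤ ι 6 * u
  good = y , small
    where
    ex = E-∃ Ω (λ y → cyc L y + cyc T y + cyc R y)
    y = proj₁ ex
    sum≤ : cyc L y + cyc T y + cyc R y ≤ (u + u) + (u + u) + (u + u)
    sum≤ = ℚₚ.≤-trans (proj₂ ex) (subst (_≤ (u + u) + (u + u) + (u + u)) (sym (trans (E-+ Ω _ _) (cong (_+ E Ω (λ y → cyc R y)) (E-+ Ω _ _)))) ((few-cycles L ⊕ few-cycles T) ⊕ few-cycles R))
    0≤c : ∀ ℓ → 0ℚ ≤ cyc ℓ y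
    0≤c ℓ = Cut.cycles≥0 U (G ℓ y)
    small : ∀ ℓ → cyc ℓ y ≤ ι 6 * u
    small L = ≤-by (sum≤ ⊕ 0≤c T ⊕ 0≤c R) (solve 4 (λ a b c u → con (ι 6) :* u :- a := ((u :+ u) :+ (u :+ u) :+ (u :+ u) :+ (b :+ c)) :- (a :+ b :+ c :+ (con 0ℚ :+ con 0ℚ))) refl (cyc L y) (cyc T y) (cyc R y) u)
    small T = ≤-by (sum≤ ⊕ 0≤c L ⊕ 0≤c R) (solve 4 (λ a b c u → con (ι 6) :* u :- b := ((u :+ u) :+ (u :+ u) :+ (u :+ u) :+ (a :+ c)) :- (a :+ b :+ c :+ (con 0ℚ :+ con 0ℚ))) refl (cyc L y) (cyc T y) (cyc R y) u)
    small R = ≤-by (sum≤ ⊕ 0≤c L ⊕ 0≤c T) (solve 4 (λ a b c u → con (ι 6) :* u :- c := ((u :+ u) :+ (u :+ u) :+ (u :+ u) :+ (a :+ b)) :- (a :+ b :+ c :+ (con 0ℚ :+ con 0ℚ))) refl (cyc L y) (cyc T y) (cyc R y) u)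

  q : ℚ
  q = t * (t * t)

  module Counting {η : ℚ} (0η : 0ℚ ≤ η) (small : ι 6 * u ≤ (η * η) * (η * η)) where

    y : Vec Label (N ℕ.* N)
    y = proj₁ good

    open Colouring₃ (colour y) public

    cut≥ : ∀ ℓ (A B : Fin N → Bool) → - η ≤ E U (λ a → E U (λ b → ⟦ A a ⟧ * (⟦ B b ⟧ * G ℓ y a b)))
    cut≥ ℓ = Cut.cut≥ U (G ℓ y) 0η (ℚₚ.≤-trans (proj₂ good ℓ) small)

    shrink : ∀ {s x} → 0ℚ ≤ s → s ≤ 1ℚ → - η ≤ x → - η ≤ s * x
    shrink {s} {x} 0s s1 h = ≤-by ((0s ⊗ h) ⊕ (0η ⊗ s1)) (solve 3 (λ s x η → s :* x :- (:- η) := (s :* x :+ η :* con 1ℚ) :- (s :* (:- η) :+ η :* s)) refl s x η)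

    module _ (W : Vec Bool N) where

      w : Fin N → Bool
      w = lookup W

      -- In each term of `telescope` the vertex outside the centred pair is held fixed; the other
      -- factors then form a set for each endpoint of that pair, that is, a cut.
      A₁ B₁ A₂ B₂ A₃ : Fin N → Fin N → Bool
      A₁ c a = w c ∧ (w a ∧ eqL (colour y a c) T)
      B₁ c b = w b ∧ (ltᵇ′ b c ∧ eqL (colour y b c) R)
      A₂ b a = w b ∧ (w a ∧ ltᵇ′ a b)
      B₂ b c = w c ∧ (ltᵇ′ b c ∧ eqL (colour y b c) R)
      A₃ a b = w a ∧ (w b ∧ ltᵇ′ a b)

      term₁ term₂ term₃ : Fin N → Fin N → Fin N → ℚ
      term₁ a b c = ⟦ A₁ c a ⟧ * (⟦ B₁ c b ⟧ * G L y a b)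
      term₂ a b c = ⟦ A₂ b a ⟧ * (⟦ B₂ b c ⟧ * G T y a c)
      term₃ a b c = ⟦ A₃ a b ⟧ * (⟦ w c ⟧ * G R y b c)

      E³ : (Fin N → Fin N → Fin N → ℚ) → ℚ
      E³ f = E U (λ a → E U (λ b → E U (f a b)))

      E³-+ : ∀ f f′ → E³ (λ a b c → f a b c + f′ a b c) ≡ E³ f + E³ f′
      E³-+ f f′ = trans (E-cong U (λ a → trans (E-cong U (λ b → E-+ U (f a b) (f′ a b))) (E-+ U _ _))) (E-+ U _ _)

      E³-* : ∀ k f → E³ (λ a b c → k * f a b c) ≡ k * E³ f
      E³-* k f = trans (E-cong U (λ a → trans (E-cong U (λ b → E-* U k (f a b))) (E-* U k _))) (E-* U k _)

      low₁ : - η ≤ E³ term₁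
      low₁ = subst (- η ≤_) (trans (E-swap U U _) (E-cong U (λ a → E-swap U U _))) (E-≥c U (λ c → cut≥ L (A₁ c) (B₁ c)))

      low₂ : - η ≤ E³ term₂
      low₂ = subst (- η ≤_) (E-swap U U _) (E-≥c U (λ b → cut≥ T (A₂ b) (B₂ b)))

      low₃ : - η ≤ E³ term₃
      low₃ = E-≥c U (λ a → cut≥ R (A₃ a) w)

      defect : Fin N → Fin N → Fin N → ℚ
      defect a b c = ⟦ ltᵇ′ a b ∧ ltᵇ′ b c ⟧ * (inW³ W a b c * (⟦ edge graph a b c ⟧ - q))

      ⟦∧∧⟧ : ∀ p r s → ⟦ p ∧ (r ∧ s) ⟧ ≡ ⟦ p ⟧ * (⟦ r ⟧ * ⟦ s ⟧)
      ⟦∧∧⟧ p r s = trans (⟦∧⟧ p (r ∧ s)) (cong (⟦ p ⟧ *_) (⟦∧⟧ r s))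

      -- XYZ - t³ = (X - t)YZ + t(Y - t)Z + t²(Z - t)
      telescope : ∀ a b c → defect a b c ≡ term₁ a b c + (t * term₂ a b c + (t * t) * term₃ a b c)
      telescope a b c = trans (cong₂ (λ i j → i * (inW³ W a b c * (j - q))) (sym (ltᵇ-trans a b c)) (⟦∧∧⟧ (eqL (colour y a b) L) (eqL (colour y a c) T) (eqL (colour y b c) R)))
        (trans (solve 10 (λ p r m wa wb wc X Y Z t → p :* r :* m :* ((wa :* (wb :* wc)) :* (X :* (Y :* Z) :- t :* (t :* t))) :=
            (wa :* wb :* wc :* (X :- t) :* Y :* Z :* (p :* r :* m)) :+ (t :* ((wb :* (wa :* p)) :* ((wc :* (r :* Z)) :* (m :* (Y :- t)))) :+ t :* t :* (wa :* wb :* wc :* (Z :- t) :* (p :* r :* m)))) refl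
            lab lbc lm wa wb wc xl xt xr t)
        (trans (cong (λ z → (wa * wb * wc * (xl - t) * xt * xr * z) + (t * ((wb * (wa * lab)) * ((wc * (lbc * xr)) * (lm * (xt - t)))) + t * t * (wa * wb * wc * (xr - t) * z))) (trans (ltᵇ-trans a b c) (⟦∧⟧ (ltᵇ′ a b) (ltᵇ′ b c))))
        (trans (solve 10 (λ p r m wa wb wc X Y Z t → (wa :* wb :* wc :* (X :- t) :* Y :* Z :* (p :* r)) :+ (t :* ((wb :* (wa :* p)) :* ((wc :* (r :* Z)) :* (m :* (Y :- t)))) :+ t :* t :* (wa :* wb :* wc :* (Z :- t) :* (p :* r))) :=
            (wc :* (wa :* Y)) :* ((wb :* (r :* Z)) :* (p :* (X :- t))) :+ (t :* ((wb :* (wa :* p)) :* ((wc :* (r :* Z)) :* (m :* (Y :- t)))) :+ t :* t :* ((wa :* (wb :* p)) :* (wc :* (r :* (Z :- t)))))) refl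
            lab lbc lm wa wb wc xl xt xr t)
          (sym (cong₂ _+_ (cong₂ (λ i j → i * (j * G L y a b)) (⟦∧∧⟧ (w c) (w a) (eqL (colour y a c) T)) (⟦∧∧⟧ (w b) (ltᵇ′ b c) (eqL (colour y b c) R)))
            (cong₂ _+_ (cong (t *_) (cong₂ (λ i j → i * (j * G T y a c)) (⟦∧∧⟧ (w b) (w a) (ltᵇ′ a b)) (⟦∧∧⟧ (w c) (ltᵇ′ b c) (eqL (colour y b c) R))))
              (cong (λ i → t * t * (i * (⟦ w c ⟧ * G R y b c))) (⟦∧∧⟧ (w a) (w b) (ltᵇ′ a b)))))))))
        where
        lab = ⟦ ltᵇ′ a b ⟧
        lbc = ⟦ ltᵇ′ b c ⟧
        lm = ⟦ ltᵇ′ a c ⟧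
        wa = ⟦ w a ⟧
        wb = ⟦ w b ⟧
        wc = ⟦ w c ⟧
        xl = ⟦ eqL (colour y a b) L ⟧
        xt = ⟦ eqL (colour y a c) T ⟧
        xr = ⟦ eqL (colour y b c) R ⟧

      low : - (ι 3 * η) ≤ E³ defect
      low = subst (- (ι 3 * η) ≤_) (sym (trans (E-cong U (λ a → E-cong U (λ b → E-cong U (λ c → telescope a b c)))) (trans (E³-+ term₁ _) (cong (λ z → E³ term₁ + z) (trans (E³-+ _ _) (cong₂ _+_ (E³-* t term₂) (E³-* (t * t) term₃)))))))
        (≤-by (low₁ ⊕ shrink 0t t1 low₂ ⊕ shrink (0t ⊛ 0t) (*-mono 0t 0≤1 t1 t1) low₃)
          (solve 4 (λ η a b c → (a :+ (b :+ c)) :- (:- (con (ι 3) :* η)) := (a :+ (b :+ c)) :- ((:- η) :+ ((:- η) :+ (:- η)))) refl η (E³ term₁) (t * E³ term₂) (t * t * E³ term₃)))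

      n³ : ℚ
      n³ = ι N * (ι N * ι N)

      O₃-E³ : ∀ f → O₃ N f ≡ n³ * E³ (λ a b c → ⟦ ltᵇ′ a b ∧ ltᵇ′ b c ⟧ * f a b c)
      O₃-E³ f = trans (ΣF-cong N (λ a → trans (ΣF-cong N (λ b → sym (E-unif N′ (h a b)))) (trans (ΣF-* N (ι N) (hb a)) (cong (ι N *_) (sym (E-unif N′ (hb a)))))))
        (trans (ΣF-* N (ι N) (λ a → ι N * ha a)) (trans (cong (ι N *_) (trans (ΣF-* N (ι N) ha) (cong (ι N *_) (sym (E-unif N′ ha))))) (solve 2 (λ n e → n :* (n :* (n :* e)) := n :* (n :* n) :* e) refl (ι N) (E U ha))))
        where
        h : Fin N → Fin N → Fin N → ℚ
        h a b c = ⟦ ltᵇ′ a b ∧ ltᵇ′ b c ⟧ * f a b c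
        hb : Fin N → Fin N → ℚ
        hb a b = E U (h a b)
        ha : Fin N → ℚ
        ha a = E U (hb a)

      many-edges : q * ι (∣ W ∣ choose 3) - ι 3 * η * n³ ≤ ℕtoℚ (edgesIn graph W)
      many-edges = subst (q * ι (∣ W ∣ choose 3) - ι 3 * η * n³ ≤_) (sym count) (≤-by ((0≤ι N ⊛ 0≤ι N ⊛ 0≤ι N) ⊗ low)
          (solve 4 (λ c n e x → (c :+ n :* e) :- (c :- x :* n) := n :* e :- n :* (:- x)) refl (q * ι (∣ W ∣ choose 3)) n³ (E³ defect) (ι 3 * η)))
        where
        residue : Fin N → Fin N → Fin N → ℚ
        residue a b c = inW³ W a b c * (⟦ edge graph a b c ⟧ - q)
        count : ℕtoℚ (edgesIn graph W) ≡ q * ι (∣ W ∣ choose 3) + n³ * E³ defect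
        count = trans (edges-O₃ graph W) (trans (O₃-cong N (λ a b c → solve 3 (λ i e q → i :* e := q :* i :+ i :* (e :- q)) refl (inW³ W a b c) ⟦ edge graph a b c ⟧ q))
          (trans (O₃-+ N (λ a b c → q * inW³ W a b c) residue) (cong₂ _+_ (trans (O₃-* N q (inW³ W)) (cong (q *_) (count₃ W))) (O₃-E³ residue))))

module Lower {n : ℕ} (H₀ : 3Graph n) (none : ¬ HasVanishingOrdering H₀) {t : ℚ} (0t : 0ℚ ≤ t) (t1 : t ≤ 1ℚ) (3t : ι 3 * t ≡ 1ℚ) where

  admissible : ∀ d → 0ℚ ≤ d → d < t * (t * t) → Admissible H₀ d
  admissible d 0d dq ε 0ε N₀ = Rn.N , N≥ , graph , dense , λ c → none (vanishing-copy H₀ c)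
    where
    r₃ = inverse (0<ι 2)
    -- `many-edges` loses 3η, and the cut bound requires 6/N ≤ η⁴; hence η = ε/3 and N of order
    -- 6/η⁴.
    η : ℚ
    η = ε * proj₁ r₃
    0η : 0ℚ < η
    0η = 0<* 0ε (proj₁ (proj₂ r₃))
    3η : ι 3 * η ≡ ε
    3η = trans (solve 3 (λ a x r → a :* (x :* r) := x :* (a :* r)) refl (ι 3) ε (proj₁ r₃)) (trans (cong (ε *_) (proj₂ (proj₂ r₃))) (ℚₚ.*-identityʳ ε))
    η⁴ = (η * η) * (η * η)
    0η⁴ : 0ℚ < η⁴
    0η⁴ = 0<* (0<* 0η 0η) (0<* 0η 0η)
    k : Σ ℕ λ k → ι 6 ≤ ι k * η⁴
    k = archimedean⁻¹ 0η⁴ (ι 6)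
    N′ = N₀ ℕ.+ proj₁ k
    module Rn = Random N′ 0t t1 3t
    N≥ : Rn.N ℕ.≥ N₀
    N≥ = ℕₚ.m≤n⇒m≤1+n (ℕₚ.m≤m+n N₀ (proj₁ k))
    0u : 0ℚ ≤ Rn.u
    0u = ℚₚ.<⇒≤ (proj₁ (proj₂ (inverse (0<ι N′))))
    6≤ : ι 6 ≤ ι Rn.N * η⁴
    6≤ = ℚₚ.≤-trans (proj₂ k) (subst₂ _≤_ (ℚₚ.*-comm η⁴ _) (ℚₚ.*-comm η⁴ _) (ℚₚ.<⇒≤ 0η⁴ ⊗ ι-mono (ℕₚ.m≤n⇒m≤1+n (ℕₚ.m≤n+m (proj₁ k) N₀))))
    small : ι 6 * Rn.u ≤ η⁴
    small = subst₂ _≤_ (ℚₚ.*-comm Rn.u (ι 6)) (trans (solve 3 (λ u n h → u :* (n :* h) := (n :* u) :* h) refl Rn.u (ι Rn.N) η⁴) (trans (cong (_* η⁴) Rn.Nu) (ℚₚ.*-identityˡ η⁴))) (0u ⊗ 6≤)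
    open Rn.Counting (ℚₚ.<⇒≤ 0η) small
    dense : Dense graph d ε
    dense W = ≤-by (many-edges W ⊕ (0≤ι (∣ W ∣ choose 3) ⊗ ℚₚ.<⇒≤ dq))
      (trans (cong₂ (λ c n → ℕtoℚ (edgesIn graph W) - (d * c - ε * n)) (ℕtoℚ≡ι (∣ W ∣ choose 3)) cubed)
        (trans (cong (λ z → ℕtoℚ (edgesIn graph W) - (d * ι (∣ W ∣ choose 3) - z * (ι Rn.N * (ι Rn.N * ι Rn.N)))) (sym 3η))
          (solve 6 (λ e d c x n q → e :- (d :* c :- x :* n) := (e :+ c :* q) :- (q :* c :- x :* n :+ c :* d)) refl
            (ℕtoℚ (edgesIn graph W)) d (ι (∣ W ∣ choose 3)) (ι 3 * η) (ι Rn.N * (ι Rn.N * ι Rn.N)) (t * (t * t)))))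
      where
      cubed : ℕtoℚ (Rn.N ℕ.^ 3) ≡ ι Rn.N * (ι Rn.N * ι Rn.N)
      cubed = trans (ℕtoℚ≡ι (Rn.N ℕ.^ 3)) (trans (ι-* Rn.N (Rn.N ℕ.* (Rn.N ℕ.* 1))) (cong (ι Rn.N *_) (trans (ι-* Rn.N (Rn.N ℕ.* 1)) (cong (λ z → ι Rn.N * ι z) (ℕₚ.*-identityʳ Rn.N)))))

theorem5p1 : {n : ℕ} (H0 : 3Graph n) →
    ¬ HasVanishingOrdering H0 →
    SplitCondition H0 R L →
    SplitCondition H0 T L →
    UniformTuranDensityIs H0 (+ 1 / 27)
theorem5p1 H0 none rl tl =
  Lower.admissible H0 none {+ 1 / 3} (ℚ.*≤* (ℤ.+≤+ z≤n)) (ℚ.*≤* (ℤ.+≤+ (s≤s z≤n))) refl ,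
  λ d qd d1 → Upper.not-admissible H0 rl tl {+ 1 / 27} {d} refl (ℚ.*≤* (ℤ.+≤+ z≤n)) qd d1
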